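{- No non-trivial finite group has an omniversal Cayley table. The finite groups whose Cayley tables are near-omniversal are exactly $\mathbb{Z}_2$, $\mathbb{Z}_3$, $\mathbb{Z}_5$, $\mathbb{Z}_6$, $D_6$, $D_8$ and the non-abelian groups of order $16$.
   Context: The Cayley table of a finite group $G$ of order $n$ is the Latin square of order $n$ with rows and columns indexed by $G$ whose cell $(g,h)$ contains the symbol $gh$; it is viewed as the set of triples $(g,h,gh)$. A partial transversal of a Latin square is a set of its triples containing at most one triple in each row, at most one in each column, and at most one with each symbol; its length is its number of triples. It is maximal if it is not contained in a partial transversal of greater length. A Latin square of order $n$ is omniversal if it has a maximal partial transversal of every length $\ell$ with $\lceil n/2\rceil\le\ell\le n$, and near-omniversal if there is exactly one such $\ell$ for which it has no maximal partial transversal of length $\ell$. $\mathbb{Z}_k$ denotes the cyclic group of order $k$ and $D_k$ the dihedral group of order $k$. -}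

module Defs where

open import Data.Nat using (ℕ; suc; _+_; _∸_; _≤_; ⌈_/2⌉; NonZero)
open import Data.Nat.DivMod using (_mod_)
open import Data.Fin using (Fin; toℕ)
open import Data.Bool using (Bool; true; false; _xor_)
open import Data.Product using (Σ; ∃; _×_; _,_; proj₁; proj₂)
open import Data.List using (List; map; length)
open import Data.List.Relation.Unary.Unique.Propositional using (Unique)
open import Data.List.Membership.Propositional using (_∈_)
open import Relation.Binary.PropositionalEquality using (_≡_)
open import Relation.Nullary using (¬_)
open import Algebra.Structures using (IsGroup)
open import Function.Definitions using (Bijective)

-- Finite groups: a group structure on Fin n (every finite group of order
-- n is isomorphic to one of these).

record FinGroup (n : ℕ) : Set where
  field
    _·_     : Fin n → Fin n → Fin n
    ε       : Fin n
    _⁻¹     : Fin n → Fin n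
    isGroup : IsGroup _≡_ _·_ ε _⁻¹

Square : ℕ → Set
Square n = Fin n → Fin n → Fin n

Triple : ℕ → Set
Triple n = Fin n × Fin n × Fin n

row col sym : ∀ {n} → Triple n → Fin n
row t = proj₁ t
col t = proj₁ (proj₂ t)
sym t = proj₂ (proj₂ t)

InSquare : ∀ {n} → Square n → Triple n → Set
InSquare L t = sym t ≡ L (row t) (col t)

-- A partial transversal: a set (duplicate-free list) of triples of L with
-- at most one triple per row, per column and per symbol.
record PartialTransversal {n : ℕ} (L : Square n) (T : List (Triple n)) : Set where
  field
    triples  : ∀ {t} → t ∈ T → InSquare L t
    rowsUniq : Unique (map row T)
    colsUniq : Unique (map col T)
    symsUniq : Unique (map sym T)

Maximal : ∀ {n} → Square n → List (Triple n) → Set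
Maximal L T = PartialTransversal L T ×
  (∀ T' → PartialTransversal L T' → (∀ {t} → t ∈ T → t ∈ T') → length T' ≤ length T)

HasMaximalPTOfLength : ∀ {n} → Square n → ℕ → Set
HasMaximalPTOfLength L ℓ = Σ (List _) λ T → Maximal L T × length T ≡ ℓ

Omniversal : ∀ {n} → Square n → Set
Omniversal {n} L = ∀ ℓ → ⌈ n /2⌉ ≤ ℓ → ℓ ≤ n → HasMaximalPTOfLength L ℓ

NearOmniversal : ∀ {n} → Square n → Set
NearOmniversal {n} L =
  Σ ℕ λ ℓ → (⌈ n /2⌉ ≤ ℓ × ℓ ≤ n × ¬ HasMaximalPTOfLength L ℓ) ×
    (∀ ℓ' → ⌈ n /2⌉ ≤ ℓ' → ℓ' ≤ n → ¬ HasMaximalPTOfLength L ℓ' → ℓ' ≡ ℓ)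

cayley : ∀ {n} → FinGroup n → Square n
cayley G g h = g · h
  where open FinGroup G

IsoTo : ∀ {n} → FinGroup n → (A : Set) → (A → A → A) → Set
IsoTo {n} G A _∘_ = Σ (Fin n → A) λ f → Bijective _≡_ _≡_ f × (∀ x y → f (x · y) ≡ f x ∘ f y)
  where open FinGroup G

zadd : (k : ℕ) .{{_ : NonZero k}} → Fin k → Fin k → Fin k
zadd k a b = (toℕ a + toℕ b) mod k

IsCyclic : ∀ {n} → FinGroup n → (k : ℕ) .{{_ : NonZero k}} → Set
IsCyclic G k = IsoTo G (Fin k) (zadd k)

-- Dihedral group of order 2m: elements r^i s^a encoded as (a , i),
-- with (r^i s^a)(r^j s^b) = r^(i + (-1)^a j) s^(a+b).
dmul : (m : ℕ) .{{_ : NonZero m}} → Bool × Fin m → Bool × Fin m → Bool × Fin m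
dmul m (false , i) (b , j) = (b , (toℕ i + toℕ j) mod m)
dmul m (true  , i) (b , j) = (true xor b , (toℕ i + (m ∸ toℕ j)) mod m)

-- G ≅ D_(2m)  (dihedral group of order 2m)
IsDihedral : ∀ {n} → FinGroup n → (m : ℕ) .{{_ : NonZero m}} → Set
IsDihedral G m = IsoTo G (Bool × Fin m) (dmul m)

NonAbelian : ∀ {n} → FinGroup n → Set
NonAbelian G = ∃ λ x → ∃ λ y → ¬ (x · y ≡ y · x)
  where open FinGroup G

{-# OPTIONS --safe #-}
-- Let a maximal partial transversal of length n ∸ k leave the rows A, the columns B and the symbols C
-- unused (k of each). Maximality says that AB avoids C, and summing a homomorphism φ into an abelian
-- group over the cells gives φ(G) + φ(C) = φ(A) + φ(B). If 5k > 2n, then |AB| < 3/2 |A|, and Freiman's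
-- argument puts A and B into cosets of a subgroup of index two; the sum for the sign of that subgroup
-- then forces n/2 − k to be even, and k = n/2 moreover makes the subgroup admit a complete mapping,
-- which is impossible when its order is 2 modulo 4. Together with the lengths n and n − 1 for abelian
-- groups and n for groups of order 2 modulo 4, this excludes two lengths for all orders except
-- 2, 3, 5, 6, 8, 10, 16 and 24. For 10 and 24 the sets are split along a subgroup of index two and the
-- same ideas are applied to the parts. Groups of order 8 and 16 are enumerated by their
-- power-commutator presentations, and the transversals that do exist are listed.
module Submission where

open import Defs
open import Data.Nat using (ℕ; zero; suc; _+_; _*_; _∸_; _^_; _≤_; _<_; z≤n; s≤s; s≤s⁻¹; _≤?_; _<?_; _≟_; NonZero; >-nonZero; nonTrivial⇒n>1; ⌈_/2⌉; ⌊_/2⌋)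
open import Data.Nat.Properties hiding (_≟_; _≤?_; _<?_)
open import Data.Nat.DivMod using (_%_; _/_; _mod_; [m+kn]%n≡m%n; m≡m%n+[m/n]*n; m%n<n)
open import Data.Nat.Divisibility using (_∣_; _∣?_; divides; ∣-refl; ∣⇒≤; ∣m∣n⇒∣m+n; ∣m+n∣m⇒∣n; _∣0)
open import Data.Nat.ListAction using () renaming (sum to sumL)
open import Data.Nat.Primality using (Prime; prime[2]; prime?; euclidsLemma; prime⇒irreducible; prime⇒nonTrivial)
open import Data.Nat.Tactic.RingSolver using (solve-∀)
open import Data.Fin using (Fin; zero; suc; toℕ; fromℕ<)
open import Data.Fin.Patterns using (0F; 1F; 2F; 3F; 4F; 5F)
open import Data.Fin.Permutation using (permutation)
open import Data.Fin.Properties using (any?; all?; toℕ-injective; ¬∀⟶∃¬; pigeonhole; toℕ-fromℕ<; toℕ<n) renaming (_≟_ to _≟F_)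
open import Data.Bool using (Bool; true; false; if_then_else_; not; _xor_)
open import Data.Bool.Properties using () renaming (_≟_ to _≟B_)
open import Data.Vec using (Vec; []; _∷_; lookup; replicate) renaming (map to mapV)
import Data.Vec.Properties as VecP
open import Data.Maybe using (Maybe; just; nothing)
open import Data.List using (List; []; _∷_; _++_; length; filter; allFin; cartesianProductWith) renaming (map to mapL)
import Data.List.Properties as ListP
open import Data.List.Properties using (length-map; map-∘)
open import Data.List.Relation.Unary.Any using (Any; here; there; satisfied) renaming (any? to any-list?)
open import Data.List.Relation.Unary.All using (All; []; _∷_) renaming (all? to all-list?; lookup to All-lookup; tabulate to All-tabulate)
open import Data.List.Relation.Unary.AllPairs using ([]; _∷_; allPairs?)
open import Data.List.Relation.Unary.Unique.Propositional using (Unique)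
open import Data.List.Relation.Unary.Unique.Propositional.Properties using (allFin⁺) renaming (map⁺ to Unique-map⁺; filter⁺ to Unique-filter⁺)
open import Data.List.Membership.Propositional using (find) renaming (_∈_ to _∈L_)
open import Data.List.Membership.Propositional.Properties using (∈-map⁺; ∈-map⁻; ∈-++⁺ˡ; ∈-++⁺ʳ; ∈-cartesianProductWith⁺; ∈-filter⁺; ∈-filter⁻; ∈-allFin)
open import Data.List.Membership.DecPropositional using () renaming (_∈?_ to mem-dec)
open import Data.Product using (Σ; ∃; _×_; _,_; proj₁; proj₂)
open import Data.Product.Properties using (≡-dec)
open import Data.Sum using (_⊎_; inj₁; inj₂)
open import Data.Empty using (⊥; ⊥-elim)
open import Data.Unit using (⊤; tt)
open import Function using (_∘_; id)
open import Function.Bundles using (_⇔_; mk⇔)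
open import Relation.Binary.Definitions using (tri<; tri≈; tri>)
open import Relation.Binary.PropositionalEquality using (_≡_; _≢_; refl; cong; cong₂; subst; subst₂; trans; module ≡-Reasoning) renaming (sym to ≡sym)
open import Relation.Nullary using (¬_; Dec; yes; no; does; contradiction)
open import Relation.Nullary.Decidable using (_×-dec_; ¬?; _⊎-dec_; _→-dec_; from-yes; from-no; dec-true; dec-false)
open import Algebra.Bundles using (CommutativeMonoid)
open import Algebra.Structures using (IsGroup)
import Algebra.Properties.CommutativeMonoid.Sum as CMSum
import Algebra.Properties.CommutativeSemigroup as CSG
open CMSum +-0-commutativeMonoid using (sum; sum-cong-≗; ∑-comm; ∑-distrib-+)
open CSG +-commutativeSemigroup using () renaming (interchange to +-interchange)

-- Counting

-- The list of exceptional orders comes from the strict inequality 5k > 2n. Let n = 2m. Parity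
-- excludes k = m - 1 and k = m - 3, and both satisfy the inequality from m = 16 on. For smaller m >
-- 5 only k = m - 1 is certain, and a second length comes from k = 0 if m is odd and from k = m if m
-- is 2 modulo 4. Apart from m ≤ 3 this leaves m = 4, 8, 12, and m = 5, where k = 4 gives exactly 5k
-- = 2n. For m = 12 the deficit 9 fails the inequality by 45 < 48; it is refuted only jointly with k
-- = 12, whose occurrence supplies a subgroup of order 12 with vanishing sums. If n = 2m + 1, no
-- subgroup of index two exists, so k = m and k = m - 1 are both excluded for m ≥ 8, and all smaller
-- odd orders force G to be abelian. Orders 8 and 16 can be enumerated because a 2-group has a
-- central series with factors of order two, so a power-commutator presentation, and there are
-- finitely many of these.

record Sub (n : ℕ) : Set₁ where
  constructor ⟪_⟫
  field
    {Mem} : Fin n → Set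
    mem?  : ∀ x → Dec (Mem x)
open Sub public

infix 4 _∈_ _⊆_
_∈_ : ∀ {n} → Fin n → Sub n → Set
x ∈ S = Mem S x

_⊆_ : ∀ {n} → Sub n → Sub n → Set
S ⊆ T = ∀ {x} → x ∈ S → x ∈ T

infixr 7 _∩_
_∩_ : ∀ {n} → Sub n → Sub n → Sub n
S ∩ T = ⟪ (λ x → mem? S x ×-dec mem? T x) ⟫

∁ : ∀ {n} → Sub n → Sub n
∁ S = ⟪ (λ x → ¬? (mem? S x)) ⟫

full : ∀ {n} → Sub n
full = ⟪ (λ _ → yes tt) ⟫

⁅_⁆ : ∀ {n} → Fin n → Sub n
⁅ y ⁆ = ⟪ (λ x → x ≟F y) ⟫

bit : ∀ {A : Set} → Dec A → ℕ
bit d = if does d then 1 else 0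

∣_∣ : ∀ {n} → Sub n → ℕ
∣ S ∣ = sum (λ x → bit (mem? S x))

bit-mono : ∀ {A B : Set} (d : Dec A) (e : Dec B) → (A → B) → bit d ≤ bit e
bit-mono (no _) e f = z≤n
bit-mono (yes a) (yes b) f = ≤-refl
bit-mono (yes a) (no b) f = contradiction (f a) b

sum-mono : ∀ {n} {f g : Fin n → ℕ} → (∀ x → f x ≤ g x) → sum f ≤ sum g
sum-mono {zero} h = z≤n
sum-mono {suc n} h = +-mono-≤ (h zero) (sum-mono (h ∘ suc))

sum-const : ∀ n (c : ℕ) → sum {n} (λ _ → c) ≡ n * c
sum-const zero c = refl
sum-const (suc n) c = cong (c +_) (sum-const n c)

∣∣-mono : ∀ {n} (S T : Sub n) → S ⊆ T → ∣ S ∣ ≤ ∣ T ∣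
∣∣-mono S T h = sum-mono (λ x → bit-mono (mem? S x) (mem? T x) h)

∣∣-cong : ∀ {n} (S T : Sub n) → S ⊆ T → T ⊆ S → ∣ S ∣ ≡ ∣ T ∣
∣∣-cong S T f g = ≤-antisym (∣∣-mono S T f) (∣∣-mono T S g)

∣full∣ : ∀ {n} → ∣ full {n} ∣ ≡ n
∣full∣ {n} = trans (sum-const n 1) (*-identityʳ n)

bit-split : ∀ {A B : Set} (a : Dec A) (b : Dec B) → bit a ≡ bit (a ×-dec b) + bit (a ×-dec ¬? b)
bit-split (no _) b = refl
bit-split (yes _) (yes _) = refl
bit-split (yes _) (no _) = refl

∣∣-split : ∀ {n} (S P : Sub n) → ∣ S ∣ ≡ ∣ S ∩ P ∣ + ∣ S ∩ ∁ P ∣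
∣∣-split S P = trans (sum-cong-≗ (λ x → bit-split (mem? S x) (mem? P x)))
                     (∑-distrib-+ (λ x → bit (mem? (S ∩ P) x)) (λ x → bit (mem? (S ∩ ∁ P) x)))

∣∣-∁ : ∀ {n} (S : Sub n) → ∣ S ∣ + ∣ ∁ S ∣ ≡ n
∣∣-∁ S = trans (cong₂ _+_ (∣∣-cong S (full ∩ S) (tt ,_) proj₂) (∣∣-cong (∁ S) (full ∩ ∁ S) (tt ,_) proj₂))
               (trans (≡sym (∣∣-split full S)) ∣full∣)

∣∣-disjoint : ∀ {n} (S T U : Sub n) → S ⊆ U → T ⊆ U → (∀ {x} → x ∈ S → ¬ x ∈ T) → ∣ S ∣ + ∣ T ∣ ≤ ∣ U ∣
∣∣-disjoint S T U s t d = begin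
  ∣ S ∣ + ∣ T ∣ ≤⟨ +-mono-≤ (∣∣-mono S (U ∩ S) (λ x → s x , x)) (∣∣-mono T (U ∩ ∁ S) (λ x → t x , λ y → d y x)) ⟩
  ∣ U ∩ S ∣ + ∣ U ∩ ∁ S ∣ ≡⟨ ∣∣-split U S ⟨
  ∣ U ∣ ∎
  where open ≤-Reasoning

-- Inclusion and exclusion with the union replaced by any set containing it. Freiman's argument uses
-- it to force overlaps of translates.
∣∣-∩ : ∀ {n} (S T U : Sub n) → S ⊆ U → T ⊆ U → ∣ S ∣ + ∣ T ∣ ≤ ∣ U ∣ + ∣ S ∩ T ∣
∣∣-∩ S T U s t = begin
  ∣ S ∣ + ∣ T ∣ ≡⟨ cong (_+ ∣ T ∣) (∣∣-split S T) ⟩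
  ∣ S ∩ T ∣ + ∣ S ∩ ∁ T ∣ + ∣ T ∣ ≡⟨ +-assoc ∣ S ∩ T ∣ _ _ ⟩
  ∣ S ∩ T ∣ + (∣ S ∩ ∁ T ∣ + ∣ T ∣) ≤⟨ +-monoʳ-≤ ∣ S ∩ T ∣ (∣∣-disjoint (S ∩ ∁ T) T U (s ∘ proj₁) t proj₂) ⟩
  ∣ S ∩ T ∣ + ∣ U ∣ ≡⟨ +-comm ∣ S ∩ T ∣ _ ⟩
  ∣ U ∣ + ∣ S ∩ T ∣ ∎
  where open ≤-Reasoning

∣∣-empty : ∀ {n} (S : Sub n) → (∀ {x} → ¬ x ∈ S) → ∣ S ∣ ≡ 0
∣∣-empty {n} S h = trans (≤-antisym (≤-trans (∣∣-mono S (∁ full) (λ x → ⊥-elim (h x))) (≤-reflexive (trans (sum-const n 0) (*-zeroʳ n)))) z≤n) refl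

∣⁅⁆∣ : ∀ {n} (y : Fin n) → ∣ ⁅ y ⁆ ∣ ≡ 1
∣⁅⁆∣ {suc n} zero = cong suc (trans (sum-cong-≗ {n} (λ x → refl)) (trans (sum-const n 0) (*-zeroʳ n)))
∣⁅⁆∣ {suc n} (suc y) = trans (sum-cong-≗ {n} (λ x → lem x)) (∣⁅⁆∣ y)
  where
  lem : ∀ x → bit (suc x ≟F suc y) ≡ bit (x ≟F y)
  lem x with x ≟F y
  ... | yes _ = refl
  ... | no _ = refl

nonempty : ∀ {n} (S : Sub n) → 0 < ∣ S ∣ → ∃ λ x → x ∈ S
nonempty S p with any? (mem? S)
... | yes q = q
... | no q = contradiction p (≤⇒≯ (≤-reflexive (∣∣-empty S (λ x∈ → q (_ , x∈)))))

∣∣-pos : ∀ {n} (S : Sub n) {x} → x ∈ S → 0 < ∣ S ∣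
∣∣-pos S {x} h = subst (_≤ ∣ S ∣) (∣⁅⁆∣ x) (∣∣-mono ⁅ x ⁆ S (λ where refl → h))

meeting : ∀ {n} (S T U : Sub n) → S ⊆ U → T ⊆ U → ∣ U ∣ < ∣ S ∣ + ∣ T ∣ → ∃ λ x → x ∈ S × x ∈ T
meeting S T U s t lt = nonempty (S ∩ T) (+-cancelˡ-< ∣ U ∣ 0 _ (subst (_< ∣ U ∣ + ∣ S ∩ T ∣) (≡sym (+-identityʳ _)) (<-≤-trans lt (∣∣-∩ S T U s t))))

∣∣-remove : ∀ {n} (S : Sub n) {y} → y ∈ S → ∣ S ∣ ≡ suc ∣ S ∩ ∁ ⁅ y ⁆ ∣
∣∣-remove S {y} y∈ = trans (∣∣-split S ⁅ y ⁆) (cong (_+ ∣ S ∩ ∁ ⁅ y ⁆ ∣) (trans (∣∣-cong (S ∩ ⁅ y ⁆) ⁅ y ⁆ proj₂ (λ where refl → y∈ , refl)) (∣⁅⁆∣ y)))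

another : ∀ {n} (S : Sub n) (y : Fin n) → 1 < ∣ S ∣ → ∃ λ x → x ∈ S × x ≢ y
another S y lt with mem? S y
... | yes y∈ = let x , x∈ , x≢ = nonempty (S ∩ ∁ ⁅ y ⁆) (s≤s⁻¹ (subst (1 <_) (∣∣-remove S y∈) lt)) in x , x∈ , x≢
... | no y∉ = let x , x∈ = nonempty S (<-trans (s≤s z≤n) lt) in x , x∈ , λ where refl → y∉ x∈

⊆-full : ∀ {n} (S T : Sub n) → S ⊆ T → ∣ T ∣ ≤ ∣ S ∣ → T ⊆ S
⊆-full S T s le {x} x∈T with mem? S x
... | yes p = p
... | no p = contradiction le (<⇒≱ (begin-strict
        ∣ S ∣ ≤⟨ ∣∣-mono S (T ∩ ∁ ⁅ x ⁆) (λ y → s y , λ where refl → p y) ⟩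
        ∣ T ∩ ∁ ⁅ x ⁆ ∣ <⟨ n<1+n _ ⟩
        suc ∣ T ∩ ∁ ⁅ x ⁆ ∣ ≡⟨ ∣∣-remove T x∈T ⟨
        ∣ T ∣ ∎))
  where open ≤-Reasoning

∣∣-inj : ∀ {m n} (S : Sub m) (T : Sub n) (f : Fin m → Fin n) → (∀ {x} → x ∈ S → f x ∈ T) →
  (∀ {x y} → x ∈ S → y ∈ S → f x ≡ f y → x ≡ y) → ∣ S ∣ ≤ ∣ T ∣
∣∣-inj {zero} S T f h i = z≤n
∣∣-inj {suc m} S T f h i with mem? S zero
... | no _ = ∣∣-inj ⟪ mem? S ∘ suc ⟫ T (f ∘ suc) h (λ p q e → suc-inj (i p q e))
  where
  suc-inj : ∀ {n} {x y : Fin n} → Fin.suc x ≡ suc y → x ≡ y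
  suc-inj refl = refl
... | yes z = subst (suc _ ≤_) (≡sym (∣∣-remove T (h z))) (s≤s
      (∣∣-inj ⟪ mem? S ∘ suc ⟫ (T ∩ ∁ ⁅ f zero ⁆) (f ∘ suc) (λ p → h p , λ e → 0≢s (i p z e)) (λ p q e → suc-inj (i p q e))))
  where
  suc-inj : ∀ {n} {x y : Fin n} → Fin.suc x ≡ suc y → x ≡ y
  suc-inj refl = refl
  0≢s : ∀ {n} {x : Fin n} → Fin.suc x ≢ zero
  0≢s ()

∣∣-bij : ∀ {m n} (S : Sub m) (T : Sub n) (f : Fin m → Fin n) (g : Fin n → Fin m) → (∀ x → g (f x) ≡ x) → (∀ y → f (g y) ≡ y) →
  (∀ {x} → x ∈ S → f x ∈ T) → (∀ {y} → y ∈ T → g y ∈ S) → ∣ S ∣ ≡ ∣ T ∣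
∣∣-bij S T f g gf fg h k = ≤-antisym
  (∣∣-inj S T f h (λ {x} {y} _ _ e → trans (≡sym (gf x)) (trans (cong g e) (gf y))))
  (∣∣-inj T S g k (λ {x} {y} _ _ e → trans (≡sym (fg x)) (trans (cong f e) (fg y))))

sum-over-≥ : ∀ {n} (S : Sub n) (f : Fin n → ℕ) c → (∀ {x} → x ∈ S → c ≤ f x) → ∣ S ∣ * c ≤ sum f
sum-over-≥ {zero} S f c h = z≤n
sum-over-≥ {suc n} S f c h with mem? S zero
... | yes p = +-mono-≤ (h p) (sum-over-≥ ⟪ mem? S ∘ suc ⟫ (f ∘ suc) c h)
... | no p = ≤-trans (sum-over-≥ ⟪ mem? S ∘ suc ⟫ (f ∘ suc) c h) (m≤n+m _ (f zero))

sum-over-≤ : ∀ {n} (S : Sub n) (f : Fin n → ℕ) c → (∀ {x} → x ∈ S → f x ≤ c) → (∀ {x} → ¬ x ∈ S → f x ≡ 0) → sum f ≤ ∣ S ∣ * c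
sum-over-≤ {zero} S f c h k = z≤n
sum-over-≤ {suc n} S f c h k with mem? S zero
... | yes p = +-mono-≤ (h p) (sum-over-≤ ⟪ mem? S ∘ suc ⟫ (f ∘ suc) c h k)
... | no p = subst (λ z → z + sum (f ∘ suc) ≤ _) (≡sym (k p)) (sum-over-≤ ⟪ mem? S ∘ suc ⟫ (f ∘ suc) c h k)

-- Both sides estimate the number of related pairs, counted by rows on the left and by columns on
-- the right.
double-count : ∀ {m n} {R : Fin m → Fin n → Set} (R? : ∀ x y → Dec (R x y)) (S : Sub m) (T : Sub n) r c →
  (∀ {x} → x ∈ S → r ≤ ∣ ⟪ R? x ⟫ ∣) → (∀ {y} → y ∈ T → ∣ ⟪ (λ x → R? x y) ⟫ ∣ ≤ c) →
  (∀ {x y} → R x y → y ∈ T) → ∣ S ∣ * r ≤ ∣ T ∣ * c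
double-count R? S T r c h k i = begin
  ∣ S ∣ * r ≤⟨ sum-over-≥ S _ r h ⟩
  sum (λ x → sum (λ y → bit (R? x y))) ≡⟨ ∑-comm (λ x y → bit (R? x y)) ⟩
  sum (λ y → sum (λ x → bit (R? x y))) ≤⟨ sum-over-≤ T _ c k (λ y∉ → ∣∣-empty ⟪ (λ x → R? x _) ⟫ (λ r → y∉ (i r))) ⟩
  ∣ T ∣ * c ∎
  where open ≤-Reasoning

-- S is peeled off one equivalence class at a time. Reflexivity is asked for on S alone, so that
-- `even-fixfree` can use a relation that includes membership in S. Lagrange's theorem and the class
-- equation arguments are further instances.
class-divides : ∀ {n} {R : Fin n → Fin n → Set} (R? : ∀ x y → Dec (R x y)) d (S : Sub n) →
  (∀ {x} → x ∈ S → R x x) → (∀ {x y} → R x y → R y x) → (∀ {x y z} → R x y → R y z → R x z) →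
  (∀ {x y} → x ∈ S → R x y → y ∈ S) → (∀ {x} → x ∈ S → d ∣ ∣ ⟪ R? x ⟫ ∣) → d ∣ ∣ S ∣
class-divides {n} {R} R? d S rf sy tr cl dv = go ∣ S ∣ S ≤-refl rf cl dv
  where
  go : ∀ m (S : Sub n) → ∣ S ∣ ≤ m → (∀ {x} → x ∈ S → R x x) → (∀ {x y} → x ∈ S → R x y → y ∈ S) →
       (∀ {x} → x ∈ S → d ∣ ∣ ⟪ R? x ⟫ ∣) → d ∣ ∣ S ∣
  go m S le rf cl dv with any? (mem? S)
  ... | no e = subst (d ∣_) (≡sym (∣∣-empty S (λ p → e (_ , p)))) (d ∣0)
  go zero S le rf cl dv | yes (x , x∈) = contradiction le (<⇒≱ (∣∣-pos S x∈))
  go (suc m) S le rf cl dv | yes (x , x∈) =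
    subst (d ∣_) (≡sym e) (∣m∣n⇒∣m+n (dv x∈) (go m S′ le′ (rf ∘ proj₁) (λ p r → cl (proj₁ p) r , λ q → proj₂ p (tr q (sy r))) (dv ∘ proj₁)))
    where
    S′ : Sub n
    S′ = S ∩ ∁ ⟪ R? x ⟫
    e : ∣ S ∣ ≡ ∣ ⟪ R? x ⟫ ∣ + ∣ S′ ∣
    e = trans (∣∣-split S ⟪ R? x ⟫) (cong (_+ ∣ S′ ∣) (∣∣-cong (S ∩ ⟪ R? x ⟫) ⟪ R? x ⟫ proj₂ (λ r → cl x∈ r , r)))
    le′ : ∣ S′ ∣ ≤ m
    le′ = ≤-pred (begin
      suc ∣ S′ ∣ ≤⟨ +-monoˡ-≤ ∣ S′ ∣ (∣∣-pos ⟪ R? x ⟫ (rf x∈)) ⟩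
      ∣ ⟪ R? x ⟫ ∣ + ∣ S′ ∣ ≡⟨ e ⟨
      ∣ S ∣ ≤⟨ le ⟩
      suc m ∎)
      where open ≤-Reasoning

even-fixfree : ∀ {n} (S : Sub n) (f : Fin n → Fin n) → (∀ {x} → x ∈ S → f x ∈ S) → (∀ {x} → x ∈ S → f (f x) ≡ x) → (∀ {x} → x ∈ S → f x ≢ x) → 2 ∣ ∣ S ∣
even-fixfree {n} S f h inv nf = class-divides R? 2 S (λ p → p , p , inj₁ refl) sy tr (λ _ → proj₁ ∘ proj₂) two
  where
  R : Fin n → Fin n → Set
  R x y = x ∈ S × y ∈ S × (y ≡ x ⊎ y ≡ f x)
  R? : ∀ x y → Dec (R x y)
  R? x y = mem? S x ×-dec (mem? S y ×-dec ((y ≟F x) ⊎-dec (y ≟F f x)))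
  sy : ∀ {x y} → R x y → R y x
  sy (o , p , inj₁ refl) = p , o , inj₁ refl
  sy (o , p , inj₂ refl) = p , o , inj₂ (≡sym (inv o))
  tr : ∀ {x y z} → R x y → R y z → R x z
  tr (o , p , inj₁ refl) r = r
  tr (o , p , inj₂ refl) (_ , q , inj₁ refl) = o , q , inj₂ refl
  tr (o , p , inj₂ refl) (_ , q , inj₂ e) = o , q , inj₁ (trans e (inv o))
  two : ∀ {x} → x ∈ S → 2 ∣ ∣ ⟪ R? x ⟫ ∣
  two {x} p = divides 1 (trans (∣∣-remove ⟪ R? x ⟫ (p , p , inj₁ refl)) (cong suc
    (trans (∣∣-cong (⟪ R? x ⟫ ∩ ∁ ⁅ x ⁆) ⁅ f x ⁆ (λ { ((_ , _ , inj₁ e) , ne) → contradiction e ne ; ((_ , _ , inj₂ e) , _) → e })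
      (λ { refl → (p , h p , inj₂ refl) , nf p })) (∣⁅⁆∣ (f x)))))

-- Words in a free group

infixl 7 _⊗_
data Word (k : ℕ) : Set where
  var : Fin k → Word k
  𝟙   : Word k
  _⊗_ : Word k → Word k → Word k
  inv : Word k → Word k

pattern 𝕩 = var zero
pattern 𝕪 = var (suc zero)
pattern 𝕫 = var (suc (suc zero))
pattern 𝕦 = var (suc (suc (suc zero)))
pattern 𝕧 = var (suc (suc (suc (suc zero))))

Letter : ℕ → Set
Letter k = Bool × Fin k

-- Free reduction decides the word problem of the free group; Theory.free turns it into an equality prover for G.
push : ∀ {k} → Letter k → List (Letter k) → List (Letter k)
push l [] = l ∷ []
push (s , i) ((t , j) ∷ w) with i ≟F j | s | t
... | yes _ | true  | false = w
... | yes _ | false | true  = w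
... | _     | _     | _     = (s , i) ∷ (t , j) ∷ w

letters : ∀ {k} → Bool → Word k → List (Letter k) → List (Letter k)
letters s (var i) w = push (s , i) w
letters s 𝟙 w = w
letters true (a ⊗ b) w = letters true a (letters true b w)
letters false (a ⊗ b) w = letters false b (letters false a w)
letters s (inv a) w = letters (not s) a w

-- Weighted sums and congruences

infix 6 _∖_
_∖_ : ∀ {n} → Sub n → List (Fin n) → Sub n
S ∖ xs = ⟪ (λ x → mem? S x ×-dec ¬? (mem-dec _≟F_ x xs)) ⟫

-- Three monoids are substituted: the naturals for cardinalities, the naturals modulo m for
-- homomorphisms, and G itself when it is abelian.
module Weighted {c ℓ} (M : CommutativeMonoid c ℓ) where
  open CommutativeMonoid M renaming (_∙_ to infixl 6 _⊕_; ε to 0#; refl to ≈refl; sym to ≈sym; trans to ≈trans; ∙-cong to ⊕-cong; identityˡ to ⊕-identityˡ; identityʳ to ⊕-identityʳ; assoc to ⊕-assoc; comm to ⊕-comm) public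
  open CMSum M using (sum-cong-≋; sum-permute; sum-replicate-zero) renaming (sum to ⨁; sum-cong-≗ to ⨁-cong-≗; ∑-distrib-+ to ⨁-distrib-⊕) public
  open import Relation.Binary.Reasoning.Setoid setoid

  pick : ∀ {A : Set} → Dec A → Carrier → Carrier
  pick d x = if does d then x else 0#

  weight : ∀ {n} → Sub n → (Fin n → Carrier) → Carrier
  weight S φ = ⨁ (λ x → pick (mem? S x) (φ x))

  pick-cong : ∀ {A B : Set} (d : Dec A) (e : Dec B) {x y} → (A → B) → (B → A) → (A → x ≈ y) → pick d x ≈ pick e y
  pick-cong (yes a) (yes b) f g h = h a
  pick-cong (no a) (no b) f g h = ≈refl
  pick-cong (yes a) (no b) f g h = contradiction (f a) b
  pick-cong (no a) (yes b) f g h = contradiction (g b) a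

  weight-cong : ∀ {n} → (S T : Sub n) (φ ψ : Fin n → Carrier) → S ⊆ T → T ⊆ S → (∀ {x} → x ∈ S → φ x ≈ ψ x) → weight S φ ≈ weight T ψ
  weight-cong S T φ ψ f g h = sum-cong-≋ (λ x → pick-cong (mem? S x) (mem? T x) f g h)

  weight-split : ∀ {n} → (S P : Sub n) (φ : Fin n → Carrier) → weight S φ ≈ weight (S ∩ P) φ ⊕ weight (S ∩ ∁ P) φ
  weight-split S P φ = ≈trans (sum-cong-≋ (λ x → lem (mem? S x) (mem? P x) (φ x))) (⨁-distrib-⊕ (λ x → pick (mem? (S ∩ P) x) (φ x)) _)
    where
    lem : ∀ {A B : Set} (a : Dec A) (b : Dec B) x → pick a x ≈ pick (a ×-dec b) x ⊕ pick (a ×-dec ¬? b) x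
    lem (no _) b x = ≈sym (⊕-identityˡ _)
    lem (yes _) (yes _) x = ≈sym (⊕-identityʳ _)
    lem (yes _) (no _) x = ≈sym (⊕-identityˡ _)

  weight-empty : ∀ {n} → (S : Sub n) (φ : Fin n → Carrier) → (∀ {x} → ¬ x ∈ S) → weight S φ ≈ 0#
  weight-empty {n} S φ h = ≈trans (sum-cong-≋ (λ x → lem (mem? S x) h)) (sum-replicate-zero n)
    where
    lem : ∀ {A : Set} {x} (a : Dec A) → ¬ A → pick a x ≈ 0#
    lem (no _) h = ≈refl
    lem (yes a) h = contradiction a h

  weight-singleton : ∀ {n} → (y : Fin n) (φ : Fin n → Carrier) → weight ⁅ y ⁆ φ ≈ φ y
  weight-singleton {suc n} zero φ = ≈trans (⊕-cong ≈refl (sum-replicate-zero n)) (⊕-identityʳ _)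
  weight-singleton {suc n} (suc y) φ = ≈trans (⊕-identityˡ _) (≈trans (sum-cong-≋ (λ x → pick-cong (suc x ≟F suc y) (x ≟F y) (λ { refl → refl }) (λ { refl → refl }) (λ _ → ≈refl))) (weight-singleton y (φ ∘ suc)))

  weight-remove : ∀ {n} → (S : Sub n) (φ : Fin n → Carrier) {y : Fin n} → y ∈ S → weight S φ ≈ φ y ⊕ weight (S ∩ ∁ ⁅ y ⁆) φ
  weight-remove S φ {y} p = ≈trans (weight-split S ⁅ y ⁆ φ) (⊕-cong (≈trans (weight-cong (S ∩ ⁅ y ⁆) ⁅ y ⁆ φ φ proj₂ (λ { refl → p , refl }) (λ _ → ≈refl)) (weight-singleton y φ)) ≈refl)

  listSum : ∀ {A : Set} → (A → Carrier) → List A → Carrier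
  listSum f [] = 0#
  listSum f (x ∷ xs) = f x ⊕ listSum f xs

  weight-list : ∀ {n} → (S : Sub n) (φ : Fin n → Carrier) (xs : List (Fin n)) → Unique xs → (∀ {x} → x ∈L xs → x ∈ S) →
    weight S φ ≈ listSum φ xs ⊕ weight (S ∖ xs) φ
  weight-list S φ [] u s = ≈trans (weight-cong S (S ∖ []) φ φ (λ p → p , λ ()) proj₁ (λ _ → ≈refl)) (≈sym (⊕-identityˡ _))
  weight-list S φ (x ∷ xs) (x∉ ∷ u) s = begin
    weight S φ ≈⟨ weight-remove S φ (s (here refl)) ⟩
    φ x ⊕ weight S′ φ ≈⟨ ⊕-cong ≈refl (weight-list S′ φ xs u (λ p → s (there p) , λ { refl → All-lookup x∉ p refl })) ⟩
    φ x ⊕ (listSum φ xs ⊕ weight (S′ ∖ xs) φ) ≈⟨ ⊕-assoc _ _ _ ⟨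
    φ x ⊕ listSum φ xs ⊕ weight (S′ ∖ xs) φ ≈⟨ ⊕-cong ≈refl (weight-cong (S′ ∖ xs) (S ∖ (x ∷ xs)) φ φ
       (λ { ((p , q) , r) → p , λ { (here refl) → q refl ; (there z) → r z } })
       (λ { (p , q) → (p , λ { refl → q (here refl) }) , λ z → q (there z) }) (λ _ → ≈refl)) ⟩
    φ x ⊕ listSum φ xs ⊕ weight (S ∖ (x ∷ xs)) φ ∎
    where S′ = S ∩ ∁ ⁅ x ⁆

  listSum-hom : ∀ {A : Set} (f g h : A → Carrier) xs → (∀ {t} → t ∈L xs → h t ≈ f t ⊕ g t) → listSum h xs ≈ listSum f xs ⊕ listSum g xs
  listSum-hom f g h [] p = ≈sym (⊕-identityˡ _)
  listSum-hom f g h (x ∷ xs) p = ≈trans (⊕-cong (p (here refl)) (listSum-hom f g h xs (p ∘ there))) (interchange _ _ _ _)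
    where open CSG commutativeSemigroup using (interchange)

  listSum-map : ∀ {A B : Set} (f : B → Carrier) (g : A → B) xs → listSum f (mapL g xs) ≡ listSum (f ∘ g) xs
  listSum-map f g [] = refl
  listSum-map f g (x ∷ xs) = cong (f (g x) ⊕_) (listSum-map f g xs)

module ℕW = Weighted +-0-commutativeMonoid

∣∣-list : ∀ {n} (S : Sub n) xs → Unique xs → (∀ {x} → x ∈L xs → x ∈ S) → ∣ S ∣ ≡ length xs + ∣ S ∖ xs ∣
∣∣-list S xs u s = trans (ℕW.weight-list S (λ _ → 1) xs u s) (cong (_+ ∣ S ∖ xs ∣) (ones xs))
  where
  ones : ∀ {A : Set} (xs : List A) → ℕW.listSum (λ _ → 1) xs ≡ length xs
  ones [] = refl
  ones (x ∷ xs) = cong suc (ones xs)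

infix 4 _≈[_]_
-- Multiples are added on both sides so that congruence needs neither subtraction nor integers.
record _≈[_]_ (x m y : ℕ) : Set where
  constructor ≈by
  field
    i j : ℕ
    eq  : x + i * m ≡ y + j * m

module Mod (m : ℕ) where
  mrefl : ∀ {x} → x ≈[ m ] x
  mrefl = ≈by 0 0 refl
  ≡⇒≈ : ∀ {x y} → x ≡ y → x ≈[ m ] y
  ≡⇒≈ refl = mrefl
  msym : ∀ {x y} → x ≈[ m ] y → y ≈[ m ] x
  msym (≈by i j p) = ≈by j i (≡sym p)
  mtrans : ∀ {x y z} → x ≈[ m ] y → y ≈[ m ] z → x ≈[ m ] z
  mtrans {x} {y} {z} (≈by i j p) (≈by k l q) = ≈by (i + k) (j + l) (begin
    x + (i + k) * m ≡⟨ l1 x i k m ⟩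
    (x + i * m) + k * m ≡⟨ cong (_+ k * m) p ⟩
    (y + j * m) + k * m ≡⟨ l2 y j k m ⟩
    (y + k * m) + j * m ≡⟨ cong (_+ j * m) q ⟩
    (z + l * m) + j * m ≡⟨ l3 z l j m ⟩
    z + (j + l) * m ∎)
    where
    open ≡-Reasoning
    l1 : ∀ x i k m → x + (i + k) * m ≡ (x + i * m) + k * m
    l1 = solve-∀
    l2 : ∀ y j k m → (y + j * m) + k * m ≡ (y + k * m) + j * m
    l2 = solve-∀
    l3 : ∀ z l j m → (z + l * m) + j * m ≡ z + (j + l) * m
    l3 = solve-∀
  m+ : ∀ {x y u v} → x ≈[ m ] y → u ≈[ m ] v → x + u ≈[ m ] y + v
  m+ {x} {y} {u} {v} (≈by i j p) (≈by k l q) = ≈by (i + k) (j + l) (trans (l1 x u i k m) (trans (cong₂ _+_ p q) (≡sym (l1 y v j l m))))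
    where
    l1 : ∀ x u i k m → x + u + (i + k) * m ≡ (x + i * m) + (u + k * m)
    l1 = solve-∀
  mcancel : ∀ z {x y} → z + x ≈[ m ] z + y → x ≈[ m ] y
  mcancel z {x} {y} (≈by i j p) = ≈by i j (+-cancelˡ-≡ z _ _ (trans (≡sym (+-assoc z x _)) (trans p (+-assoc z y _))))

  monoid : CommutativeMonoid _ _
  monoid = record
    { Carrier = ℕ ; _≈_ = _≈[ m ]_ ; _∙_ = _+_ ; ε = 0
    ; isCommutativeMonoid = record
      { isMonoid = record
        { isSemigroup = record
          { isMagma = record { isEquivalence = record { refl = mrefl ; sym = msym ; trans = mtrans } ; ∙-cong = m+ }
          ; assoc = λ x y z → ≡⇒≈ (+-assoc x y z) }
        ; identity = (λ x → mrefl) , λ x → ≡⇒≈ (+-identityʳ x) }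
      ; comm = λ x y → ≡⇒≈ (+-comm x y) } }

  module W = Weighted monoid

  ≈-const : ∀ {n} (S : Sub n) (φ : Fin n → ℕ) c → (∀ {x} → x ∈ S → φ x ≈[ m ] c) → W.weight S φ ≈[ m ] ∣ S ∣ * c
  ≈-const {zero} S φ c h = mrefl
  ≈-const {suc n} S φ c h with mem? S zero
  ... | yes p = m+ (h p) (≈-const ⟪ mem? S ∘ suc ⟫ (φ ∘ suc) c h)
  ... | no p = ≈-const ⟪ mem? S ∘ suc ⟫ (φ ∘ suc) c h

≈⇒% : ∀ m .{{_ : NonZero m}} {x y} → x ≈[ m ] y → x % m ≡ y % m
≈⇒% m {x} {y} (≈by i j p) = trans (≡sym ([m+kn]%n≡m%n x i m)) (trans (cong (_% m) p) ([m+kn]%n≡m%n y j m))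

-- q = 1 would give c = n, and q ≥ 3 would give n ≥ 3c ≥ 3k. This fixes the index of the subgroup
-- found by Freiman's argument.
quotient-two : ∀ {n c k} q → n ≡ q * c → k ≤ c → c < n → n < k + k + k → n ≡ c + c
quotient-two {c = c} zero refl _ lt _ = contradiction lt λ ()
quotient-two {c = c} (suc zero) e _ lt _ = contradiction (subst (c <_) (trans e (+-identityʳ c)) lt) (<-irrefl refl)
quotient-two {c = c} (suc (suc zero)) e _ _ _ = trans e (cong (c +_) (+-identityʳ c))
quotient-two {n} {c} {k} (suc (suc (suc q))) e le _ lt = contradiction (begin-strict
  n <⟨ lt ⟩
  k + k + k ≤⟨ +-mono-≤ (+-mono-≤ le le) le ⟩
  c + c + c ≤⟨ m≤m+n _ (q * c) ⟩
  c + c + c + q * c ≡⟨ l c q ⟩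
  suc (suc (suc q)) * c ≡⟨ e ⟨
  n ∎) (<-irrefl refl)
  where
  open ≤-Reasoning
  l : ∀ c q → c + c + c + q * c ≡ (3 + q) * c
  l = solve-∀

%≈ : ∀ m .{{_ : NonZero m}} x → x ≈[ m ] x % m
%≈ m x = ≈by 0 (x / m) (trans (+-identityʳ x) (m≡m%n+[m/n]*n x m))

double-injective : ∀ {a b} → a + a ≡ b + b → a ≡ b
double-injective {a} {b} p = *-cancelˡ-≡ a b 2 (trans (cong (a +_) (+-identityʳ a)) (trans p (cong (b +_) (≡sym (+-identityʳ b)))))

below : ∀ {P : ℕ → Set} N → (∀ (i : Fin (suc N)) → P (toℕ i)) → ∀ {k} → k ≤ N → P k
below {P} N f le = subst P (toℕ-fromℕ< (s≤s le)) (f (fromℕ< (s≤s le)))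

least : ∀ {P : ℕ → Set} (P? : ∀ i → Dec (P i)) b → P b → ∃ λ m → P m × (∀ {i} → i < m → ¬ P i)
least {P} P? b p = go b 0 (λ ()) (subst P (≡sym (+-identityʳ b)) p)
  where
  go : ∀ k i → (∀ {j} → j < i → ¬ P j) → P (k + i) → ∃ λ m → P m × (∀ {i} → i < m → ¬ P i)
  go zero i below q = i , q , below
  go (suc k) i below q with P? i
  ... | yes r = i , r , below
  ... | no r = go k (suc i) (λ {j} lt → case-lt (m<1+n⇒m<n∨m≡n lt)) (subst P (≡sym (+-suc k i)) q)
    where
    case-lt : ∀ {j} → j < i ⊎ j ≡ i → ¬ P j
    case-lt (inj₁ lt) = below lt
    case-lt (inj₂ refl) = r

<-via : ∀ {a b c d} → a ≡ c → b ≡ d → c < d → a < b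
<-via refl refl p = p

∣24 : ∀ c → 5 ≤ c → c ≤ 7 → c ∣ 24 → c ≡ 6
∣24 c lo hi = below {λ c → 5 ≤ c → c ∣ 24 → c ≡ 6} 7 (from-yes (all? {n = 8} λ i → (5 ≤? toℕ i) →-dec ((toℕ i ∣? 24) →-dec (toℕ i ≟ 6)))) hi lo

xor-notʳ : ∀ i j → i xor not j ≡ not (i xor j)
xor-notʳ false j = refl
xor-notʳ true false = refl
xor-notʳ true true = refl

xor-notˡ : ∀ i j → not i xor j ≡ not (i xor j)
xor-notˡ false j = refl
xor-notˡ true false = refl
xor-notˡ true true = refl

not-not : ∀ i → not (not i) ≡ i
not-not false = refl
not-not true = refl

three-or-six : ∀ c → 3 ≤ c → c ∣ 6 → c ≡ 3 ⊎ c ≡ 6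
three-or-six c lo p = below {λ c → 3 ≤ c → c ∣ 6 → c ≡ 3 ⊎ c ≡ 6} 6 (from-yes (all? {n = 7} λ i → (3 ≤? toℕ i) →-dec ((toℕ i ∣? 6) →-dec ((toℕ i ≟ 3) ⊎-dec (toℕ i ≟ 6))))) (∣⇒≤ p) lo p

six-or-twelve : ∀ c → 6 ≤ c → c ∣ 12 → c ≡ 6 ⊎ c ≡ 12
six-or-twelve c lo p = below {λ c → 6 ≤ c → c ∣ 12 → c ≡ 6 ⊎ c ≡ 12} 12 (from-yes (all? {n = 13} λ i → (6 ≤? toℕ i) →-dec ((toℕ i ∣? 12) →-dec ((toℕ i ≟ 6) ⊎-dec (toℕ i ≟ 12))))) (∣⇒≤ p) lo p

side-size : ℕ → ℕ → Bool → ℕ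
side-size k a false = a
side-size k a true = k ∸ a

-- a, b and d are the sizes of A, B and D on the two sides of a subgroup of order m and index two.
Fits : ℕ → ℕ → (Bool → ℕ) → (Bool → ℕ) → (Bool → ℕ) → Set
Fits k m a b d = ((a true + b true + d true) % 2 ≡ m % 2) ×
  (∀ i j → (0 < d (i xor j) → a i + b j ≤ m) × (0 < a i → b j + d (i xor j) ≤ m) × (0 < b j → d (i xor j) + a i ≤ m))

∀B? : ∀ {P : Bool → Set} → (∀ b → Dec (P b)) → Dec (∀ b → P b)
∀B? P? with P? false | P? true
... | yes p | yes q = yes λ { false → p ; true → q }
... | no p | _ = no λ f → p (f false)
... | yes _ | no q = no λ f → q (f true)

∃B? : ∀ {P : Bool → Set} → (∀ b → Dec (P b)) → Dec (∃ P)
∃B? P? with P? false | P? true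
... | yes p | _ = yes (false , p)
... | no _ | yes q = yes (true , q)
... | no p | no q = no λ { (false , r) → p r ; (true , r) → q r }

fits? : ∀ k m a b d → Dec (Fits k m a b d)
fits? k m a b d = (_ ≟ _) ×-dec ∀B? (λ i → ∀B? (λ j → ((_ <? _) →-dec (_ ≤? _)) ×-dec (((_ <? _) →-dec (_ ≤? _)) ×-dec ((_ <? _) →-dec (_ ≤? _)))))

Triples : Set
Triples = List (ℕ × ℕ × ℕ)

Hit : Triples → (Bool → ℕ) → (Bool → ℕ) → (Bool → ℕ) → Set
Hit ts a b d = ∃ λ i → ∃ λ j → (a i , b j , d (i xor j)) ∈L ts

hit? : ∀ ts a b d → Dec (Hit ts a b d)
hit? ts a b d = ∃B? (λ i → ∃B? (λ j → mem-dec (≡-dec _≟_ (≡-dec _≟_ _≟_)) _ ts))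

-- The three alternatives are the rotations of (A, B, D), under which configurations are invariant.
AnyHit : Triples → (Bool → ℕ) → (Bool → ℕ) → (Bool → ℕ) → Set
AnyHit ts a b d = Hit ts a b d ⊎ Hit ts b d a ⊎ Hit ts d a b

Critical : ℕ → ℕ → Triples → Set
Critical k m ts = ∀ (a b d : Fin (suc k)) → Fits k m (side-size k (toℕ a)) (side-size k (toℕ b)) (side-size k (toℕ d)) → AnyHit ts (side-size k (toℕ a)) (side-size k (toℕ b)) (side-size k (toℕ d))

critical? : ∀ k m ts → Dec (Critical k m ts)
critical? k m ts = all? λ a → all? λ b → all? λ d → fits? k m (side-size k (toℕ a)) (side-size k (toℕ b)) (side-size k (toℕ d)) →-dec (hit? ts (side-size k (toℕ a)) (side-size k (toℕ b)) (side-size k (toℕ d)) ⊎-dec (hit? ts (side-size k (toℕ b)) (side-size k (toℕ d)) (side-size k (toℕ a)) ⊎-dec hit? ts (side-size k (toℕ d)) (side-size k (toℕ a)) (side-size k (toℕ b))))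

-- All four sums a i + b j + d (i xor j) are odd; their total is 24 for order 10 and 54 for order 24, so one of
-- them is at least 7, respectively 15.
triples₁₀ triples₂₄ : Triples
triples₁₀ = (2 , 2 , 3) ∷ []
triples₂₄ = (6 , 6 , 3) ∷ (4 , 6 , 5) ∷ (5 , 5 , 5) ∷ (5 , 6 , 6) ∷ (5 , 5 , 7) ∷ []

abstract
  critical₁₀ : Critical 4 5 triples₁₀
  critical₁₀ = from-yes (critical? 4 5 triples₁₀)

  critical₂₄ : Critical 9 12 triples₂₄
  critical₂₄ = from-yes (critical? 9 12 triples₂₄)

power-of-two : ∀ m q → q ∣ 2 ^ m → q ≡ 1 ⊎ 2 ∣ q
power-of-two zero q (divides zero ())
power-of-two zero q (divides (suc c) e) = inj₁ (m*n≡1⇒n≡1 (suc c) q (≡sym e))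
power-of-two (suc m) q (divides c e) with euclidsLemma c q prime[2] (divides (2 ^ m) (trans (≡sym e) (*-comm 2 (2 ^ m))))
... | inj₂ 2∣q = inj₂ 2∣q
... | inj₁ (divides c′ e′) = power-of-two m q (divides c′ (*-cancelʳ-≡ _ _ 2 (trans (*-comm (2 ^ m) 2) (trans e (trans (cong (_* q) e′) (l c′ q))))))
  where
  l : ∀ a b → a * 2 * b ≡ a * b * 2
  l = solve-∀

-- Power-commutator presentations

V : ℕ → Set
V = Vec Bool

∃V? : ∀ {m} {P : V m → Set} → (∀ v → Dec (P v)) → Dec (∃ P)
∃V? {zero} P? with P? []
... | yes p = yes ([] , p)
... | no p = no λ { ([] , q) → p q }
∃V? {suc m} P? with ∃V? (λ v → P? (false ∷ v)) | ∃V? (λ v → P? (true ∷ v))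
... | yes (v , p) | _ = yes (false ∷ v , p)
... | no _ | yes (v , p) = yes (true ∷ v , p)
... | no p | no q = no λ { (false ∷ v , r) → p (v , r) ; (true ∷ v , r) → q (v , r) }

Tails : ℕ → Set
Tails zero = ⊤
Tails (suc m) = V m × Tails m

-- A power-commutator presentation of a group of order 2^m: adjoining g on top of h₁, …, hₘ
-- records g² as a word in the hᵢ and each commutator as a word in the generators below hᵢ.
data Pres : ℕ → Set where
  triv : Pres 0
  ext  : ∀ {m} → Pres m → V m → Tails m → Pres (suc m)

-- Collection into normal form: `act p τ u` is what u becomes when a new top generator g with
-- commutators τ is moved to its left, and a resulting g² is replaced by the word s.
pmul : ∀ {m} → Pres m → V m → V m → V m
act  : ∀ {m} → Pres m → Tails m → V m → V m
act triv _ [] = []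
act (ext p s τ) (t , ts) (false ∷ u) = false ∷ act p ts u
act (ext p s τ) (t , ts) (true ∷ u) = true ∷ pmul p t (act p ts u)
pmul triv [] [] = []
pmul (ext p s τ) (b ∷ u) (false ∷ v) = b ∷ pmul p u v
pmul (ext p s τ) (false ∷ u) (true ∷ v) = true ∷ pmul p (act p τ u) v
pmul (ext p s τ) (true ∷ u) (true ∷ v) = false ∷ pmul p (pmul p s (act p τ u)) v

zeros : ∀ {m} → V m
zeros = replicate _ false

module Presented {X : Set} (_∙_ : X → X → X) (e₀ : X) where
  ev : ∀ {m} → Vec X m → V m → X
  ev [] [] = e₀
  ev (g ∷ gs) (false ∷ v) = ev gs v
  ev (g ∷ gs) (true ∷ v) = g ∙ ev gs v

  -- The tail t stands for the commutator h⁻¹g⁻¹hg, so the relation moves g to the left past h.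
  Comm : ∀ {m} → X → Vec X m → Tails m → Set
  Comm g [] _ = ⊤
  Comm g (h ∷ hs) (t , ts) = (h ∙ g ≡ g ∙ (h ∙ ev hs t)) × Comm g hs ts

  Sat : ∀ {m} → Pres m → Vec X m → Set
  Sat triv [] = ⊤
  Sat (ext p s τ) (g ∷ gs) = Sat p gs × (g ∙ g ≡ ev gs s) × Comm g gs τ

  module _ (_≟X_ : ∀ (x y : X) → Dec (x ≡ y)) where
    comm? : ∀ {m} g (gs : Vec X m) τ → Dec (Comm g gs τ)
    comm? g [] τ = yes tt
    comm? g (h ∷ hs) (t , ts) = (_ ≟X _) ×-dec comm? g hs ts

    sat? : ∀ {m} (p : Pres m) gs → Dec (Sat p gs)
    sat? triv [] = yes tt
    sat? (ext p s τ) (g ∷ gs) = sat? p gs ×-dec ((_ ≟X _) ×-dec comm? g gs τ)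

  module Assoc (assoc : ∀ x y z → (x ∙ y) ∙ z ≡ x ∙ (y ∙ z)) (idˡ : ∀ x → e₀ ∙ x ≡ x) (idʳ : ∀ x → x ∙ e₀ ≡ x) where
    -- The two statements hold by simultaneous induction on the presentation. Consistency of the
    -- presentation is not assumed: wherever the relations hold, collection preserves the value of a
    -- word, even if distinct normal forms have equal values.
    ev-act : ∀ {m} (p : Pres m) gs → Sat p gs → ∀ {g τ} → Comm g gs τ → ∀ u → ev gs u ∙ g ≡ g ∙ ev gs (act p τ u)
    ev-mul : ∀ {m} (p : Pres m) gs → Sat p gs → ∀ u v → ev gs u ∙ ev gs v ≡ ev gs (pmul p u v)
    ev-act triv [] s c [] = trans (idˡ _) (≡sym (idʳ _))
    ev-act (ext p s τ) (h ∷ hs) (st , _) (_ , cs) (false ∷ u) = ev-act p hs st cs u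
    ev-act (ext p s τ) (h ∷ hs) (st , _) {g} {t , ts} (c , cs) (true ∷ u) = begin
      (h ∙ ev hs u) ∙ g ≡⟨ assoc _ _ _ ⟩
      h ∙ (ev hs u ∙ g) ≡⟨ cong (h ∙_) (ev-act p hs st cs u) ⟩
      h ∙ (g ∙ ev hs u′) ≡⟨ assoc _ _ _ ⟨
      (h ∙ g) ∙ ev hs u′ ≡⟨ cong (_∙ ev hs u′) c ⟩
      (g ∙ (h ∙ ev hs t)) ∙ ev hs u′ ≡⟨ trans (assoc _ _ _) (cong (g ∙_) (assoc _ _ _)) ⟩
      g ∙ (h ∙ (ev hs t ∙ ev hs u′)) ≡⟨ cong (λ z → g ∙ (h ∙ z)) (ev-mul p hs st t u′) ⟩
      g ∙ (h ∙ ev hs (pmul p t u′)) ∎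
      where
      open ≡-Reasoning
      u′ = act p ts u
    ev-mul triv [] s [] [] = idˡ _
    ev-mul (ext p s τ) (g ∷ gs) (st , _) (false ∷ u) (false ∷ v) = ev-mul p gs st u v
    ev-mul (ext p s τ) (g ∷ gs) (st , _) (true ∷ u) (false ∷ v) = trans (assoc _ _ _) (cong (g ∙_) (ev-mul p gs st u v))
    ev-mul (ext p s τ) (g ∷ gs) (st , sq , c) (false ∷ u) (true ∷ v) =
      trans (≡sym (assoc _ _ _)) (trans (cong (_∙ ev gs v) (ev-act p gs st c u)) (trans (assoc _ _ _) (cong (g ∙_) (ev-mul p gs st (act p τ u) v))))
    ev-mul (ext p s τ) (g ∷ gs) (st , sq , c) (true ∷ u) (true ∷ v) = begin
      (g ∙ ev gs u) ∙ (g ∙ ev gs v) ≡⟨ trans (assoc _ _ _) (cong (g ∙_) (≡sym (assoc _ _ _))) ⟩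
      g ∙ ((ev gs u ∙ g) ∙ ev gs v) ≡⟨ cong (λ z → g ∙ (z ∙ ev gs v)) (ev-act p gs st c u) ⟩
      g ∙ ((g ∙ ev gs u′) ∙ ev gs v) ≡⟨ trans (≡sym (assoc _ _ _)) (cong (_∙ ev gs v) (≡sym (assoc _ _ _))) ⟩
      ((g ∙ g) ∙ ev gs u′) ∙ ev gs v ≡⟨ cong (λ z → (z ∙ ev gs u′) ∙ ev gs v) sq ⟩
      (ev gs s ∙ ev gs u′) ∙ ev gs v ≡⟨ cong (_∙ ev gs v) (ev-mul p gs st s u′) ⟩
      ev gs (pmul p s u′) ∙ ev gs v ≡⟨ ev-mul p gs st _ v ⟩
      ev gs (pmul p (pmul p s u′) v) ∎
      where
      open ≡-Reasoning
      u′ = act p τ u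

module Transfer {X Y : Set} {_∙_ : X → X → X} {e₀ : X} {_∘′_ : Y → Y → Y} {e₁ : Y}
                (f : X → Y) (f-∙ : ∀ x y → f (x ∙ y) ≡ f x ∘′ f y) (f-e : f e₀ ≡ e₁) where
  module PX = Presented _∙_ e₀
  module PY = Presented _∘′_ e₁

  ev-map : ∀ {m} (gs : Vec X m) v → f (PX.ev gs v) ≡ PY.ev (mapV f gs) v
  ev-map [] [] = f-e
  ev-map (g ∷ gs) (false ∷ v) = ev-map gs v
  ev-map (g ∷ gs) (true ∷ v) = trans (f-∙ _ _) (cong (f g ∘′_) (ev-map gs v))

  comm-map : ∀ {m} g (gs : Vec X m) τ → PX.Comm g gs τ → PY.Comm (f g) (mapV f gs) τ
  comm-map g [] τ c = tt
  comm-map g (h ∷ hs) (t , ts) (c , cs) = trans (≡sym (f-∙ _ _)) (trans (cong f c) (trans (f-∙ _ _) (cong (f g ∘′_) (trans (f-∙ _ _) (cong (f h ∘′_) (ev-map hs t)))))) , comm-map g hs ts cs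

  sat-map : ∀ {m} (p : Pres m) gs → PX.Sat p gs → PY.Sat p (mapV f gs)
  sat-map triv [] s = tt
  sat-map (ext p s τ) (g ∷ gs) (st , sq , c) = sat-map p gs st , trans (≡sym (f-∙ _ _)) (trans (cong f sq) (ev-map gs s)) , comm-map g gs τ c

record Struct {n} (G : FinGroup n) {m : ℕ} (p : Pres m) : Set where
  open FinGroup G
  field
    w      : V m → Fin n
    w-inj  : ∀ {u v} → w u ≡ w v → u ≡ v
    w-surj : ∀ x → ∃ λ v → w v ≡ x
    w-hom  : ∀ u v → w u · w v ≡ w (pmul p u v)
    w-ε    : w zeros ≡ ε

unique-map : ∀ {X Y : Set} {f : X → Y} {xs x y} → Unique (mapL f xs) → x ∈L xs → y ∈L xs → f x ≡ f y → x ≡ y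
unique-map u (here refl) (here refl) _ = refl
unique-map {f = f} (a ∷ _) (here refl) (there q) e = contradiction e (All-lookup a (∈-map⁺ f q))
unique-map {f = f} (a ∷ _) (there p) (here refl) e = contradiction (≡sym e) (All-lookup a (∈-map⁺ f p))
unique-map (_ ∷ u) (there p) (there q) e = unique-map u p q e

module Witnesses {X : Set} (_≟X_ : ∀ (x y : X) → Dec (x ≡ y)) (elems : List X) (complete : ∀ x → x ∈L elems) where
  unique? : ∀ (xs : List X) → Dec (Unique xs)
  unique? = allPairs? (λ x y → ¬? (x ≟X y))

  in? : ∀ x (xs : List X) → Dec (x ∈L xs)
  in? = mem-dec _≟X_

  module _ (_∙_ : X → X → X) where
    symbol : X × X → X
    symbol (r , c) = r ∙ c

    -- Maximality as a finite test: every cell of the table shares its row, its column or its symbol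
    -- with a chosen cell.
    Blocked : List X → List X → List X → Set
    Blocked rs cs ss = All (λ a → a ∈L rs ⊎ All (λ b → b ∈L cs ⊎ (a ∙ b) ∈L ss) elems) elems

    Witness : List (X × X) → Set
    Witness ps = Unique (mapL proj₁ ps) × Unique (mapL proj₂ ps) × Unique (mapL symbol ps) × Blocked (mapL proj₁ ps) (mapL proj₂ ps) (mapL symbol ps)

    witness? : ∀ ps → Dec (Witness ps)
    witness? ps = unique? _ ×-dec (unique? _ ×-dec (unique? _ ×-dec all-list? (λ a → in? a _ ⊎-dec all-list? (λ b → in? b _ ⊎-dec in? _ _) elems) elems))

    module _ {n} (G : FinGroup n) (f : X → Fin n) (f-inj : ∀ {x y} → f x ≡ f y → x ≡ y) (f-surj : ∀ x → ∃ λ v → f v ≡ x)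
             (f-hom : ∀ x y → FinGroup._·_ G (f x) (f y) ≡ f (x ∙ y)) where
      open FinGroup G

      triple : X × X → Triple n
      triple (r , c) = f r , f c , f (r ∙ c)

      -- Let T′ be a partial transversal containing T. Each triple of T′ is blocked by some triple
      -- of T, which also belongs to T′ and shares a coordinate with it, so the two coincide. The
      -- rows of T′ are thus rows of T, which bounds the length of T′.
      has-witness : ∀ ps → Witness ps → HasMaximalPTOfLength (cayley G) (length ps)
      has-witness ps (ur , uc , us , bl) = T , (pt , max) , length-map triple ps
        where
        T = mapL triple ps
        um : ∀ {g : X × X → X} → Unique (mapL g ps) → Unique (mapL (λ p → f (g p)) ps)
        um {g} u = subst Unique (≡sym (map-∘ ps)) (Unique-map⁺ f-inj u)
        pt : PartialTransversal (cayley G) T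
        pt = record
          { triples = λ t∈ → let (r , c) , _ , e = ∈-map⁻ triple t∈ in subst (InSquare (cayley G)) (≡sym e) (≡sym (f-hom r c))
          ; rowsUniq = subst Unique (map-∘ ps) (um ur)
          ; colsUniq = subst Unique (map-∘ ps) (um uc)
          ; symsUniq = subst Unique (map-∘ ps) (um us) }
        max : ∀ T′ → PartialTransversal (cayley G) T′ → (∀ {t} → t ∈L T → t ∈L T′) → length T′ ≤ length T
        max T′ pt′ sub = begin
            length T′ ≡⟨ length-map row T′ ⟨
            length (mapL row T′) ≤⟨ m≤m+n _ _ ⟩
            length (mapL row T′) + ∣ R ∖ mapL row T′ ∣ ≡⟨ ∣∣-list R (mapL row T′) (PartialTransversal.rowsUniq pt′) inR ⟨
            ∣ R ∣ ≡⟨ ∣∣-list R (mapL row T) (PartialTransversal.rowsUniq pt) id ⟩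
            length (mapL row T) + ∣ R ∖ mapL row T ∣ ≡⟨ cong₂ _+_ (length-map row T) (∣∣-empty (R ∖ mapL row T) (λ (p , q) → q p)) ⟩
            length T + 0 ≡⟨ +-identityʳ _ ⟩
            length T ∎
          where
          open ≤-Reasoning
          R : Sub n
          R = ⟪ (λ x → mem-dec _≟F_ x (mapL row T)) ⟫
          module PT′ = PartialTransversal pt′
          old : ∀ {t p} → t ∈L T′ → p ∈L ps → row (triple p) ≡ row t ⊎ col (triple p) ≡ col t ⊎ sym (triple p) ≡ sym t → row t ∈L mapL row T
          old {t} {p} t∈ p∈ e = subst (λ z → row z ∈L mapL row T) (same e) (∈-map⁺ row (∈-map⁺ triple p∈))
            where
            same : row (triple p) ≡ row t ⊎ col (triple p) ≡ col t ⊎ sym (triple p) ≡ sym t → triple p ≡ t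
            same (inj₁ e) = unique-map PT′.rowsUniq (sub (∈-map⁺ triple p∈)) t∈ e
            same (inj₂ (inj₁ e)) = unique-map PT′.colsUniq (sub (∈-map⁺ triple p∈)) t∈ e
            same (inj₂ (inj₂ e)) = unique-map PT′.symsUniq (sub (∈-map⁺ triple p∈)) t∈ e
          inR : ∀ {x} → x ∈L mapL row T′ → x ∈ R
          inR x∈ = let t , t∈ , e = ∈-map⁻ row x∈ in subst (_∈L mapL row T) (≡sym e) (go t t∈)
            where
            go : ∀ t → t ∈L T′ → row t ∈L mapL row T
            go t t∈ = let a , ea = f-surj (row t) ; b , eb = f-surj (col t) in split a b ea eb (All-lookup bl (complete a))
              where
              symt : ∀ {a b} → f a ≡ row t → f b ≡ col t → f (a ∙ b) ≡ sym t
              symt {a} {b} ea eb = trans (≡sym (f-hom a b)) (trans (cong₂ _·_ ea eb) (≡sym (PT′.triples t∈)))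
              inner : ∀ a b → f a ≡ row t → f b ≡ col t → b ∈L mapL proj₂ ps ⊎ (a ∙ b) ∈L mapL symbol ps → row t ∈L mapL row T
              inner a b ea eb (inj₁ q) = let p , p∈ , e = ∈-map⁻ proj₂ q in old t∈ p∈ (inj₂ (inj₁ (trans (cong f (≡sym e)) eb)))
              inner a b ea eb (inj₂ q) = let p , p∈ , e = ∈-map⁻ symbol q in old t∈ p∈ (inj₂ (inj₂ (trans (cong f (≡sym e)) (symt ea eb))))
              split : ∀ a b → f a ≡ row t → f b ≡ col t → a ∈L mapL proj₁ ps ⊎ All (λ b → b ∈L mapL proj₂ ps ⊎ (a ∙ b) ∈L mapL symbol ps) elems → row t ∈L mapL row T
              split a b ea eb (inj₁ q) = let p , p∈ , e = ∈-map⁻ proj₁ q in old t∈ p∈ (inj₁ (trans (cong f (≡sym e)) ea))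
              split a b ea eb (inj₂ al) = inner a b ea eb (All-lookup al (complete b))

allV : ∀ m → List (V m)
allV zero = [] ∷ []
allV (suc m) = mapL (false ∷_) (allV m) ++ mapL (true ∷_) (allV m)

allV-complete : ∀ {m} (v : V m) → v ∈L allV m
allV-complete [] = here refl
allV-complete (false ∷ v) = ∈-++⁺ˡ (∈-map⁺ (false ∷_) (allV-complete v))
allV-complete (true ∷ v) = ∈-++⁺ʳ (mapL (false ∷_) (allV _)) (∈-map⁺ (true ∷_) (allV-complete v))

allTails : ∀ m → List (Tails m)
allTails zero = tt ∷ []
allTails (suc m) = cartesianProductWith _,_ (allV m) (allTails m)

allTails-complete : ∀ {m} (τ : Tails m) → τ ∈L allTails m
allTails-complete {zero} tt = here refl
allTails-complete {suc m} (t , τ) = ∈-cartesianProductWith⁺ _,_ (allV-complete t) (allTails-complete τ)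

allPres : ∀ m → List (Pres m)
allPres zero = triv ∷ []
allPres (suc m) = cartesianProductWith (λ p st → ext p (proj₁ st) (proj₂ st)) (allPres m) (cartesianProductWith _,_ (allV m) (allTails m))

allPres-complete : ∀ {m} (p : Pres m) → p ∈L allPres m
allPres-complete triv = here refl
allPres-complete (ext p s τ) = ∈-cartesianProductWith⁺ _ (allPres-complete p) (∈-cartesianProductWith⁺ _,_ (allV-complete s) (allTails-complete τ))

_≟V_ : ∀ {m} (u v : V m) → Dec (u ≡ v)
_≟V_ = VecP.≡-dec _≟B_

units : ∀ m → List (V m)
units zero = []
units (suc m) = (true ∷ zeros) ∷ mapL (false ∷_) (units m)

-- One failure already shows that no group has this presentation, and in the enumerations below a
-- triple of generators provides it for every presentation coded by 0.
NonAssoc : ∀ {m} → Pres m → Set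
NonAssoc {m} p = Any (λ u → Any (λ v → Any (λ t → pmul p (pmul p u v) t ≢ pmul p u (pmul p v t)) (units m)) (units m)) (units m)

nonAssoc? : ∀ {m} (p : Pres m) → Dec (NonAssoc p)
nonAssoc? {m} p = any-list? (λ u → any-list? (λ v → any-list? (λ t → ¬? (_ ≟V _)) (units m)) (units m)) (units m)

Commutative : ∀ {m} → Pres m → Set
Commutative {m} p = All (λ u → All (λ v → pmul p u v ≡ pmul p v u) (allV m)) (allV m)

commutative? : ∀ {m} (p : Pres m) → Dec (Commutative p)
commutative? {m} p = all-list? (λ u → all-list? (λ v → _ ≟V _) (allV m)) (allV m)

module _ {m} (p q : Pres m) (cs : Vec (V m) m) where
  open Presented (pmul p) zeros

  Spans : List (V m) → Set
  Spans l = Unique l × All (λ v → v ∈L l) (allV m)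

  spans? : ∀ l → Dec (Spans l)
  spans? l = allPairs? (λ x y → ¬? (x ≟V y)) l ×-dec all-list? (λ v → mem-dec _≟V_ v l) (allV m)

  -- A change of generators from p to q: the relations of q hold for `cs` in the table of p, and the
  -- normal words in `cs` run through all elements once.
  Presents : Set
  Presents = Sat q cs × Spans (mapL (ev cs) (allV m))

  presents? : Dec Presents
  presents? = sat? _≟V_ q cs ×-dec spans? (mapL (ev cs) (allV m))

-- Binary digits of k, the most significant first; the leading digit belongs to the top generator of
-- a presentation.
bits : ∀ m → ℕ → V m
bits zero k = []
bits (suc m) k = bit? (k / 2 ^ m) ∷ bits m k
  where
  instance
    nz : NonZero (2 ^ m)
    nz = m^n≢0 2 m
  bit? : ℕ → Bool
  bit? k = does (k % 2 ≟ 1)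

-- A code is 0, or 1 + i + 16 (c₁ + 2^m (c₂ + …)): the presentation is isomorphic to the i-th
-- canonical one, whose generators are the words numbered c₁, c₂, …
digits : ∀ m k → ℕ → Vec (V m) k
digits m zero c = []
digits m (suc k) c = bits m (c % 2 ^ m) ∷ digits m k (c / 2 ^ m)
  where
  instance
    nz : NonZero (2 ^ m)
    nz = m^n≢0 2 m

nth : ∀ {A : Set} (xs : List A) → ℕ → Maybe (∃ λ x → x ∈L xs)
nth [] _ = nothing
nth (x ∷ xs) zero = just (x , here refl)
nth (x ∷ xs) (suc i) with nth xs i
... | nothing = nothing
... | just (y , p) = just (y , there p)

module Classification {m} (canon : List (Pres m)) where

  Is : Pres m → Vec (V m) m → Maybe (∃ λ q → q ∈L canon) → Set
  Is p cs nothing = ⊥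
  Is p cs (just (q , _)) = Presents p q cs

  is? : ∀ p cs q → Dec (Is p cs q)
  is? p cs nothing = no id
  is? p cs (just (q , _)) = presents? p q cs

  Verdict : Pres m → ℕ → Set
  Verdict p zero = NonAssoc p
  Verdict p (suc c) = Is p (digits m m (c / 16)) (nth canon (c % 16))

  verdict? : ∀ p c → Dec (Verdict p c)
  verdict? p zero = nonAssoc? p
  verdict? p (suc c) = is? p (digits m m (c / 16)) (nth canon (c % 16))

  Verdicts : List (Pres m) → List ℕ → Set
  Verdicts [] _ = ⊤
  Verdicts (p ∷ ps) [] = ⊥
  Verdicts (p ∷ ps) (c ∷ cs) = Verdict p c × Verdicts ps cs

  verdicts? : ∀ ps cs → Dec (Verdicts ps cs)
  verdicts? [] _ = yes tt
  verdicts? (p ∷ ps) [] = no id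
  verdicts? (p ∷ ps) (c ∷ cs) = verdict? p c ×-dec verdicts? ps cs

  verdict : ∀ {ps cs p} → Verdicts ps cs → p ∈L ps → ∃ (Verdict p)
  verdict {_ ∷ _} {c ∷ _} (v , _) (here refl) = c , v
  verdict {_ ∷ _} {_ ∷ _} (_ , vs) (there i) = verdict vs i

-- The arguments of `pres₂`, `pres₃` and `pres₄` number the squares and commutators from the bottom
-- generator upwards. The bottom generator has order two and is central, so it takes no argument.
pres₂ : ℕ → Pres 2
pres₂ a = ext (ext triv [] tt) (bits 1 a) ([] , tt)

pres₃ : ℕ → ℕ → ℕ → Pres 3
pres₃ a b c = ext (pres₂ a) (bits 2 b) (bits 1 c , [] , tt)

pres₄ : ℕ → ℕ → ℕ → ℕ → ℕ → ℕ → Pres 4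
pres₄ a b c d e f = ext (pres₃ a b c) (bits 3 d) (bits 2 e , bits 1 f , [] , tt)

-- Groups of order 8 and 16

-- In this order: the elementary abelian group, the dihedral group, ℤ₄ × ℤ₂, the quaternion group
-- and ℤ₈.
canon₃ : List (Pres 3)
canon₃ = pres₃ 0 0 0 ∷ pres₃ 0 0 1 ∷ pres₃ 0 1 0 ∷ pres₃ 1 1 1 ∷ pres₃ 1 2 0 ∷ []

codes₃ : List ℕ
codes₃ =
  1345 ∷ 1346 ∷ 1347 ∷ 1378 ∷ 2243 ∷ 0 ∷ 3267 ∷ 0 ∷ 1571 ∷ 1634 ∷ 1827 ∷ 1348 ∷ 1349 ∷ 0 ∷ 1381 ∷ 0 ∷ []

-- Five of the fourteen groups are abelian; their entries in `transversals₄` are empty, because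
-- `Checked` accepts commutativity instead.
canon₄ : List (Pres 4)
canon₄ =
  pres₄ 0 0 0 0 0 0 ∷
  pres₄ 0 0 0 0 0 1 ∷
  pres₄ 0 0 0 1 0 0 ∷
  pres₄ 0 0 0 1 2 0 ∷
  pres₄ 0 0 1 0 1 1 ∷
  pres₄ 0 1 0 1 1 0 ∷
  pres₄ 0 1 0 1 2 0 ∷
  pres₄ 0 1 0 2 0 0 ∷
  pres₄ 0 1 0 4 0 0 ∷
  pres₄ 0 1 0 4 0 1 ∷
  pres₄ 1 0 1 0 2 1 ∷
  pres₄ 1 0 1 1 2 1 ∷
  pres₄ 1 1 1 1 2 1 ∷
  pres₄ 1 2 0 4 0 0 ∷ []

codes₄ : List ℕ
codes₄ =
  74881 ∷ 74882 ∷ 82562 ∷ 75394 ∷ 147842 ∷ 0 ∷ 213378 ∷ 0 ∷ 74883 ∷ 74914 ∷ 82626 ∷ 75426 ∷ 74884 ∷ 0 ∷ 78980 ∷ 0 ∷ 136323 ∷ 0 ∷ 136324 ∷ 0 ∷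
  147906 ∷ 0 ∷ 79044 ∷ 0 ∷ 201859 ∷ 0 ∷ 136388 ∷ 0 ∷ 74948 ∷ 0 ∷ 213442 ∷ 0 ∷ 266883 ∷ 266884 ∷ 0 ∷ 0 ∷ 0 ∷ 0 ∷ 0 ∷ 0 ∷ 332419 ∷ 266916 ∷ 0 ∷ 0 ∷ 0 ∷
  0 ∷ 0 ∷ 0 ∷ 397955 ∷ 0 ∷ 0 ∷ 397956 ∷ 0 ∷ 0 ∷ 0 ∷ 0 ∷ 463491 ∷ 0 ∷ 0 ∷ 397988 ∷ 0 ∷ 0 ∷ 0 ∷ 0 ∷ 75842 ∷ 76866 ∷ 76354 ∷ 74885 ∷ 0 ∷ 0 ∷ 0 ∷ 0 ∷
  74981 ∷ 74917 ∷ 74949 ∷ 77378 ∷ 0 ∷ 0 ∷ 0 ∷ 0 ∷ 0 ∷ 0 ∷ 0 ∷ 0 ∷ 0 ∷ 0 ∷ 0 ∷ 0 ∷ 0 ∷ 0 ∷ 0 ∷ 0 ∷ 0 ∷ 0 ∷ 0 ∷ 0 ∷ 0 ∷ 0 ∷ 0 ∷ 0 ∷ 0 ∷ 0 ∷ 0 ∷ 0 ∷ 0 ∷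
  0 ∷ 0 ∷ 0 ∷ 0 ∷ 0 ∷ 0 ∷ 0 ∷ 0 ∷ 0 ∷ 0 ∷ 0 ∷ 0 ∷ 0 ∷ 0 ∷ 0 ∷ 0 ∷ 0 ∷ 0 ∷ 0 ∷ 0 ∷ 0 ∷ 0 ∷ 0 ∷ 75843 ∷ 76005 ∷ 99010 ∷ 75973 ∷ 75844 ∷ 0 ∷ 79940 ∷ 0 ∷
  76867 ∷ 76485 ∷ 74886 ∷ 76517 ∷ 74887 ∷ 0 ∷ 78983 ∷ 0 ∷ 74888 ∷ 0 ∷ 137415 ∷ 0 ∷ 74951 ∷ 0 ∷ 80964 ∷ 0 ∷ 74952 ∷ 0 ∷ 202951 ∷ 0 ∷ 76868 ∷ 0 ∷
  79047 ∷ 0 ∷ 74889 ∷ 74890 ∷ 0 ∷ 0 ∷ 0 ∷ 0 ∷ 0 ∷ 0 ∷ 74953 ∷ 74922 ∷ 0 ∷ 0 ∷ 0 ∷ 0 ∷ 0 ∷ 0 ∷ 75401 ∷ 0 ∷ 0 ∷ 75402 ∷ 0 ∷ 0 ∷ 0 ∷ 0 ∷ 75465 ∷ 0 ∷ 0 ∷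
  75434 ∷ 0 ∷ 0 ∷ 0 ∷ 0 ∷ 75874 ∷ 75397 ∷ 76386 ∷ 77410 ∷ 0 ∷ 0 ∷ 0 ∷ 0 ∷ 75461 ∷ 76898 ∷ 75493 ∷ 75429 ∷ 0 ∷ 0 ∷ 0 ∷ 0 ∷ 0 ∷ 0 ∷ 0 ∷ 0 ∷ 0 ∷ 0 ∷ 0 ∷
  0 ∷ 0 ∷ 0 ∷ 0 ∷ 0 ∷ 0 ∷ 0 ∷ 0 ∷ 0 ∷ 0 ∷ 0 ∷ 0 ∷ 0 ∷ 0 ∷ 0 ∷ 0 ∷ 0 ∷ 0 ∷ 0 ∷ 0 ∷ 0 ∷ 0 ∷ 0 ∷ 0 ∷ 0 ∷ 0 ∷ 0 ∷ 0 ∷ 0 ∷ 0 ∷ 0 ∷ 0 ∷ 0 ∷ 0 ∷ 0 ∷ 0 ∷ 0 ∷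
  0 ∷ 0 ∷ 0 ∷ 0 ∷ 137283 ∷ 0 ∷ 137284 ∷ 0 ∷ 164290 ∷ 0 ∷ 80068 ∷ 0 ∷ 75848 ∷ 0 ∷ 136391 ∷ 0 ∷ 75975 ∷ 0 ∷ 81028 ∷ 0 ∷ 138307 ∷ 0 ∷ 136327 ∷ 0 ∷
  136326 ∷ 0 ∷ 144519 ∷ 0 ∷ 76872 ∷ 0 ∷ 138308 ∷ 0 ∷ 207047 ∷ 0 ∷ 144583 ∷ 0 ∷ 136329 ∷ 0 ∷ 0 ∷ 0 ∷ 0 ∷ 0 ∷ 0 ∷ 0 ∷ 136585 ∷ 0 ∷ 0 ∷ 0 ∷ 0 ∷ 0 ∷ 0 ∷
  0 ∷ 136393 ∷ 0 ∷ 0 ∷ 0 ∷ 0 ∷ 0 ∷ 0 ∷ 0 ∷ 136649 ∷ 0 ∷ 0 ∷ 0 ∷ 0 ∷ 0 ∷ 0 ∷ 0 ∷ 0 ∷ 0 ∷ 0 ∷ 0 ∷ 0 ∷ 0 ∷ 0 ∷ 0 ∷ 0 ∷ 0 ∷ 0 ∷ 0 ∷ 0 ∷ 0 ∷ 0 ∷ 0 ∷ 0 ∷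
  0 ∷ 0 ∷ 0 ∷ 0 ∷ 0 ∷ 0 ∷ 0 ∷ 0 ∷ 0 ∷ 0 ∷ 0 ∷ 0 ∷ 0 ∷ 0 ∷ 0 ∷ 0 ∷ 0 ∷ 0 ∷ 0 ∷ 0 ∷ 0 ∷ 0 ∷ 0 ∷ 0 ∷ 0 ∷ 0 ∷ 0 ∷ 0 ∷ 0 ∷ 0 ∷ 0 ∷ 0 ∷ 0 ∷ 0 ∷ 0 ∷ 0 ∷ 0 ∷
  0 ∷ 0 ∷ 0 ∷ 0 ∷ 0 ∷ 0 ∷ 0 ∷ 0 ∷ 0 ∷ 0 ∷ 202819 ∷ 0 ∷ 137412 ∷ 0 ∷ 75972 ∷ 0 ∷ 229826 ∷ 0 ∷ 75976 ∷ 0 ∷ 201927 ∷ 0 ∷ 76932 ∷ 0 ∷ 80071 ∷ 0 ∷ 76936 ∷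
  0 ∷ 138372 ∷ 0 ∷ 206023 ∷ 0 ∷ 145607 ∷ 0 ∷ 203843 ∷ 0 ∷ 201863 ∷ 0 ∷ 205959 ∷ 0 ∷ 201862 ∷ 0 ∷ 201865 ∷ 0 ∷ 0 ∷ 0 ∷ 0 ∷ 0 ∷ 0 ∷ 0 ∷ 202121 ∷ 0 ∷
  0 ∷ 0 ∷ 0 ∷ 0 ∷ 0 ∷ 0 ∷ 202185 ∷ 0 ∷ 0 ∷ 0 ∷ 0 ∷ 0 ∷ 0 ∷ 0 ∷ 201929 ∷ 0 ∷ 0 ∷ 0 ∷ 0 ∷ 0 ∷ 0 ∷ 0 ∷ 0 ∷ 0 ∷ 0 ∷ 0 ∷ 0 ∷ 0 ∷ 0 ∷ 0 ∷ 0 ∷ 0 ∷ 0 ∷ 0 ∷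
  0 ∷ 0 ∷ 0 ∷ 0 ∷ 0 ∷ 0 ∷ 0 ∷ 0 ∷ 0 ∷ 0 ∷ 0 ∷ 0 ∷ 0 ∷ 0 ∷ 0 ∷ 0 ∷ 0 ∷ 0 ∷ 0 ∷ 0 ∷ 0 ∷ 0 ∷ 0 ∷ 0 ∷ 0 ∷ 0 ∷ 0 ∷ 0 ∷ 0 ∷ 0 ∷ 0 ∷ 0 ∷ 0 ∷ 0 ∷ 0 ∷ 0 ∷ 0 ∷
  0 ∷ 0 ∷ 0 ∷ 0 ∷ 0 ∷ 0 ∷ 0 ∷ 0 ∷ 0 ∷ 0 ∷ 0 ∷ 0 ∷ 0 ∷ 0 ∷ 0 ∷ 84003 ∷ 99490 ∷ 84197 ∷ 84133 ∷ 0 ∷ 0 ∷ 0 ∷ 0 ∷ 84515 ∷ 82566 ∷ 84677 ∷ 85221 ∷ 0 ∷ 0 ∷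
  0 ∷ 0 ∷ 82569 ∷ 0 ∷ 82570 ∷ 0 ∷ 0 ∷ 0 ∷ 0 ∷ 0 ∷ 82601 ∷ 0 ∷ 82602 ∷ 0 ∷ 0 ∷ 0 ∷ 0 ∷ 0 ∷ 82568 ∷ 268455 ∷ 0 ∷ 0 ∷ 0 ∷ 0 ∷ 0 ∷ 0 ∷ 82600 ∷ 333991 ∷
  0 ∷ 0 ∷ 0 ∷ 0 ∷ 0 ∷ 0 ∷ 83593 ∷ 0 ∷ 0 ∷ 83594 ∷ 0 ∷ 0 ∷ 0 ∷ 0 ∷ 83625 ∷ 0 ∷ 0 ∷ 83658 ∷ 0 ∷ 0 ∷ 0 ∷ 0 ∷ 84066 ∷ 85090 ∷ 83589 ∷ 85602 ∷ 0 ∷ 74891 ∷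
  0 ∷ 74923 ∷ 83621 ∷ 83685 ∷ 84578 ∷ 83653 ∷ 0 ∷ 74892 ∷ 0 ∷ 74924 ∷ 0 ∷ 0 ∷ 0 ∷ 0 ∷ 74987 ∷ 0 ∷ 74956 ∷ 0 ∷ 0 ∷ 0 ∷ 0 ∷ 0 ∷ 74988 ∷ 0 ∷ 74955 ∷ 0 ∷
  0 ∷ 0 ∷ 0 ∷ 0 ∷ 0 ∷ 0 ∷ 0 ∷ 0 ∷ 0 ∷ 0 ∷ 0 ∷ 0 ∷ 0 ∷ 0 ∷ 0 ∷ 0 ∷ 0 ∷ 0 ∷ 0 ∷ 0 ∷ 0 ∷ 0 ∷ 0 ∷ 0 ∷ 0 ∷ 0 ∷ 0 ∷ 0 ∷ 0 ∷ 0 ∷ 0 ∷ 0 ∷ 92195 ∷ 92325 ∷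
  92357 ∷ 100002 ∷ 0 ∷ 0 ∷ 0 ∷ 0 ∷ 92707 ∷ 93413 ∷ 92901 ∷ 90758 ∷ 0 ∷ 0 ∷ 0 ∷ 0 ∷ 90761 ∷ 0 ∷ 90762 ∷ 0 ∷ 0 ∷ 0 ∷ 0 ∷ 0 ∷ 90793 ∷ 0 ∷ 90794 ∷ 0 ∷
  0 ∷ 0 ∷ 0 ∷ 0 ∷ 91273 ∷ 91274 ∷ 0 ∷ 0 ∷ 0 ∷ 0 ∷ 0 ∷ 0 ∷ 91305 ∷ 91338 ∷ 0 ∷ 0 ∷ 0 ∷ 0 ∷ 0 ∷ 0 ∷ 90760 ∷ 0 ∷ 0 ∷ 399527 ∷ 0 ∷ 0 ∷ 0 ∷ 0 ∷ 90792 ∷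
  0 ∷ 0 ∷ 465063 ∷ 0 ∷ 0 ∷ 0 ∷ 0 ∷ 98886 ∷ 101093 ∷ 101605 ∷ 101061 ∷ 0 ∷ 75884 ∷ 0 ∷ 75852 ∷ 109797 ∷ 115270 ∷ 107078 ∷ 123462 ∷ 0 ∷ 74893 ∷ 0 ∷
  74925 ∷ 0 ∷ 0 ∷ 0 ∷ 0 ∷ 74989 ∷ 0 ∷ 76908 ∷ 0 ∷ 0 ∷ 0 ∷ 0 ∷ 0 ∷ 76876 ∷ 0 ∷ 74957 ∷ 0 ∷ 0 ∷ 0 ∷ 0 ∷ 0 ∷ 0 ∷ 0 ∷ 0 ∷ 0 ∷ 0 ∷ 0 ∷ 0 ∷ 0 ∷ 0 ∷ 0 ∷ 0 ∷
  0 ∷ 0 ∷ 0 ∷ 0 ∷ 0 ∷ 0 ∷ 0 ∷ 0 ∷ 0 ∷ 0 ∷ 0 ∷ 0 ∷ 0 ∷ 0 ∷ 0 ∷ 0 ∷ 0 ∷ 98889 ∷ 0 ∷ 98890 ∷ 0 ∷ 0 ∷ 76012 ∷ 0 ∷ 75979 ∷ 107081 ∷ 0 ∷ 107082 ∷ 0 ∷ 0 ∷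
  76940 ∷ 0 ∷ 75981 ∷ 123465 ∷ 0 ∷ 115274 ∷ 0 ∷ 0 ∷ 0 ∷ 0 ∷ 0 ∷ 115273 ∷ 0 ∷ 123466 ∷ 0 ∷ 0 ∷ 0 ∷ 0 ∷ 0 ∷ 74894 ∷ 0 ∷ 0 ∷ 0 ∷ 0 ∷ 0 ∷ 0 ∷ 0 ∷ 74926 ∷
  0 ∷ 0 ∷ 0 ∷ 0 ∷ 0 ∷ 0 ∷ 0 ∷ 74990 ∷ 0 ∷ 0 ∷ 0 ∷ 0 ∷ 0 ∷ 0 ∷ 0 ∷ 74958 ∷ 0 ∷ 0 ∷ 0 ∷ 0 ∷ 0 ∷ 0 ∷ 0 ∷ 0 ∷ 0 ∷ 0 ∷ 0 ∷ 0 ∷ 0 ∷ 0 ∷ 0 ∷ 0 ∷ 0 ∷ 0 ∷ 0 ∷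
  0 ∷ 0 ∷ 0 ∷ 0 ∷ 0 ∷ 0 ∷ 0 ∷ 0 ∷ 0 ∷ 0 ∷ 0 ∷ 0 ∷ 0 ∷ 0 ∷ 0 ∷ 0 ∷ 0 ∷ 0 ∷ 0 ∷ 0 ∷ 0 ∷ 0 ∷ 0 ∷ 0 ∷ 0 ∷ 0 ∷ 0 ∷ 0 ∷ 0 ∷ 0 ∷ 0 ∷ 0 ∷ 0 ∷ 0 ∷ 0 ∷ 0 ∷ 0 ∷
  0 ∷ 0 ∷ 0 ∷ 0 ∷ 0 ∷ 0 ∷ 0 ∷ 0 ∷ 0 ∷ 0 ∷ 0 ∷ 0 ∷ 0 ∷ 0 ∷ 0 ∷ 98921 ∷ 0 ∷ 98922 ∷ 0 ∷ 0 ∷ 76011 ∷ 0 ∷ 75980 ∷ 107113 ∷ 0 ∷ 107114 ∷ 0 ∷ 0 ∷ 76013 ∷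
  0 ∷ 76972 ∷ 115305 ∷ 0 ∷ 123498 ∷ 0 ∷ 0 ∷ 0 ∷ 0 ∷ 0 ∷ 123497 ∷ 0 ∷ 115306 ∷ 0 ∷ 0 ∷ 0 ∷ 0 ∷ 0 ∷ 75502 ∷ 0 ∷ 0 ∷ 0 ∷ 0 ∷ 0 ∷ 0 ∷ 0 ∷ 75470 ∷ 0 ∷ 0 ∷
  0 ∷ 0 ∷ 0 ∷ 0 ∷ 0 ∷ 75406 ∷ 0 ∷ 0 ∷ 0 ∷ 0 ∷ 0 ∷ 0 ∷ 0 ∷ 75438 ∷ 0 ∷ 0 ∷ 0 ∷ 0 ∷ 0 ∷ 0 ∷ 0 ∷ 0 ∷ 0 ∷ 0 ∷ 0 ∷ 0 ∷ 0 ∷ 0 ∷ 0 ∷ 0 ∷ 0 ∷ 0 ∷ 0 ∷ 0 ∷ 0 ∷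
  0 ∷ 0 ∷ 0 ∷ 0 ∷ 0 ∷ 0 ∷ 0 ∷ 0 ∷ 0 ∷ 0 ∷ 0 ∷ 0 ∷ 0 ∷ 0 ∷ 0 ∷ 0 ∷ 0 ∷ 0 ∷ 0 ∷ 0 ∷ 0 ∷ 0 ∷ 0 ∷ 0 ∷ 0 ∷ 0 ∷ 0 ∷ 0 ∷ 0 ∷ 0 ∷ 0 ∷ 0 ∷ 0 ∷ 0 ∷ 0 ∷ 0 ∷ 0 ∷
  0 ∷ 0 ∷ 0 ∷ 0 ∷ 0 ∷ 0 ∷ 0 ∷ 0 ∷ 0 ∷ 0 ∷ 0 ∷ 0 ∷ 0 ∷ []

abstract
  verdicts₃ : Classification.Verdicts canon₃ (allPres 3) codes₃
  verdicts₃ = from-yes (Classification.verdicts? canon₃ (allPres 3) codes₃)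

  verdicts₄ : Classification.Verdicts canon₄ (allPres 4) codes₄
  verdicts₄ = from-yes (Classification.verdicts? canon₄ (allPres 4) codes₄)

-- Maximal partial transversals of the non-abelian groups of order 16, of lengths 16, …, 10 and 8;
-- the number 16 r + c stands for the cell in row r and column c.
transversals₄ : List (List (List ℕ))
transversals₄ =
  [] ∷
  ( (2 ∷ 20 ∷ 43 ∷ 60 ∷ 64 ∷ 86 ∷ 109 ∷ 127 ∷ 137 ∷ 158 ∷ 165 ∷ 186 ∷ 199 ∷ 209 ∷ 227 ∷ 248 ∷ [])
  ∷ (21 ∷ 44 ∷ 54 ∷ 77 ∷ 82 ∷ 111 ∷ 120 ∷ 138 ∷ 147 ∷ 171 ∷ 183 ∷ 193 ∷ 222 ∷ 233 ∷ 244 ∷ [])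
  ∷ (2 ∷ 22 ∷ 45 ∷ 76 ∷ 88 ∷ 101 ∷ 119 ∷ 129 ∷ 147 ∷ 180 ∷ 201 ∷ 219 ∷ 238 ∷ 250 ∷ [])
  ∷ (15 ∷ 24 ∷ 32 ∷ 60 ∷ 67 ∷ 93 ∷ 118 ∷ 142 ∷ 154 ∷ 177 ∷ 199 ∷ 235 ∷ 242 ∷ [])
  ∷ (20 ∷ 32 ∷ 58 ∷ 67 ∷ 85 ∷ 108 ∷ 139 ∷ 157 ∷ 167 ∷ 194 ∷ 225 ∷ 246 ∷ [])
  ∷ (31 ∷ 44 ∷ 49 ∷ 85 ∷ 110 ∷ 115 ∷ 139 ∷ 167 ∷ 202 ∷ 214 ∷ 232 ∷ [])
  ∷ (41 ∷ 53 ∷ 136 ∷ 155 ∷ 172 ∷ 191 ∷ 205 ∷ 222 ∷ 230 ∷ 250 ∷ [])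
  ∷ (4 ∷ 22 ∷ 47 ∷ 61 ∷ 133 ∷ 151 ∷ 174 ∷ 188 ∷ [])
  ∷ []) ∷
  [] ∷
  ( (13 ∷ 27 ∷ 32 ∷ 63 ∷ 68 ∷ 83 ∷ 106 ∷ 118 ∷ 129 ∷ 156 ∷ 174 ∷ 185 ∷ 200 ∷ 210 ∷ 229 ∷ 247 ∷ [])
  ∷ (10 ∷ 22 ∷ 35 ∷ 59 ∷ 71 ∷ 80 ∷ 105 ∷ 126 ∷ 129 ∷ 149 ∷ 164 ∷ 188 ∷ 207 ∷ 210 ∷ 248 ∷ [])
  ∷ (7 ∷ 16 ∷ 36 ∷ 57 ∷ 78 ∷ 88 ∷ 133 ∷ 156 ∷ 161 ∷ 178 ∷ 202 ∷ 211 ∷ 237 ∷ 255 ∷ [])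
  ∷ (4 ∷ 59 ∷ 87 ∷ 104 ∷ 122 ∷ 142 ∷ 146 ∷ 163 ∷ 188 ∷ 193 ∷ 223 ∷ 237 ∷ 249 ∷ [])
  ∷ (5 ∷ 19 ∷ 95 ∷ 106 ∷ 135 ∷ 153 ∷ 160 ∷ 178 ∷ 203 ∷ 216 ∷ 238 ∷ 244 ∷ [])
  ∷ (30 ∷ 42 ∷ 71 ∷ 89 ∷ 117 ∷ 152 ∷ 173 ∷ 193 ∷ 219 ∷ 226 ∷ 244 ∷ [])
  ∷ (14 ∷ 24 ∷ 45 ∷ 59 ∷ 76 ∷ 82 ∷ 111 ∷ 121 ∷ 138 ∷ 148 ∷ [])
  ∷ (65 ∷ 89 ∷ 96 ∷ 120 ∷ 203 ∷ 210 ∷ 234 ∷ 243 ∷ [])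
  ∷ []) ∷
  ( (12 ∷ 27 ∷ 42 ∷ 52 ∷ 67 ∷ 89 ∷ 98 ∷ 118 ∷ 135 ∷ 145 ∷ 168 ∷ 190 ∷ 207 ∷ 221 ∷ 224 ∷ 245 ∷ [])
  ∷ (8 ∷ 16 ∷ 44 ∷ 51 ∷ 79 ∷ 87 ∷ 100 ∷ 122 ∷ 157 ∷ 161 ∷ 190 ∷ 197 ∷ 219 ∷ 226 ∷ 249 ∷ [])
  ∷ (7 ∷ 19 ∷ 34 ∷ 61 ∷ 79 ∷ 89 ∷ 110 ∷ 140 ∷ 152 ∷ 161 ∷ 182 ∷ 203 ∷ 213 ∷ 250 ∷ [])
  ∷ (2 ∷ 29 ∷ 44 ∷ 55 ∷ 74 ∷ 113 ∷ 133 ∷ 158 ∷ 160 ∷ 185 ∷ 196 ∷ 214 ∷ 255 ∷ [])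
  ∷ (8 ∷ 17 ∷ 39 ∷ 50 ∷ 78 ∷ 89 ∷ 143 ∷ 154 ∷ 172 ∷ 212 ∷ 229 ∷ 243 ∷ [])
  ∷ (22 ∷ 43 ∷ 63 ∷ 69 ∷ 94 ∷ 131 ∷ 154 ∷ 180 ∷ 205 ∷ 210 ∷ 249 ∷ [])
  ∷ (12 ∷ 37 ∷ 65 ∷ 93 ∷ 111 ∷ 115 ∷ 130 ∷ 158 ∷ 164 ∷ 176 ∷ [])
  ∷ (7 ∷ 25 ∷ 42 ∷ 52 ∷ 200 ∷ 214 ∷ 229 ∷ 251 ∷ [])
  ∷ []) ∷
  ( (5 ∷ 30 ∷ 40 ∷ 51 ∷ 66 ∷ 87 ∷ 106 ∷ 127 ∷ 141 ∷ 144 ∷ 164 ∷ 187 ∷ 198 ∷ 209 ∷ 233 ∷ 252 ∷ [])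
  ∷ (6 ∷ 27 ∷ 45 ∷ 51 ∷ 64 ∷ 88 ∷ 97 ∷ 127 ∷ 140 ∷ 170 ∷ 185 ∷ 194 ∷ 222 ∷ 228 ∷ 247 ∷ [])
  ∷ (10 ∷ 18 ∷ 39 ∷ 63 ∷ 67 ∷ 102 ∷ 120 ∷ 156 ∷ 165 ∷ 176 ∷ 193 ∷ 219 ∷ 237 ∷ 254 ∷ [])
  ∷ (13 ∷ 38 ∷ 56 ∷ 85 ∷ 105 ∷ 129 ∷ 159 ∷ 162 ∷ 180 ∷ 199 ∷ 222 ∷ 236 ∷ 243 ∷ [])
  ∷ (3 ∷ 43 ∷ 69 ∷ 94 ∷ 97 ∷ 122 ∷ 141 ∷ 182 ∷ 204 ∷ 212 ∷ 224 ∷ 249 ∷ [])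
  ∷ (23 ∷ 42 ∷ 51 ∷ 104 ∷ 124 ∷ 153 ∷ 190 ∷ 196 ∷ 214 ∷ 235 ∷ 242 ∷ [])
  ∷ (12 ∷ 19 ∷ 47 ∷ 53 ∷ 155 ∷ 160 ∷ 205 ∷ 210 ∷ 238 ∷ 241 ∷ [])
  ∷ (9 ∷ 26 ∷ 33 ∷ 50 ∷ 128 ∷ 147 ∷ 171 ∷ 184 ∷ [])
  ∷ []) ∷
  ( (7 ∷ 17 ∷ 40 ∷ 63 ∷ 78 ∷ 89 ∷ 101 ∷ 114 ∷ 141 ∷ 155 ∷ 170 ∷ 188 ∷ 195 ∷ 208 ∷ 228 ∷ 246 ∷ [])
  ∷ (11 ∷ 24 ∷ 35 ∷ 62 ∷ 84 ∷ 98 ∷ 113 ∷ 135 ∷ 149 ∷ 169 ∷ 189 ∷ 202 ∷ 220 ∷ 224 ∷ 246 ∷ [])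
  ∷ (11 ∷ 29 ∷ 54 ∷ 79 ∷ 96 ∷ 115 ∷ 130 ∷ 153 ∷ 165 ∷ 186 ∷ 200 ∷ 220 ∷ 238 ∷ 241 ∷ [])
  ∷ (7 ∷ 47 ∷ 57 ∷ 80 ∷ 110 ∷ 118 ∷ 141 ∷ 165 ∷ 187 ∷ 204 ∷ 216 ∷ 226 ∷ 241 ∷ [])
  ∷ (24 ∷ 38 ∷ 51 ∷ 65 ∷ 94 ∷ 154 ∷ 173 ∷ 187 ∷ 192 ∷ 215 ∷ 239 ∷ 242 ∷ [])
  ∷ (46 ∷ 50 ∷ 69 ∷ 89 ∷ 100 ∷ 139 ∷ 159 ∷ 163 ∷ 182 ∷ 231 ∷ 250 ∷ [])
  ∷ (6 ∷ 16 ∷ 71 ∷ 89 ∷ 108 ∷ 120 ∷ 132 ∷ 155 ∷ 165 ∷ 186 ∷ [])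
  ∷ (8 ∷ 28 ∷ 41 ∷ 61 ∷ 78 ∷ 91 ∷ 111 ∷ 122 ∷ [])
  ∷ []) ∷
  [] ∷
  [] ∷
  ( (0 ∷ 20 ∷ 42 ∷ 60 ∷ 79 ∷ 86 ∷ 98 ∷ 121 ∷ 142 ∷ 149 ∷ 168 ∷ 179 ∷ 193 ∷ 215 ∷ 235 ∷ 253 ∷ [])
  ∷ (8 ∷ 26 ∷ 39 ∷ 52 ∷ 76 ∷ 86 ∷ 96 ∷ 121 ∷ 142 ∷ 147 ∷ 175 ∷ 181 ∷ 205 ∷ 226 ∷ 251 ∷ [])
  ∷ (14 ∷ 19 ∷ 64 ∷ 84 ∷ 102 ∷ 121 ∷ 139 ∷ 159 ∷ 170 ∷ 177 ∷ 197 ∷ 215 ∷ 226 ∷ 253 ∷ [])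
  ∷ (2 ∷ 27 ∷ 46 ∷ 65 ∷ 102 ∷ 112 ∷ 136 ∷ 173 ∷ 180 ∷ 197 ∷ 215 ∷ 236 ∷ 243 ∷ [])
  ∷ (2 ∷ 16 ∷ 47 ∷ 57 ∷ 88 ∷ 97 ∷ 150 ∷ 171 ∷ 188 ∷ 196 ∷ 221 ∷ 234 ∷ [])
  ∷ (34 ∷ 63 ∷ 68 ∷ 94 ∷ 131 ∷ 149 ∷ 168 ∷ 187 ∷ 218 ∷ 233 ∷ 253 ∷ [])
  ∷ (21 ∷ 47 ∷ 128 ∷ 152 ∷ 163 ∷ 182 ∷ 199 ∷ 210 ∷ 228 ∷ 241 ∷ [])
  ∷ (134 ∷ 147 ∷ 165 ∷ 176 ∷ 196 ∷ 209 ∷ 231 ∷ 242 ∷ [])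
  ∷ []) ∷
  ( (14 ∷ 24 ∷ 35 ∷ 54 ∷ 71 ∷ 92 ∷ 107 ∷ 112 ∷ 133 ∷ 145 ∷ 175 ∷ 186 ∷ 205 ∷ 217 ∷ 228 ∷ 242 ∷ [])
  ∷ (2 ∷ 20 ∷ 37 ∷ 62 ∷ 77 ∷ 88 ∷ 111 ∷ 118 ∷ 129 ∷ 151 ∷ 163 ∷ 204 ∷ 208 ∷ 235 ∷ 249 ∷ [])
  ∷ (13 ∷ 23 ∷ 43 ∷ 50 ∷ 72 ∷ 90 ∷ 112 ∷ 131 ∷ 145 ∷ 175 ∷ 185 ∷ 198 ∷ 238 ∷ 252 ∷ [])
  ∷ (46 ∷ 51 ∷ 66 ∷ 88 ∷ 101 ∷ 112 ∷ 141 ∷ 170 ∷ 183 ∷ 203 ∷ 212 ∷ 230 ∷ 241 ∷ [])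
  ∷ (11 ∷ 19 ∷ 82 ∷ 106 ∷ 141 ∷ 149 ∷ 164 ∷ 190 ∷ 200 ∷ 215 ∷ 239 ∷ 246 ∷ [])
  ∷ (25 ∷ 37 ∷ 58 ∷ 82 ∷ 99 ∷ 123 ∷ 164 ∷ 184 ∷ 193 ∷ 221 ∷ 236 ∷ [])
  ∷ (72 ∷ 82 ∷ 107 ∷ 113 ∷ 133 ∷ 179 ∷ 192 ∷ 218 ∷ 233 ∷ 252 ∷ [])
  ∷ (11 ∷ 16 ∷ 41 ∷ 50 ∷ 129 ∷ 154 ∷ 163 ∷ 184 ∷ [])
  ∷ []) ∷
  ( (14 ∷ 20 ∷ 37 ∷ 59 ∷ 70 ∷ 81 ∷ 105 ∷ 122 ∷ 131 ∷ 152 ∷ 162 ∷ 189 ∷ 192 ∷ 215 ∷ 236 ∷ 255 ∷ [])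
  ∷ (4 ∷ 22 ∷ 40 ∷ 61 ∷ 69 ∷ 94 ∷ 105 ∷ 115 ∷ 135 ∷ 154 ∷ 160 ∷ 207 ∷ 220 ∷ 235 ∷ 242 ∷ [])
  ∷ (8 ∷ 26 ∷ 45 ∷ 49 ∷ 68 ∷ 99 ∷ 117 ∷ 130 ∷ 144 ∷ 166 ∷ 190 ∷ 201 ∷ 236 ∷ 251 ∷ [])
  ∷ (14 ∷ 20 ∷ 42 ∷ 67 ∷ 86 ∷ 103 ∷ 124 ∷ 143 ∷ 152 ∷ 185 ∷ 208 ∷ 225 ∷ 245 ∷ [])
  ∷ (23 ∷ 41 ∷ 76 ∷ 80 ∷ 102 ∷ 122 ∷ 142 ∷ 145 ∷ 191 ∷ 194 ∷ 221 ∷ 243 ∷ [])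
  ∷ (41 ∷ 55 ∷ 78 ∷ 111 ∷ 122 ∷ 136 ∷ 157 ∷ 166 ∷ 179 ∷ 226 ∷ 252 ∷ [])
  ∷ (20 ∷ 72 ∷ 90 ∷ 103 ∷ 114 ∷ 163 ∷ 193 ∷ 217 ∷ 235 ∷ 240 ∷ [])
  ∷ (12 ∷ 31 ∷ 40 ∷ 58 ∷ 73 ∷ 91 ∷ 110 ∷ 125 ∷ [])
  ∷ []) ∷
  ( (6 ∷ 31 ∷ 32 ∷ 59 ∷ 73 ∷ 82 ∷ 108 ∷ 116 ∷ 131 ∷ 149 ∷ 167 ∷ 177 ∷ 202 ∷ 222 ∷ 232 ∷ 253 ∷ [])
  ∷ (4 ∷ 25 ∷ 44 ∷ 51 ∷ 69 ∷ 87 ∷ 104 ∷ 122 ∷ 143 ∷ 161 ∷ 190 ∷ 205 ∷ 208 ∷ 230 ∷ 251 ∷ [])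
  ∷ (1 ∷ 27 ∷ 45 ∷ 52 ∷ 70 ∷ 90 ∷ 98 ∷ 120 ∷ 137 ∷ 144 ∷ 165 ∷ 191 ∷ 220 ∷ 231 ∷ [])
  ∷ (6 ∷ 18 ∷ 36 ∷ 57 ∷ 85 ∷ 107 ∷ 126 ∷ 152 ∷ 175 ∷ 202 ∷ 220 ∷ 224 ∷ 247 ∷ [])
  ∷ (13 ∷ 25 ∷ 43 ∷ 69 ∷ 81 ∷ 102 ∷ 115 ∷ 138 ∷ 158 ∷ 192 ∷ 220 ∷ 228 ∷ [])
  ∷ (42 ∷ 62 ∷ 71 ∷ 84 ∷ 102 ∷ 156 ∷ 175 ∷ 179 ∷ 216 ∷ 226 ∷ 251 ∷ [])
  ∷ (12 ∷ 22 ∷ 39 ∷ 63 ∷ 85 ∷ 141 ∷ 158 ∷ 168 ∷ 180 ∷ 225 ∷ [])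
  ∷ (78 ∷ 86 ∷ 101 ∷ 124 ∷ 199 ∷ 223 ∷ 237 ∷ 244 ∷ [])
  ∷ []) ∷
  [] ∷ []

lengths₄ : List ℕ
lengths₄ = 16 ∷ 15 ∷ 14 ∷ 13 ∷ 12 ∷ 11 ∷ 10 ∷ 8 ∷ []

module W₄ = Witnesses (_≟V_ {4}) (allV 4) allV-complete

cell : ℕ → V 4 × V 4
cell c = bits 4 (c / 16) , bits 4 (c % 16)

Checked : Pres 4 → List (List ℕ) → Set
Checked q pss = Commutative q ⊎ All (λ ps → W₄.Witness (pmul q) (mapL cell ps)) pss × mapL length pss ≡ lengths₄

checked? : ∀ q pss → Dec (Checked q pss)
checked? q pss = commutative? q ⊎-dec (all-list? (λ ps → W₄.witness? (pmul q) (mapL cell ps)) pss ×-dec ListP.≡-dec _≟_ _ _)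

AllChecked : List (Pres 4) → List (List (List ℕ)) → Set
AllChecked [] _ = ⊤
AllChecked (_ ∷ _) [] = ⊥
AllChecked (q ∷ qs) (t ∷ ts) = Checked q t × AllChecked qs ts

allChecked? : ∀ qs ts → Dec (AllChecked qs ts)
allChecked? [] _ = yes tt
allChecked? (_ ∷ _) [] = no id
allChecked? (q ∷ qs) (t ∷ ts) = checked? q t ×-dec allChecked? qs ts

checked : ∀ {qs ts q} → AllChecked qs ts → q ∈L qs → ∃ (Checked q)
checked {_ ∷ _} {t ∷ _} (c , _) (here refl) = t , c
checked {_ ∷ _} {_ ∷ _} (_ , cs) (there i) = checked cs i

abstract
  checked₄ : AllChecked canon₄ transversals₄
  checked₄ = from-yes (allChecked? canon₄ transversals₄)

-- Explicit group tables and exhaustive search for configurations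

choose : ∀ {X : Set} → ℕ → (X → Bool) → List X → List (List X)
choose zero ok xs = [] ∷ []
choose (suc k) ok [] = []
choose (suc k) ok (x ∷ xs) = (if ok x then mapL (x ∷_) (choose k ok xs) else []) ++ choose (suc k) ok xs

choose-skip : ∀ {X : Set} k {ok : X → Bool} {x ys xs} → ys ∈L choose k ok xs → ys ∈L choose k ok (x ∷ xs)
choose-skip zero p = p
choose-skip (suc k) {ok} {x} {xs = xs} p = ∈-++⁺ʳ (if ok x then mapL (x ∷_) (choose k ok xs) else []) p

choose-filter : ∀ {X : Set} {P : X → Set} (P? : ∀ x → Dec (P x)) (ok : X → Bool) → (∀ {x} → P x → ok x ≡ true) →
  ∀ xs → filter P? xs ∈L choose (length (filter P? xs)) ok xs
choose-filter P? ok h [] = here refl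
choose-filter P? ok h (x ∷ xs) with P? x
... | yes p rewrite h p = ∈-++⁺ˡ (∈-map⁺ (x ∷_) (choose-filter P? ok h xs))
... | no p = choose-skip (length (filter P? xs)) (choose-filter P? ok h xs)

record Table {n} (G : FinGroup n) {X : Set} (_∙_ : X → X → X) : Set where
  open FinGroup G
  field
    f      : X → Fin n
    f-inj  : ∀ {x y} → f x ≡ f y → x ≡ y
    f-surj : ∀ x → ∃ λ v → f v ≡ x
    f-hom  : ∀ x y → f x · f y ≡ f (x ∙ y)

  f⁻¹ : Fin n → X
  f⁻¹ x = proj₁ (f-surj x)

  f-f⁻¹ : ∀ x → f (f⁻¹ x) ≡ x
  f-f⁻¹ x = proj₂ (f-surj x)

  f⁻¹-f : ∀ v → f⁻¹ (f v) ≡ v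
  f⁻¹-f v = f-inj (f-f⁻¹ (f v))

  f⁻¹-hom : ∀ x y → f⁻¹ (x · y) ≡ f⁻¹ x ∙ f⁻¹ y
  f⁻¹-hom x y = f-inj (trans (f-f⁻¹ (x · y)) (trans (≡sym (cong₂ _·_ (f-f⁻¹ x) (f-f⁻¹ y))) (f-hom _ _)))

  iso : IsoTo G X _∙_
  iso = f⁻¹ , ((λ {x} {y} e → trans (≡sym (f-f⁻¹ x)) (trans (cong f e) (f-f⁻¹ y))) , λ v → f v , λ { refl → f⁻¹-f v }) , f⁻¹-hom

from-iso : ∀ {n} {G : FinGroup n} {X : Set} {_∙_ : X → X → X} → IsoTo G X _∙_ → Table G _∙_
from-iso {G = G} {X} {_∙_} (g , (inj , surj) , hm) = record
  { f = f ; f-inj = λ {x} {y} e → trans (≡sym (gf x)) (trans (cong g e) (gf y))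
  ; f-surj = λ x → g x , inj (gf (g x))
  ; f-hom = λ x y → inj (trans (hm (f x) (f y)) (trans (cong₂ _∙_ (gf x) (gf y)) (≡sym (gf (x ∙ y))))) }
  where
  f : X → Fin _
  f v = proj₁ (surj v)
  gf : ∀ v → g (f v) ≡ v
  gf v = proj₂ (surj v) refl

struct-table : ∀ {n} {G : FinGroup n} {m} {p : Pres m} → Struct G p → Table G (pmul p)
struct-table S = record { f = w ; f-inj = w-inj ; f-surj = w-surj ; f-hom = w-hom }
  where open Struct S

module Explicit {X : Set} (_≟X_ : ∀ (x y : X) → Dec (x ≡ y)) (elems : List X) (complete : ∀ x → x ∈L elems) (uniq : Unique elems)
                (_∙_ : X → X → X) where
  open Witnesses _≟X_ elems complete public

  table-witness : ∀ {n} {G : FinGroup n} → Table G _∙_ → ∀ ps → Witness _∙_ ps → HasMaximalPTOfLength (cayley G) (length ps)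
  table-witness {G = G} t ps wt = has-witness _∙_ G f f-inj f-surj f-hom ps wt
    where open Table t

  table-order : ∀ {n} {G : FinGroup n} → Table G _∙_ → n ≡ length elems
  table-order {n} t = trans (≡sym ∣full∣) (trans (∣∣-list full (mapL f elems) (Unique-map⁺ f-inj uniq) (λ _ → tt)) (trans (cong₂ _+_ (length-map f elems) (∣∣-empty (full {n} ∖ mapL f elems) none)) (+-identityʳ _)))
    where
    open Table t
    none : ∀ {x} → ¬ x ∈ full {n} ∖ mapL f elems
    none {x} (_ , q) = q (subst (_∈L mapL f elems) (f-f⁻¹ x) (∈-map⁺ f (complete (f⁻¹ x))))

  module Brute (e₀ : X) where
    total : (X → ℕ) → List X → ℕ
    total φ xs = sumL (mapL φ xs)

    -- This condition is tested on each element while the third set is being chosen, so only sets D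
    -- compatible with A and B are enumerated.
    okD : List X → List X → X → Bool
    okD as bs d = does (all-list? (λ a → all-list? (λ b → ¬? (((a ∙ b) ∙ d) ≟X e₀)) bs) as)

    -- One modulus serves all searches: ℤ₂ sits inside ℤ₈ as {0, 4} and ℤ₄ as {0, 2, 4, 6}.
    Additive : (X → ℕ) → Set
    Additive φ = All (λ x → All (λ y → φ (x ∙ y) % 8 ≡ (φ x + φ y) % 8) elems) elems

    Mismatch : List X → List X → List X → (X → ℕ) → Set
    Mismatch as bs ds φ = total φ elems % 8 ≢ (total φ as + total φ bs + total φ ds) % 8

    NoConfig : ℕ → List (X → ℕ) → Set
    NoConfig k φs = All Additive φs ×
      All (λ as → All (λ bs → All (λ ds → Any (Mismatch as bs ds) φs) (choose k (okD as bs) elems)) (choose k (λ _ → true) elems)) (choose k (λ _ → true) elems)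

    noConfig? : ∀ k φs → Dec (NoConfig k φs)
    noConfig? k φs = all-list? (λ φ → all-list? (λ x → all-list? (λ y → _ ≟ _) elems) elems) φs ×-dec
      all-list? (λ as → all-list? (λ bs → all-list? (λ ds → any-list? (λ φ → ¬? (_ ≟ _)) φs) (choose k (okD as bs) elems)) (choose k (λ _ → true) elems)) (choose k (λ _ → true) elems)

double-half : ∀ k {n} → k + k ≤ n → ⌈ n /2⌉ ≤ n ∸ k
double-half k {n} le = begin
  ⌈ n /2⌉ ≡⟨ m+n∸m≡n ⌊ n /2⌋ ⌈ n /2⌉ ⟨
  ⌊ n /2⌋ + ⌈ n /2⌉ ∸ ⌊ n /2⌋ ≡⟨ cong (_∸ ⌊ n /2⌋) (⌊n/2⌋+⌈n/2⌉≡n n) ⟩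
  n ∸ ⌊ n /2⌋ ≤⟨ ∸-monoʳ-≤ n (subst (_≤ ⌊ n /2⌋) (≡sym (n≡⌊n+n/2⌋ k)) (⌊n/2⌋-mono le)) ⟩
  n ∸ k ∎
  where open ≤-Reasoning

allV-unique₃ : Unique (allV 3)
allV-unique₃ = from-yes (allPairs? (λ x y → ¬? (x ≟V y)) (allV 3))

linear : ∀ {m} → Vec ℕ m → V m → ℕ
linear [] [] = 0
linear (_ ∷ as) (false ∷ v) = linear as v
linear (a ∷ as) (true ∷ v) = a + linear as v

module E₃ (p : Pres 3) = Explicit _≟V_ (allV 3) allV-complete allV-unique₃ (pmul p)

-- Generators of the group of homomorphisms into ℤ₈. In ℤ₄ × ℤ₂ the top generator has order four and
-- its square is the bottom one, whence the values 2 and 4.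
homs-E₈ homs-Z₄Z₂ homs-Q₈ : List (V 3 → ℕ)
homs-E₈ = linear (4 ∷ 0 ∷ 0 ∷ []) ∷ linear (0 ∷ 4 ∷ 0 ∷ []) ∷ linear (0 ∷ 0 ∷ 4 ∷ []) ∷ []
homs-Z₄Z₂ = linear (2 ∷ 0 ∷ 4 ∷ []) ∷ linear (0 ∷ 4 ∷ 0 ∷ []) ∷ []
homs-Q₈ = linear (4 ∷ 0 ∷ 0 ∷ []) ∷ linear (0 ∷ 4 ∷ 0 ∷ []) ∷ []

abstract
  brute-E₈ : E₃.Brute.NoConfig (pres₃ 0 0 0) zeros 3 homs-E₈
  brute-E₈ = from-yes (E₃.Brute.noConfig? (pres₃ 0 0 0) zeros 3 homs-E₈)

  brute-Z₄Z₂ : E₃.Brute.NoConfig (pres₃ 0 1 0) zeros 3 homs-Z₄Z₂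
  brute-Z₄Z₂ = from-yes (E₃.Brute.noConfig? (pres₃ 0 1 0) zeros 3 homs-Z₄Z₂)

  brute-Q₈ : E₃.Brute.NoConfig (pres₃ 1 1 1) zeros 3 homs-Q₈
  brute-Q₈ = from-yes (E₃.Brute.noConfig? (pres₃ 1 1 1) zeros 3 homs-Q₈)

-- Near-omniversal groups

near : ∀ {n} (G : FinGroup n) k → k + k ≤ n → ¬ HasMaximalPTOfLength (cayley G) (n ∸ k) →
  (∀ k′ → k′ + k′ ≤ n → k′ ≢ k → HasMaximalPTOfLength (cayley G) (n ∸ k′)) → NearOmniversal (cayley G)
near {n} G k le miss has = n ∸ k , (double-half k le , m∸n≤m n k , miss) , uniq
  where
  uniq : ∀ ℓ → ⌈ n /2⌉ ≤ ℓ → ℓ ≤ n → ¬ HasMaximalPTOfLength (cayley G) ℓ → ℓ ≡ n ∸ k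
  uniq ℓ lo hi absent with (n ∸ ℓ) ≟ k
  ... | yes refl = ≡sym (m∸[m∸n]≡n hi)
  ... | no ne = contradiction (subst (HasMaximalPTOfLength (cayley G)) (m∸[m∸n]≡n hi) (has (n ∸ ℓ) small ne)) absent
    where
    small : (n ∸ ℓ) + (n ∸ ℓ) ≤ n
    small = begin
      (n ∸ ℓ) + (n ∸ ℓ) ≤⟨ +-mono-≤ (∸-monoʳ-≤ n lo) (∸-monoʳ-≤ n lo) ⟩
      (n ∸ ⌈ n /2⌉) + (n ∸ ⌈ n /2⌉) ≡⟨ cong (λ z → z + z) (trans (cong (_∸ ⌈ n /2⌉) (≡sym (⌊n/2⌋+⌈n/2⌉≡n n))) (m+n∸n≡m ⌊ n /2⌋ ⌈ n /2⌉)) ⟩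
      ⌊ n /2⌋ + ⌊ n /2⌋ ≤⟨ +-monoʳ-≤ ⌊ n /2⌋ (⌊n/2⌋≤⌈n/2⌉ n) ⟩
      ⌊ n /2⌋ + ⌈ n /2⌉ ≡⟨ ⌊n/2⌋+⌈n/2⌉≡n n ⟩
      n ∎
      where open ≤-Reasoning

module Near {X : Set} (_≟X_ : ∀ (x y : X) → Dec (x ≡ y)) (elems : List X) (complete : ∀ x → x ∈L elems) (uniq : Unique elems)
            (_∙_ : X → X → X) where
  open Explicit _≟X_ elems complete uniq _∙_ public

  N = length elems

  Lengths : ℕ → List (List (X × X)) → Set
  Lengths k pss = ∀ (i : Fin (suc N)) → toℕ i + toℕ i ≤ N → toℕ i ≢ k → (N ∸ toℕ i) ∈L mapL length pss

  Enough : ℕ → List (List (X × X)) → Set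
  Enough k pss = All (Witness _∙_) pss × Lengths k pss

  enough? : ∀ k pss → Dec (Enough k pss)
  enough? k pss = all-list? (witness? _∙_) pss ×-dec all? (λ i → (_ ≤? _) →-dec (¬? (_ ≟ _) →-dec mem-dec _≟_ _ _))

  has-length : ∀ {n} {G : FinGroup n} → Table G _∙_ → ∀ {pss} → All (Witness _∙_) pss → ∀ {ℓ} → ℓ ∈L mapL length pss → HasMaximalPTOfLength (cayley G) ℓ
  has-length {G = G} t al ℓ∈ = let ps , ps∈ , e = ∈-map⁻ length ℓ∈ in subst (HasMaximalPTOfLength (cayley G)) (≡sym e) (table-witness t ps (All-lookup al ps∈))

  near-table : ∀ {n} (G : FinGroup n) → Table G _∙_ → ∀ k {pss} → k + k ≤ N → Enough k pss → ¬ HasMaximalPTOfLength (cayley G) (n ∸ k) → NearOmniversal (cayley G)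
  near-table {n} G t k {pss} le (al , len) miss = near G k (subst (k + k ≤_) (≡sym n≡N) le) miss has
    where
    n≡N = table-order t
    has : ∀ k′ → k′ + k′ ≤ n → k′ ≢ k → HasMaximalPTOfLength (cayley G) (n ∸ k′)
    has k′ le′ ne = subst (λ z → HasMaximalPTOfLength (cayley G) (z ∸ k′)) (≡sym n≡N)
        (has-length t al (below {λ k′ → k′ + k′ ≤ N → k′ ≢ k → (N ∸ k′) ∈L mapL length pss} N len (≤-trans (m≤m+n k′ k′) le″) le″ ne))
      where
      le″ : k′ + k′ ≤ N
      le″ = subst (k′ + k′ ≤_) n≡N le′

module Cyc (k : ℕ) .{{_ : NonZero k}} = Near _≟F_ (allFin k) ∈-allFin (allFin⁺ k) (zadd k)

elemsD : ∀ m → List (Bool × Fin m)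
elemsD m = mapL (false ,_) (allFin m) ++ mapL (true ,_) (allFin m)

elemsD-complete : ∀ {m} (x : Bool × Fin m) → x ∈L elemsD m
elemsD-complete (false , i) = ∈-++⁺ˡ (∈-map⁺ (false ,_) (∈-allFin i))
elemsD-complete (true , i) = ∈-++⁺ʳ (mapL (false ,_) (allFin _)) (∈-map⁺ (true ,_) (∈-allFin i))

_≟D_ : ∀ {m} (x y : Bool × Fin m) → Dec (x ≡ y)
_≟D_ = ≡-dec _≟B_ _≟F_

elemsD₃-unique : Unique (elemsD 3)
elemsD₃-unique = from-yes (allPairs? (λ x y → ¬? (x ≟D y)) (elemsD 3))

elemsD₄-unique : Unique (elemsD 4)
elemsD₄-unique = from-yes (allPairs? (λ x y → ¬? (x ≟D y)) (elemsD 4))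

module Dih₃ = Near _≟D_ (elemsD 3) elemsD-complete elemsD₃-unique (dmul 3)
module Dih₄ = Near _≟D_ (elemsD 4) elemsD-complete elemsD₄-unique (dmul 4)

pattern r⟨_⟩ i = (false , i)
pattern s⟨_⟩ i = (true , i)

homs-D₈ : List (Bool × Fin 4 → ℕ)
homs-D₈ = (λ x → if proj₁ x then 4 else 0) ∷ (λ x → 4 * toℕ (proj₂ x)) ∷ []

pts-Z₂ : List (List (Fin 2 × Fin 2))
pts-Z₂ = ((1F , 1F) ∷ []) ∷ []

pts-Z₃ : List (List (Fin 3 × Fin 3))
pts-Z₃ = ((0F , 1F) ∷ (1F , 2F) ∷ (2F , 0F) ∷ []) ∷ []

pts-Z₅ : List (List (Fin 5 × Fin 5))
pts-Z₅ = ((0F , 1F) ∷ (1F , 3F) ∷ (2F , 0F) ∷ (3F , 2F) ∷ (4F , 4F) ∷ [])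
  ∷ ((2F , 3F) ∷ (3F , 4F) ∷ (4F , 2F) ∷ []) ∷ []

pts-Z₆ : List (List (Fin 6 × Fin 6))
pts-Z₆ = ((1F , 4F) ∷ (2F , 2F) ∷ (4F , 3F) ∷ (3F , 5F) ∷ (5F , 1F) ∷ [])
  ∷ ((3F , 4F) ∷ (2F , 1F) ∷ (4F , 2F) ∷ (5F , 5F) ∷ [])
  ∷ ((1F , 3F) ∷ (3F , 5F) ∷ (5F , 1F) ∷ []) ∷ []

pts-D₆ : List (List ((Bool × Fin 3) × (Bool × Fin 3)))
pts-D₆ = ((r⟨ 1F ⟩ , r⟨ 1F ⟩) ∷ (s⟨ 2F ⟩ , s⟨ 1F ⟩) ∷ (s⟨ 1F ⟩ , r⟨ 2F ⟩) ∷ (r⟨ 2F ⟩ , s⟨ 2F ⟩) ∷ (s⟨ 0F ⟩ , s⟨ 0F ⟩) ∷ [])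
  ∷ ((r⟨ 2F ⟩ , s⟨ 1F ⟩) ∷ (s⟨ 2F ⟩ , s⟨ 2F ⟩) ∷ (r⟨ 1F ⟩ , r⟨ 1F ⟩) ∷ (s⟨ 1F ⟩ , r⟨ 2F ⟩) ∷ [])
  ∷ ((s⟨ 0F ⟩ , s⟨ 0F ⟩) ∷ (s⟨ 1F ⟩ , s⟨ 2F ⟩) ∷ (s⟨ 2F ⟩ , s⟨ 1F ⟩) ∷ []) ∷ []

pts-D₈ : List (List ((Bool × Fin 4) × (Bool × Fin 4)))
pts-D₈ = ((r⟨ 0F ⟩ , r⟨ 0F ⟩) ∷ (r⟨ 1F ⟩ , r⟨ 2F ⟩) ∷ (s⟨ 0F ⟩ , r⟨ 1F ⟩) ∷ (s⟨ 2F ⟩ , s⟨ 0F ⟩) ∷ (s⟨ 1F ⟩ , r⟨ 3F ⟩) ∷ (s⟨ 3F ⟩ , s⟨ 2F ⟩) ∷ (r⟨ 2F ⟩ , s⟨ 3F ⟩) ∷ (r⟨ 3F ⟩ , s⟨ 1F ⟩) ∷ [])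
  ∷ ((r⟨ 1F ⟩ , s⟨ 0F ⟩) ∷ (r⟨ 3F ⟩ , s⟨ 1F ⟩) ∷ (r⟨ 2F ⟩ , r⟨ 2F ⟩) ∷ (s⟨ 0F ⟩ , s⟨ 3F ⟩) ∷ (s⟨ 2F ⟩ , r⟨ 3F ⟩) ∷ (s⟨ 1F ⟩ , s⟨ 2F ⟩) ∷ (s⟨ 3F ⟩ , r⟨ 1F ⟩) ∷ [])
  ∷ ((r⟨ 2F ⟩ , s⟨ 3F ⟩) ∷ (r⟨ 3F ⟩ , r⟨ 2F ⟩) ∷ (s⟨ 1F ⟩ , s⟨ 1F ⟩) ∷ (s⟨ 0F ⟩ , s⟨ 2F ⟩) ∷ (s⟨ 2F ⟩ , r⟨ 3F ⟩) ∷ (s⟨ 3F ⟩ , s⟨ 0F ⟩) ∷ [])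
  ∷ ((r⟨ 1F ⟩ , s⟨ 1F ⟩) ∷ (r⟨ 3F ⟩ , r⟨ 3F ⟩) ∷ (s⟨ 1F ⟩ , r⟨ 1F ⟩) ∷ (s⟨ 3F ⟩ , s⟨ 3F ⟩) ∷ []) ∷ []

abstract
  brute-D₈ : Dih₄.Brute.NoConfig r⟨ 0F ⟩ 3 homs-D₈
  brute-D₈ = from-yes (Dih₄.Brute.noConfig? r⟨ 0F ⟩ 3 homs-D₈)

  enough-Z₂ : Cyc.Enough 2 0 pts-Z₂
  enough-Z₂ = from-yes (Cyc.enough? 2 0 pts-Z₂)
  enough-Z₃ : Cyc.Enough 3 1 pts-Z₃
  enough-Z₃ = from-yes (Cyc.enough? 3 1 pts-Z₃)
  enough-Z₅ : Cyc.Enough 5 1 pts-Z₅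
  enough-Z₅ = from-yes (Cyc.enough? 5 1 pts-Z₅)
  enough-Z₆ : Cyc.Enough 6 0 pts-Z₆
  enough-Z₆ = from-yes (Cyc.enough? 6 0 pts-Z₆)
  enough-D₆ : Dih₃.Enough 0 pts-D₆
  enough-D₆ = from-yes (Dih₃.enough? 0 pts-D₆)
  enough-D₈ : Dih₄.Enough 3 pts-D₈
  enough-D₈ = from-yes (Dih₄.enough? 3 pts-D₈)

divisors-of-6 : ∀ d → d ∣ 6 → d ≡ 1 ⊎ d ≡ 2 ⊎ d ≡ 3 ⊎ d ≡ 6
divisors-of-6 d p = below {λ d → d ∣ 6 → d ≡ 1 ⊎ d ≡ 2 ⊎ d ≡ 3 ⊎ d ≡ 6} 6
  (from-yes (all? {n = 7} λ i → (toℕ i ∣? 6) →-dec ((toℕ i ≟ 1) ⊎-dec ((toℕ i ≟ 2) ⊎-dec ((toℕ i ≟ 3) ⊎-dec (toℕ i ≟ 6)))))) (∣⇒≤ p) p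

rotation : Pres 3
rotation = pres₃ 0 0 1

-- The two upper generators g and h are involutions with a central commutator of order two. So r =
-- gh, numbered 6, has order four, and s = g, numbered 4, inverts it.
dihedral-word : Bool × Fin 4 → V 3
dihedral-word (a , i) = pmul rotation (power (toℕ i)) (if a then bits 3 4 else zeros)
  where
  power : ℕ → V 3
  power zero = zeros
  power (suc k) = pmul rotation (bits 3 6) (power k)

Renames : ∀ {X : Set} {m} → List X → (X → X → X) → Pres m → (X → V m) → Set
Renames {m = m} xs _∙_ p g = Unique (mapL g xs) × All (λ v → v ∈L mapL g xs) (allV m) × All (λ x → All (λ y → pmul p (g x) (g y) ≡ g (x ∙ y)) xs) xs

renames? : ∀ {X : Set} {m} (xs : List X) (_∙_ : X → X → X) (p : Pres m) (g : X → V m) → Dec (Renames xs _∙_ p g)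
renames? {m = m} xs _∙_ p g = allPairs? (λ x y → ¬? (x ≟V y)) (mapL g xs) ×-dec (all-list? (λ v → mem-dec _≟V_ v (mapL g xs)) (allV m) ×-dec
  all-list? (λ x → all-list? (λ y → pmul p (g x) (g y) ≟V g (x ∙ y)) xs) xs)

rename-table : ∀ {n} {G : FinGroup n} {X : Set} {m} {xs : List X} {_∙_ : X → X → X} {p : Pres m} (g : X → V m) →
  (∀ x → x ∈L xs) → Renames xs _∙_ p g → Struct G p → Table G _∙_
rename-table g complete (u , sur , hm) S = record
  { f = λ x → w (g x)
  ; f-inj = λ {x} {y} e → unique-map u (complete x) (complete y) (w-inj e)
  ; f-surj = λ x → let v , e = w-surj x ; y , _ , e′ = ∈-map⁻ g (All-lookup sur (allV-complete v)) in y , trans (cong w (≡sym e′)) e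
  ; f-hom = λ x y → trans (w-hom _ _) (cong w (All-lookup (All-lookup hm (complete x)) (complete y))) }
  where open Struct S

abstract
  dihedral-words : Renames (elemsD 4) (dmul 4) rotation dihedral-word
  dihedral-words = from-yes (renames? (elemsD 4) (dmul 4) rotation dihedral-word)

Listed : ∀ {n} → FinGroup n → Set
Listed {n} G = IsCyclic G 2 ⊎ IsCyclic G 3 ⊎ IsCyclic G 5 ⊎ IsCyclic G 6 ⊎ IsDihedral G 3 ⊎ IsDihedral G 4 ⊎ (n ≡ 16 × NonAbelian G)

halve : ∀ n → ∃ λ m → n ≡ m + m ⊎ n ≡ suc (m + m)
halve zero = 0 , inj₁ refl
halve (suc n) with halve n
... | m , inj₁ refl = m , inj₂ refl
... | m , inj₂ refl = suc m , inj₁ (cong suc (≡sym (+-suc m m)))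

<-by : ∀ a d {c} → a + suc d ≡ c → a < c
<-by a d refl = m<m+n a (s≤s z≤n)

parity-suc : ∀ k → suc k % 2 ≢ k % 2
parity-suc zero ()
parity-suc (suc zero) ()
parity-suc (suc (suc k)) = parity-suc k

-- Subgroups, cosets and Freiman's theorem on small product sets

module Theory {n} (G : FinGroup n) where
  open FinGroup G public renaming (_·_ to infixl 7 _·_; _⁻¹ to infix 8 _⁻¹)
  open IsGroup isGroup public using (assoc; identityˡ; identityʳ; inverseˡ; inverseʳ)

  ⟦_⟧ : ∀ {k} → Word k → Vec (Fin n) k → Fin n
  ⟦ var i ⟧ ρ = lookup ρ i
  ⟦ 𝟙 ⟧ ρ = ε
  ⟦ a ⊗ b ⟧ ρ = ⟦ a ⟧ ρ · ⟦ b ⟧ ρ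
  ⟦ inv a ⟧ ρ = ⟦ a ⟧ ρ ⁻¹

  letter : ∀ {k} → Vec (Fin n) k → Letter k → Fin n
  letter ρ (true , i) = lookup ρ i
  letter ρ (false , i) = lookup ρ i ⁻¹

  spell : ∀ {k} → Vec (Fin n) k → List (Letter k) → Fin n
  spell ρ [] = ε
  spell ρ (l ∷ w) = letter ρ l · spell ρ w

  cancelˡ : ∀ x y → x · (x ⁻¹ · y) ≡ y
  cancelˡ x y = trans (≡sym (assoc _ _ _)) (trans (cong (_· y) (inverseʳ x)) (identityˡ y))
  cancelˡ′ : ∀ x y → x ⁻¹ · (x · y) ≡ y
  cancelˡ′ x y = trans (≡sym (assoc _ _ _)) (trans (cong (_· y) (inverseˡ x)) (identityˡ y))

  push-ok : ∀ {k} (ρ : Vec (Fin n) k) l w → spell ρ (push l w) ≡ letter ρ l · spell ρ w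
  push-ok ρ l [] = refl
  push-ok ρ (s , i) ((t , j) ∷ w) with i ≟F j | s | t
  ... | yes refl | true | false = ≡sym (cancelˡ _ _)
  ... | yes refl | false | true = ≡sym (cancelˡ′ _ _)
  ... | yes _ | true | true = refl
  ... | yes _ | false | false = refl
  ... | no _ | true | true = refl
  ... | no _ | true | false = refl
  ... | no _ | false | true = refl
  ... | no _ | false | false = refl

  ·-cancelˡ : ∀ x {y z} → x · y ≡ x · z → y ≡ z
  ·-cancelˡ x {y} {z} p = trans (≡sym (cancelˡ′ x y)) (trans (cong (x ⁻¹ ·_) p) (cancelˡ′ x z))

  ⁻¹-unique : ∀ x y → x · y ≡ ε → y ≡ x ⁻¹
  ⁻¹-unique x y p = ·-cancelˡ x (trans p (≡sym (inverseʳ x)))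

  ⁻¹⁻¹ : ∀ x → x ⁻¹ ⁻¹ ≡ x
  ⁻¹⁻¹ x = ≡sym (⁻¹-unique (x ⁻¹) x (inverseˡ x))

  ⁻¹-· : ∀ x y → (x · y) ⁻¹ ≡ y ⁻¹ · x ⁻¹
  ⁻¹-· x y = ≡sym (⁻¹-unique (x · y) _ (trans (assoc x y _) (trans (cong (x ·_) (cancelˡ y _)) (inverseʳ x))))

  ε⁻¹ : ε ⁻¹ ≡ ε
  ε⁻¹ = ≡sym (⁻¹-unique ε ε (identityˡ ε))

  sgn : Bool → Fin n → Fin n
  sgn true x = x
  sgn false x = x ⁻¹

  letters-ok : ∀ {k} (ρ : Vec (Fin n) k) s a w → spell ρ (letters s a w) ≡ sgn s (⟦ a ⟧ ρ) · spell ρ w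
  letters-ok ρ true (var i) w = push-ok ρ _ w
  letters-ok ρ false (var i) w = push-ok ρ _ w
  letters-ok ρ true 𝟙 w = ≡sym (identityˡ _)
  letters-ok ρ false 𝟙 w = trans (≡sym (identityˡ _)) (cong (_· spell ρ w) (≡sym ε⁻¹))
  letters-ok ρ true (a ⊗ b) w = trans (letters-ok ρ true a _) (trans (cong (⟦ a ⟧ ρ ·_) (letters-ok ρ true b w)) (≡sym (assoc _ _ _)))
  letters-ok ρ false (a ⊗ b) w = trans (letters-ok ρ false b _) (trans (cong (⟦ b ⟧ ρ ⁻¹ ·_) (letters-ok ρ false a w))
    (trans (≡sym (assoc _ _ _)) (cong (_· spell ρ w) (≡sym (⁻¹-· _ _)))))
  letters-ok ρ true (inv a) w = letters-ok ρ false a w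
  letters-ok ρ false (inv a) w = trans (letters-ok ρ true a w) (cong (_· spell ρ w) (≡sym (⁻¹⁻¹ _)))

  free : ∀ {k} (a b : Word k) (ρ : Vec (Fin n) k) → letters true a [] ≡ letters true b [] → ⟦ a ⟧ ρ ≡ ⟦ b ⟧ ρ
  free a b ρ p = trans (≡sym (lem a)) (trans (cong (spell ρ) p) (lem b))
    where
    lem : ∀ a → spell ρ (letters true a []) ≡ ⟦ a ⟧ ρ
    lem a = trans (letters-ok ρ true a []) (identityʳ _)

  record IsSubgroup (K : Sub n) : Set where
    field
      ε∈  : ε ∈ K
      ·∈  : ∀ {x y} → x ∈ K → y ∈ K → x · y ∈ K
      ⁻¹∈ : ∀ {x} → x ∈ K → x ⁻¹ ∈ K

    cosetʳ : ∀ {x y} → x ∈ K → x · y ∈ K → y ∈ K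
    cosetʳ {x} {y} p q = subst (_∈ K) (cancelˡ′ x y) (·∈ (⁻¹∈ p) q)

    cosetˡ : ∀ {x y} → y ∈ K → x · y ∈ K → x ∈ K
    cosetˡ {x} {y} p q = subst (_∈ K) (free (𝕩 ⊗ 𝕪 ⊗ inv 𝕪) 𝕩 (x ∷ y ∷ []) refl) (·∈ q (⁻¹∈ p))

  open IsSubgroup

  full-subgroup : IsSubgroup full
  full-subgroup = record { ε∈ = tt ; ·∈ = λ _ _ → tt ; ⁻¹∈ = λ _ → tt }

  infixr 6 _◃_
  infixl 6 _▹_
  _◃_ : Fin n → Sub n → Sub n
  g ◃ S = ⟪ (λ x → mem? S (g ⁻¹ · x)) ⟫

  _▹_ : Sub n → Fin n → Sub n
  S ▹ g = ⟪ (λ x → mem? S (x · g ⁻¹)) ⟫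

  ∣◃∣ : ∀ g S → ∣ g ◃ S ∣ ≡ ∣ S ∣
  ∣◃∣ g S = ∣∣-bij (g ◃ S) S (g ⁻¹ ·_) (g ·_) (cancelˡ g) (cancelˡ′ g) id (λ {y} p → subst (_∈ S) (≡sym (cancelˡ′ g y)) p)

  cancelʳ : ∀ x g → x · g · g ⁻¹ ≡ x
  cancelʳ x g = free (𝕩 ⊗ 𝕪 ⊗ inv 𝕪) 𝕩 (x ∷ g ∷ []) refl
  cancelʳ′ : ∀ x g → x · g ⁻¹ · g ≡ x
  cancelʳ′ x g = free (𝕩 ⊗ inv 𝕪 ⊗ 𝕪) 𝕩 (x ∷ g ∷ []) refl

  ∣▹∣ : ∀ S g → ∣ S ▹ g ∣ ≡ ∣ S ∣
  ∣▹∣ S g = ∣∣-bij (S ▹ g) S (_· g ⁻¹) (_· g) (λ x → cancelʳ′ x g) (λ x → cancelʳ x g) id (λ {y} p → subst (_∈ S) (≡sym (cancelʳ y g)) p)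

  ·-cancelʳ : ∀ g {x y} → x · g ≡ y · g → x ≡ y
  ·-cancelʳ g {x} {y} p = trans (≡sym (cancelʳ x g)) (trans (cong (_· g ⁻¹) p) (cancelʳ y g))

  _⁻¹ˢ : Sub n → Sub n
  S ⁻¹ˢ = ⟪ (λ x → mem? S (x ⁻¹)) ⟫

  ∣⁻¹ˢ∣ : ∀ S → ∣ S ⁻¹ˢ ∣ ≡ ∣ S ∣
  ∣⁻¹ˢ∣ S = ∣∣-bij (S ⁻¹ˢ) S _⁻¹ _⁻¹ ⁻¹⁻¹ ⁻¹⁻¹ id (λ {y} → subst (_∈ S) (≡sym (⁻¹⁻¹ y)))

  lagrange′ : ∀ {H} (h : IsSubgroup H) (S : Sub n) → (∀ {x y} → x ∈ S → y ∈ H → x · y ∈ S) → ∣ H ∣ ∣ ∣ S ∣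
  lagrange′ {H} h S cl = class-divides R? ∣ H ∣ S
    (λ {x} _ → subst (_∈ H) (≡sym (inverseˡ x)) (ε∈ h))
    (λ {x} {y} p → subst (_∈ H) (free (inv (inv 𝕩 ⊗ 𝕪)) (inv 𝕪 ⊗ 𝕩) (x ∷ y ∷ []) refl) (⁻¹∈ h p))
    (λ {x} {y} {z} p q → subst (_∈ H) (free ((inv 𝕩 ⊗ 𝕪) ⊗ (inv 𝕪 ⊗ 𝕫)) (inv 𝕩 ⊗ 𝕫) (x ∷ y ∷ z ∷ []) refl) (·∈ h p q))
    (λ {x} {y} p q → subst (_∈ S) (cancelˡ x y) (cl p q))
    (λ {x} _ → subst (∣ H ∣ ∣_) (≡sym (∣◃∣ x H)) ∣-refl)
    where
    R? : ∀ x y → Dec (x ⁻¹ · y ∈ H)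
    R? x y = mem? H (x ⁻¹ · y)

  lagrange : ∀ {H L} → IsSubgroup H → IsSubgroup L → H ⊆ L → ∣ H ∣ ∣ ∣ L ∣
  lagrange {L = L} h l s = lagrange′ h L (λ p q → ·∈ l p (s q))

  lagrange-full : ∀ {H} → IsSubgroup H → ∣ H ∣ ∣ n
  lagrange-full {H} h = subst (∣ H ∣ ∣_) ∣full∣ (lagrange h full-subgroup (λ _ → tt))

  -- If xy were outside K, then xK, K and the single element xy would be disjoint in H, which is too
  -- small for that.
  index2 : ∀ {H K} → IsSubgroup H → IsSubgroup K → K ⊆ H → ∣ H ∣ ≤ ∣ K ∣ + ∣ K ∣ → ∀ {x y} → x ∈ H → y ∈ H → ¬ x ∈ K → ¬ y ∈ K → x · y ∈ K
  index2 {H} {K} hH h s le {x} {y} xH yH x∉ y∉ with mem? K (x · y)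
  ... | yes p = p
  ... | no p = contradiction (begin-strict
      ∣ H ∣ ≤⟨ le ⟩
      ∣ K ∣ + ∣ K ∣ ≡⟨ cong (_+ ∣ K ∣) (∣◃∣ x K) ⟨
      ∣ x ◃ K ∣ + ∣ K ∣ ≤⟨ ∣∣-disjoint (x ◃ K) K (H ∩ ∁ ⁅ x · y ⁆)
        (λ {z} q → subst (_∈ H) (cancelˡ x z) (·∈ hH xH (s q)) , λ { refl → y∉ (subst (_∈ K) (cancelˡ′ x y) q) })
        (λ {z} q → s q , λ { refl → p q })
        (λ {z} q r → x∉ (subst (_∈ K) (⁻¹⁻¹ x) (⁻¹∈ h (cosetˡ h r q)))) ⟩
      ∣ H ∩ ∁ ⁅ x · y ⁆ ∣ <⟨ n<1+n _ ⟩
      suc ∣ H ∩ ∁ ⁅ x · y ⁆ ∣ ≡⟨ ∣∣-remove H (·∈ hH xH yH) ⟨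
      ∣ H ∣ ∎) (<-irrefl refl)
    where open ≤-Reasoning

  -- X lies in the left coset xK and Y in the right coset Ky. To write xky as a product, look for k′
  -- in K with xk′ in X and k′⁻¹ky in Y; the two conditions select subsets of K of sizes at least
  -- |X| and |Y|, so they have a common solution.
  fill-coset : ∀ {K} → IsSubgroup K → (X Y E : Sub n) → (∀ {x y} → x ∈ X → y ∈ Y → x · y ∈ E) →
    (∀ {x x′} → x ∈ X → x′ ∈ X → x ⁻¹ · x′ ∈ K) → (∀ {y y′} → y ∈ Y → y′ ∈ Y → y · y′ ⁻¹ ∈ K) →
    ∣ K ∣ < ∣ X ∣ + ∣ Y ∣ → ∀ {x k y} → x ∈ X → k ∈ K → y ∈ Y → x · k · y ∈ E
  fill-coset {K} hK X Y E XY⊆E sX sY lt {x} {k} {y} p q r =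
    let k′ , (_ , s) , (_ , t) = meeting S T K proj₁ proj₁ (<-≤-trans lt (+-mono-≤ cX cY))
    in subst (_∈ E) (free (𝕩 ⊗ 𝕪 ⊗ (inv 𝕪 ⊗ (𝕫 ⊗ 𝕦))) (𝕩 ⊗ 𝕫 ⊗ 𝕦) (x ∷ k′ ∷ k ∷ y ∷ []) refl) (XY⊆E s t)
    where
    S T : Sub n
    S = ⟪ (λ k′ → mem? K k′ ×-dec mem? X (x · k′)) ⟫
    T = ⟪ (λ k′ → mem? K k′ ×-dec mem? Y (k′ ⁻¹ · (k · y))) ⟫
    cX : ∣ X ∣ ≤ ∣ S ∣
    cX = ∣∣-inj X S (x ⁻¹ ·_) (λ {z} z∈ → sX p z∈ , subst (_∈ X) (≡sym (cancelˡ x z)) z∈) (λ _ _ → ·-cancelˡ (x ⁻¹))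
    cY : ∣ Y ∣ ≤ ∣ T ∣
    cY = ∣∣-inj Y T (λ z → k · (y · z ⁻¹))
      (λ {z} z∈ → ·∈ hK q (sY r z∈) , subst (_∈ Y) (free 𝕫 (inv (𝕩 ⊗ (𝕪 ⊗ inv 𝕫)) ⊗ (𝕩 ⊗ 𝕪)) (k ∷ y ∷ z ∷ []) refl) z∈)
      (λ {a} {b} _ _ z → trans (≡sym (⁻¹⁻¹ a)) (trans (cong _⁻¹ (·-cancelˡ y (·-cancelˡ k z))) (⁻¹⁻¹ b)))

  -- K is A⁻¹A. Two translates Ab and Ab′ both lie in E, so they meet and BB⁻¹ ⊆ K. Conversely, for
  -- g in K the translates aB and agB overlap in at least 2|B| - |E| elements, more than half of
  -- |B|, so g has that many representations in BB⁻¹. Representations of two elements of K can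
  -- therefore be chosen with a common middle factor, and K is closed under products.
  module Freiman (A B E : Sub n) (AB⊆E : ∀ {a b} → a ∈ A → b ∈ B → a · b ∈ E)
                 (E<2A : ∣ E ∣ < ∣ A ∣ + ∣ A ∣) (2E<3B : ∣ E ∣ + ∣ E ∣ < ∣ B ∣ + ∣ B ∣ + ∣ B ∣) where

    K : Sub n
    K = ⟪ (λ g → any? (λ a → mem? A a ×-dec mem? A (a · g))) ⟫

    A⁻¹A⊆K : ∀ {a a′} → a ∈ A → a′ ∈ A → a ⁻¹ · a′ ∈ K
    A⁻¹A⊆K {a} {a′} p q = a , p , subst (_∈ A) (≡sym (cancelˡ a a′)) q

    BB⁻¹⊆K : ∀ {b b′} → b ∈ B → b′ ∈ B → b · b′ ⁻¹ ∈ K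
    BB⁻¹⊆K {b} {b′} p q =
      let x , r , s = meeting (A ▹ b) (A ▹ b′) E (λ {x} r → subst (_∈ E) (cancelʳ′ x b) (AB⊆E r p)) (λ {x} r → subst (_∈ E) (cancelʳ′ x b′) (AB⊆E r q))
                        (subst (∣ E ∣ <_) (≡sym (cong₂ _+_ (∣▹∣ A b) (∣▹∣ A b′))) E<2A)
      in x · b ⁻¹ , r , subst (_∈ A) (free (𝕩 ⊗ inv 𝕫) (𝕩 ⊗ inv 𝕪 ⊗ (𝕪 ⊗ inv 𝕫)) (x ∷ b ∷ b′ ∷ []) refl) s

    shift : Fin n → Sub n
    shift g = ⟪ (λ b → mem? B b ×-dec mem? B (g ⁻¹ · b)) ⟫

    many : ∀ {g} → g ∈ K → ∣ B ∣ + ∣ B ∣ ≤ ∣ E ∣ + ∣ shift g ∣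
    many {g} (a , p , q) = begin
      ∣ B ∣ + ∣ B ∣ ≡⟨ cong₂ _+_ (∣◃∣ a B) (∣◃∣ (a · g) B) ⟨
      ∣ a ◃ B ∣ + ∣ a · g ◃ B ∣ ≤⟨ ∣∣-∩ (a ◃ B) (a · g ◃ B) E (λ {x} r → subst (_∈ E) (cancelˡ a x) (AB⊆E p r)) (λ {x} r → subst (_∈ E) (cancelˡ (a · g) x) (AB⊆E q r)) ⟩
      ∣ E ∣ + ∣ (a ◃ B) ∩ (a · g ◃ B) ∣ ≤⟨ +-monoʳ-≤ ∣ E ∣ (∣∣-inj ((a ◃ B) ∩ (a · g ◃ B)) (shift g) (a ⁻¹ ·_)
          (λ {x} (r , s) → r , subst (_∈ B) (free (inv (𝕩 ⊗ 𝕪) ⊗ 𝕫) (inv 𝕪 ⊗ (inv 𝕩 ⊗ 𝕫)) (a ∷ g ∷ x ∷ []) refl) s) (λ _ _ → ·-cancelˡ (a ⁻¹))) ⟩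
      ∣ E ∣ + ∣ shift g ∣ ∎
      where open ≤-Reasoning

    subgroup : IsSubgroup K
    subgroup = record { ε∈ = ε∈K ; ·∈ = cl ; ⁻¹∈ = iv }
      where
      ε∈K : ε ∈ K
      ε∈K = let a , p = nonempty A (n≢0⇒n>0 λ z → n≮0 (subst (λ z → ∣ E ∣ < z + z) z E<2A)) in
        a , p , subst (_∈ A) (≡sym (identityʳ a)) p
      iv : ∀ {x} → x ∈ K → x ⁻¹ ∈ K
      iv {x} (a , p , q) = a · x , q , subst (_∈ A) (≡sym (cancelʳ a x)) p
      cl : ∀ {x y} → x ∈ K → y ∈ K → x · y ∈ K
      cl {x} {y} p q =
        let b , (b∈ , r) , (_ , s) = meeting (shift (x ⁻¹)) (shift y) B proj₁ proj₁ (≰⇒> small)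
        in subst (_∈ K) (free (inv (inv 𝕩) ⊗ 𝕫 ⊗ inv (inv 𝕪 ⊗ 𝕫)) (𝕩 ⊗ 𝕪) (x ∷ y ∷ b ∷ []) refl) (BB⁻¹⊆K r s)
        where
        open ≤-Reasoning
        small : ¬ ∣ shift (x ⁻¹) ∣ + ∣ shift y ∣ ≤ ∣ B ∣
        small le = <⇒≱ 2E<3B (+-cancelʳ-≤ ∣ B ∣ _ _ (begin
          ∣ B ∣ + ∣ B ∣ + ∣ B ∣ + ∣ B ∣ ≡⟨ +-assoc (∣ B ∣ + ∣ B ∣) _ _ ⟩
          (∣ B ∣ + ∣ B ∣) + (∣ B ∣ + ∣ B ∣) ≤⟨ +-mono-≤ (many (iv p)) (many q) ⟩
          (∣ E ∣ + ∣ shift (x ⁻¹) ∣) + (∣ E ∣ + ∣ shift y ∣) ≡⟨ +-interchange ∣ E ∣ _ _ _ ⟩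
          (∣ E ∣ + ∣ E ∣) + (∣ shift (x ⁻¹) ∣ + ∣ shift y ∣) ≤⟨ +-monoʳ-≤ (∣ E ∣ + ∣ E ∣) le ⟩
          ∣ E ∣ + ∣ E ∣ + ∣ B ∣ ∎))

    -- Counts the pairs (g, b) with b and g⁻¹b in B: each g in K has at least 2|B| - |E| partners by
    -- `many`, each b at most |B|.
    bound : ∣ K ∣ * (∣ B ∣ + ∣ B ∣ ∸ ∣ E ∣) ≤ ∣ B ∣ * ∣ B ∣
    bound = double-count (λ g b → mem? B b ×-dec mem? B (g ⁻¹ · b)) K B _ _
      (λ p → m≤n+o⇒m∸n≤o (∣ B ∣ + ∣ B ∣) ∣ E ∣ (many p))
      (λ {b} p → ∣∣-inj ⟪ (λ g → mem? B b ×-dec mem? B (g ⁻¹ · b)) ⟫ B (λ g → g ⁻¹ · b) proj₂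
        (λ {x} {y} _ _ q → trans (≡sym (⁻¹⁻¹ x)) (trans (cong _⁻¹ (·-cancelʳ b q)) (⁻¹⁻¹ y))))
      proj₁

    fill : ∣ K ∣ < ∣ A ∣ + ∣ B ∣ → ∀ {a k b} → a ∈ A → k ∈ K → b ∈ B → a · k · b ∈ E
    fill = fill-coset subgroup A B E AB⊆E A⁻¹A⊆K BB⁻¹⊆K

  -- Configurations left unused by a maximal partial transversal

  record Homᴴ (H : Sub n) (m : ℕ) (φ : Fin n → ℕ) : Set where
    constructor mkHom
    field
      hom : ∀ {x y} → x ∈ H → y ∈ H → φ (x · y) ≈[ m ] φ x + φ y
  open Homᴴ public

  wt : Sub n → (Fin n → ℕ) → ℕ
  wt = ℕW.weight

  -- A and B are the unused rows and columns, D the inverses of the unused symbols: with inverses all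
  -- conditions are invariant under rotating (A, B, D).
  record Config (k : ℕ) : Set₁ where
    field
      A B D : Sub n
      ∣A∣ : ∣ A ∣ ≡ k
      ∣B∣ : ∣ B ∣ ≡ k
      ∣D∣ : ∣ D ∣ ≡ k
      free-of-ε : ∀ {a b d} → a ∈ A → b ∈ B → d ∈ D → a · b · d ≢ ε
      hom-sum : ∀ m φ → Homᴴ full m φ → wt full φ ≈[ m ] wt A φ + wt B φ + wt D φ

  rotate : ∀ {k} → Config k → Config k
  rotate C = record
    { A = B ; B = D ; D = A ; ∣A∣ = ∣B∣ ; ∣B∣ = ∣D∣ ; ∣D∣ = ∣A∣
    ; free-of-ε = λ {b} {d} {a} p q r z → free-of-ε r p q (trans (free (𝕩 ⊗ 𝕪 ⊗ 𝕫) (𝕩 ⊗ (𝕪 ⊗ 𝕫 ⊗ 𝕩) ⊗ inv 𝕩) (a ∷ b ∷ d ∷ []) refl)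
        (trans (cong (λ z → a · z · a ⁻¹) z) (free (𝕩 ⊗ 𝟙 ⊗ inv 𝕩) 𝟙 (a ∷ []) refl)))
    ; hom-sum = λ m φ h → Mod.mtrans m (hom-sum m φ h) (Mod.≡⇒≈ m (trans (+-assoc (wt A φ) _ _) (+-comm (wt A φ) _))) }
    where open Config C

  hom-inv : ∀ {H} → IsSubgroup H → ∀ {m φ} → Homᴴ H m φ → ∀ {x} → x ∈ H → 0 ≈[ m ] φ x + φ (x ⁻¹)
  hom-inv {H} hH {m} {φ} h {x} p = mtrans (msym zero≈) (subst (λ z → φ z ≈[ m ] _) (inverseʳ x) (hom h p (IsSubgroup.⁻¹∈ hH p)))
    where
    open Mod m
    zero≈ : φ ε ≈[ m ] 0
    zero≈ = mcancel (φ ε) (mtrans (msym (subst (λ z → φ z ≈[ m ] φ ε + φ ε) (identityˡ ε) (hom h (IsSubgroup.ε∈ hH) (IsSubgroup.ε∈ hH)))) (≡⇒≈ (≡sym (+-identityʳ _))))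

  wt-inv : ∀ S φ → wt (S ⁻¹ˢ) φ ≡ wt S (φ ∘ _⁻¹)
  wt-inv S φ = trans (ℕW.⨁-cong-≗ (λ x → cong (λ z → ℕW.pick (mem? S (x ⁻¹)) (φ z)) (≡sym (⁻¹⁻¹ x))))
    (≡sym (ℕW.sum-permute (λ x → ℕW.pick (mem? S x) (φ (x ⁻¹))) (permutation _⁻¹ _⁻¹ ⁻¹⁻¹ ⁻¹⁻¹)))

  module FromMaximal {T} (max : Maximal (cayley G) T) where
    open PartialTransversal (proj₁ max)

    A B C : Sub n
    A = full ∖ mapL row T
    B = full ∖ mapL col T
    C = full ∖ mapL sym T

    size : ∀ (f : Triple n → Fin n) → Unique (mapL f T) → length T + ∣ full ∖ mapL f T ∣ ≡ n
    size f u = trans (cong (_+ ∣ full ∖ mapL f T ∣) (≡sym (length-map f T))) (trans (≡sym (∣∣-list full (mapL f T) u (λ _ → tt))) ∣full∣)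

    -- Otherwise the cell (a, b) could be adjoined to T.
    AB∩C : ∀ {a b} → a ∈ A → b ∈ B → ¬ a · b ∈ C
    AB∩C {a} {b} (_ , p) (_ , q) (_ , r) = <-irrefl refl (proj₂ max ((a , b , a · b) ∷ T) record
      { triples = λ { (here refl) → refl ; (there z) → triples z }
      ; rowsUniq = All-tabulate (λ z w → p (subst (_∈L _) (≡sym w) z)) ∷ rowsUniq
      ; colsUniq = All-tabulate (λ z w → q (subst (_∈L _) (≡sym w) z)) ∷ colsUniq
      ; symsUniq = All-tabulate (λ z w → r (subst (_∈L _) (≡sym w) z)) ∷ symsUniq } there)

    module _ {c ℓ} (M : CommutativeMonoid c ℓ) where
      open Weighted M
      open import Relation.Binary.Reasoning.Setoid setoid
      open CSG commutativeSemigroup using (interchange; x∙yz≈y∙xz)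

      hom-sums : (∀ z {x y} → z ⊕ x ≈ z ⊕ y → x ≈ y) → (φ : Fin n → Carrier) → (∀ x y → φ (x · y) ≈ φ x ⊕ φ y) →
        weight full φ ⊕ weight C φ ≈ weight A φ ⊕ weight B φ
      hom-sums cancel φ φ-hom = cancel (L sym) (begin
        L sym ⊕ (σ ⊕ weight C φ) ≈⟨ x∙yz≈y∙xz _ _ _ ⟩
        σ ⊕ (L sym ⊕ weight C φ) ≈⟨ ⊕-cong ≈refl (σ≈ sym symsUniq) ⟨
        σ ⊕ σ ≈⟨ ⊕-cong (σ≈ row rowsUniq) (σ≈ col colsUniq) ⟩
        (L row ⊕ weight A φ) ⊕ (L col ⊕ weight B φ) ≈⟨ interchange _ _ _ _ ⟩
        (L row ⊕ L col) ⊕ (weight A φ ⊕ weight B φ) ≈⟨ ⊕-cong (listSum-hom (φ ∘ row) (φ ∘ col) (φ ∘ sym) T (λ {t} z → ≈trans (reflexive (cong φ (triples z))) (φ-hom (row t) (col t)))) ≈refl ⟨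
        L sym ⊕ (weight A φ ⊕ weight B φ) ∎)
        where
        σ = weight full φ
        L : (Triple n → Fin n) → Carrier
        L f = listSum (φ ∘ f) T
        σ≈ : ∀ f → Unique (mapL f T) → σ ≈ L f ⊕ weight (full ∖ mapL f T) φ
        σ≈ f u = ≈trans (weight-list full φ (mapL f T) u (λ _ → tt)) (⊕-cong (reflexive (listSum-map φ f T)) ≈refl)

    config : Config (n ∸ length T)
    config = record
      { A = A ; B = B ; D = C ⁻¹ˢ ; ∣A∣ = sz row rowsUniq ; ∣B∣ = sz col colsUniq ; ∣D∣ = trans (∣⁻¹ˢ∣ C) (sz sym symsUniq)
      ; free-of-ε = λ {a} {b} {d} p q r z → AB∩C p q (subst (_∈ C) (≡sym (trans (⁻¹-unique′ z) refl)) r)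
      ; hom-sum = hs }
      where
      ⁻¹-unique′ : ∀ {x y} → x · y ≡ ε → x ≡ y ⁻¹
      ⁻¹-unique′ {x} {y} z = ·-cancelʳ y (trans z (≡sym (inverseˡ y)))
      sz : ∀ f → Unique (mapL f T) → ∣ full ∖ mapL f T ∣ ≡ n ∸ length T
      sz f u = trans (≡sym (m+n∸m≡n (length T) _)) (cong (_∸ length T) (size f u))
      -- φ(C⁻¹) is added to both sides; on the left it cancels φ(C), which leaves the form symmetric
      -- in A, B and D.
      hs : ∀ m φ → Homᴴ full m φ → wt full φ ≈[ m ] wt A φ + wt B φ + wt (C ⁻¹ˢ) φ
      hs m φ h = mtrans (mtrans (≡⇒≈ (≡sym (+-identityʳ _))) (mtrans (m+ mrefl zz) (≡⇒≈ (≡sym (+-assoc (wt full φ) _ _))))) (m+ (hom-sums (Mod.monoid m) mcancel φ (λ x y → hom h tt tt)) mrefl)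
        where
        open Mod m
        zz : 0 ≈[ m ] wt C φ + wt (C ⁻¹ˢ) φ
        zz = mtrans (mtrans (msym (W.sum-replicate-zero n)) (W.sum-cong-≋ (λ x → lem (mem? C x) (hom-inv full-subgroup h tt))))
          (≡⇒≈ (trans (ℕW.⨁-distrib-⊕ (λ x → ℕW.pick (mem? C x) (φ x)) _) (cong (wt C φ +_) (≡sym (wt-inv C φ)))))
          where
          lem : ∀ {P : Set} (d : Dec P) {x y} → 0 ≈[ m ] x + y → 0 ≈[ m ] ℕW.pick d x + ℕW.pick d y
          lem (yes _) p = p
          lem (no _) p = mrefl

  module Index2 {K} (hK : IsSubgroup K) (half : ∣ K ∣ + ∣ K ∣ ≡ n) where
    χ : Fin n → ℕ
    χ x = bit (¬? (mem? K x))

    in0 : ∀ {x} → x ∈ K → χ x ≡ 0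
    in0 {x} p with mem? K x
    ... | yes _ = refl
    ... | no q = contradiction p q

    out1 : ∀ {x} → ¬ x ∈ K → χ x ≡ 1
    out1 {x} p with mem? K x
    ... | yes q = contradiction q p
    ... | no _ = refl

    cross : ∀ {x y} → ¬ x ∈ K → ¬ y ∈ K → x · y ∈ K
    cross = index2 full-subgroup hK (λ _ → tt) (≤-reflexive (trans ∣full∣ (≡sym half))) tt tt

    χ-hom : Homᴴ full 2 χ
    χ-hom = mkHom h
      where
      open Mod 2
      h : ∀ {x y} → _ → _ → χ (x · y) ≈[ 2 ] χ x + χ y
      h {x} {y} _ _ with mem? K x | mem? K y
      ... | yes p | yes q = ≡⇒≈ (in0 (·∈ hK p q))
      ... | yes p | no q = ≡⇒≈ (out1 (λ r → q (cosetʳ hK p r)))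
      ... | no p | yes q = ≡⇒≈ (out1 (λ r → p (cosetˡ hK q r)))
      ... | no p | no q = subst (_≈[ 2 ] 2) (≡sym (in0 (cross p q))) (≈by 1 0 refl)

    wt-χ : wt full χ ≡ ∣ K ∣
    wt-χ = +-cancelˡ-≡ ∣ K ∣ _ _ (trans (∣∣-∁ K) (≡sym half))

    ∣∁∣ : ∣ ∁ K ∣ ≡ ∣ K ∣
    ∣∁∣ = wt-χ

  -- The sign χ of K is constant on A and on B. No d⁻¹ lies in aKb, and aKb is a full coset of K, so
  -- χ(a) + χ(b) + χ(d) is odd for every d, which makes χ constant on D as well. The sum of χ over
  -- A, B and D is then k times an odd number, while its sum over G is |K|.
  parity-one-coset : ∀ {K} → IsSubgroup K → ∣ K ∣ + ∣ K ∣ ≡ n → ∀ {k} (C : Config k) → let open Config C in 0 < k →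
    (∀ {a a′} → a ∈ A → a′ ∈ A → a ⁻¹ · a′ ∈ K) → (∀ {b b′} → b ∈ B → b′ ∈ B → b · b′ ⁻¹ ∈ K) →
    (∀ {a x b d} → a ∈ A → x ∈ K → b ∈ B → d ∈ D → a · x · b · d ≢ ε) → ∣ K ∣ ≈[ 2 ] k
  parity-one-coset {K} hK half {k} C pos sA sB fr = begin
      ∣ K ∣ ≡⟨ wt-χ ⟨
      wt full χ ≈⟨ hom-sum 2 χ χ-hom ⟩
      wt A χ + wt B χ + wt D χ ≈⟨ m+ (m+ (≈-const A χ (χ a₀) cA) (≈-const B χ (χ b₀) cB)) (≈-const D χ (χ d₀) cD) ⟩
      ∣ A ∣ * χ a₀ + ∣ B ∣ * χ b₀ + ∣ D ∣ * χ d₀ ≡⟨ cong₂ _+_ (cong₂ _+_ (cong (_* χ a₀) ∣A∣) (cong (_* χ b₀) ∣B∣)) (cong (_* χ d₀) ∣D∣) ⟩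
      k * χ a₀ + k * χ b₀ + k * χ d₀ ≡⟨ l k (χ a₀) (χ b₀) (χ d₀) ⟩
      k * (χ a₀ + χ b₀ + χ d₀) ≈⟨ mul k (tot d∈) ⟩
      k * 1 ≡⟨ *-identityʳ k ⟩
      k ∎
    where
    open Config C
    open Index2 hK half
    open Mod 2
    open import Relation.Binary.Reasoning.Setoid (CommutativeMonoid.setoid monoid)
    l : ∀ k a b c → k * a + k * b + k * c ≡ k * (a + b + c)
    l = solve-∀
    mul : ∀ k {x y} → x ≈[ 2 ] y → k * x ≈[ 2 ] k * y
    mul zero p = mrefl
    mul (suc k) p = m+ p (mul k p)
    a₀ = proj₁ (nonempty A (subst (0 <_) (≡sym ∣A∣) pos))
    a∈ = proj₂ (nonempty A (subst (0 <_) (≡sym ∣A∣) pos))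
    b₀ = proj₁ (nonempty B (subst (0 <_) (≡sym ∣B∣) pos))
    b∈ = proj₂ (nonempty B (subst (0 <_) (≡sym ∣B∣) pos))
    d₀ = proj₁ (nonempty D (subst (0 <_) (≡sym ∣D∣) pos))
    d∈ = proj₂ (nonempty D (subst (0 <_) (≡sym ∣D∣) pos))
    cA : ∀ {a} → a ∈ A → χ a ≈[ 2 ] χ a₀
    cA {a} p = mtrans (mtrans (≡⇒≈ (cong χ (≡sym (cancelˡ a₀ a)))) (hom χ-hom tt tt)) (≡⇒≈ (trans (cong (χ a₀ +_) (in0 (sA a∈ p))) (+-identityʳ _)))
    cB : ∀ {b} → b ∈ B → χ b ≈[ 2 ] χ b₀
    cB {b} p = mtrans (mtrans (≡⇒≈ (cong χ (≡sym (cancelʳ′ b b₀)))) (hom χ-hom tt tt)) (≡⇒≈ (cong (_+ χ b₀) (in0 (sB p b∈))))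
    tot : ∀ {d} → d ∈ D → χ a₀ + χ b₀ + χ d ≈[ 2 ] 1
    tot {d} p = mtrans (msym (mtrans (hom χ-hom tt tt) (m+ (hom χ-hom tt tt) mrefl))) (≡⇒≈ (out1 λ q →
       fr a∈ (k∈ q) b∈ p (free (𝕩 ⊗ (inv 𝕩 ⊗ inv 𝕫 ⊗ inv 𝕪) ⊗ 𝕪 ⊗ 𝕫) 𝟙 (a₀ ∷ b₀ ∷ d ∷ []) refl)))
      where
      k∈ : a₀ · b₀ · d ∈ K → a₀ ⁻¹ · d ⁻¹ · b₀ ⁻¹ ∈ K
      k∈ q = cls (mtrans (hom χ-hom tt tt) (mtrans (m+ (hom χ-hom tt tt) mrefl) (mcancel (χ a₀ + χ b₀ + χ d) (mtrans (≡⇒≈ (l3 (χ a₀) (χ b₀) (χ d) _ _ _)) (mtrans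
           (m+ (m+ (msym (hom-inv full-subgroup χ-hom tt)) (msym (hom-inv full-subgroup χ-hom tt))) (msym (hom-inv full-subgroup χ-hom tt))) (mtrans (mtrans (≡⇒≈ (≡sym (in0 q))) (hom χ-hom tt tt)) (mtrans (m+ (hom χ-hom tt tt) mrefl) (≡⇒≈ (≡sym (+-identityʳ _))))))))))
        where
        cls : ∀ {x} → χ x ≈[ 2 ] 0 → x ∈ K
        cls {x} r with mem? K x
        ... | yes z = z
        ... | no z with ≈⇒% 2 r
        ...   | ()
        l3 : ∀ a b d a′ d′ b′ → a + b + d + (a′ + d′ + b′) ≡ (a + a′) + (b + b′) + (d + d′)
        l3 = solve-∀
    cD : ∀ {d} → d ∈ D → χ d ≈[ 2 ] χ d₀
    cD p = mcancel (χ a₀ + χ b₀) (mtrans (tot p) (msym (tot d∈)))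

  record Half {k} (C : Config k) : Set₁ where
    open Config C
    field
      K    : Sub n
      hK   : IsSubgroup K
      half : ∣ K ∣ + ∣ K ∣ ≡ n
      sA   : ∀ {a a′} → a ∈ A → a′ ∈ A → a ⁻¹ · a′ ∈ K
      sB   : ∀ {b b′} → b ∈ B → b′ ∈ B → b · b′ ⁻¹ ∈ K
      fr   : ∀ {a x b d} → a ∈ A → x ∈ K → b ∈ B → d ∈ D → a · x · b · d ≢ ε

  module _ {k} (C : Config k) where
    open Config C

    Avoid : Sub n
    Avoid = ∁ (D ⁻¹ˢ)

    ∈Avoid : ∀ {a b} → a ∈ A → b ∈ B → a · b ∈ Avoid
    ∈Avoid {a} {b} p q r = free-of-ε p q r (inverseʳ (a · b))

    Avoid⁻ : ∀ {x d} → x ∈ Avoid → d ∈ D → x · d ≢ ε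
    Avoid⁻ {x} p d∈ z = p (subst (_∈ D) (⁻¹-unique x _ z) d∈)

    ∣Avoid∣ : k + ∣ Avoid ∣ ≡ n
    ∣Avoid∣ = trans (cong (_+ ∣ Avoid ∣) (≡sym (trans (∣⁻¹ˢ∣ D) ∣D∣))) (∣∣-∁ (D ⁻¹ˢ))

    -- AB lies in a set of size E = n - k, and 5k > 2n means 2E < 3k, so Freiman's subgroup K
    -- exists. Since 2k - E > k/2, the counting bound yields |K| < 2k, so aKb lies in the same set
    -- and |K| ≤ E < n. With k ≤ |K| and n < 3k the index of K is two.
    large-half : n + n < k + k + k + k + k → Half C
    large-half lt = record { K = K ; hK = subgroup ; half = ≡sym two ; sA = A⁻¹A⊆K ; sB = BB⁻¹⊆K
        ; fr = λ p x q r z → Avoid⁻ (fill lt2k p x q) r z }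
      where
      open ≤-Reasoning
      E = ∣ Avoid ∣
      pos : 0 < k
      pos = n≢0⇒n>0 λ { refl → n≮0 lt }
      c1 : k + k + (E + E) ≡ n + n
      c1 = trans (l k E) (cong₂ _+_ ∣Avoid∣ ∣Avoid∣)
        where
        l : ∀ k E → k + k + (E + E) ≡ (k + E) + (k + E)
        l = solve-∀
      2E<3k : E + E < k + k + k
      2E<3k = +-cancelˡ-< (k + k) _ _ (subst₂ _<_ (≡sym c1) (l k) lt)
        where
        l : ∀ k → k + k + k + k + k ≡ k + k + (k + k + k)
        l = solve-∀
      E<2k : E < k + k
      E<2k = ≰⇒> λ le → <⇒≱ 2E<3k (≤-trans (m≤m+n (k + k + k) k) (≤-trans (≤-reflexive (+-assoc (k + k) k k)) (+-mono-≤ le le)))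
      open Freiman A B Avoid ∈Avoid (subst (λ z → E < z + z) (≡sym ∣A∣) E<2k) (subst (λ z → E + E < z + z + z) (≡sym ∣B∣) 2E<3k)
      r = k + k ∸ E
      k<2r : k < r + r
      k<2r = +-cancelˡ-< (E + E) _ _ (begin-strict
        E + E + k <⟨ +-monoˡ-< k 2E<3k ⟩
        k + k + k + k ≡⟨ +-assoc (k + k) k k ⟩
        (k + k) + (k + k) ≡⟨ cong (λ z → z + z) (m+[n∸m]≡n {E} {k + k} (<⇒≤ E<2k)) ⟨
        (E + r) + (E + r) ≡⟨ l E r ⟩
        E + E + (r + r) ∎)
        where
        l : ∀ E r → (E + r) + (E + r) ≡ E + E + (r + r)
        l = solve-∀
      K<2k : ∣ K ∣ < k + k
      K<2k = ≰⇒> λ le → <⇒≱ k<2r (*-cancelˡ-≤ k {{>-nonZero pos}} (begin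
        k * (r + r) ≡⟨ l k r ⟩
        (k + k) * r ≤⟨ *-monoˡ-≤ r le ⟩
        ∣ K ∣ * r ≤⟨ subst (λ b → ∣ K ∣ * (b + b ∸ E) ≤ b * b) ∣B∣ bound ⟩
        k * k ∎))
        where
        l : ∀ k r → k * (r + r) ≡ (k + k) * r
        l = solve-∀
      lt2k : ∣ K ∣ < ∣ A ∣ + ∣ B ∣
      lt2k = subst₂ (λ a b → ∣ K ∣ < a + b) (≡sym ∣A∣) (≡sym ∣B∣) K<2k
      a₀ = nonempty A (subst (0 <_) (≡sym ∣A∣) pos)
      b₀ = nonempty B (subst (0 <_) (≡sym ∣B∣) pos)
      K≤E : ∣ K ∣ ≤ E
      K≤E = ∣∣-inj K Avoid (λ x → proj₁ a₀ · x · proj₁ b₀) (λ x → fill lt2k (proj₂ a₀) x (proj₂ b₀)) (λ _ _ z → ·-cancelˡ (proj₁ a₀) (·-cancelʳ (proj₁ b₀) z))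
      k≤K : k ≤ ∣ K ∣
      k≤K = subst (_≤ ∣ K ∣) ∣A∣ (∣∣-inj A K (proj₁ a₀ ⁻¹ ·_) (A⁻¹A⊆K (proj₂ a₀)) (λ _ _ → ·-cancelˡ _))
      n<3k : n < k + k + k
      n<3k = subst (_< k + k + k) ∣Avoid∣ (subst (k + E <_) (≡sym (+-assoc k k k)) (+-monoʳ-< k E<2k))
      two : n ≡ ∣ K ∣ + ∣ K ∣
      two = let divides q eq = lagrange-full subgroup in quotient-two q eq k≤K (≤-<-trans K≤E (subst (E <_) ∣Avoid∣ (m<n+m E pos))) n<3k

    large-parity : n + n < k + k + k + k + k → Σ ℕ λ m → m + m ≡ n × m ≈[ 2 ] k
    large-parity lt = ∣ K ∣ , half , parity-one-coset hK half C (n≢0⇒n>0 λ { refl → n≮0 lt }) sA sB fr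
      where open Half (large-half lt)

  Has : ℕ → Set
  Has k = HasMaximalPTOfLength (cayley G) (n ∸ k)

  has-config : ∀ {k} → k ≤ n → Has k → Config k
  has-config {k} le (T , max , len) = subst Config (trans (cong (n ∸_) len) (m∸[m∸n]≡n le)) (FromMaximal.config max)

  -- Necessary for K to have a complete mapping.
  ZeroSum : Sub n → Set
  ZeroSum K = ∀ m φ → Homᴴ K m φ → wt K φ ≈[ m ] 0

  has-all : Has 0 → ZeroSum full
  has-all h m φ φh = mtrans (hom-sum m φ φh) (m+ (m+ (z A ∣A∣) (z B ∣B∣)) (z D ∣D∣))
    where
    open Config (has-config z≤n h)
    open Mod m
    z : ∀ S → ∣ S ∣ ≡ 0 → wt S φ ≈[ m ] 0
    z S e = W.weight-empty S φ (λ p → <⇒≱ (∣∣-pos S p) (≤-reflexive e))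

  has-half : ∀ {m} → m + m ≡ n → Has m → Σ (Sub n) λ K → IsSubgroup K × ∣ K ∣ ≡ m × ZeroSum K
  has-half {zero} refl h = contradiction ε λ ()
  has-half {m@(suc _)} mm h@(T , max , len) = K , hK , K≡m , zs
    where
    open FromMaximal max using (size; A; B)
    C = FromMaximal.config max
    k≡m : n ∸ length T ≡ m
    k≡m = trans (cong (n ∸_) len) (m∸[m∸n]≡n (subst (m ≤_) mm (m≤m+n m m)))
    len≡m : length T ≡ m
    len≡m = trans len (trans (cong (_∸ m) (≡sym mm)) (m+n∸n≡m m m))
    lt : ∀ k → k ≡ m → n + n < k + k + k + k + k
    lt k refl = subst (_< m + m + m + m + m) (trans (+-assoc (m + m) m m) (cong₂ _+_ mm mm)) (m<m+n _ (s≤s z≤n))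
    open Half (large-half C (lt _ k≡m))
    open Config C using (∣A∣; ∣B∣)
    open PartialTransversal (proj₁ max)
    K≡m : ∣ K ∣ ≡ m
    K≡m = dbl (trans half (≡sym mm))
      where
      dbl : ∀ {a b} → a + a ≡ b + b → a ≡ b
      dbl {a} {b} p = *-cancelˡ-≡ a b 2 (trans (cong (a +_) (+-identityʳ a)) (trans p (cong (b +_) (≡sym (+-identityʳ b)))))
    open Index2 hK half using (cross)
    a₀∈ = nonempty A (subst (0 <_) (≡sym (trans ∣A∣ k≡m)) (s≤s z≤n))
    b₀∈ = nonempty B (subst (0 <_) (≡sym (trans ∣B∣ k≡m)) (s≤s z≤n))
    a₀ = proj₁ a₀∈
    b₀ = proj₁ b₀∈
    aK⊆A : ∀ {x} → a₀ ⁻¹ · x ∈ K → x ∈ A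
    aK⊆A = ⊆-full A (a₀ ◃ K) (sA (proj₂ a₀∈)) (≤-reflexive (trans (∣◃∣ a₀ K) (trans K≡m (≡sym (trans ∣A∣ k≡m)))))
    Kb⊆B : ∀ {x} → x · b₀ ⁻¹ ∈ K → x ∈ B
    Kb⊆B = ⊆-full B (K ▹ b₀) (λ p → sB p (proj₂ b₀∈)) (≤-reflexive (trans (∣▹∣ K b₀) (trans K≡m (≡sym (trans ∣B∣ k≡m)))))
    rows : ∀ {t} → t ∈L T → ¬ a₀ ⁻¹ · row t ∈ K
    rows p q = proj₂ (aK⊆A q) (∈-map⁺ row p)
    cols : ∀ {t} → t ∈L T → ¬ col t · b₀ ⁻¹ ∈ K
    cols p q = proj₂ (Kb⊆B q) (∈-map⁺ col p)
    first : ∀ T → length T ≡ m → ∃ λ t → t ∈L T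
    first (t ∷ _) _ = t , here refl
    t₀ = proj₁ (first T len≡m)
    t₀∈ = proj₂ (first T len≡m)
    -- Division by the row and the column of one fixed cell t₀ moves all three coordinates into K
    -- and keeps s t = f t · g t.
    f g s : Triple n → Fin n
    f t = row t₀ ⁻¹ · row t
    g t = col t · col t₀ ⁻¹
    s t = row t₀ ⁻¹ · sym t · col t₀ ⁻¹
    f∈ : ∀ {t} → t ∈L T → f t ∈ K
    f∈ {t} p = subst (_∈ K) (free (inv (inv 𝕩 ⊗ 𝕪) ⊗ (inv 𝕩 ⊗ 𝕫)) (inv 𝕪 ⊗ 𝕫) (a₀ ∷ row t₀ ∷ row t ∷ []) refl)
       (cross (λ q → rows t₀∈ (subst (_∈ K) (⁻¹⁻¹ _) (⁻¹∈ hK q))) (rows p))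
    g∈ : ∀ {t} → t ∈L T → g t ∈ K
    g∈ {t} p = subst (_∈ K) (free (𝕫 ⊗ inv 𝕩 ⊗ inv (𝕪 ⊗ inv 𝕩)) (𝕫 ⊗ inv 𝕪) (b₀ ∷ col t₀ ∷ col t ∷ []) refl)
       (cross (cols p) (λ q → cols t₀∈ (subst (_∈ K) (⁻¹⁻¹ _) (⁻¹∈ hK q))))
    s≡ : ∀ {t} → t ∈L T → s t ≡ f t · g t
    s≡ {t} p = trans (cong (λ z → row t₀ ⁻¹ · z · col t₀ ⁻¹) (triples p)) (free (inv 𝕩 ⊗ (𝕪 ⊗ 𝕫) ⊗ inv 𝕦) (inv 𝕩 ⊗ 𝕪 ⊗ (𝕫 ⊗ inv 𝕦)) (row t₀ ∷ row t ∷ col t ∷ col t₀ ∷ []) refl)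
    module _ (mo : ℕ) (φ : Fin n → ℕ) where
      open Mod mo
      enum : (u : Triple n → Fin n) → (∀ {t} → t ∈L T → u t ∈ K) → Unique (mapL u T) → wt K φ ≈[ mo ] W.listSum (φ ∘ u) T
      enum u u∈ uq = mtrans (W.weight-list K φ (mapL u T) uq mem) (mtrans (m+ (≡⇒≈ (W.listSum-map φ u T)) (W.weight-empty (K ∖ mapL u T) φ none)) (≡⇒≈ (+-identityʳ _)))
        where
        mem : ∀ {x} → x ∈L mapL u T → x ∈ K
        mem p with ∈-map⁻ u p
        ... | t , q , refl = u∈ q
        none : ∀ {x} → ¬ x ∈ K ∖ mapL u T
        none p = <⇒≱ (∣∣-pos (K ∖ mapL u T) p) (≤-reflexive (+-cancelˡ-≡ (length (mapL u T)) _ _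
          (trans (≡sym (∣∣-list K (mapL u T) uq mem)) (trans K≡m (trans (≡sym len≡m) (trans (≡sym (length-map u T)) (≡sym (+-identityʳ _))))))))
    zs : ZeroSum K
    zs mo φ φh = mcancel (wt K φ) (mtrans (m+ (enum mo φ f f∈ (subst Unique (≡sym (map-∘ T)) (Unique-map⁺ (·-cancelˡ _) rowsUniq))) (enum mo φ g g∈ (subst Unique (≡sym (map-∘ T)) (Unique-map⁺ (·-cancelʳ _) colsUniq))))
         (mtrans (msym (W.listSum-hom (φ ∘ f) (φ ∘ g) (φ ∘ s) T (λ p → mtrans (≡⇒≈ (cong φ (s≡ p))) (hom φh (f∈ p) (g∈ p)))))
         (mtrans (msym (enum mo φ s (λ p → subst (_∈ K) (≡sym (s≡ p)) (·∈ hK (f∈ p) (g∈ p))) (subst Unique (≡sym (map-∘ T)) (Unique-map⁺ (λ z → ·-cancelˡ _ (·-cancelʳ _ z)) symsUniq)))) (≡⇒≈ (≡sym (+-identityʳ _))))))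
      where open Mod mo

  -- Abelian groups, involutions and groups of order 2 modulo 4

  module Abelian (comm : ∀ x y → x · y ≡ y · x) where
    M : CommutativeMonoid _ _
    M = record { isCommutativeMonoid = record { isMonoid = IsGroup.isMonoid isGroup ; comm = comm } }
    open Weighted M using (weight; weight-empty; weight-remove)
    open FromMaximal using (hom-sums; size; AB∩C)

    sizes : ∀ {T} (max : Maximal (cayley G) T) {k} → length T + k ≡ n → ∀ f → Unique (mapL f T) → ∣ full ∖ mapL f T ∣ ≡ k
    sizes {T} max len f u = +-cancelˡ-≡ (length T) _ _ (trans (size max f u) (≡sym len))

    zero-weight : ∀ S → ∣ S ∣ ≡ 0 → weight S id ≡ ε
    zero-weight S q = weight-empty S id (λ p → <⇒≱ (∣∣-pos S p) (≤-reflexive q))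

    one-weight : ∀ S → ∣ S ∣ ≡ 1 → ∃ λ x → x ∈ S × weight S id ≡ x
    one-weight S q = let x , p = nonempty S (≤-reflexive (≡sym q)) in x , p ,
      trans (weight-remove S id p) (trans (cong (x ·_) (zero-weight (S ∩ ∁ ⁅ x ⁆) (suc-injective (trans (≡sym (∣∣-remove S p)) q)))) (identityʳ x))

    abelian-missing : 2 ≤ n → ¬ Has 0 ⊎ ¬ Has 1
    abelian-missing 2≤n with weight full id ≟F ε
    ... | no σ≢ = inj₁ λ { (T , max , len) →
          let open PartialTransversal (proj₁ max)
              z = λ f u → zero-weight (full ∖ mapL f T) (sizes max (trans (+-identityʳ _) len) f u)
          in σ≢ (begin
          weight full id ≡⟨ identityʳ _ ⟨
          weight full id · ε ≡⟨ cong (weight full id ·_) (≡sym (z sym symsUniq)) ⟩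
          weight full id · weight (full ∖ mapL sym T) id ≡⟨ hom-sums max M ·-cancelˡ id (λ _ _ → refl) ⟩
          weight (full ∖ mapL row T) id · weight (full ∖ mapL col T) id ≡⟨ cong₂ _·_ (z row rowsUniq) (z col colsUniq) ⟩
          ε · ε ≡⟨ identityˡ ε ⟩
          ε ∎) }
      where open ≡-Reasoning
    ... | yes σ≡ = inj₂ λ { (T , max , len) →
          let open PartialTransversal (proj₁ max)
              o = λ f u → one-weight (full ∖ mapL f T) (sizes max (trans (cong (_+ 1) len) (m∸n+n≡m {n} {1} (<⇒≤ 2≤n))) f u)
              a , a∈ , wa = o row rowsUniq
              b , b∈ , wb = o col colsUniq
              c , c∈ , wc = o sym symsUniq
          in AB∩C max a∈ b∈ (subst (_∈ full ∖ mapL sym T) (begin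
               c ≡⟨ wc ⟨
               weight (full ∖ mapL sym T) id ≡⟨ identityˡ _ ⟨
               ε · weight (full ∖ mapL sym T) id ≡⟨ cong (_· weight (full ∖ mapL sym T) id) σ≡ ⟨
               weight full id · weight (full ∖ mapL sym T) id ≡⟨ hom-sums max M ·-cancelˡ id (λ _ _ → refl) ⟩
               weight (full ∖ mapL row T) id · weight (full ∖ mapL col T) id ≡⟨ cong₂ _·_ wa wb ⟩
               a · b ∎) c∈) }
      where open ≡-Reasoning

  -- Inversion pairs off the elements that differ from their inverse, so the number of solutions of
  -- x⁻¹ = x is even; ε is one of them.
  involution : ∀ {K} → IsSubgroup K → ∀ j → ∣ K ∣ ≡ j + j → ∃ λ t → t ∈ K × t ≢ ε × t · t ≡ ε
  involution {K} hK j eq = let t , (t∈ , ti) , t≢ = another I ε (two (∣∣-pos I (ε∈ hK , ε⁻¹)) even) in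
      t , t∈ , t≢ , trans (cong (t ·_) (≡sym ti)) (inverseʳ t)
    where
    P I : Sub n
    P = ⟪ (λ x → (x ⁻¹) ≟F x) ⟫
    I = K ∩ P
    even : 2 ∣ ∣ I ∣
    even = ∣m+n∣m⇒∣n (subst (2 ∣_) (trans (∣∣-split K P) (+-comm ∣ I ∣ _)) (divides j (trans eq (l j))))
       (even-fixfree (K ∩ ∁ P) _⁻¹ (λ { (p , q) → ⁻¹∈ hK p , λ z → q (≡sym (trans (≡sym (⁻¹⁻¹ _)) z)) }) (λ _ → ⁻¹⁻¹ _) proj₂)
      where
      l : ∀ j → j + j ≡ j * 2
      l = solve-∀
    two : ∀ {m} → 0 < m → 2 ∣ m → 1 < m
    two () (divides zero refl)
    two _ (divides (suc q) refl) = s≤s (s≤s z≤n)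

  -- Cayley's argument in order 4j + 2: left translation by the involution t consists of 2j + 1
  -- transpositions and is odd, so the even translations form a subgroup of index two.
  module Sign {K} (hK : IsSubgroup K) (j : ℕ) (∣K∣ : ∣ K ∣ ≡ suc (j + j) + suc (j + j))
              (t : Fin n) (t∈ : t ∈ K) (t≢ : t ≢ ε) (tt≡ : t · t ≡ ε) where

    t² : ∀ x → x · t · t ≡ x
    t² x = trans (assoc x t t) (trans (cong (x ·_) tt≡) (identityʳ x))
    t²ˡ : ∀ x → t · (t · x) ≡ x
    t²ˡ x = trans (≡sym (assoc t t x)) (trans (cong (_· x) tt≡) (identityˡ x))
    xt≢ : ∀ x → x · t ≢ x
    xt≢ x p = t≢ (·-cancelˡ x (trans p (≡sym (identityʳ x))))
    tx≢ : ∀ x → t · x ≢ x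
    tx≢ x p = t≢ (·-cancelʳ x (trans p (≡sym (identityˡ x))))

    -- c selects one element of each coset x⟨t⟩, and ψ below is the transfer of K to ⟨t⟩, i.e. the sign of a left translation.
    c : Fin n → Bool
    c x = does (toℕ x <? toℕ (x · t))

    c-flip : ∀ x → c (x · t) ≡ not (c x)
    c-flip x with <-cmp (toℕ x) (toℕ (x · t))
    ... | tri< lt _ ngt = trans (dec-false (_ <? _) (λ q → ngt (subst (toℕ (x · t) <_) (cong toℕ (t² x)) q))) (cong not (≡sym (dec-true (_ <? _) lt)))
    ... | tri≈ _ eq _ = contradiction (≡sym (toℕ-injective eq)) (xt≢ x)
    ... | tri> nlt _ gt = trans (dec-true (_ <? _) (subst (toℕ (x · t) <_) (≡sym (cong toℕ (t² x))) gt)) (cong not (≡sym (dec-false (_ <? _) nlt)))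

    f : Fin n → Fin n → Bool
    f g x = c (g · x) xor c x

    f-inv : ∀ g x → f g (x · t) ≡ f g x
    f-inv g x = trans (cong₂ _xor_ (trans (cong c (≡sym (assoc g x t))) (c-flip (g · x))) (c-flip x)) (nn (c (g · x)) (c x))
      where
      nn : ∀ a b → not a xor not b ≡ a xor b
      nn false false = refl
      nn false true = refl
      nn true false = refl
      nn true true = refl

    f-· : ∀ g h x → f (g · h) x ≡ f g (h · x) xor f h x
    f-· g h x = trans (cong (λ z → c z xor c x) (assoc g h x)) (tel (c (g · (h · x))) (c (h · x)) (c x))
      where
      tel : ∀ a b d → a xor d ≡ (a xor b) xor (b xor d)
      tel false false d = refl
      tel false true false = refl
      tel false true true = refl
      tel true false false = refl
      tel true false true = refl
      tel true true d = refl

    Kᵇ : (Fin n → Bool) → Sub n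
    Kᵇ p = ⟪ (λ x → mem? K x ×-dec (p x ≟B true)) ⟫

    even-inv : (p : Fin n → Bool) → (∀ x → p (x · t) ≡ p x) → 2 ∣ ∣ Kᵇ p ∣
    even-inv p pi = even-fixfree (Kᵇ p) (_· t) (λ { {x} (q , r) → ·∈ hK q t∈ , trans (pi x) r }) (λ _ → t² _) (λ _ → xt≢ _)

    abstract
      -- `f g` is constant on the cosets of ⟨t⟩, so half of its count is the number of cosets on
      -- which g disturbs the selection `c`. The induced permutation of blocks of size two is even,
      -- so this number has the parity of the translation.
      ψ : Fin n → ℕ
      ψ g = _∣_.quotient (even-inv (f g) (f-inv g))

      F≡2ψ : ∀ g → ∣ Kᵇ (f g) ∣ ≡ ψ g * 2
      F≡2ψ g = _∣_.equality (even-inv (f g) (f-inv g))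

    xor-count : (p q : Fin n → Bool) → ∣ Kᵇ (λ x → p x xor q x) ∣ + 2 * ∣ Kᵇ (λ x → if p x then q x else false) ∣ ≡ ∣ Kᵇ p ∣ + ∣ Kᵇ q ∣
    xor-count p q = begin
      X + 2 * PQ ≡⟨ cong (_+ 2 * PQ) (∣∣-split (Kᵇ pq) (Kᵇ p)) ⟩
      ∣ Kᵇ pq ∩ Kᵇ p ∣ + ∣ Kᵇ pq ∩ ∁ (Kᵇ p) ∣ + 2 * PQ ≡⟨ cong₂ (λ a b → a + b + 2 * PQ)
          (∣∣-cong (Kᵇ pq ∩ Kᵇ p) (Kᵇ p ∩ ∁ (Kᵇ q)) (λ { {x} ((k , a) , (_ , b)) → (k , b) , λ { (_ , d) → case₁ (p x) (q x) a b d } })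
             (λ { {x} ((k , b) , nd) → (k , case₂ (p x) (q x) b (λ d → nd (k , d))) , (k , b) }))
          (∣∣-cong (Kᵇ pq ∩ ∁ (Kᵇ p)) (Kᵇ q ∩ ∁ (Kᵇ p)) (λ { {x} ((k , a) , nb) → (k , case₃ (p x) (q x) a (λ b → nb (k , b))) , nb })
             (λ { {x} ((k , d) , nb) → (k , case₄ (p x) (q x) d (λ b → nb (k , b))) , nb })) ⟩
      a₁ + a₂ + 2 * PQ ≡⟨ l a₁ a₂ PQ ⟩
      (PQ + a₁) + (PQ + a₂) ≡⟨ cong₂ _+_ (trans (cong (_+ a₁) (∣∣-cong (Kᵇ p∧q) (Kᵇ p ∩ Kᵇ q)
           (λ { {x} (k , a) → (k , proj₁ (case₅ (p x) (q x) a)) , (k , proj₂ (case₅ (p x) (q x) a)) }) (λ { {x} ((k , a) , (_ , b)) → k , case₆ (p x) (q x) a b }))) (≡sym (∣∣-split (Kᵇ p) (Kᵇ q))))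
           (trans (cong (_+ a₂) (∣∣-cong (Kᵇ p∧q) (Kᵇ q ∩ Kᵇ p)
           (λ { {x} (k , a) → (k , proj₂ (case₅ (p x) (q x) a)) , (k , proj₁ (case₅ (p x) (q x) a)) }) (λ { {x} ((k , b) , (_ , a)) → k , case₆ (p x) (q x) a b }))) (≡sym (∣∣-split (Kᵇ q) (Kᵇ p)))) ⟩
      ∣ Kᵇ p ∣ + ∣ Kᵇ q ∣ ∎
      where
      open ≡-Reasoning
      pq p∧q : Fin n → Bool
      pq x = p x xor q x
      p∧q x = if p x then q x else false
      X = ∣ Kᵇ pq ∣
      PQ = ∣ Kᵇ p∧q ∣
      a₁ = ∣ Kᵇ p ∩ ∁ (Kᵇ q) ∣
      a₂ = ∣ Kᵇ q ∩ ∁ (Kᵇ p) ∣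
      l : ∀ a b c → a + b + 2 * c ≡ (c + a) + (c + b)
      l = solve-∀
      case₁ : ∀ a b → a xor b ≡ true → a ≡ true → b ≡ true → ⊥
      case₁ true true () _ _
      case₂ : ∀ a b → a ≡ true → ¬ b ≡ true → a xor b ≡ true
      case₂ true true _ z = contradiction refl z
      case₂ true false _ _ = refl
      case₃ : ∀ a b → a xor b ≡ true → ¬ a ≡ true → b ≡ true
      case₃ true b _ z = contradiction refl z
      case₃ false b z _ = z
      case₄ : ∀ a b → b ≡ true → ¬ a ≡ true → a xor b ≡ true
      case₄ true b _ z = contradiction refl z
      case₄ false b z _ = z
      case₅ : ∀ a b → (if a then b else false) ≡ true → a ≡ true × b ≡ true
      case₅ true true _ = refl , refl
      case₆ : ∀ a b → a ≡ true → b ≡ true → (if a then b else false) ≡ true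
      case₆ true true _ _ = refl

    -- `f-·` is a cocycle identity: the set counted for gh is the symmetric difference of a
    -- translate of the set for g and the set for h. Their intersection is again a union of cosets
    -- of ⟨t⟩, hence even, so after halving the correction term is even.
    ψ-hom : Homᴴ K 2 ψ
    ψ-hom = mkHom λ {g} {h} g∈ h∈ → lem g h h∈
      where
      lem : ∀ g h → h ∈ K → ψ (g · h) ≈[ 2 ] ψ g + ψ h
      lem g h h∈ = ≈by q 0 (*-cancelʳ-≡ _ _ 2 (begin
         (ψ (g · h) + q * 2) * 2 ≡⟨ l1 (ψ (g · h)) q ⟩
         ψ (g · h) * 2 + 2 * (q * 2) ≡⟨ cong₂ (λ a b → a + 2 * b) (≡sym (F≡2ψ (g · h))) (≡sym (_∣_.equality ev)) ⟩
         ∣ Kᵇ (f (g · h)) ∣ + 2 * ∣ Kᵇ p∧q ∣ ≡⟨ cong (_+ 2 * ∣ Kᵇ p∧q ∣) (∣∣-cong (Kᵇ (f (g · h))) (Kᵇ (λ x → f g (h · x) xor f h x)) (λ { {x} (k , a) → k , trans (≡sym (f-· g h x)) a }) (λ { {x} (k , a) → k , trans (f-· g h x) a })) ⟩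
         ∣ Kᵇ (λ x → f g (h · x) xor f h x) ∣ + 2 * ∣ Kᵇ p∧q ∣ ≡⟨ xor-count (λ x → f g (h · x)) (f h) ⟩
         ∣ Kᵇ (λ x → f g (h · x)) ∣ + ∣ Kᵇ (f h) ∣ ≡⟨ cong (_+ ∣ Kᵇ (f h) ∣) (∣∣-bij (Kᵇ (λ x → f g (h · x))) (Kᵇ (f g)) (h ·_) (h ⁻¹ ·_) (cancelˡ′ h) (cancelˡ h)
              (λ { (k , a) → ·∈ hK h∈ k , a }) (λ { {y} (k , a) → ·∈ hK (⁻¹∈ hK h∈) k , trans (cong (f g) (cancelˡ h y)) a })) ⟩
         ∣ Kᵇ (f g) ∣ + ∣ Kᵇ (f h) ∣ ≡⟨ cong₂ _+_ (F≡2ψ g) (F≡2ψ h) ⟩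
         ψ g * 2 + ψ h * 2 ≡⟨ l2 (ψ g) (ψ h) ⟩
         (ψ g + ψ h + 0) * 2 ∎))
        where
        open ≡-Reasoning
        p∧q : Fin n → Bool
        p∧q x = if f g (h · x) then f h x else false
        ev : 2 ∣ ∣ Kᵇ p∧q ∣
        ev = even-inv p∧q (λ x → cong₂ (λ a b → if a then b else false) (trans (cong (f g) (≡sym (assoc h x t))) (f-inv g (h · x))) (f-inv h x))
        q = _∣_.quotient ev
        l1 : ∀ a b → (a + b * 2) * 2 ≡ a * 2 + 2 * (b * 2)
        l1 = solve-∀
        l2 : ∀ a b → a * 2 + b * 2 ≡ (a + b + 0) * 2
        l2 = solve-∀

    -- Right multiplication by t exchanges the selected and the unselected half of S. On the
    -- selected half, x is paired with whichever of tx and txt is selected; this involution has no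
    -- fixed point because t commutes with no element of S.
    four : (S : Sub n) → (∀ {x} → x ∈ S → x · t ∈ S) → (∀ {x} → x ∈ S → t · x ∈ S) → (∀ {x} → x ∈ S → t · x ≢ x · t) → ∃ λ q → ∣ S ∣ ≡ q * 2 + q * 2
    four S r l ne = q , trans (∣∣-split S C⁺) (cong₂ _+_ q≡ (trans (∣∣-bij (S ∩ ∁ C⁺) (S ∩ C⁺) (_· t) (_· t) t² t²
         (λ { {x} (p , z) → r p , trans (c-flip x) (cong not (nf (c x) z)) }) (λ { {x} (p , z) → r p , λ w → contradiction (trans (≡sym w) (trans (c-flip x) (cong not z))) λ () })) q≡))
      where
      nf : ∀ b → ¬ b ≡ true → b ≡ false
      nf true z = contradiction refl z
      nf false z = refl
      C⁺ : Sub n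
      C⁺ = ⟪ (λ x → c x ≟B true) ⟫
      g : Fin n → Fin n
      g x = if c (t · x) then t · x else t · x · t
      ev : 2 ∣ ∣ S ∩ C⁺ ∣
      ev = even-fixfree (S ∩ C⁺) g into invol fixfree
        where
        into : ∀ {x} → x ∈ S ∩ C⁺ → g x ∈ S ∩ C⁺
        into {x} (p , z) with c (t · x) in w
        ... | true = l p , w
        ... | false = r (l p) , trans (c-flip (t · x)) (cong not w)
        invol : ∀ {x} → x ∈ S ∩ C⁺ → g (g x) ≡ x
        invol {x} (p , z) with c (t · x)
        ... | true = trans (cong (λ b → if b then t · (t · x) else t · (t · x) · t) (trans (cong c (t²ˡ x)) z)) (t²ˡ x)
        ... | false = trans (cong (λ b → if b then t · (t · x · t) else t · (t · x · t) · t) (trans (cong c e₁) (trans (c-flip x) (cong not z)))) (trans (cong (_· t) e₁) (t² x))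
          where
          e₁ : t · (t · x · t) ≡ x · t
          e₁ = trans (≡sym (assoc t _ t)) (cong (_· t) (t²ˡ x))
        fixfree : ∀ {x} → x ∈ S ∩ C⁺ → g x ≢ x
        fixfree {x} (p , z) with c (t · x)
        ... | true = tx≢ x
        ... | false = λ w → ne p (trans (≡sym (t² (t · x))) (cong (_· t) w))
      q = _∣_.quotient ev
      q≡ = _∣_.equality ev

    -- Modulo 4 only the x commuting with t count: the others fall into quadruples {x, tx, xt, txt}.
    ψt-odd : ψ t ≈[ 2 ] 1
    ψt-odd = ≈by v (j + u) (*-cancelʳ-≡ _ _ 2 (begin
        (ψ t + v * 2) * 2 ≡⟨ l1 (ψ t) v ⟩
        ψ t * 2 + (v * 2 + v * 2) ≡⟨ cong₂ _+_ (trans (≡sym (F≡2ψ t)) splitF) (≡sym (proj₂ N4)) ⟩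
        (Z + (u * 2 + u * 2)) + ∣ K ∩ ∁ C ∣ ≡⟨ l2 Z _ _ ⟩
        (Z + ∣ K ∩ ∁ C ∣) + (u * 2 + u * 2) ≡⟨ cong (_+ (u * 2 + u * 2)) (trans (≡sym (∣∣-split K C)) ∣K∣) ⟩
        suc (j + j) + suc (j + j) + (u * 2 + u * 2) ≡⟨ l3 j u ⟩
        (1 + (j + u) * 2) * 2 ∎))
      where
      open ≡-Reasoning
      C : Sub n
      C = ⟪ (λ x → (t · x) ≟F (x · t)) ⟫
      Z = ∣ K ∩ C ∣
      swapʳ : ∀ {x} → t · x ≢ x · t → t · (x · t) ≢ x · t · t
      swapʳ {x} z w = z (·-cancelʳ t (trans (assoc t x t) w))
      swapˡ : ∀ {x} → t · x ≢ x · t → t · (t · x) ≢ t · x · t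
      swapˡ {x} z w = z (·-cancelˡ t (trans w (assoc t x t)))
      N4 = four (K ∩ ∁ C) (λ { (k , z) → ·∈ hK k t∈ , swapʳ z }) (λ { (k , z) → ·∈ hK t∈ k , swapˡ z }) proj₂
      v = proj₁ N4
      S4 = four (Kᵇ (f t) ∩ ∁ C) (λ { {x} ((k , a) , z) → (·∈ hK k t∈ , trans (f-inv t x) a) , swapʳ z })
             (λ { {x} ((k , a) , z) → (·∈ hK t∈ k , trans (trans (cong (λ y → c y xor c (t · x)) (t²ˡ x)) (xc (c x) (c (t · x)))) a) , swapˡ z }) proj₂
        where
        xc : ∀ a b → a xor b ≡ b xor a
        xc false false = refl
        xc false true = refl
        xc true false = refl
        xc true true = refl
      u = proj₁ S4
      splitF : ∣ Kᵇ (f t) ∣ ≡ Z + (u * 2 + u * 2)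
      splitF = trans (∣∣-split (Kᵇ (f t)) C) (cong₂ _+_ (∣∣-cong (Kᵇ (f t) ∩ C) (K ∩ C) (λ { ((k , _) , z) → k , z })
          (λ { {x} (k , z) → (k , trans (cong (λ y → c y xor c x) z) (trans (cong (_xor c x) (c-flip x)) (nx (c x)))) , z })) (proj₂ S4))
        where
        nx : ∀ a → not a xor a ≡ true
        nx false = refl
        nx true = refl
      l1 : ∀ a b → (a + b * 2) * 2 ≡ a * 2 + (b * 2 + b * 2)
      l1 = solve-∀
      l2 : ∀ a b c → (a + b) + c ≡ (a + c) + b
      l2 = solve-∀
      l3 : ∀ j u → suc (j + j) + suc (j + j) + (u * 2 + u * 2) ≡ (1 + (j + u) * 2) * 2
      l3 = solve-∀

    Ker : Sub n
    Ker = ⟪ (λ x → mem? K x ×-dec (ψ x % 2 ≟ 0)) ⟫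

    private
      open Mod 2
      %2 : ∀ m → m % 2 ≡ 0 ⊎ m % 2 ≡ 1
      %2 m with m % 2 | m%n<n m 2
      ... | 0 | _ = inj₁ refl
      ... | 1 | _ = inj₂ refl
      ... | suc (suc _) | s≤s (s≤s ())
      even≈ : ∀ {x} → ψ x % 2 ≡ 0 → ψ x ≈[ 2 ] 0
      even≈ {x} p = subst (ψ x ≈[ 2 ]_) p (%≈ 2 (ψ x))

    ∣Ker∣ : ∣ Ker ∣ ≡ suc (j + j)
    ∣Ker∣ = double-injective (trans (cong₂ _+_ (∣∣-cong Ker (K ∩ Ker) (λ p → proj₁ p , p) proj₂)
        (∣∣-bij Ker (K ∩ ∁ Ker) (_· t) (_· t) t² t²
           (λ { {x} (k , a) → ·∈ hK k t∈ , λ { (_ , b) → contradiction (≈⇒% 2 (mtrans (msym (even≈ {x · t} b)) (mtrans (hom ψ-hom k t∈) (m+ (even≈ a) ψt-odd)))) λ () } })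
           (λ { {y} (k , z) → ·∈ hK k t∈ , odd y k z })))
        (trans (≡sym (∣∣-split K Ker)) ∣K∣))
      where
      odd : ∀ y → y ∈ K → ¬ y ∈ Ker → ψ (y · t) % 2 ≡ 0
      odd y k z with %2 (ψ y)
      ... | inj₁ w = contradiction (k , w) z
      ... | inj₂ w = ≈⇒% 2 (mtrans (hom ψ-hom k t∈) (mtrans {_} {_} {0} (m+ (subst (ψ y ≈[ 2 ]_) w (%≈ 2 (ψ y))) ψt-odd) (≈by 0 1 refl)))

    Ker-subgroup : IsSubgroup Ker
    Ker-subgroup = record
      { ε∈ = ε∈ hK , ≈⇒% 2 ψε
      ; ·∈ = λ { (p , a) (q , b) → ·∈ hK p q , ≈⇒% 2 (mtrans (hom ψ-hom p q) (m+ (even≈ a) (even≈ b))) }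
      ; ⁻¹∈ = λ { {x} (p , a) → ⁻¹∈ hK p , ≈⇒% 2 (msym (mtrans (hom-inv hK ψ-hom p) (m+ (even≈ a) mrefl))) } }
      where
      ψε : ψ ε ≈[ 2 ] 0
      ψε = mcancel (ψ ε) (mtrans (msym (subst (λ z → ψ z ≈[ 2 ] ψ ε + ψ ε) (identityˡ ε) (hom ψ-hom (ε∈ hK) (ε∈ hK)))) (≡⇒≈ (≡sym (+-identityʳ _))))

    -- ψ is odd on exactly 2j + 1 elements of K, so its sum over K is odd.
    ¬ZeroSum : ¬ ZeroSum K
    ¬ZeroSum zs = contradiction (≈⇒% 2 (mtrans (msym (zs 2 ψ ψ-hom)) (mtrans (W.weight-split K Ker ψ)
        (mtrans (m+ (≈-const (K ∩ Ker) ψ 0 (λ p → even≈ (proj₂ (proj₂ p)))) (≈-const (K ∩ ∁ Ker) ψ 1 odd≈)) (≡⇒≈ (cong₂ _+_ (*-zeroʳ ∣ K ∩ Ker ∣) (trans (*-identityʳ _) out)))))))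
        (λ z → contradiction (trans z (trans (cong (_% 2) (l j)) ([m+kn]%n≡m%n 1 j 2))) λ ())
      where
      l : ∀ j → 0 + suc (j + j) ≡ 1 + j * 2
      l = solve-∀
      out : ∣ K ∩ ∁ Ker ∣ ≡ suc (j + j)
      out = +-cancelˡ-≡ (suc (j + j)) _ _ (trans (cong (_+ ∣ K ∩ ∁ Ker ∣) (≡sym (trans (∣∣-cong (K ∩ Ker) Ker proj₂ (λ p → proj₁ p , p)) ∣Ker∣))) (trans (≡sym (∣∣-split K Ker)) ∣K∣))
      odd≈ : ∀ {x} → x ∈ K ∩ ∁ Ker → ψ x ≈[ 2 ] 1
      odd≈ {x} (k , z) with %2 (ψ x)
      ... | inj₁ w = contradiction (k , w) z
      ... | inj₂ w = subst (ψ x ≈[ 2 ]_) w (%≈ 2 (ψ x))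

  ¬ZeroSum-4j+2 : ∀ {K} → IsSubgroup K → ∀ j → ∣ K ∣ ≡ suc (j + j) + suc (j + j) → ¬ ZeroSum K
  ¬ZeroSum-4j+2 hK j ∣K∣ = let t , t∈ , t≢ , tt≡ = involution hK (suc (j + j)) ∣K∣ in Sign.¬ZeroSum hK j ∣K∣ t t∈ t≢ tt≡

  half-4j+2 : ∀ j → n ≡ suc (j + j) + suc (j + j) → Σ (Sub n) λ H → IsSubgroup H × ∣ H ∣ ≡ suc (j + j)
  half-4j+2 j eq = let t , t∈ , t≢ , tt≡ = involution full-subgroup (suc (j + j)) (trans ∣full∣ eq)
                       open Sign full-subgroup j (trans ∣full∣ eq) t t∈ t≢ tt≡
                   in Ker , Ker-subgroup , ∣Ker∣

  -- Powers, orders of elements and cyclic quotients of order four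

  infixr 8 _^^_
  _^^_ : Fin n → ℕ → Fin n
  x ^^ zero = ε
  x ^^ suc i = x · x ^^ i

  ^-+ : ∀ x i j → x ^^ (i + j) ≡ x ^^ i · x ^^ j
  ^-+ x zero j = ≡sym (identityˡ _)
  ^-+ x (suc i) j = trans (cong (x ·_) (^-+ x i j)) (≡sym (assoc _ _ _))

  ^-1 : ∀ x → x ^^ 1 ≡ x
  ^-1 = identityʳ

  ^-mul : ∀ x d → x ^^ d ≡ ε → ∀ q → x ^^ (q * d) ≡ ε
  ^-mul x d p zero = refl
  ^-mul x d p (suc q) = trans (^-+ x d (q * d)) (trans (cong₂ _·_ p (^-mul x d p q)) (identityˡ ε))

  ^-% : ∀ x d .{{_ : NonZero d}} → x ^^ d ≡ ε → ∀ i → x ^^ i ≡ x ^^ (i % d)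
  ^-% x d p i = trans (cong (x ^^_) (m≡m%n+[m/n]*n i d)) (trans (^-+ x (i % d) _) (trans (cong (x ^^ (i % d) ·_) (^-mul x d p (i / d))) (identityʳ _)))

  ^-∸ : ∀ x {i j} → i ≤ j → x ^^ i ≡ x ^^ j → x ^^ (j ∸ i) ≡ ε
  ^-∸ x {i} {j} le p = ·-cancelˡ (x ^^ i) (trans (≡sym (^-+ x i (j ∸ i))) (trans (cong (x ^^_) (m+[n∸m]≡n le)) (trans (≡sym p) (≡sym (identityʳ _)))))

  ^∈ : ∀ {K} → IsSubgroup K → ∀ {x} → x ∈ K → ∀ i → x ^^ i ∈ K
  ^∈ hK p zero = ε∈ hK
  ^∈ hK p (suc i) = ·∈ hK p (^∈ hK p i)

  record Order (x : Fin n) : Set where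
    field
      d-1 : ℕ
      killed : x ^^ suc d-1 ≡ ε
      minimal : ∀ {i} → i < d-1 → x ^^ suc i ≢ ε
    d : ℕ
    d = suc d-1

    nonzero : ∀ {i j} → i < j → j < d → x ^^ (j ∸ i) ≢ ε
    nonzero {i} {j} lt q w with j ∸ i | m<n⇒0<n∸m lt | ≤-<-trans (m∸n≤m j i) q
    ... | suc k | _ | s≤s u = minimal u w

    distinct : ∀ {i j} → i < d → j < d → x ^^ i ≡ x ^^ j → i ≡ j
    distinct {i} {j} p q z with <-cmp i j
    ... | tri≈ _ r _ = r
    ... | tri< lt _ _ = ⊥-elim (nonzero lt q (^-∸ x (<⇒≤ lt) z))
    ... | tri> _ _ gt = ⊥-elim (nonzero gt p (^-∸ x (<⇒≤ gt) (≡sym z)))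

  abstract
    order : ∀ x → Order x
    order x = let i , j , lt , z = pigeonhole {n} {suc n} (n<1+n n) (λ i → x ^^ toℕ i)
                  k , p = pos (m<n⇒0<n∸m lt) (^-∸ x (<⇒≤ lt) z)
                  m , q , mn = least (λ i → x ^^ suc i ≟F ε) k p
              in record { d-1 = m ; killed = q ; minimal = mn }
      where
      pos : ∀ {m} → 0 < m → x ^^ m ≡ ε → ∃ λ k → x ^^ suc k ≡ ε
      pos {suc k} _ z = k , z

  module Cyclic {x} (o : Order x) where
    open Order o

    ⟨x⟩ : Sub n
    ⟨x⟩ = ⟪ (λ y → any? {n = d} (λ i → y ≟F x ^^ toℕ i)) ⟫

    ^∈⟨⟩ : ∀ i → x ^^ i ∈ ⟨x⟩
    ^∈⟨⟩ i = fromℕ< (m%n<n i d) , trans (^-% x d killed i) (cong (x ^^_) (≡sym (toℕ-fromℕ< (m%n<n i d))))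

    ⟨⟩-subgroup : IsSubgroup ⟨x⟩
    ⟨⟩-subgroup = record
      { ε∈ = ^∈⟨⟩ 0
      ; ·∈ = λ { (i , refl) (j , refl) → subst (_∈ ⟨x⟩) (^-+ x (toℕ i) (toℕ j)) (^∈⟨⟩ (toℕ i + toℕ j)) }
      ; ⁻¹∈ = λ { (i , refl) → subst (_∈ ⟨x⟩) (⁻¹-unique _ _ (trans (≡sym (^-+ x (toℕ i) (d ∸ toℕ i))) (trans (cong (x ^^_) (m+[n∸m]≡n (<⇒≤ (toℕ<n i)))) killed))) (^∈⟨⟩ (d ∸ toℕ i)) } }

    log : Fin n → Fin d
    log y with any? {n = d} (λ i → y ≟F x ^^ toℕ i)
    ... | yes (i , _) = i
    ... | no _ = zero

    ^-log : ∀ {y} → y ∈ ⟨x⟩ → y ≡ x ^^ toℕ (log y)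
    ^-log {y} p with any? {n = d} (λ i → y ≟F x ^^ toℕ i)
    ... | yes (_ , q) = q
    ... | no q = contradiction p q

    ∣⟨⟩∣ : ∣ ⟨x⟩ ∣ ≡ d
    ∣⟨⟩∣ = ≤-antisym
      (subst (∣ ⟨x⟩ ∣ ≤_) ∣full∣ (∣∣-inj ⟨x⟩ (full {d}) log (λ _ → tt) (λ p q z → trans (^-log p) (trans (cong (λ i → x ^^ toℕ i) z) (≡sym (^-log q))))))
      (subst (_≤ ∣ ⟨x⟩ ∣) ∣full∣ (∣∣-inj (full {d}) ⟨x⟩ (λ i → x ^^ toℕ i) (λ {i} _ → i , refl) (λ {i} {j} _ _ z → toℕ-injective (distinct (toℕ<n i) (toℕ<n j) z))))

    d∣ : ∀ {K} → IsSubgroup K → x ∈ K → d ∣ ∣ K ∣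
    d∣ {K} hK p = subst (_∣ ∣ K ∣) ∣⟨⟩∣ (lagrange ⟨⟩-subgroup hK (λ { (i , refl) → ^∈ hK p (toℕ i) }))

  ^-∣∣ : ∀ {K} → IsSubgroup K → ∀ {x} → x ∈ K → x ^^ ∣ K ∣ ≡ ε
  ^-∣∣ hK {x} p = let divides q e = Cyclic.d∣ (order x) hK p in trans (cong (x ^^_) e) (^-mul x _ (Order.killed (order x)) q)

  -- H / L has order four and h² ∉ L, so it is cyclic and φ is the exponent of h.
  module Quarter {H L} (hH : IsSubgroup H) (hL : IsSubgroup L) (L⊆H : L ⊆ H)
                 (normal : ∀ {x l} → x ∈ H → l ∈ L → x · l · x ⁻¹ ∈ L)
                 (∣H∣ : ∣ H ∣ ≡ ∣ L ∣ + ∣ L ∣ + (∣ L ∣ + ∣ L ∣))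
                 {h : Fin n} (h∈ : h ∈ H) (h²∉ : ¬ h · h ∈ L) where

    Coset : ℕ → Sub n
    Coset i = h ^^ i ◃ L

    ∈Coset : ℕ → Fin n → Set
    ∈Coset i x = x ∈ Coset i

    coset∈ : ∀ {x y} i → x ∈ Coset i → x ⁻¹ · y ∈ L → y ∈ Coset i
    coset∈ {x} {y} i p q = subst (_∈ L) (free (inv 𝕫 ⊗ 𝕩 ⊗ (inv 𝕩 ⊗ 𝕪)) (inv 𝕫 ⊗ 𝕪) (x ∷ y ∷ h ^^ i ∷ []) refl) (·∈ hL p q)

    coset-· : ∀ {x y} i j → y ∈ H → x ∈ Coset i → y ∈ Coset j → x · y ∈ Coset (i + j)
    coset-· {x} {y} i j yH p q = subst (_∈ L) (trans (free (inv 𝕦 ⊗ (inv 𝕫 ⊗ 𝕩) ⊗ inv (inv 𝕦) ⊗ (inv 𝕦 ⊗ 𝕪)) (inv (𝕫 ⊗ 𝕦) ⊗ (𝕩 ⊗ 𝕪)) (x ∷ y ∷ h ^^ i ∷ h ^^ j ∷ []) refl) (cong (λ z → z ⁻¹ · (x · y)) (≡sym (^-+ h i j))))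
       (·∈ hL (normal (⁻¹∈ hH (^∈ hH h∈ j)) p) q)

    coset-cancel : ∀ i j {x} → h ^^ i · x ∈ Coset (i + j) → x ∈ Coset j
    coset-cancel i j {x} p = subst (_∈ L) (trans (cong (λ z → z ⁻¹ · (h ^^ i · x)) (^-+ h i j)) (free (inv (𝕩 ⊗ 𝕪) ⊗ (𝕩 ⊗ 𝕫)) (inv 𝕪 ⊗ 𝕫) (h ^^ i ∷ h ^^ j ∷ x ∷ []) refl)) p

    coset0 : ∀ {x} → x ∈ Coset 0 → x ∈ L
    coset0 = subst (_∈ L) (free (inv 𝟙 ⊗ 𝕩) 𝕩 (_ ∷ []) refl)
    coset0⁻ : ∀ {x} → x ∈ L → x ∈ Coset 0
    coset0⁻ = subst (_∈ L) (≡sym (free (inv 𝟙 ⊗ 𝕩) 𝕩 (_ ∷ []) refl))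

    ^∈Coset : ∀ i j → h ^^ i ∈ Coset j → i ≤ j → h ^^ (j ∸ i) ∈ L
    ^∈Coset i j p le = subst (_∈ L) (trans (cong (λ z → (z ⁻¹ · h ^^ i) ⁻¹) (trans (cong (h ^^_) (≡sym (m+[n∸m]≡n le))) (^-+ h i (j ∸ i))))
      (free (inv (inv (𝕩 ⊗ 𝕪) ⊗ 𝕩)) 𝕪 (h ^^ i ∷ h ^^ (j ∸ i) ∷ []) refl)) (⁻¹∈ hL p)

    disjoint : ∀ i j {x} → i ≤ j → x ∈ Coset i → x ∈ Coset j → h ^^ (j ∸ i) ∈ L
    disjoint i j {x} le p q = ^∈Coset i j (coset∈ j q (subst (_∈ L) (free (inv (inv 𝕪 ⊗ 𝕩)) (inv 𝕩 ⊗ 𝕪) (x ∷ h ^^ i ∷ []) refl) (⁻¹∈ hL p))) le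

    h²∉′ : ¬ h ^^ 2 ∈ L
    h²∉′ p = h²∉ (subst (_∈ L) (cong (h ·_) (identityʳ h)) p)
    h∉ : ¬ h ^^ 1 ∈ L
    h∉ p = h²∉ (·∈ hL (subst (_∈ L) (identityʳ h) p) (subst (_∈ L) (identityʳ h) p))

    L₀ = ∣ L ∣
    Q : Sub n
    Q = ((H ∩ ∁ (Coset 0)) ∩ ∁ (Coset 1)) ∩ ∁ (Coset 2)

    Coset⊆H : ∀ i → Coset i ⊆ H
    Coset⊆H i {x} p = subst (_∈ H) (cancelˡ (h ^^ i) x) (·∈ hH (^∈ hH h∈ i) (L⊆H p))

    ∣Q∣ : ∣ Q ∣ ≡ L₀
    ∣Q∣ = +-cancelˡ-≡ (L₀ + L₀ + L₀) _ _ (begin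
      L₀ + L₀ + L₀ + ∣ Q ∣ ≡⟨ +-assoc (L₀ + L₀) L₀ _ ⟩
      L₀ + L₀ + (L₀ + ∣ Q ∣) ≡⟨ cong (L₀ + L₀ +_) (step (H₁ ∩ ∁ (Coset 1)) 2 (λ p → (Coset⊆H 2 p , λ q → h²∉′ (disjoint 0 2 z≤n q p)) , λ q → h∉ (disjoint 1 2 (s≤s z≤n) q p))) ⟨
      L₀ + L₀ + ∣ H₁ ∩ ∁ (Coset 1) ∣ ≡⟨ +-assoc L₀ L₀ _ ⟩
      L₀ + (L₀ + ∣ H₁ ∩ ∁ (Coset 1) ∣) ≡⟨ cong (L₀ +_) (step H₁ 1 (λ p → Coset⊆H 1 p , λ q → h∉ (disjoint 0 1 z≤n q p))) ⟨
      L₀ + ∣ H₁ ∣ ≡⟨ step H 0 (Coset⊆H 0) ⟨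
      ∣ H ∣ ≡⟨ ∣H∣ ⟩
      L₀ + L₀ + (L₀ + L₀) ≡⟨ +-assoc (L₀ + L₀) L₀ L₀ ⟨
      L₀ + L₀ + L₀ + L₀ ∎)
      where
      open ≡-Reasoning
      H₁ = H ∩ ∁ (Coset 0)
      step : ∀ S i → Coset i ⊆ S → ∣ S ∣ ≡ L₀ + ∣ S ∩ ∁ (Coset i) ∣
      step S i s = trans (∣∣-split S (Coset i)) (cong (_+ ∣ S ∩ ∁ (Coset i) ∣) (trans (∣∣-cong (S ∩ Coset i) (Coset i) proj₂ (λ p → s p , p)) (∣◃∣ (h ^^ i) L)))

    Covered : Fin n → Set
    Covered x = ∈Coset 0 x ⊎ ∈Coset 1 x ⊎ ∈Coset 2 x ⊎ x ∈ Q

    cover : ∀ {x} → x ∈ H → Covered x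
    cover {x} p with mem? (Coset 0) x | mem? (Coset 1) x | mem? (Coset 2) x
    ... | yes q | _ | _ = inj₁ q
    ... | no _ | yes q | _ = inj₂ (inj₁ q)
    ... | no _ | no _ | yes q = inj₂ (inj₂ (inj₁ q))
    ... | no a | no b | no c = inj₂ (inj₂ (inj₂ (((p , a) , b) , c)))

    Q⊆ : ∀ {q} → q ∈ Q → ∀ {x} → x ∈ Q → q ⁻¹ · x ∈ L
    Q⊆ {q} (((a , b) , c) , d) = ⊆-full (q ◃ L) Q
      (λ {x} p → let bk = λ i (r : x ∈ Coset i) → coset∈ i r (subst (_∈ L) (free (inv (inv 𝕩 ⊗ 𝕪)) (inv 𝕪 ⊗ 𝕩) (q ∷ x ∷ []) refl) (⁻¹∈ hL p)) in
         ((subst (_∈ H) (cancelˡ q x) (·∈ hH a (L⊆H p)) , λ r → b (bk 0 r)) , λ r → c (bk 1 r)) , λ r → d (bk 2 r))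
      (≤-reflexive (trans ∣Q∣ (≡sym (∣◃∣ q L))))

    -- If h³ were in L, multiplication by h would permute L, hL and h²L and so map the fourth coset
    -- Q to itself; by normality h would be in L.
    h³∉ : ¬ h ^^ 3 ∈ L
    h³∉ p = let q , q∈ = nonempty Q (subst (0 <_) (≡sym ∣Q∣) (∣∣-pos L (ε∈ hL))) in
            let qH = proj₁ (proj₁ (proj₁ q∈)) in split q q∈ qH (cover (·∈ hH (^∈ hH h∈ 1) qH))
      where
      split : ∀ q → q ∈ Q → q ∈ H → Covered (h ^^ 1 · q) → ⊥
      split q (((a , b) , c) , d) qH (inj₁ r) = d (subst (_∈ L) (free (𝕦 ⊗ inv 𝕫 ⊗ inv 𝕦 ⊗ (𝕦 ⊗ 𝕩)) (𝕦 ⊗ inv 𝕫 ⊗ 𝕩) (q ∷ ε ∷ h ^^ 3 ∷ h ∷ []) refl ⟫= eq)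
           (·∈ hL (normal h∈ (⁻¹∈ hL p)) (subst (_∈ L) (cong (_· q) (identityʳ h)) (coset0 r))))
        where
        _⟫=_ = trans
        eq : h · (h ^^ 3) ⁻¹ · q ≡ (h ^^ 2) ⁻¹ · q
        eq = free (𝕩 ⊗ inv (𝕩 ⊗ (𝕩 ⊗ (𝕩 ⊗ 𝟙))) ⊗ 𝕪) (inv (𝕩 ⊗ (𝕩 ⊗ 𝟙)) ⊗ 𝕪) (h ∷ q ∷ []) refl
      split q (((a , b) , c) , d) qH (inj₂ (inj₁ r)) = b (coset-cancel 1 0 r)
      split q (((a , b) , c) , d) qH (inj₂ (inj₂ (inj₁ r))) = c (coset-cancel 1 1 r)
      split q q∈ qH (inj₂ (inj₂ (inj₂ r))) = h∉ (subst (_∈ L) (free (𝕪 ⊗ (inv 𝕪 ⊗ (𝕩 ⊗ 𝕪)) ⊗ inv 𝕪) 𝕩 (h ^^ 1 ∷ q ∷ []) refl) (normal qH (Q⊆ q∈ r)))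

    h³∈Q : h ^^ 3 ∈ Q
    h³∈Q = ((^∈ hH h∈ 3 , λ p → h³∉ (coset0 p)) , λ p → h²∉′ (coset0 (coset-cancel 1 0 (subst (_∈ Coset 1) e₁ p)))) , λ p → h∉ (coset0 (coset-cancel 2 0 (subst (_∈ Coset 2) e₂ p)))
      where
      e₁ : h ^^ 3 ≡ h ^^ 1 · h ^^ 2
      e₁ = ^-+ h 1 2
      e₂ : h ^^ 3 ≡ h ^^ 2 · h ^^ 1
      e₂ = ^-+ h 2 1

    h⁴∈ : h ^^ 4 ∈ L
    h⁴∈ = split (cover (^∈ hH h∈ 4))
      where
      split : Covered (h ^^ 4) → h ^^ 4 ∈ L
      split (inj₁ r) = coset0 r
      split (inj₂ (inj₁ r)) = contradiction (coset0 (coset-cancel 1 0 (subst (_∈ Coset 1) (^-+ h 1 3) r))) h³∉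
      split (inj₂ (inj₂ (inj₁ r))) = contradiction (coset0 (coset-cancel 2 0 (subst (_∈ Coset 2) (^-+ h 2 2) r))) h²∉′
      split (inj₂ (inj₂ (inj₂ r))) = contradiction (coset0 (coset-cancel 3 0 (subst (_∈ Coset 3) (^-+ h 3 1) (Q⊆ h³∈Q r)))) h∉

    index : ∀ {x} → x ∈ H → ∃ λ i → i < 4 × x ∈ Coset i
    index {x} p = split (cover p)
      where
      split : Covered x → ∃ λ i → i < 4 × x ∈ Coset i
      split (inj₁ r) = 0 , s≤s z≤n , r
      split (inj₂ (inj₁ r)) = 1 , s≤s (s≤s z≤n) , r
      split (inj₂ (inj₂ (inj₁ r))) = 2 , s≤s (s≤s (s≤s z≤n)) , r
      split (inj₂ (inj₂ (inj₂ r))) = 3 , s≤s (s≤s (s≤s (s≤s z≤n))) , Q⊆ h³∈Q r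

    abstract
      φ : Fin n → ℕ
      φ x with mem? H x
      ... | yes p = proj₁ (index p)
      ... | no _ = 0

      φ∈ : ∀ {x} → x ∈ H → φ x < 4 × x ∈ Coset (φ x)
      φ∈ {x} p with mem? H x
      ... | yes q = proj₂ (index q)
      ... | no q = contradiction p q

    shift4 : ∀ q i {x} → x ∈ H → x ∈ Coset (i + q * 4) → x ∈ Coset i
    shift4 zero i _ p = subst (λ z → _ ∈ Coset z) (+-identityʳ i) p
    shift4 (suc q) i {x} xH p = shift4 q i xH (coset-cancel 4 (i + q * 4) (subst (λ z → h ^^ 4 · x ∈ Coset z) (l i q) (coset-· 0 (i + suc q * 4) xH (coset0⁻ h⁴∈) p)))
      where
      l : ∀ i q → i + suc q * 4 ≡ 4 + (i + q * 4)
      l = solve-∀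

    power∉ : ∀ {k} → 0 < k → k < 4 → ¬ h ^^ k ∈ L
    power∉ {1} _ _ = h∉
    power∉ {2} _ _ = h²∉′
    power∉ {3} _ _ = h³∉
    power∉ {suc (suc (suc (suc _)))} _ (s≤s (s≤s (s≤s (s≤s ()))))

    unique : ∀ {i j} → i < 4 → j < 4 → ∀ {x} → x ∈ Coset i → x ∈ Coset j → i ≡ j
    unique {i} {j} p q r s with <-cmp i j
    ... | tri≈ _ z _ = z
    ... | tri< lt _ _ = contradiction (disjoint i j (<⇒≤ lt) r s) (power∉ (m<n⇒0<n∸m lt) (≤-<-trans (m∸n≤m j i) q))
    ... | tri> _ _ lt = contradiction (disjoint j i (<⇒≤ lt) s r) (power∉ (m<n⇒0<n∸m lt) (≤-<-trans (m∸n≤m i j) p))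

    φ≈ : ∀ {x} i → x ∈ H → x ∈ Coset i → φ x ≈[ 4 ] i
    φ≈ {x} i p q = Mod.msym 4 (subst (i ≈[ 4 ]_) (unique (m%n<n i 4) (proj₁ (φ∈ p)) (shift4 (i / 4) (i % 4) p (subst (λ z → x ∈ Coset z) (m≡m%n+[m/n]*n i 4) q)) (proj₂ (φ∈ p))) (%≈ 4 i))

    φ-hom : Homᴴ H 4 φ
    φ-hom = mkHom λ {x} {y} p q → φ≈ (φ x + φ y) (·∈ hH p q) (coset-· (φ x) (φ y) q (proj₂ (φ∈ p)) (proj₂ (φ∈ q)))

    wt-φ : wt H φ ≈[ 4 ] ∣ L ∣ * 6
    wt-φ = mtrans (W.weight-split H (Coset 0) φ) (mtrans (m+ (part H 0 (Coset⊆H 0) (Coset⊆H 0))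
             (mtrans (W.weight-split H₁ (Coset 1) φ) (m+ (part H₁ 1 (λ p → Coset⊆H 1 p , λ q → h∉ (disjoint 0 1 z≤n q p)) (Coset⊆H 1))
             (mtrans (W.weight-split H₂ (Coset 2) φ) (m+ (part H₂ 2 (λ p → (Coset⊆H 2 p , λ q → h²∉′ (disjoint 0 2 z≤n q p)) , λ q → h∉ (disjoint 1 2 (s≤s z≤n) q p)) (Coset⊆H 2))
               (mtrans (≈-const Q φ 3 (λ p → φ≈ 3 (proj₁ (proj₁ (proj₁ p))) (Q⊆ h³∈Q p))) (≡⇒≈ (cong (_* 3) ∣Q∣))))))))
             (≡⇒≈ (l L₀)))
      where
      open Mod 4
      H₁ = H ∩ ∁ (Coset 0)
      H₂ = H₁ ∩ ∁ (Coset 1)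
      part : ∀ S i → Coset i ⊆ S → Coset i ⊆ H → W.weight (S ∩ Coset i) φ ≈[ 4 ] L₀ * i
      part S i s t = mtrans (≈-const (S ∩ Coset i) φ i (λ p → φ≈ i (t (proj₂ p)) (proj₂ p))) (≡⇒≈ (cong (_* i) (trans (∣∣-cong (S ∩ Coset i) (Coset i) proj₂ (λ p → s p , p)) (∣◃∣ (h ^^ i) L))))
      l : ∀ a → a * 0 + (a * 1 + (a * 2 + a * 3)) ≡ a * 6
      l = solve-∀

    -- The sum of φ over H is |L|(0 + 1 + 2 + 3) = 6|L|, which is 2 modulo 4 for odd |L|.
    quarter-¬ZeroSum : ∀ j → ∣ L ∣ ≡ suc (j + j) → ¬ ZeroSum H
    quarter-¬ZeroSum j e zs = contradiction (≈⇒% 4 (Mod.mtrans 4 (Mod.msym 4 (zs 4 φ φ-hom)) wt-φ))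
        (λ z → contradiction (trans z (trans (cong (_% 4) (trans (cong (_* 6) e) (l j))) ([m+kn]%n≡m%n 2 (1 + 3 * j) 4))) λ ())
      where
      l : ∀ j → suc (j + j) * 6 ≡ 2 + (1 + 3 * j) * 4
      l = solve-∀

  -- Orders 10 and 24

  index2-normal : ∀ {H K} → IsSubgroup H → IsSubgroup K → K ⊆ H → ∣ H ∣ ≤ ∣ K ∣ + ∣ K ∣ → ∀ {g κ} → g ∈ H → κ ∈ K → g · κ · g ⁻¹ ∈ K
  index2-normal {H} {K} hH hK s le {g} {κ} gH p with mem? K g
  ... | yes q = ·∈ hK (·∈ hK q p) (⁻¹∈ hK q)
  ... | no q = index2 hH hK s le (·∈ hH gH (s p)) (⁻¹∈ hH gH) (λ r → q (cosetˡ hK p r)) (λ r → q (subst (_∈ K) (⁻¹⁻¹ g) (⁻¹∈ hK r)))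

  module Halves {H} (hH : IsSubgroup H) (half : ∣ H ∣ + ∣ H ∣ ≡ n) where
    open Index2 hH half public

    Side : Bool → Sub n
    Side false = H
    Side true = ∁ H

    ∣Side∣ : ∀ i → ∣ Side i ∣ ≡ ∣ H ∣
    ∣Side∣ false = refl
    ∣Side∣ true = ∣∁∣

    side-· : ∀ i j {x y} → x ∈ Side i → y ∈ Side j → x · y ∈ Side (i xor j)
    side-· false false p q = ·∈ hH p q
    side-· false true p q = λ r → q (cosetʳ hH p r)
    side-· true false p q = λ r → p (cosetˡ hH q r)
    side-· true true p q = cross p q

    side-⁻¹ : ∀ i {x} → x ∈ Side i → x ⁻¹ ∈ Side i
    side-⁻¹ false p = ⁻¹∈ hH p
    side-⁻¹ true {x} p = λ r → p (subst (_∈ H) (⁻¹⁻¹ x) (⁻¹∈ hH r))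

    xx : ∀ i → i xor i ≡ false
    xx false = refl
    xx true = refl

    same-sideˡ : ∀ i {x y} → x ∈ Side i → y ∈ Side i → x ⁻¹ · y ∈ H
    same-sideˡ i p q = subst (λ b → _ ∈ Side b) (xx i) (side-· i i (side-⁻¹ i p) q)

    same-sideʳ : ∀ i {x y} → x ∈ Side i → y ∈ Side i → x · y ⁻¹ ∈ H
    same-sideʳ i p q = subst (λ b → _ ∈ Side b) (xx i) (side-· i i p (side-⁻¹ i q))

    opposite : ∀ i {x y} → x ∈ Side i → y ∈ Side (not i) → ¬ x ⁻¹ · y ∈ H
    opposite i {x} {y} p q = subst (λ b → x ⁻¹ · y ∈ Side b) (xn i) (side-· i (not i) (side-⁻¹ i p) q)
      where
      xn : ∀ i → i xor not i ≡ true
      xn false = refl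
      xn true = refl

    -- An element z outside H factors as g · (g⁻¹z) with the second factor in H, because H has index
    -- two.
    normal-extend : ∀ {K g} → IsSubgroup K → (∀ {h κ} → h ∈ H → κ ∈ K → h · κ · h ⁻¹ ∈ K) → ¬ g ∈ H → (∀ {κ} → κ ∈ K → g · κ · g ⁻¹ ∈ K) →
      ∀ {z κ} → κ ∈ K → z · κ · z ⁻¹ ∈ K
    normal-extend {K} {g} hK nH g∉ ng {z} {κ} p with mem? H z
    ... | yes q = nH q p
    ... | no q = subst (_∈ K) (free (𝕪 ⊗ (inv 𝕪 ⊗ 𝕩 ⊗ 𝕫 ⊗ inv (inv 𝕪 ⊗ 𝕩)) ⊗ inv 𝕪) (𝕩 ⊗ 𝕫 ⊗ inv 𝕩) (z ∷ g ∷ κ ∷ []) refl)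
                   (ng (nH (cross (λ r → g∉ (subst (_∈ H) (⁻¹⁻¹ g) (⁻¹∈ hH r))) q) p))

    module SideConfig {k} (C : Config k) where
      open Config C

      Aˢ Bˢ Dˢ Eˢ : Bool → Sub n
      Aˢ i = A ∩ Side i
      Bˢ i = B ∩ Side i
      Dˢ i = D ∩ Side i
      Eˢ i = Side i ∩ Avoid C

      ∣Aˢ∣ : ∣ Aˢ false ∣ + ∣ Aˢ true ∣ ≡ k
      ∣Aˢ∣ = trans (≡sym (∣∣-split A H)) ∣A∣
      ∣Bˢ∣ : ∣ Bˢ false ∣ + ∣ Bˢ true ∣ ≡ k
      ∣Bˢ∣ = trans (≡sym (∣∣-split B H)) ∣B∣
      ∣Dˢ∣ : ∣ Dˢ false ∣ + ∣ Dˢ true ∣ ≡ k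
      ∣Dˢ∣ = trans (≡sym (∣∣-split D H)) ∣D∣

      ∣Eˢ∣ : ∀ i → ∣ Dˢ i ∣ + ∣ Eˢ i ∣ ≡ ∣ H ∣
      ∣Eˢ∣ i = trans (cong (_+ ∣ Eˢ i ∣) (trans (≡sym (∣⁻¹ˢ∣ (Dˢ i))) (∣∣-cong (Dˢ i ⁻¹ˢ) (Side i ∩ (D ⁻¹ˢ)) (λ { {x} (p , q) → subst (_∈ Side i) (⁻¹⁻¹ x) (side-⁻¹ i q) , p }) (λ { (p , q) → q , side-⁻¹ i p }))))
                 (trans (≡sym (∣∣-split (Side i) (D ⁻¹ˢ))) (∣Side∣ i))

      prod : ∀ i j {a b} → a ∈ Aˢ i → b ∈ Bˢ j → a · b ∈ Eˢ (i xor j)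
      prod i j (p , q) (r , s) = side-· i j q s , ∈Avoid C p r

      -- For a fixed d the elements a⁻¹d⁻¹ must avoid B, and both sets lie on side j, which has |H|
      -- elements.
      pair-bound : ∀ i j → 0 < ∣ Dˢ (i xor j) ∣ → ∣ Aˢ i ∣ + ∣ Bˢ j ∣ ≤ ∣ H ∣
      pair-bound i j pos = let d , d∈ , ds = nonempty (Dˢ (i xor j)) pos in
        subst₂ _≤_ (cong (_+ ∣ Bˢ j ∣) (trans (∣▹∣ (Aˢ i ⁻¹ˢ) (d ⁻¹)) (∣⁻¹ˢ∣ (Aˢ i)))) (∣Side∣ j)
          (∣∣-disjoint (Aˢ i ⁻¹ˢ ▹ d ⁻¹) (Bˢ j) (Side j)
            (λ { {x} (p , q) → subst (_∈ Side j) (free (inv (inv (𝕩 ⊗ inv (inv 𝕪))) ⊗ inv 𝕪) 𝕩 (x ∷ d ∷ []) refl)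
                (subst (λ b → (x · d ⁻¹ ⁻¹) ⁻¹ ⁻¹ · d ⁻¹ ∈ Side b) (il i j) (side-· i (i xor j) (side-⁻¹ i q) (side-⁻¹ (i xor j) ds))) })
            proj₂
            (λ { {x} (p , _) (q , _) → free-of-ε p q d∈ (free (inv (𝕩 ⊗ inv (inv 𝕪)) ⊗ 𝕩 ⊗ 𝕪) 𝟙 (x ∷ d ∷ []) refl) }))
        where
        il : ∀ i j → i xor (i xor j) ≡ j
        il false j = refl
        il true false = refl
        il true true = refl

      side-parity : ∣ H ∣ ≈[ 2 ] ∣ Aˢ true ∣ + ∣ Bˢ true ∣ + ∣ Dˢ true ∣
      side-parity = subst₂ (_≈[ 2 ]_) wt-χ (cong₂ _+_ (cong₂ _+_ (ct A) (ct B)) (ct D)) (hom-sum 2 χ χ-hom)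
        where
        ct : ∀ S → wt S χ ≡ ∣ S ∩ ∁ H ∣
        ct S = sum-cong-≗ (λ x → lem (mem? S x) (¬? (mem? H x)))
          where
          lem : ∀ {P Q : Set} (d : Dec P) (e : Dec Q) → (if does d then bit e else 0) ≡ bit (d ×-dec e)
          lem (yes _) (yes _) = refl
          lem (yes _) (no _) = refl
          lem (no _) e = refl

  module TwentyFour (n≡24 : n ≡ 24) where
    module Cross {H} (hH : IsSubgroup H) (∣H∣ : ∣ H ∣ ≡ 12) (C : Config 9) (i j : Bool) where
      open Halves hH (trans (cong₂ _+_ ∣H∣ ∣H∣) (≡sym n≡24))
      open Config C
      open SideConfig C

      ij = i xor j
      X₀ X₁ Y₀ Y₁ Z₀ Z₁ E₀ E₁ : Sub n
      X₀ = Aˢ i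
      X₁ = Aˢ (not i)
      Y₀ = Bˢ j
      Y₁ = Bˢ (not j)
      Z₀ = Dˢ ij
      Z₁ = Dˢ (not ij)
      E₀ = Eˢ ij
      E₁ = Eˢ (not ij)

      X₀Y₀ : ∀ {x y} → x ∈ X₀ → y ∈ Y₀ → x · y ∈ E₀
      X₀Y₀ = prod i j
      X₀Y₁ : ∀ {x y} → x ∈ X₀ → y ∈ Y₁ → x · y ∈ E₁
      X₀Y₁ p q = subst (λ b → _ ∈ Eˢ b) (xor-notʳ i j) (prod i (not j) p q)
      X₁Y₀ : ∀ {x y} → x ∈ X₁ → y ∈ Y₀ → x · y ∈ E₁
      X₁Y₀ p q = subst (λ b → _ ∈ Eˢ b) (xor-notˡ i j) (prod (not i) j p q)
      X₁Y₁ : ∀ {x y} → x ∈ X₁ → y ∈ Y₁ → x · y ∈ E₀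
      X₁Y₁ p q = subst (λ b → _ ∈ Eˢ b) (trans (xor-notˡ i (not j)) (trans (cong not (xor-notʳ i j)) (not-not ij))) (prod (not i) (not j) p q)

      E₀⁻ : ∀ {g d} → g ∈ E₀ → d ∈ D → g · d ≢ ε
      E₀⁻ p = Avoid⁻ C (proj₂ p)
      E₁⁻ : ∀ {g d} → g ∈ E₁ → d ∈ D → g · d ≢ ε
      E₁⁻ p = Avoid⁻ C (proj₂ p)

      in-side : ∀ i {S : Sub n} {a} → a ∈ S → a ∈ S ∩ Side i ⊎ a ∈ S ∩ Side (not i)
      in-side false {a = a} p with mem? H a
      ... | yes q = inj₁ (p , q)
      ... | no q = inj₂ (p , q)
      in-side true {a = a} p with mem? H a
      ... | yes q = inj₂ (p , q)
      ... | no q = inj₁ (p , q)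

      -- A ⊆ xK ∪ xwK and B ⊆ Ky ∪ Kwy with K normal of index four: either ⟨K, w⟩ has index two, or G / K is
      -- cyclic of order four.
      module End {K} (hK : IsSubgroup K) (∣K∣ : ∣ K ∣ ≡ 6) (normal : ∀ {z κ} → κ ∈ K → z · κ · z ⁻¹ ∈ K) (K⊆H : K ⊆ H)
                 {x v y u : Fin n} (x∈ : x ∈ X₀) (v∈ : v ∈ X₁) (y∈ : y ∈ Y₀)
                 (sX₀ : ∀ {a} → a ∈ X₀ → x ⁻¹ · a ∈ K) (sX₁ : ∀ {a} → a ∈ X₁ → v ⁻¹ · a ∈ K)
                 (sY₀ : ∀ {b} → b ∈ Y₀ → b · y ⁻¹ ∈ K) (sY₁ : ∀ {b} → b ∈ Y₁ → b · u ⁻¹ ∈ K)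
                 (w : Fin n) (v≡ : v ≡ x · w) (κ₀ : Fin n) (κ₀∈ : κ₀ ∈ K) (u≡ : u ≡ κ₀ · w · y)
                 (f00 : ∀ {κ} → κ ∈ K → x · κ · y ∈ E₀) (f01 : ∀ {κ} → κ ∈ K → x · κ · u ∈ E₁) where

        normal′ : ∀ {z κ} → κ ∈ K → z ⁻¹ · κ · z ∈ K
        normal′ {z} {κ} p = subst (λ t → z ⁻¹ · κ · t ∈ K) (⁻¹⁻¹ z) (normal p)

        w∉H : ¬ w ∈ H
        w∉H p = opposite i (proj₂ x∈) (subst (_∈ Side (not i)) v≡ (proj₂ v∈)) (subst (_∈ H) (≡sym (cancelˡ′ x w)) p)

        -- If w² is in K, then K ∪ wK is a subgroup of order 12; A lies in one of its left cosets
        -- and B in one of its right cosets, so the parity argument would give 12 ≡ 9 modulo 2.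
        klein : ¬ w · w ∈ K
        klein ww = contradiction (≈⇒% 2 (subst (_≈[ 2 ] 9) ∣H′∣ (parity-one-coset hH′ (trans (cong₂ _+_ ∣H′∣ ∣H′∣) (≡sym n≡24)) C (s≤s z≤n) sA sB fr))) λ ()
          where
          H′ : Sub n
          H′ = ⟪ (λ g → mem? K g ⊎-dec mem? K (w ⁻¹ · g)) ⟫
          mul : ∀ {g g′} → g ∈ H′ → g′ ∈ H′ → g · g′ ∈ H′
          mul (inj₁ p) (inj₁ q) = inj₁ (·∈ hK p q)
          mul {g} {g′} (inj₁ p) (inj₂ q) = inj₂ (subst (_∈ K) (free (inv 𝕩 ⊗ 𝕪 ⊗ 𝕩 ⊗ (inv 𝕩 ⊗ 𝕫)) (inv 𝕩 ⊗ (𝕪 ⊗ 𝕫)) (w ∷ g ∷ g′ ∷ []) refl) (·∈ hK (normal′ p) q))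
          mul {g} {g′} (inj₂ p) (inj₁ q) = inj₂ (subst (_∈ K) (assoc (w ⁻¹) g g′) (·∈ hK p q))
          mul {g} {g′} (inj₂ p) (inj₂ q) = inj₁ (subst (_∈ K) (free (𝕩 ⊗ (inv 𝕩 ⊗ 𝕪) ⊗ inv 𝕩 ⊗ (𝕩 ⊗ 𝕩) ⊗ (inv 𝕩 ⊗ 𝕫)) (𝕪 ⊗ 𝕫) (w ∷ g ∷ g′ ∷ []) refl) (·∈ hK (·∈ hK (normal p) ww) q))
          ivs : ∀ {g} → g ∈ H′ → g ⁻¹ ∈ H′
          ivs (inj₁ p) = inj₁ (⁻¹∈ hK p)
          ivs {g} (inj₂ p) = inj₂ (subst (_∈ K) (free (inv 𝕩 ⊗ inv (inv 𝕩 ⊗ 𝕪) ⊗ 𝕩 ⊗ inv (𝕩 ⊗ 𝕩)) (inv 𝕩 ⊗ inv 𝕪) (w ∷ g ∷ []) refl) (·∈ hK (normal′ (⁻¹∈ hK p)) (⁻¹∈ hK ww)))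
          hH′ : IsSubgroup H′
          hH′ = record { ε∈ = inj₁ (ε∈ hK) ; ·∈ = mul ; ⁻¹∈ = ivs }
          ∣H′∣ : ∣ H′ ∣ ≡ 12
          ∣H′∣ = trans (∣∣-split H′ K) (cong₂ _+_ (trans (∣∣-cong (H′ ∩ K) K proj₂ (λ p → inj₁ p , p)) ∣K∣)
            (trans (∣∣-cong (H′ ∩ ∁ K) (w ◃ K) (λ { (inj₁ p , q) → contradiction p q ; (inj₂ p , q) → p })
              (λ {g} p → inj₂ p , λ q → w∉H (subst (_∈ H) (free (inv (inv 𝕪 ⊗ 𝕩) ) (inv 𝕩 ⊗ 𝕪) (g ∷ w ∷ []) refl ⟫ free (𝕩 ⊗ (inv 𝕩 ⊗ 𝕪)) 𝕪 (g ∷ w ∷ []) refl) (bad g p q)))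
              ) (trans (∣◃∣ w K) ∣K∣)))
            where
            _⟫_ : ∀ {g : Fin n} → (w ⁻¹ · g) ⁻¹ ≡ g ⁻¹ · w → g · (g ⁻¹ · w) ≡ w → g · (w ⁻¹ · g) ⁻¹ ≡ w
            p ⟫ q = trans (cong (_ ·_) p) q
            bad : ∀ g → w ⁻¹ · g ∈ K → g ∈ K → g · (w ⁻¹ · g) ⁻¹ ∈ H
            bad g p q = K⊆H (·∈ hK q (⁻¹∈ hK p))
          A⊆ : ∀ {a} → a ∈ A → x ⁻¹ · a ∈ H′
          A⊆ {a} p with in-side i {A} p
          ... | inj₁ q = inj₁ (sX₀ q)
          ... | inj₂ q = inj₂ (subst (_∈ K) (trans (cong (λ z → z ⁻¹ · a) v≡) (free (inv (𝕩 ⊗ 𝕪) ⊗ 𝕫) (inv 𝕪 ⊗ (inv 𝕩 ⊗ 𝕫)) (x ∷ w ∷ a ∷ []) refl)) (sX₁ q))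
          B⊆ : ∀ {b} → b ∈ B → b · y ⁻¹ ∈ H′
          B⊆ {b} p with in-side j {B} p
          ... | inj₁ q = inj₁ (sY₀ q)
          ... | inj₂ q = subst (_∈ H′) (trans (cong (λ z → b · z ⁻¹ · (κ₀ · w)) u≡) (free (𝕩 ⊗ inv (𝕪 ⊗ 𝕫 ⊗ 𝕦) ⊗ (𝕪 ⊗ 𝕫)) (𝕩 ⊗ inv 𝕦) (b ∷ κ₀ ∷ w ∷ y ∷ []) refl))
               (mul {b · u ⁻¹} {κ₀ · w} (inj₁ (sY₁ q)) (inj₂ (subst (_∈ K) (assoc (w ⁻¹) κ₀ w) (normal′ κ₀∈))))
          sA : ∀ {a a′} → a ∈ A → a′ ∈ A → a ⁻¹ · a′ ∈ H′
          sA {a} {a′} p q = subst (_∈ H′) (free (inv (inv 𝕩 ⊗ 𝕪) ⊗ (inv 𝕩 ⊗ 𝕫)) (inv 𝕪 ⊗ 𝕫) (x ∷ a ∷ a′ ∷ []) refl) (mul (ivs (A⊆ p)) (A⊆ q))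
          sB : ∀ {b b′} → b ∈ B → b′ ∈ B → b · b′ ⁻¹ ∈ H′
          sB {b} {b′} p q = subst (_∈ H′) (free (𝕪 ⊗ inv 𝕩 ⊗ inv (𝕫 ⊗ inv 𝕩)) (𝕪 ⊗ inv 𝕫) (y ∷ b ∷ b′ ∷ []) refl) (mul (B⊆ p) (ivs (B⊆ q)))
          xH′y : ∀ {g d} → g ∈ H′ → d ∈ D → x · g · y · d ≢ ε
          xH′y (inj₁ p) d∈ = E₀⁻ (f00 p) d∈
          xH′y {g} {d} (inj₂ p) d∈ z = E₁⁻ (f01 (·∈ hK (normal {w} p) (⁻¹∈ hK κ₀∈))) d∈
             (trans (cong (_· d) (trans (cong (λ t → x · (w · (w ⁻¹ · g) · w ⁻¹ · κ₀ ⁻¹) · t) u≡) (free (𝕩 ⊗ (𝕪 ⊗ (inv 𝕪 ⊗ 𝕫) ⊗ inv 𝕪 ⊗ inv 𝕦) ⊗ (𝕦 ⊗ 𝕪 ⊗ 𝕧)) (𝕩 ⊗ 𝕫 ⊗ 𝕧) (x ∷ w ∷ g ∷ κ₀ ∷ y ∷ []) refl))) z)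
          fr : ∀ {a g b d} → a ∈ A → g ∈ H′ → b ∈ B → d ∈ D → a · g · b · d ≢ ε
          fr {a} {g} {b} {d} p q r s z = xH′y (mul (mul (A⊆ p) q) (B⊆ r)) s
            (trans (cong (_· d) (free (𝕩 ⊗ (inv 𝕩 ⊗ 𝕫 ⊗ 𝕦 ⊗ (𝕧 ⊗ inv 𝕪)) ⊗ 𝕪) (𝕫 ⊗ 𝕦 ⊗ 𝕧) (x ∷ y ∷ a ∷ g ∷ b ∷ []) refl)) z)

        -- φ is the exponent of w modulo 4. It takes the values φ(x) and φ(x) + 1 on A, φ(y) and
        -- φ(y) + 1 on B. An inverse of an element of Z₀ lies in an even coset relative to xy but
        -- not in xKy, which leaves exponent 2; for Z₁ the exponent is odd and not 1, which leaves
        -- 3. All values are then determined, and their sum contradicts `hom-sum`.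
        cyclic : ¬ w · w ∈ K → ∣ X₀ ∣ ≡ 6 → ∣ X₁ ∣ ≡ 3 → ∣ Y₀ ∣ ≡ 6 → ∣ Y₁ ∣ ≡ 3 → ∣ Z₀ ∣ ≡ 3 → ∣ Z₁ ∣ ≡ 6 → ⊥
        cyclic w²∉ cX₀ cX₁ cY₀ cY₁ cZ₀ cZ₁ = contradiction (≈⇒% 4 (total (φ x) (φ y) c₀ c₁ (zero₀ d₀∈) (zero₁ d₁∈)
             (mtrans (msym (mtrans wt-φ (≡⇒≈ (cong (_* 6) ∣K∣)))) (mtrans (hom-sum 4 φ φ-hom) (m+ (m+ wA wB) wD))))) λ ()
          where
          open Mod 4
          open Quarter full-subgroup hK (λ _ → tt) (λ _ → normal) (trans (trans ∣full∣ n≡24) (≡sym (cong₂ _+_ (cong₂ _+_ ∣K∣ ∣K∣) (cong₂ _+_ ∣K∣ ∣K∣)))) {w} tt w²∉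
          φK : ∀ {κ} → κ ∈ K → φ κ ≈[ 4 ] 0
          φK p = φ≈ 0 tt (coset0⁻ p)
          φK⁻ : ∀ {g} → φ g ≈[ 4 ] 0 → g ∈ K
          φK⁻ {g} p = coset0 (subst (λ k → g ∈ Coset k) (small (proj₁ (φ∈ {g} tt)) (≈⇒% 4 p)) (proj₂ (φ∈ {g} tt)))
            where
            small : ∀ {k} → k < 4 → k % 4 ≡ 0 → k ≡ 0
            small {0} _ _ = refl
            small {1} _ ()
            small {2} _ ()
            small {3} _ ()
            small {suc (suc (suc (suc _)))} (s≤s (s≤s (s≤s (s≤s ())))) _
          φw : φ w ≈[ 4 ] 1
          φw = φ≈ 1 tt (subst (_∈ K) (free 𝟙 (inv (𝕩 ⊗ 𝟙) ⊗ 𝕩) (w ∷ []) refl) (ε∈ hK))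
          h· : ∀ a b → φ (a · b) ≈[ 4 ] φ a + φ b
          h· a b = hom φ-hom {a} {b} tt tt
          rightK : ∀ {a g} → a ⁻¹ · g ∈ K → φ g ≈[ 4 ] φ a
          rightK {a} {g} p = mtrans (mtrans (≡⇒≈ (cong φ (≡sym (cancelˡ a g)))) (h· a _)) (mtrans (m+ mrefl (φK p)) (≡⇒≈ (+-identityʳ _)))
          leftK : ∀ {a g} → g · a ⁻¹ ∈ K → φ g ≈[ 4 ] φ a
          leftK {a} {g} p = mtrans (mtrans (≡⇒≈ (cong φ (≡sym (cancelʳ′ g a)))) (h· _ a)) (m+ (φK p) mrefl)
          φv : φ v ≈[ 4 ] φ x + 1
          φv = mtrans (≡⇒≈ (cong φ v≡)) (mtrans (h· x w) (m+ mrefl φw))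
          φu : φ u ≈[ 4 ] φ y + 1
          φu = mtrans (≡⇒≈ (cong φ u≡)) (mtrans (h· (κ₀ · w) y) (mtrans (m+ (mtrans (h· κ₀ w) (m+ (φK κ₀∈) φw)) mrefl) (≡⇒≈ (+-comm 1 (φ y)))))
          φ⁻¹ : ∀ g → 0 ≈[ 4 ] φ g + φ (g ⁻¹)
          φ⁻¹ g = hom-inv full-subgroup φ-hom {g} tt
          between : ∀ {g} a b → φ g ≈[ 4 ] φ a + φ b → φ (a ⁻¹ · g · b ⁻¹) ≈[ 4 ] 0
          between a b p = mtrans (mtrans (h· _ _) (m+ (h· _ _) mrefl)) (mtrans (m+ (m+ (mrefl {φ (a ⁻¹)}) p) (mrefl {φ (b ⁻¹)})) (mtrans (≡⇒≈ (l (φ (a ⁻¹)) (φ a) (φ b) (φ (b ⁻¹)))) (m+ (msym (φ⁻¹ a)) (msym (φ⁻¹ b)))))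
            where
            l : ∀ a′ a b b′ → a′ + (a + b) + b′ ≡ (a + a′) + (b + b′)
            l = solve-∀
          to00 : ∀ {g} → φ g ≈[ 4 ] φ x + φ y → g ∈ E₀
          to00 {g} p = subst (_∈ E₀) (free (𝕩 ⊗ (inv 𝕩 ⊗ 𝕫 ⊗ inv 𝕪) ⊗ 𝕪) 𝕫 (x ∷ y ∷ g ∷ []) refl) (f00 (φK⁻ (between x y p)))
          to01 : ∀ {g} → φ g ≈[ 4 ] φ x + φ u → g ∈ E₁
          to01 {g} p = subst (_∈ E₁) (free (𝕩 ⊗ (inv 𝕩 ⊗ 𝕫 ⊗ inv 𝕪) ⊗ 𝕪) 𝕫 (x ∷ u ∷ g ∷ []) refl) (f01 (φK⁻ (between x u p)))
          xy∈ : x · y ∈ Side (i xor j)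
          xy∈ = side-· i j (proj₂ x∈) (proj₂ y∈)
          φd : ∀ d k → φ ((x · y) ⁻¹ · d ⁻¹) ≡ k → φ (d ⁻¹) ≈[ 4 ] φ x + φ y + k
          φd d k eq = mtrans (≡⇒≈ (cong φ (≡sym (cancelˡ (x · y) (d ⁻¹))))) (mtrans (h· _ _) (m+ (h· x y) (≡⇒≈ eq)))
          ww∈H : w · w ∈ H
          ww∈H = cross w∉H w∉H
          odd-coset : ∀ g → g ∈ Coset 1 ⊎ g ∈ Coset 3 → ¬ g ∈ H
          odd-coset g (inj₁ p) q = w∉H (subst (_∈ H) (free (𝕩 ⊗ inv (inv (𝕪 ⊗ 𝟙) ⊗ 𝕩)) 𝕪 (g ∷ w ∷ []) refl) (·∈ hH q (⁻¹∈ hH (K⊆H p))))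
          odd-coset g (inj₂ p) q = w∉H (cosetˡ hH ww∈H (subst (_∈ H) (free (𝕩 ⊗ inv (inv (𝕪 ⊗ (𝕪 ⊗ (𝕪 ⊗ 𝟙))) ⊗ 𝕩)) (𝕪 ⊗ (𝕪 ⊗ 𝕪)) (g ∷ w ∷ []) refl) (·∈ hH q (⁻¹∈ hH (K⊆H p)))))
          even-coset : ∀ g → g ∈ Coset 0 ⊎ g ∈ Coset 2 → g ∈ H
          even-coset g (inj₁ p) = K⊆H (coset0 p)
          even-coset g (inj₂ p) = subst (_∈ H) (free (𝕪 ⊗ 𝕪 ⊗ (inv (𝕪 ⊗ (𝕪 ⊗ 𝟙)) ⊗ 𝕩)) 𝕩 (g ∷ w ∷ []) refl) (·∈ hH ww∈H (K⊆H p))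
          zero₀ : ∀ {d} → d ∈ Z₀ → 0 ≈[ 4 ] φ d + (φ x + φ y + 2)
          zero₀ {d} (p , q) = mtrans (φ⁻¹ d) (m+ mrefl (φd d 2 (pick (φ g) refl (φ∈ {g} tt))))
            where
            g = (x · y) ⁻¹ · d ⁻¹
            g∈H : g ∈ H
            g∈H = same-sideˡ ij xy∈ (side-⁻¹ ij q)
            pick : ∀ k → φ g ≡ k → k < 4 × g ∈ Coset k → φ g ≡ 2
            pick 0 eq _ = ⊥-elim (E₀⁻ (to00 (subst (φ (d ⁻¹) ≈[ 4 ]_) (+-identityʳ _) (φd d 0 eq))) p (inverseˡ d))
            pick 1 eq (_ , r) = ⊥-elim (odd-coset g (inj₁ r) g∈H)
            pick 2 eq _ = eq
            pick 3 eq (_ , r) = ⊥-elim (odd-coset g (inj₂ r) g∈H)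
            pick (suc (suc (suc (suc _)))) eq (s≤s (s≤s (s≤s (s≤s ()))) , _)
          zero₁ : ∀ {d} → d ∈ Z₁ → 0 ≈[ 4 ] φ d + (φ x + φ y + 3)
          zero₁ {d} (p , q) = mtrans (φ⁻¹ d) (m+ mrefl (φd d 3 (pick (φ g) refl (φ∈ {g} tt))))
            where
            g = (x · y) ⁻¹ · d ⁻¹
            g∉H : ¬ g ∈ H
            g∉H = opposite ij xy∈ (side-⁻¹ (not ij) q)
            pick : ∀ k → φ g ≡ k → k < 4 × g ∈ Coset k → φ g ≡ 3
            pick 0 eq (_ , r) = ⊥-elim (g∉H (even-coset g (inj₁ r)))
            pick 1 eq _ = ⊥-elim (E₁⁻ (to01 (mtrans (φd d 1 eq) (mtrans (≡⇒≈ (+-assoc (φ x) (φ y) 1)) (m+ mrefl (msym φu))))) p (inverseˡ d))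
            pick 2 eq (_ , r) = ⊥-elim (g∉H (even-coset g (inj₂ r)))
            pick 3 eq _ = eq
            pick (suc (suc (suc (suc _)))) eq (s≤s (s≤s (s≤s (s≤s ()))) , _)
          split : ∀ i (S : Sub n) → wt S φ ≈[ 4 ] wt (S ∩ Side i) φ + wt (S ∩ Side (not i)) φ
          split false S = W.weight-split S H φ
          split true S = mtrans (W.weight-split S H φ) (≡⇒≈ (+-comm (wt (S ∩ H) φ) _))
          const : ∀ S {m} → ∣ S ∣ ≡ m → ∀ c → (∀ {g} → g ∈ S → φ g ≈[ 4 ] c) → wt S φ ≈[ 4 ] m * c
          const S refl c h = ≈-const S φ c h
          wA : wt A φ ≈[ 4 ] 6 * φ x + 3 * (φ x + 1)
          wA = mtrans (split i A) (m+ (const X₀ cX₀ (φ x) (λ p → rightK (sX₀ p))) (const X₁ cX₁ (φ x + 1) (λ p → mtrans (rightK (sX₁ p)) φv)))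
          wB : wt B φ ≈[ 4 ] 6 * φ y + 3 * (φ y + 1)
          wB = mtrans (split j B) (m+ (const Y₀ cY₀ (φ y) (λ p → leftK (sY₀ p))) (const Y₁ cY₁ (φ y + 1) (λ p → mtrans (leftK (sY₁ p)) φu)))
          d₀∈ = proj₂ (nonempty Z₀ (subst (0 <_) (≡sym cZ₀) (s≤s z≤n)))
          d₁∈ = proj₂ (nonempty Z₁ (subst (0 <_) (≡sym cZ₁) (s≤s z≤n)))
          c₀ = φ (proj₁ (nonempty Z₀ (subst (0 <_) (≡sym cZ₀) (s≤s z≤n))))
          c₁ = φ (proj₁ (nonempty Z₁ (subst (0 <_) (≡sym cZ₁) (s≤s z≤n))))
          cancelʳ≈ : ∀ {a b c} → 0 ≈[ 4 ] a + c → 0 ≈[ 4 ] b + c → a ≈[ 4 ] b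
          cancelʳ≈ {a} {b} {c} p q = mcancel c (mtrans (≡⇒≈ (+-comm c a)) (mtrans (mtrans (msym p) q) (≡⇒≈ (+-comm b c))))
          wD : wt D φ ≈[ 4 ] 3 * c₀ + 6 * c₁
          wD = mtrans (split ij D) (m+ (const Z₀ cZ₀ c₀ (λ p → cancelʳ≈ (zero₀ p) (zero₀ d₀∈))) (const Z₁ cZ₁ c₁ (λ p → cancelʳ≈ (zero₁ p) (zero₁ d₁∈))))
          -- 36 is the sum of φ over G. Adding 18 completes the right side to 3(c + a + b + 2) + 6(e
          -- + a + b + 3), which vanishes modulo 4, while 54 does not.
          total : ∀ a b c e → 0 ≈[ 4 ] c + (a + b + 2) → 0 ≈[ 4 ] e + (a + b + 3) → 36 ≈[ 4 ] (6 * a + 3 * (a + 1)) + (6 * b + 3 * (b + 1)) + (3 * c + 6 * e) → 54 ≈[ 4 ] 0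
          total a b c e p q r = mtrans (m+ r (mrefl {18})) (mtrans (≡⇒≈ (l a b c e)) (msym (m+ (m+ p (m+ p p)) (m+ (m+ q (m+ q q)) (m+ q (m+ q q))))))
            where
            l : ∀ a b c e → (6 * a + 3 * (a + 1)) + (6 * b + 3 * (b + 1)) + (3 * c + 6 * e) + 18 ≡
                 (c + (a + b + 2) + (c + (a + b + 2) + (c + (a + b + 2)))) + ((e + (a + b + 3) + (e + (a + b + 3) + (e + (a + b + 3)))) + (e + (a + b + 3) + (e + (a + b + 3) + (e + (a + b + 3)))))
            l = solve-∀

  module TwentyFourCases (n≡24 : n ≡ 24) where
    open TwentyFour n≡24

    module CosetCase {H} (hH : IsSubgroup H) (∣H∣ : ∣ H ∣ ≡ 12) (C : Config 9) (i j : Bool) where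
      open Halves hH (trans (cong₂ _+_ ∣H∣ ∣H∣) (≡sym n≡24))
      open Config C
      open SideConfig C
      open Cross hH ∣H∣ C i j

      -- `k1` and `k2` are Freiman's hypotheses, and `k3` together with the counting bound makes |K|
      -- < |X₀| + |Y₀|, so that xKy lies in E₀. Then 5 ≤ |Y₀| ≤ |K| ≤ |E₀| ≤ 7, and 6 is the only
      -- divisor of 24 in this range.
      module FreimanSix {x₀ y₀ e₀} (cX₀ : ∣ X₀ ∣ ≡ x₀) (cY₀ : ∣ Y₀ ∣ ≡ y₀) (cE₀ : ∣ E₀ ∣ ≡ e₀)
          (k1 : e₀ < x₀ + x₀) (k2 : e₀ + e₀ < y₀ + y₀ + y₀) (k3 : y₀ * y₀ < (x₀ + y₀) * (y₀ + y₀ ∸ e₀)) (k4 : 5 ≤ y₀) (k5 : e₀ ≤ 7) where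

        open Freiman X₀ Y₀ E₀ X₀Y₀ (<-via cE₀ (cong₂ _+_ cX₀ cX₀) k1) (<-via (cong₂ _+_ cE₀ cE₀) (cong₂ _+_ (cong₂ _+_ cY₀ cY₀) cY₀) k2) public

        K<  : ∣ K ∣ < ∣ X₀ ∣ + ∣ Y₀ ∣
        K< = ≰⇒> λ le → <⇒≱ k3 (begin
          (x₀ + y₀) * (y₀ + y₀ ∸ e₀) ≤⟨ *-monoˡ-≤ (y₀ + y₀ ∸ e₀) (subst (_≤ ∣ K ∣) (cong₂ _+_ cX₀ cY₀) le) ⟩
          ∣ K ∣ * (y₀ + y₀ ∸ e₀) ≤⟨ subst₂ (λ y e → ∣ K ∣ * (y + y ∸ e) ≤ y * y) cY₀ cE₀ bound ⟩
          y₀ * y₀ ∎)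
          where open ≤-Reasoning

        x∈ = nonempty X₀ (n≢0⇒n>0 λ z → n≮0 (subst (λ t → e₀ < t + t) (trans (≡sym cX₀) z) k1))
        y∈ = nonempty Y₀ (subst (0 <_) (≡sym cY₀) (<-≤-trans (s≤s z≤n) k4))
        x = proj₁ x∈
        y = proj₁ y∈

        f00 : ∀ {κ} → κ ∈ K → x · κ · y ∈ E₀
        f00 p = fill K< (proj₂ x∈) p (proj₂ y∈)

        K≤E₀ : ∣ K ∣ ≤ ∣ E₀ ∣
        K≤E₀ = ∣∣-inj K E₀ (λ κ → x · κ · y) f00 (λ _ _ z → ·-cancelˡ x (·-cancelʳ y z))

        Y₀≤K : ∣ Y₀ ∣ ≤ ∣ K ∣
        Y₀≤K = ∣∣-inj Y₀ K (_· y ⁻¹) (λ p → BB⁻¹⊆K p (proj₂ y∈)) (λ _ _ → ·-cancelʳ (y ⁻¹))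

        ∣K∣ : ∣ K ∣ ≡ 6
        ∣K∣ = ∣24 ∣ K ∣ (≤-trans k4 (subst (_≤ ∣ K ∣) cY₀ Y₀≤K)) (≤-trans K≤E₀ (subst (_≤ 7) (≡sym cE₀) k5)) (subst (∣ K ∣ ∣_) n≡24 (lagrange-full subgroup))

        K⊆H : K ⊆ H
        K⊆H {κ} (a , p , q) = subst (_∈ H) (cancelˡ′ a κ) (same-sideˡ i (proj₂ p) (proj₂ q))

      -- Seven elements of D on the opposite part leave |E₀| = 12 - 7 = 5, too small for a translate
      -- of the six-element subgroup.
      five-five-seven : ∣ X₀ ∣ ≡ 5 → ∣ Y₀ ∣ ≡ 5 → ∣ E₀ ∣ ≡ 5 → ⊥
      five-five-seven cX cY cE = contradiction (subst₂ _≤_ ∣K∣ cE K≤E₀) (from-no (6 ≤? 5))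
        where open FreimanSix cX cY cE (from-yes (5 <? 10)) (from-yes (10 <? 15)) (from-yes (25 <? 50)) (from-yes (5 ≤? 5)) (from-yes (5 ≤? 7))

      -- X₁ and Y₁ lie in cosets of K as well, because translates vY₀ overlap in E₁ and translates
      -- X₁u overlap in E₀. So xKy and vKu share at least five elements of E₀, which makes K normal,
      -- while xKu and vKy meet in E₁. The two overlaps express u through wy and y through wu modulo
      -- K, where w = x⁻¹v, so w² is in K, against `klein`.
      module SixCosets {x₀ x₁ y₀ y₁ e₀ e₁} (cX₀ : ∣ X₀ ∣ ≡ x₀) (cX₁ : ∣ X₁ ∣ ≡ x₁) (cY₀ : ∣ Y₀ ∣ ≡ y₀) (cY₁ : ∣ Y₁ ∣ ≡ y₁) (cE₀ : ∣ E₀ ∣ ≡ e₀) (cE₁ : ∣ E₁ ∣ ≡ e₁)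
          (k1 : e₀ < x₀ + x₀) (k2 : e₀ + e₀ < y₀ + y₀ + y₀) (k3 : y₀ * y₀ < (x₀ + y₀) * (y₀ + y₀ ∸ e₀)) (k4 : 5 ≤ y₀) (k5 : e₀ ≤ 7)
          (k6 : e₁ < y₀ + y₀) (k7 : e₀ < x₁ + x₁) (k8 : 6 < x₀ + y₁) (k9 : 6 < x₁ + y₀) (k10 : 6 < x₁ + y₁) (k11 : e₁ < 12) (k12 : 0 < y₁) where

        open FreimanSix cX₀ cY₀ cE₀ k1 k2 k3 k4 k5
        hK = subgroup

        X₁⁻¹X₁ : ∀ {v v′} → v ∈ X₁ → v′ ∈ X₁ → v ⁻¹ · v′ ∈ K
        X₁⁻¹X₁ {v} {v′} p q =
          let g , r , s = meeting (v ◃ Y₀) (v′ ◃ Y₀) E₁ (λ {z} r → subst (_∈ E₁) (cancelˡ v z) (X₁Y₀ p r)) (λ {z} r → subst (_∈ E₁) (cancelˡ v′ z) (X₁Y₀ q r))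
                            (<-via cE₁ (cong₂ _+_ (trans (∣◃∣ v Y₀) cY₀) (trans (∣◃∣ v′ Y₀) cY₀)) k6)
          in subst (_∈ K) (free (inv 𝕩 ⊗ 𝕫 ⊗ inv (inv 𝕪 ⊗ 𝕫)) (inv 𝕩 ⊗ 𝕪) (v ∷ v′ ∷ g ∷ []) refl) (BB⁻¹⊆K r s)

        Y₁Y₁⁻¹ : ∀ {u u′} → u ∈ Y₁ → u′ ∈ Y₁ → u · u′ ⁻¹ ∈ K
        Y₁Y₁⁻¹ {u} {u′} p q =
          let g , r , s = meeting (X₁ ▹ u) (X₁ ▹ u′) E₀ (λ {z} r → subst (_∈ E₀) (cancelʳ′ z u) (X₁Y₁ r p)) (λ {z} r → subst (_∈ E₀) (cancelʳ′ z u′) (X₁Y₁ r q))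
                            (<-via cE₀ (cong₂ _+_ (trans (∣▹∣ X₁ u) cX₁) (trans (∣▹∣ X₁ u′) cX₁)) k7)
          in subst (_∈ K) (free (inv (𝕫 ⊗ inv 𝕩) ⊗ (𝕫 ⊗ inv 𝕪)) (𝕩 ⊗ inv 𝕪) (u ∷ u′ ∷ g ∷ []) refl) (X₁⁻¹X₁ r s)

        v∈ = nonempty X₁ (n≢0⇒n>0 λ z → n≮0 (subst (λ t → e₀ < t + t) (trans (≡sym cX₁) z) k7))
        u∈ = nonempty Y₁ (subst (0 <_) (≡sym cY₁) k12)
        v = proj₁ v∈
        u = proj₁ u∈

        f01 : ∀ {κ} → κ ∈ K → x · κ · u ∈ E₁
        f01 p = fill-coset hK X₀ Y₁ E₁ X₀Y₁ A⁻¹A⊆K Y₁Y₁⁻¹ (<-via ∣K∣ (cong₂ _+_ cX₀ cY₁) k8) (proj₂ x∈) p (proj₂ u∈)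
        f10 : ∀ {κ} → κ ∈ K → v · κ · y ∈ E₁
        f10 p = fill-coset hK X₁ Y₀ E₁ X₁Y₀ X₁⁻¹X₁ BB⁻¹⊆K (<-via ∣K∣ (cong₂ _+_ cX₁ cY₀) k9) (proj₂ v∈) p (proj₂ y∈)
        f11 : ∀ {κ} → κ ∈ K → v · κ · u ∈ E₀
        f11 p = fill-coset hK X₁ Y₁ E₀ X₁Y₁ X₁⁻¹X₁ Y₁Y₁⁻¹ (<-via ∣K∣ (cong₂ _+_ cX₁ cY₁) k10) (proj₂ v∈) p (proj₂ u∈)

        image : Fin n → Fin n → Sub n
        image a b = ⟪ (λ g → mem? K (a ⁻¹ · g · b ⁻¹)) ⟫

        ∣image∣ : ∀ a b → ∣ image a b ∣ ≡ 6
        ∣image∣ a b = trans (∣∣-bij (image a b) K (λ g → a ⁻¹ · g · b ⁻¹) (λ κ → a · κ · b)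
          (λ g → free (𝕩 ⊗ (inv 𝕩 ⊗ 𝕫 ⊗ inv 𝕪) ⊗ 𝕪) 𝕫 (a ∷ b ∷ g ∷ []) refl) (λ κ → free (inv 𝕩 ⊗ (𝕩 ⊗ 𝕫 ⊗ 𝕪) ⊗ inv 𝕪) 𝕫 (a ∷ b ∷ κ ∷ []) refl)
          id (λ {κ} p → subst (_∈ K) (free 𝕫 (inv 𝕩 ⊗ (𝕩 ⊗ 𝕫 ⊗ 𝕪) ⊗ inv 𝕪) (a ∷ b ∷ κ ∷ []) refl) p)) ∣K∣

        image⊆ : ∀ {a b} E → (∀ {κ} → κ ∈ K → a · κ · b ∈ E) → image a b ⊆ E
        image⊆ {a} {b} E f {g} p = subst (_∈ E) (free (𝕩 ⊗ (inv 𝕩 ⊗ 𝕫 ⊗ inv 𝕪) ⊗ 𝕪) 𝕫 (a ∷ b ∷ g ∷ []) refl) (f p)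

        P : Sub n
        P = image x y ∩ image v u

        4≤P : 4 < ∣ P ∣
        4≤P = +-cancelˡ-≤ 7 _ _ (begin
          12 ≡⟨ cong₂ _+_ (∣image∣ x y) (∣image∣ v u) ⟨
          ∣ image x y ∣ + ∣ image v u ∣ ≤⟨ ∣∣-∩ (image x y) (image v u) E₀ (image⊆ E₀ f00) (image⊆ E₀ f11) ⟩
          ∣ E₀ ∣ + ∣ P ∣ ≤⟨ +-monoˡ-≤ ∣ P ∣ (subst (_≤ 7) (≡sym cE₀) k5) ⟩
          7 + ∣ P ∣ ∎)
          where open ≤-Reasoning

        g = v ⁻¹ · x

        -- This is K ∩ g⁻¹Kg. For t and q in `P` it contains x⁻¹tq⁻¹x, so it has at least five
        -- elements; its order divides six, so it is K, and g normalises K.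
        J : Sub n
        J = ⟪ (λ κ → mem? K κ ×-dec mem? K (g · κ · g ⁻¹)) ⟫

        hJ : IsSubgroup J
        hJ = record
          { ε∈ = ε∈ hK , subst (_∈ K) (free 𝟙 (𝕩 ⊗ 𝟙 ⊗ inv 𝕩) (g ∷ []) refl) (ε∈ hK)
          ; ·∈ = λ { {a} {b} (p , q) (r , s) → ·∈ hK p r , subst (_∈ K) (free (𝕩 ⊗ 𝕪 ⊗ inv 𝕩 ⊗ (𝕩 ⊗ 𝕫 ⊗ inv 𝕩)) (𝕩 ⊗ (𝕪 ⊗ 𝕫) ⊗ inv 𝕩) (g ∷ a ∷ b ∷ []) refl) (·∈ hK q s) }
          ; ⁻¹∈ = λ { {a} (p , q) → ⁻¹∈ hK p , subst (_∈ K) (free (inv (𝕩 ⊗ 𝕪 ⊗ inv 𝕩)) (𝕩 ⊗ inv 𝕪 ⊗ inv 𝕩) (g ∷ a ∷ []) refl) (⁻¹∈ hK q) } }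

        J-full : K ⊆ J
        J-full = ⊆-full J K proj₁ (≤-trans (≤-reflexive ∣K∣) (six (<-≤-trans 4≤P P≤J) (subst (∣ J ∣ ∣_) ∣K∣ (lagrange hJ hK proj₁))))
          where
          p₀ = nonempty P (<-≤-trans (s≤s z≤n) 4≤P)
          q = proj₁ p₀
          P≤J : ∣ P ∣ ≤ ∣ J ∣
          P≤J = ∣∣-inj P J (λ t → x ⁻¹ · t · q ⁻¹ · x)
            (λ { {t} (r , s) →
               subst (_∈ K) (free (inv 𝕩 ⊗ 𝕫 ⊗ inv 𝕪 ⊗ inv (inv 𝕩 ⊗ 𝕦 ⊗ inv 𝕪)) (inv 𝕩 ⊗ 𝕫 ⊗ inv 𝕦 ⊗ 𝕩) (x ∷ y ∷ t ∷ q ∷ []) refl) (·∈ hK r (⁻¹∈ hK (proj₁ (proj₂ p₀)))) ,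
               subst (_∈ K) (free (inv 𝕧 ⊗ 𝕫 ⊗ inv 𝕪 ⊗ inv (inv 𝕧 ⊗ 𝕦 ⊗ inv 𝕪)) (inv 𝕧 ⊗ 𝕩 ⊗ (inv 𝕩 ⊗ 𝕫 ⊗ inv 𝕦 ⊗ 𝕩) ⊗ inv (inv 𝕧 ⊗ 𝕩)) (x ∷ u ∷ t ∷ q ∷ v ∷ []) refl) (·∈ hK s (⁻¹∈ hK (proj₂ (proj₂ p₀)))) })
            (λ _ _ z → ·-cancelˡ (x ⁻¹) (·-cancelʳ (q ⁻¹) (·-cancelʳ x z)))
          six : ∀ {c} → 4 < c → c ∣ 6 → 6 ≤ c
          six lt p = below {λ c → 4 < c → c ∣ 6 → 6 ≤ c} 6 (from-yes (all? {n = 7} λ i → (4 <? toℕ i) →-dec ((toℕ i ∣? 6) →-dec (6 ≤? toℕ i)))) (∣⇒≤ p) lt p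

        normal : ∀ {z κ} → κ ∈ K → z · κ · z ⁻¹ ∈ K
        normal = normal-extend hK (index2-normal hH hK K⊆H (≤-reflexive (trans ∣H∣ (≡sym (cong₂ _+_ ∣K∣ ∣K∣)))))
          (λ r → opposite i (proj₂ (proj₂ x∈)) (proj₂ (proj₂ v∈)) (subst (_∈ H) (free (inv (inv 𝕩 ⊗ 𝕪)) (inv 𝕪 ⊗ 𝕩) (v ∷ x ∷ []) refl) (⁻¹∈ hH r)))
          (λ p → proj₂ (J-full p))

        w = x ⁻¹ · v

        link : ∀ {a b t} → t ∈ image x a → t ∈ image v b → ∃ λ κ → κ ∈ K × a ≡ κ · w · b
        link {a} {b} {t} p q = (x ⁻¹ · t · a ⁻¹) ⁻¹ · (w · (v ⁻¹ · t · b ⁻¹) · w ⁻¹) , ·∈ hK (⁻¹∈ hK p) (normal {w} q) ,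
          free 𝕫 (inv (inv 𝕩 ⊗ 𝕦 ⊗ inv 𝕫) ⊗ (inv 𝕩 ⊗ 𝕪 ⊗ (inv 𝕪 ⊗ 𝕦 ⊗ inv 𝕧) ⊗ inv (inv 𝕩 ⊗ 𝕪)) ⊗ (inv 𝕩 ⊗ 𝕪) ⊗ 𝕧) (x ∷ v ∷ a ∷ t ∷ b ∷ []) refl

        square : ∀ {κ₀ κ₁ w u y} → κ₀ ∈ K → κ₁ ∈ K → u ≡ κ₀ · w · y → y ≡ κ₁ · w · u → w · w ∈ K
        square {κ₀} {κ₁} {w} {u} {y} p q e₀ e₁ = subst (_∈ K) (≡sym (⁻¹-unique (κ₁ · (w · κ₀ · w ⁻¹)) (w · w)
            (·-cancelʳ y (trans (free (𝕩 ⊗ (𝕪 ⊗ 𝕫 ⊗ inv 𝕪) ⊗ (𝕪 ⊗ 𝕪) ⊗ 𝕦) (𝕩 ⊗ 𝕪 ⊗ (𝕫 ⊗ 𝕪 ⊗ 𝕦)) (κ₁ ∷ w ∷ κ₀ ∷ y ∷ []) refl) (trans (cong (κ₁ · w ·_) (≡sym e₀)) (trans (≡sym e₁) (≡sym (identityˡ y)))))))) (⁻¹∈ hK (·∈ hK q (normal {w} p)))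

        finish : (∃ λ κ → κ ∈ K × u ≡ κ · w · y) → (∃ λ κ → κ ∈ K × y ≡ κ · w · u) → ⊥
        finish (κ₀ , κ₀∈ , u≡) (κ₁ , κ₁∈ , y≡) =
          End.klein hK ∣K∣ normal K⊆H (proj₂ x∈) (proj₂ v∈) (proj₂ y∈) (A⁻¹A⊆K (proj₂ x∈)) (X₁⁻¹X₁ (proj₂ v∈)) (λ p → BB⁻¹⊆K p (proj₂ y∈)) (λ p → Y₁Y₁⁻¹ p (proj₂ u∈))
               w (≡sym (cancelˡ x v)) κ₀ κ₀∈ u≡ f00 f01 (square κ₀∈ κ₁∈ u≡ y≡)

        contra : ⊥
        contra =
          let q , r , s = nonempty P (<-≤-trans (s≤s z≤n) 4≤P)
              t , r′ , s′ = meeting (image x u) (image v y) E₁ (image⊆ E₁ f01) (image⊆ E₁ f10) (<-via cE₁ (cong₂ _+_ (∣image∣ x u) (∣image∣ v y)) k11)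
          in finish (link r′ s′) (link r s)

  module Stabilisers (X : Sub n) where
    Stabʳ Stabˡ : Sub n
    Stabʳ = ⟪ (λ g → all? (λ a → mem? X a →-dec mem? X (a · g))) ⟫
    Stabˡ = ⟪ (λ g → all? (λ a → mem? X a →-dec mem? X (g · a))) ⟫

    stabʳ : IsSubgroup Stabʳ
    stabʳ = record
      { ε∈ = λ a p → subst (_∈ X) (≡sym (identityʳ a)) p
      ; ·∈ = λ {g} {h} p q a r → subst (_∈ X) (assoc a g h) (q _ (p a r))
      ; ⁻¹∈ = λ {g} p a r → ⊆-full ⟪ (λ z → mem? X (z · g ⁻¹) ) ⟫ X (λ {z} q → subst (_∈ X) (cancelʳ′ z g) (p _ q)) (≤-reflexive (≡sym (∣▹∣ X g))) r }

    stabˡ : IsSubgroup Stabˡ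
    stabˡ = record
      { ε∈ = λ a p → subst (_∈ X) (≡sym (identityˡ a)) p
      ; ·∈ = λ {g} {h} p q a r → subst (_∈ X) (≡sym (assoc g h a)) (p _ (q a r))
      ; ⁻¹∈ = λ {g} p a r → ⊆-full (g ◃ X) X (λ {z} q → subst (_∈ X) (cancelˡ g z) (p _ q)) (≤-reflexive (≡sym (∣◃∣ g X))) r }

    ∣Stabʳ∣ : ∣ Stabʳ ∣ ∣ ∣ X ∣
    ∣Stabʳ∣ = lagrange′ stabʳ X (λ p q → q _ p)

    -- `lagrange′` treats sets closed under right multiplication; inversion brings the left
    -- stabiliser into that form.
    ∣Stabˡ∣ : ∣ Stabˡ ∣ ∣ ∣ X ∣
    ∣Stabˡ∣ = subst (∣ Stabˡ ∣ ∣_) (∣⁻¹ˢ∣ X) (lagrange′ stabˡ (X ⁻¹ˢ) (λ {x} {y} p q → subst (_∈ X) (≡sym (⁻¹-· x y)) (⁻¹∈ stabˡ q _ p)))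

  module TwentyFourLast (n≡24 : n ≡ 24) where
    open TwentyFour n≡24

    module Last {H} (hH : IsSubgroup H) (∣H∣ : ∣ H ∣ ≡ 12) (zs : ZeroSum H) (C : Config 9) (i j : Bool) where
      open Cross hH ∣H∣ C i j

      -- X₀ Y₁ and X₁ Y₀ have the size of X₀ and of Y₀, so X₀ has stabilisers of order 3 or 6 on both sides.
      module Sized (cX₀ : ∣ X₀ ∣ ≡ 6) (cX₁ : ∣ X₁ ∣ ≡ 3) (cY₀ : ∣ Y₀ ∣ ≡ 6) (cY₁ : ∣ Y₁ ∣ ≡ 3)
          (cZ₀ : ∣ Z₀ ∣ ≡ 3) (cZ₁ : ∣ Z₁ ∣ ≡ 6) (cE₀ : ∣ E₀ ∣ ≡ 9) (cE₁ : ∣ E₁ ∣ ≡ 6)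
          {x v u : Fin n} (x∈ : x ∈ X₀) (v∈ : v ∈ X₁) (u∈ : u ∈ Y₁) {y : Fin n} (y∈ : y ∈ Y₀) where
        open Halves hH (trans (cong₂ _+_ ∣H∣ ∣H∣) (≡sym n≡24))
        open Stabilisers X₀

        E₁⊆X₀u : ∀ {u} → u ∈ Y₁ → ∀ {g} → g ∈ E₁ → g · u ⁻¹ ∈ X₀
        E₁⊆X₀u {u} p = ⊆-full (X₀ ▹ u) E₁ (λ {z} q → subst (_∈ E₁) (cancelʳ′ z u) (X₀Y₁ q p)) (≤-reflexive (trans cE₁ (≡sym (trans (∣▹∣ X₀ u) cX₀))))

        E₁⊆vY₀ : ∀ {v} → v ∈ X₁ → ∀ {g} → g ∈ E₁ → v ⁻¹ · g ∈ Y₀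
        E₁⊆vY₀ {v} p = ⊆-full (v ◃ Y₀) E₁ (λ {z} q → subst (_∈ E₁) (cancelˡ v z) (X₁Y₀ p q)) (≤-reflexive (trans cE₁ (≡sym (trans (∣◃∣ v Y₀) cY₀))))

        Y₁Y₁⁻¹ : ∀ {u u′} → u ∈ Y₁ → u′ ∈ Y₁ → u · u′ ⁻¹ ∈ Stabʳ
        Y₁Y₁⁻¹ {u} {u′} p q a r = subst (_∈ X₀) (assoc a u (u′ ⁻¹)) (E₁⊆X₀u q (X₀Y₁ r p))

        X₁X₁⁻¹ : ∀ {v v′} → v ∈ X₁ → v′ ∈ X₁ → v′ · v ⁻¹ ∈ Stabˡ
        X₁X₁⁻¹ {v} {v′} p q a r = subst (_∈ X₀) (free (𝕪 ⊗ (inv 𝕩 ⊗ (𝕫 ⊗ 𝕦)) ⊗ inv 𝕦) (𝕪 ⊗ inv 𝕩 ⊗ 𝕫) (v ∷ v′ ∷ a ∷ u ∷ []) refl)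
          (E₁⊆X₀u u∈ (X₁Y₀ q (E₁⊆vY₀ p (X₀Y₁ r u∈))))

        R₃₆ : ∣ Stabʳ ∣ ≡ 3 ⊎ ∣ Stabʳ ∣ ≡ 6
        R₃₆ = three-or-six _ (subst (_≤ ∣ Stabʳ ∣) cY₁ (∣∣-inj Y₁ Stabʳ (_· u ⁻¹) (λ p → Y₁Y₁⁻¹ p u∈) (λ _ _ → ·-cancelʳ (u ⁻¹)))) (subst (∣ Stabʳ ∣ ∣_) cX₀ ∣Stabʳ∣)

        L₃₆ : ∣ Stabˡ ∣ ≡ 3 ⊎ ∣ Stabˡ ∣ ≡ 6
        L₃₆ = three-or-six _ (subst (_≤ ∣ Stabˡ ∣) cX₁ (∣∣-inj X₁ Stabˡ (_· v ⁻¹) (λ p → X₁X₁⁻¹ v∈ p) (λ _ _ → ·-cancelʳ (v ⁻¹)))) (subst (∣ Stabˡ ∣ ∣_) cX₀ ∣Stabˡ∣)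

        module Six (∣K∣ : ∣ Stabʳ ∣ ≡ 6) where
          K = Stabʳ

          sX₀ : ∀ {a} → a ∈ X₀ → x ⁻¹ · a ∈ K
          sX₀ = ⊆-full (x ◃ K) X₀ (λ {a} p → subst (_∈ X₀) (cancelˡ x a) (p x x∈)) (≤-reflexive (trans cX₀ (≡sym (trans (∣◃∣ x K) ∣K∣))))

          K⊆H : K ⊆ H
          K⊆H {κ} p = subst (_∈ H) (cancelˡ′ x κ) (same-sideˡ i (proj₂ x∈) (proj₂ (p x x∈)))

          g = v ⁻¹ · x

          inE₀ : ∀ {κ κ′} → κ ∈ K → κ′ ∈ K → x · (κ · (g · κ′)) · u ∈ E₀
          inE₀ {κ} {κ′} p q = subst (_∈ E₀) (free (𝕩 ⊗ 𝕪 ⊗ (inv 𝕧 ⊗ (𝕩 ⊗ 𝕫 ⊗ 𝕦))) (𝕩 ⊗ (𝕪 ⊗ (inv 𝕧 ⊗ 𝕩 ⊗ 𝕫)) ⊗ 𝕦) (x ∷ κ ∷ κ′ ∷ u ∷ v ∷ []) refl)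
            (X₀Y₀ (p x x∈) (E₁⊆vY₀ v∈ (X₀Y₁ (q x x∈) u∈)))

          -- xKgKu lies in E₀. If gκg⁻¹ were outside K, the cosets Kg and Kgκ would be disjoint and
          -- give twelve elements in a set of nine.
          normal-g : ∀ {κ} → κ ∈ K → g · κ · g ⁻¹ ∈ K
          normal-g {κ} p with mem? K (g · κ · g ⁻¹)
          ... | yes q = q
          ... | no q = contradiction (begin
              12 ≡⟨ cong₂ _+_ ∣K∣ ∣K∣ ⟨
              ∣ K ∣ + ∣ K ∣ ≡⟨ cong₂ _+_ (∣▹∣ K g) (∣▹∣ K (g · κ)) ⟨
              ∣ K ▹ g ∣ + ∣ K ▹ g · κ ∣ ≤⟨ ∣∣-disjoint (K ▹ g) (K ▹ g · κ) (⟪ (λ t → mem? E₀ (x · t · u)) ⟫)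
                (λ {t} r → subst (λ z → x · z · u ∈ E₀) (free (𝕩 ⊗ inv 𝕪 ⊗ (𝕪 ⊗ 𝟙)) 𝕩 (t ∷ g ∷ []) refl) (inE₀ r (ε∈ stabʳ)))
                (λ {t} r → subst (λ z → x · z · u ∈ E₀) (cancelʳ′ t (g · κ)) (inE₀ r p))
                (λ {t} r s → q (subst (_∈ K) (free (inv (𝕩 ⊗ inv (𝕪 ⊗ 𝕫)) ⊗ (𝕩 ⊗ inv 𝕪)) (𝕪 ⊗ 𝕫 ⊗ inv 𝕪) (t ∷ g ∷ κ ∷ []) refl) (·∈ stabʳ (⁻¹∈ stabʳ s) r))) ⟩
              ∣ ⟪ (λ t → mem? E₀ (x · t · u)) ⟫ ∣ ≤⟨ ∣∣-inj ⟪ (λ t → mem? E₀ (x · t · u)) ⟫ E₀ (λ t → x · t · u) id (λ _ _ z → ·-cancelˡ x (·-cancelʳ u z)) ⟩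
              ∣ E₀ ∣ ≡⟨ cE₀ ⟩
              9 ∎) (from-no (12 ≤? 9))
            where open ≤-Reasoning

          normal : ∀ {z κ} → κ ∈ K → z · κ · z ⁻¹ ∈ K
          normal = normal-extend stabʳ (index2-normal hH stabʳ K⊆H (≤-reflexive (trans ∣H∣ (≡sym (cong₂ _+_ ∣K∣ ∣K∣)))))
            (λ r → opposite i (proj₂ x∈) (proj₂ v∈) (subst (_∈ H) (free (inv (inv 𝕩 ⊗ 𝕪)) (inv 𝕪 ⊗ 𝕩) (v ∷ x ∷ []) refl) (⁻¹∈ hH r)))
            normal-g

          core : ∀ {b} → b ∈ Y₀ → g ⁻¹ · b · u ⁻¹ ∈ K
          core {b} p = subst (_∈ K) (free (inv 𝕩 ⊗ (𝕪 ⊗ 𝕫 ⊗ inv 𝕦)) (inv (inv 𝕪 ⊗ 𝕩) ⊗ 𝕫 ⊗ inv 𝕦) (x ∷ v ∷ b ∷ u ∷ []) refl) (sX₀ (E₁⊆X₀u u∈ (X₁Y₀ v∈ p)))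

          sY₀ : ∀ {b} → b ∈ Y₀ → b · y ⁻¹ ∈ K
          sY₀ {b} p = subst (_∈ K) (free (𝕫 ⊗ (inv 𝕫 ⊗ 𝕩 ⊗ inv 𝕦 ⊗ inv (inv 𝕫 ⊗ 𝕪 ⊗ inv 𝕦)) ⊗ inv 𝕫) (𝕩 ⊗ inv 𝕪) (b ∷ y ∷ g ∷ u ∷ []) refl) (normal {g} (·∈ stabʳ (core p) (⁻¹∈ stabʳ (core y∈))))

          sX₁ : ∀ {a} → a ∈ X₁ → v ⁻¹ · a ∈ K
          sX₁ {a} p = subst (_∈ K) (free (inv 𝕩 ⊗ (𝕪 ⊗ 𝕫) ⊗ inv 𝕫) (inv 𝕩 ⊗ 𝕪) (v ∷ a ∷ y ∷ []) refl) (sY₀ (E₁⊆vY₀ v∈ (X₁Y₀ p y∈)))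

          w = x ⁻¹ · v
          κ₀ = (g ⁻¹ · y · u ⁻¹) ⁻¹
          u≡ : u ≡ κ₀ · w · y
          u≡ = free 𝕦 (inv (inv (inv 𝕪 ⊗ 𝕩) ⊗ 𝕫 ⊗ inv 𝕦) ⊗ (inv 𝕩 ⊗ 𝕪) ⊗ 𝕫) (x ∷ v ∷ y ∷ u ∷ []) refl

          open End stabʳ ∣K∣ normal K⊆H x∈ v∈ y∈ sX₀ sX₁ sY₀ (λ p → Y₁Y₁⁻¹ p u∈) w (≡sym (cancelˡ x v)) κ₀ (⁻¹∈ stabʳ (core y∈)) u≡
            (λ p → X₀Y₀ (p x x∈) y∈) (λ p → X₀Y₁ (p x x∈) u∈)

          contra : ⊥
          contra with mem? K (w · w)
          ... | yes p = klein p
          ... | no p = cyclic p cX₀ cX₁ cY₀ cY₁ cZ₀ cZ₁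

        module Three (∣R∣ : ∣ Stabʳ ∣ ≡ 3) (∣L∣ : ∣ Stabˡ ∣ ≡ 3) where
          R = Stabʳ
          L = Stabˡ

          L⊆H : L ⊆ H
          L⊆H {l} p = subst (_∈ H) (cancelʳ l x) (same-sideʳ i (proj₂ (p x x∈)) (proj₂ x∈))

          -- If a⁻¹la were outside R, the cosets aR, laR and l⁻¹aR would be disjoint, giving nine
          -- elements of X₀, which has six. The last two are separated by l³ = ε: a⁻¹l²a in R gives
          -- a⁻¹l⁴a = a⁻¹la in R.
          conj : ∀ {a l} → a ∈ X₀ → l ∈ L → a ⁻¹ · l · a ∈ R
          conj {a} {l} a∈ p with mem? R (a ⁻¹ · l · a)
          ... | yes q = q
          ... | no q = contradiction (begin
                9 ≡⟨ cong₂ _+_ (cong₂ _+_ ∣R∣ ∣R∣) ∣R∣ ⟨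
                ∣ R ∣ + ∣ R ∣ + ∣ R ∣ ≡⟨ cong₂ _+_ (cong₂ _+_ (∣◃∣ a R) (∣◃∣ (l · a) R)) (∣◃∣ (l ⁻¹ · a) R) ⟨
                ∣ a ◃ R ∣ + ∣ l · a ◃ R ∣ + ∣ l ⁻¹ · a ◃ R ∣ ≡⟨ +-assoc ∣ a ◃ R ∣ _ _ ⟩
                ∣ a ◃ R ∣ + (∣ l · a ◃ R ∣ + ∣ l ⁻¹ · a ◃ R ∣) ≤⟨ +-monoʳ-≤ ∣ a ◃ R ∣ (∣∣-disjoint (l · a ◃ R) (l ⁻¹ · a ◃ R) (X₀ ∩ ∁ (a ◃ R))
                    (λ {t} r → subX (p a a∈) r , λ s → q (subst (_∈ R) (free (inv 𝕩 ⊗ 𝕫 ⊗ inv (inv (𝕪 ⊗ 𝕩) ⊗ 𝕫)) (inv 𝕩 ⊗ 𝕪 ⊗ 𝕩) (a ∷ l ∷ t ∷ []) refl) (·∈ stabʳ s (⁻¹∈ stabʳ r))))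
                    (λ {t} r → subX (⁻¹∈ stabˡ p a a∈) r , λ s → q (subst (_∈ R) (free (inv (inv 𝕩 ⊗ 𝕫 ⊗ inv (inv (inv 𝕪 ⊗ 𝕩) ⊗ 𝕫))) (inv 𝕩 ⊗ 𝕪 ⊗ 𝕩) (a ∷ l ∷ t ∷ []) refl) (⁻¹∈ stabʳ (·∈ stabʳ s (⁻¹∈ stabʳ r)))))
                    (λ {t} r s → q (two t r s))) ⟩
                ∣ a ◃ R ∣ + ∣ X₀ ∩ ∁ (a ◃ R) ∣ ≤⟨ ∣∣-disjoint (a ◃ R) (X₀ ∩ ∁ (a ◃ R)) X₀ (subX a∈) proj₁ (λ r s → proj₂ s r) ⟩
                ∣ X₀ ∣ ≡⟨ cX₀ ⟩
                6 ∎) (from-no (9 ≤? 6))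
            where
            open ≤-Reasoning
            subX : ∀ {b t} → b ∈ X₀ → t ∈ b ◃ R → t ∈ X₀
            subX {b} {t} b∈ r = subst (_∈ X₀) (cancelˡ b t) (r b b∈)
            lll : l · (l · (l · ε)) ≡ ε
            lll = subst (λ m → l ^^ m ≡ ε) ∣L∣ (^-∣∣ stabˡ p)
            two : ∀ t → t ∈ l · a ◃ R → t ∈ l ⁻¹ · a ◃ R → a ⁻¹ · l · a ∈ R
            two t r s = subst (_∈ R) (trans (free ((inv (inv 𝕪 ⊗ 𝕩) ⊗ 𝕫 ⊗ inv (inv (𝕪 ⊗ 𝕩) ⊗ 𝕫)) ⊗ (inv (inv 𝕪 ⊗ 𝕩) ⊗ 𝕫 ⊗ inv (inv (𝕪 ⊗ 𝕩) ⊗ 𝕫))) (inv 𝕩 ⊗ 𝕪 ⊗ (𝕪 ⊗ (𝕪 ⊗ (𝕪 ⊗ 𝟙))) ⊗ 𝕩) (a ∷ l ∷ t ∷ []) refl)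
                 (trans (cong (λ z → a ⁻¹ · l · z · a) lll) (free (inv 𝕩 ⊗ 𝕪 ⊗ 𝟙 ⊗ 𝕩) (inv 𝕩 ⊗ 𝕪 ⊗ 𝕩) (a ∷ l ∷ []) refl)))
                 (·∈ stabʳ (·∈ stabʳ s (⁻¹∈ stabʳ r)) (·∈ stabʳ s (⁻¹∈ stabʳ r)))

          conj⁻ : ∀ {a r} → a ∈ X₀ → r ∈ R → a · r · a ⁻¹ ∈ L
          conj⁻ {a} a∈ = ⊆-full S R (λ {r} p → subst (_∈ R) (free (inv 𝕩 ⊗ (𝕩 ⊗ 𝕪 ⊗ inv 𝕩) ⊗ 𝕩) 𝕪 (a ∷ r ∷ []) refl) (conj a∈ p))
               (≤-reflexive (trans ∣R∣ (≡sym (trans (∣∣-bij S L (λ r → a · r · a ⁻¹) (λ l → a ⁻¹ · l · a) (λ r → free (inv 𝕩 ⊗ (𝕩 ⊗ 𝕪 ⊗ inv 𝕩) ⊗ 𝕩) 𝕪 (a ∷ r ∷ []) refl) bk id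
                 (λ {l} p → subst (_∈ L) (≡sym (bk l)) p)) ∣L∣))))
            where
            S : Sub n
            S = ⟪ (λ r → mem? L (a · r · a ⁻¹)) ⟫
            bk : ∀ l → a · (a ⁻¹ · l · a) · a ⁻¹ ≡ l
            bk l = free (𝕩 ⊗ (inv 𝕩 ⊗ 𝕪 ⊗ 𝕩) ⊗ inv 𝕩) 𝕪 (a ∷ l ∷ []) refl

          -- The normaliser of L in H. Every a in X₀ conjugates L to the same group R, so X₀x⁻¹ lies
          -- in M and |M| is 6 or 12.
          M : Sub n
          M = ⟪ (λ h → mem? H h ×-dec all? (λ l → mem? L l →-dec mem? L (h · l · h ⁻¹))) ⟫

          hM : IsSubgroup M
          hM = record
            { ε∈ = ε∈ hH , λ l p → subst (_∈ L) (free 𝕩 (𝟙 ⊗ 𝕩 ⊗ inv 𝟙) (l ∷ []) refl) p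
            ; ·∈ = λ { {g} {h} (p , q) (r , s) → ·∈ hH p r , λ l t → subst (_∈ L) (free (𝕩 ⊗ (𝕪 ⊗ 𝕫 ⊗ inv 𝕪) ⊗ inv 𝕩) (𝕩 ⊗ 𝕪 ⊗ 𝕫 ⊗ inv (𝕩 ⊗ 𝕪)) (g ∷ h ∷ l ∷ []) refl) (q _ (s l t)) }
            ; ⁻¹∈ = λ { {g} (p , q) → ⁻¹∈ hH p , λ l t → ⊆-full (S g) L (λ {z} r → subst (_∈ L) (free (𝕩 ⊗ (inv 𝕩 ⊗ 𝕪 ⊗ inv (inv 𝕩)) ⊗ inv 𝕩) 𝕪 (g ∷ z ∷ []) refl) (q _ r))
                 (≤-reflexive (≡sym (∣∣-bij (S g) L (λ l → g ⁻¹ · l · g ⁻¹ ⁻¹) (λ l → g · l · g ⁻¹) (λ l → free (𝕩 ⊗ (inv 𝕩 ⊗ 𝕪 ⊗ inv (inv 𝕩)) ⊗ inv 𝕩) 𝕪 (g ∷ l ∷ []) refl) (bk g) id (λ {l} r → subst (_∈ L) (≡sym (bk g l)) r)))) t } }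
            where
            S : Fin n → Sub n
            S g = ⟪ (λ l → mem? L (g ⁻¹ · l · g ⁻¹ ⁻¹)) ⟫
            bk : ∀ g l → g ⁻¹ · (g · l · g ⁻¹) · g ⁻¹ ⁻¹ ≡ l
            bk g l = free (inv 𝕩 ⊗ (𝕩 ⊗ 𝕪 ⊗ inv 𝕩) ⊗ inv (inv 𝕩)) 𝕪 (g ∷ l ∷ []) refl

          X₀x⁻¹ : ∀ {a} → a ∈ X₀ → a · x ⁻¹ ∈ M
          X₀x⁻¹ {a} p = same-sideʳ i (proj₂ p) (proj₂ x∈) , λ l q → subst (_∈ L) (free (𝕩 ⊗ (inv 𝕪 ⊗ 𝕫 ⊗ 𝕪) ⊗ inv 𝕩) (𝕩 ⊗ inv 𝕪 ⊗ 𝕫 ⊗ inv (𝕩 ⊗ inv 𝕪)) (a ∷ x ∷ l ∷ []) refl) (conj⁻ p (conj x∈ q))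

          6≤M : 6 ≤ ∣ M ∣
          6≤M = subst (_≤ ∣ M ∣) cX₀ (∣∣-inj X₀ M (_· x ⁻¹) X₀x⁻¹ (λ _ _ → ·-cancelʳ (x ⁻¹)))

          -- M would equal X₀x⁻¹ and would itself stabilise X₀ from the left, but that stabiliser
          -- has order three.
          not6 : ∣ M ∣ ≢ 6
          not6 m6 = contradiction (subst₂ _≤_ m6 ∣L∣ (∣∣-mono M L M⊆L)) (from-no (6 ≤? 3))
            where
            M⊆X₀x⁻¹ : ∀ {m} → m ∈ M → m · x ∈ X₀
            M⊆X₀x⁻¹ {m} p = subst (λ z → m · z ∈ X₀) (⁻¹⁻¹ x) (⊆-full (X₀ ▹ x ⁻¹) M (λ {t} q → subst (_∈ M) (free (𝕩 ⊗ inv (inv 𝕪) ⊗ inv 𝕪) 𝕩 (t ∷ x ∷ []) refl) (X₀x⁻¹ q)) (≤-reflexive (trans m6 (≡sym (trans (∣▹∣ X₀ (x ⁻¹)) cX₀)))) p)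
            M⊆L : M ⊆ L
            M⊆L {m} p a a∈ = subst (_∈ X₀) (free (𝕩 ⊗ (𝕪 ⊗ inv 𝕫) ⊗ 𝕫) (𝕩 ⊗ 𝕪) (m ∷ a ∷ x ∷ []) refl) (M⊆X₀x⁻¹ (·∈ hM p (X₀x⁻¹ a∈)))

          -- In the remaining case L is normal in H, and X₀ = Lx ∪ La for some a. Put h = ax⁻¹. If
          -- h² were in L, then h would exchange the two cosets and stabilise X₀, although it is
          -- outside L. So H / L is cyclic of order four with |L| odd, against the zero sums of H.
          contra : ⊥
          contra = done (six-or-twelve ∣ M ∣ 6≤M (subst (∣ M ∣ ∣_) ∣H∣ (lagrange hM hH proj₁)))
            where
            done : ∣ M ∣ ≡ 6 ⊎ ∣ M ∣ ≡ 12 → ⊥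
            done (inj₁ m6) = not6 m6
            done (inj₂ m12) = Quarter.quarter-¬ZeroSum hH stabˡ L⊆H (λ {h} {l} p q → normal p q) (trans ∣H∣ (≡sym (cong₂ _+_ (cong₂ _+_ ∣L∣ ∣L∣) (cong₂ _+_ ∣L∣ ∣L∣)))) {h} (proj₁ h∈M) h²∉ 1 ∣L∣ zs
              where
              normal : ∀ {h l} → h ∈ H → l ∈ L → h · l · h ⁻¹ ∈ L
              normal p q = proj₂ (⊆-full M H proj₁ (≤-reflexive (trans ∣H∣ (≡sym m12))) p) _ q
              rest = nonempty (X₀ ∩ ∁ (L ▹ x)) (+-cancelˡ-< 3 0 _ (begin-strict
                 3 <⟨ from-yes (3 <? 6) ⟩
                 6 ≡⟨ cX₀ ⟨
                 ∣ X₀ ∣ ≡⟨ ∣∣-split X₀ (L ▹ x) ⟩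
                 ∣ X₀ ∩ (L ▹ x) ∣ + ∣ X₀ ∩ ∁ (L ▹ x) ∣ ≤⟨ +-monoˡ-≤ _ (∣∣-mono (X₀ ∩ (L ▹ x)) (L ▹ x) proj₂) ⟩
                 ∣ L ▹ x ∣ + ∣ X₀ ∩ ∁ (L ▹ x) ∣ ≡⟨ cong (_+ ∣ X₀ ∩ ∁ (L ▹ x) ∣) (trans (∣▹∣ L x) ∣L∣) ⟩
                 3 + ∣ X₀ ∩ ∁ (L ▹ x) ∣ ∎))
                where open ≤-Reasoning
              a = proj₁ rest
              a∈ = proj₁ (proj₂ rest)
              h = a · x ⁻¹
              h∉L : ¬ h ∈ L
              h∉L = proj₂ (proj₂ rest)
              h∈M = X₀x⁻¹ a∈
              lx : ∀ {l b} → l ∈ L → b ∈ X₀ → l · b ∈ X₀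
              lx p q = p _ q
              cover : ∀ {c} → c ∈ X₀ → ¬ c ∈ L ▹ x → c ∈ L ▹ a
              cover {c} p q = proj₂ (⊆-full (X₀ ∩ (L ▹ a)) (X₀ ∩ ∁ (L ▹ x)) (λ { {t} (r , s) → r , λ z → h∉L (subst (_∈ L) (free (inv (𝕩 ⊗ inv 𝕪) ⊗ (𝕩 ⊗ inv 𝕫)) (𝕪 ⊗ inv 𝕫) (t ∷ a ∷ x ∷ []) refl) (·∈ stabˡ (⁻¹∈ stabˡ s) z)) })
                 (+-cancelˡ-≤ 3 _ _ (≤-reflexive (trans (trans (cong (_+ ∣ X₀ ∩ ∁ (L ▹ x) ∣) (≡sym (sz x∈))) (trans (≡sym (∣∣-split X₀ (L ▹ x))) cX₀)) (cong (3 +_) (≡sym (sz a∈)))))) (p , q))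
                where
                sz : ∀ {b} → b ∈ X₀ → ∣ X₀ ∩ (L ▹ b) ∣ ≡ 3
                sz {b} b∈ = trans (∣∣-cong (X₀ ∩ (L ▹ b)) (L ▹ b) proj₂ (λ {t} p → subst (_∈ X₀) (cancelʳ′ t b) (lx p b∈) , p)) (trans (∣▹∣ L b) ∣L∣)
              h²∉ : ¬ h · h ∈ L
              h²∉ hh = h∉L stab
                where
                stab : h ∈ L
                stab c c∈ = split (mem? (L ▹ x) c)
                  where
                  split : Dec (c ∈ L ▹ x) → h · c ∈ X₀
                  split (yes p) = subst (_∈ X₀) (free (𝕩 ⊗ inv 𝕪 ⊗ (𝕫 ⊗ inv 𝕪) ⊗ inv (𝕩 ⊗ inv 𝕪) ⊗ 𝕩) (𝕩 ⊗ inv 𝕪 ⊗ 𝕫) (a ∷ x ∷ c ∷ []) refl) (lx (normal (proj₁ h∈M) p) a∈)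
                  split (no p) = subst (_∈ X₀) (free (𝕩 ⊗ inv 𝕪 ⊗ (𝕫 ⊗ inv 𝕩) ⊗ inv (𝕩 ⊗ inv 𝕪) ⊗ (𝕩 ⊗ inv 𝕪 ⊗ (𝕩 ⊗ inv 𝕪)) ⊗ 𝕪) (𝕩 ⊗ inv 𝕪 ⊗ 𝕫) (a ∷ x ∷ c ∷ []) refl)
                        (lx (·∈ stabˡ (normal (proj₁ h∈M) (cover c∈ p)) hh) x∈)

        last : ⊥
        last = go R₃₆ L₃₆
          where
          go : ∣ Stabʳ ∣ ≡ 3 ⊎ ∣ Stabʳ ∣ ≡ 6 → ∣ Stabˡ ∣ ≡ 3 ⊎ ∣ Stabˡ ∣ ≡ 6 → ⊥
          go (inj₂ r) _ = Six.contra r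
          go (inj₁ r) (inj₁ l) = Three.contra r l
          -- With |L| = 6 the set X₀ is the single coset Lx, so x⁻¹Lx stabilises it from the right
          -- and R would have at least six elements.
          go (inj₁ r) (inj₂ l) = contradiction (subst₂ _≤_ l r (∣∣-inj Stabˡ Stabʳ (λ g → x ⁻¹ · g · x) into (λ _ _ z → ·-cancelˡ (x ⁻¹) (·-cancelʳ x z)))) (from-no (6 ≤? 3))
            where
            Lx : ∀ {c} → c ∈ X₀ → c · x ⁻¹ ∈ Stabˡ
            Lx = ⊆-full (Stabˡ ▹ x) X₀ (λ {t} p → subst (_∈ X₀) (cancelʳ′ t x) (p x x∈)) (≤-reflexive (trans cX₀ (≡sym (trans (∣▹∣ Stabˡ x) l))))
            into : ∀ {g} → g ∈ Stabˡ → x ⁻¹ · g · x ∈ Stabʳ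
            into {g} p a a∈ = subst (_∈ X₀) (free (𝕩 ⊗ inv 𝕪 ⊗ 𝕫 ⊗ 𝕪) (𝕩 ⊗ (inv 𝕪 ⊗ 𝕫 ⊗ 𝕪)) (a ∷ x ∷ g ∷ []) refl) (·∈ stabˡ (Lx a∈) p x x∈)

  -- Distribution of sizes over the two sides for orders 10 and 24

  module SizeCases where
    module _ {H} (hH : IsSubgroup H) (half : ∣ H ∣ + ∣ H ∣ ≡ n) {k} (C : Config k) where
      open Halves hH half
      open SideConfig C

      a b d : Bool → ℕ
      a i = ∣ Aˢ i ∣
      b i = ∣ Bˢ i ∣
      d i = ∣ Dˢ i ∣

      rot : ∀ i j → j xor (i xor j) ≡ i
      rot false false = refl
      rot false true = refl
      rot true false = refl
      rot true true = refl

      rot′ : ∀ i j → (i xor j) xor i ≡ j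
      rot′ false false = refl
      rot′ false true = refl
      rot′ true false = refl
      rot′ true true = refl

      fits : Fits k ∣ H ∣ a b d
      fits = ≡sym (≈⇒% 2 side-parity) , λ i j →
        pair-bound i j ,
        (λ p → SideConfig.pair-bound (rotate C) j (i xor j) (subst (λ z → 0 < a z) (≡sym (rot i j)) p)) ,
        (λ p → SideConfig.pair-bound (rotate (rotate C)) (i xor j) i (subst (λ z → 0 < b z) (≡sym (rot′ i j)) p))

      hit : ∀ {m ts} → ∣ H ∣ ≡ m → Critical k m ts → AnyHit ts a b d
      hit {m} {ts} refl cr = fit a ∣Aˢ∣ λ x ex → fit b ∣Bˢ∣ λ y ey → fit d ∣Dˢ∣ λ z ez →
          any-cong ex ey ez (cr x y z (fits-cong (≡sym ∘ ex) (≡sym ∘ ey) (≡sym ∘ ez) fits))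
        where
        fit : ∀ (f : Bool → ℕ) → f false + f true ≡ k → ∀ {P : Set} → (∀ (x : Fin (suc k)) → (∀ i → side-size k (toℕ x) i ≡ f i) → P) → P
        fit f e g = g (fromℕ< lt) λ { false → toℕ-fromℕ< lt ; true → trans (cong (k ∸_) (toℕ-fromℕ< lt)) (trans (cong (_∸ f false) (≡sym e)) (m+n∸m≡n (f false) _)) }
          where
          lt : f false < suc k
          lt = s≤s (subst (f false ≤_) e (m≤m+n _ _))
        fits-cong : ∀ {f f′ g g′ h h′} → (∀ i → f i ≡ f′ i) → (∀ i → g i ≡ g′ i) → (∀ i → h i ≡ h′ i) → Fits k ∣ H ∣ f g h → Fits k ∣ H ∣ f′ g′ h′
        fits-cong p q r (e , s) = trans (cong (_% 2) (≡sym (cong₂ _+_ (cong₂ _+_ (p true) (q true)) (r true)))) e , λ i j →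
          let s₁ , s₂ , s₃ = s i j in
          (λ z → subst₂ (λ x y → x + y ≤ ∣ H ∣) (p i) (q j) (s₁ (subst (0 <_) (≡sym (r _)) z))) ,
          (λ z → subst₂ (λ x y → x + y ≤ ∣ H ∣) (q j) (r _) (s₂ (subst (0 <_) (≡sym (p i)) z))) ,
          (λ z → subst₂ (λ x y → x + y ≤ ∣ H ∣) (r _) (p i) (s₃ (subst (0 <_) (≡sym (q j)) z)))
        hit-cong : ∀ {f f′ g g′ h h′} → (∀ i → f i ≡ f′ i) → (∀ i → g i ≡ g′ i) → (∀ i → h i ≡ h′ i) → Hit ts f g h → Hit ts f′ g′ h′
        hit-cong p q r (i , j , z) = i , j , subst (_∈L ts) (cong₂ _,_ (p i) (cong₂ _,_ (q j) (r _))) z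
        any-cong : ∀ {f f′ g g′ h h′} → (∀ i → f i ≡ f′ i) → (∀ i → g i ≡ g′ i) → (∀ i → h i ≡ h′ i) → AnyHit ts f g h → AnyHit ts f′ g′ h′
        any-cong p q r (inj₁ z) = inj₁ (hit-cong p q r z)
        any-cong p q r (inj₂ (inj₁ z)) = inj₂ (inj₁ (hit-cong q r p z))
        any-cong p q r (inj₂ (inj₂ z)) = inj₂ (inj₂ (hit-cong r p q z))

    -- At the critical triple |E| = 5 - 3 = 2. Freiman's subgroup satisfies 2|K| ≤ 4 and contains a
    -- translate of a two-element set, so it has order two and cannot lie in H, whose order is five.
    no-config₁₀ : n ≡ 10 → ¬ Config 4
    no-config₁₀ n≡ C = let H , hH , ∣H∣ = half-4j+2 2 n≡ in dispatch hH ∣H∣ C (hit hH (trans (cong₂ _+_ ∣H∣ ∣H∣) (≡sym n≡)) C ∣H∣ critical₁₀)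
      where
      module _ {H} (hH : IsSubgroup H) (∣H∣ : ∣ H ∣ ≡ 5) where
        open Halves hH (trans (cong₂ _+_ ∣H∣ ∣H∣) (≡sym n≡))
        contra : ∀ (C : Config 4) i j → let open SideConfig C in ∣ Aˢ i ∣ ≡ 2 → ∣ Bˢ j ∣ ≡ 2 → ∣ Dˢ (i xor j) ∣ ≡ 3 → ⊥
        contra C i j ca cb cd = contradiction (subst₂ _∣_ K≡2 ∣H∣ (lagrange subgroup hH (λ { {κ} (a , p , q) → subst (_∈ H) (cancelˡ′ a κ) (same-sideˡ i (proj₂ p) (proj₂ q)) }))) (from-no (2 ∣? 5))
          where
          open SideConfig C
          ce : ∣ Eˢ (i xor j) ∣ ≡ 2
          ce = +-cancelˡ-≡ 3 _ _ (trans (cong (_+ ∣ Eˢ (i xor j) ∣) (≡sym cd)) (trans (∣Eˢ∣ (i xor j)) ∣H∣))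
          open Freiman (Aˢ i) (Bˢ j) (Eˢ (i xor j)) (prod i j) (<-via ce (cong₂ _+_ ca ca) (from-yes (2 <? 4))) (<-via (cong₂ _+_ ce ce) (cong₂ _+_ (cong₂ _+_ cb cb) cb) (from-yes (4 <? 6)))
          a₀ = nonempty (Aˢ i) (subst (0 <_) (≡sym ca) (s≤s z≤n))
          K≡2 : ∣ K ∣ ≡ 2
          K≡2 = ≤-antisym (*-cancelʳ-≤ ∣ K ∣ 2 2 (subst₂ (λ y e → ∣ K ∣ * (y + y ∸ e) ≤ y * y) cb ce bound))
                 (subst (_≤ ∣ K ∣) ca (∣∣-inj (Aˢ i) K (proj₁ a₀ ⁻¹ ·_) (A⁻¹A⊆K (proj₂ a₀)) (λ _ _ → ·-cancelˡ _)))
        one : ∀ (C : Config 4) → let open SideConfig C in Hit triples₁₀ (λ i → ∣ Aˢ i ∣) (λ i → ∣ Bˢ i ∣) (λ i → ∣ Dˢ i ∣) → ⊥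
        one C (i , j , here e) = contra C i j (cong proj₁ e) (cong (proj₁ ∘ proj₂) e) (cong (proj₂ ∘ proj₂) e)
        dispatch : ∀ C → let open SideConfig C in AnyHit triples₁₀ (λ i → ∣ Aˢ i ∣) (λ i → ∣ Bˢ i ∣) (λ i → ∣ Dˢ i ∣) → ⊥
        dispatch C (inj₁ h) = one C h
        dispatch C (inj₂ (inj₁ h)) = one (rotate C) h
        dispatch C (inj₂ (inj₂ h)) = one (rotate (rotate C)) h

    no-config₂₄ : n ≡ 24 → ∀ {H} → IsSubgroup H → ∣ H ∣ ≡ 12 → ZeroSum H → ¬ Config 9
    no-config₂₄ n≡ {H} hH ∣H∣ zs C = dispatch C (hit hH (trans (cong₂ _+_ ∣H∣ ∣H∣) (≡sym n≡)) C ∣H∣ critical₂₄)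
      where
      open Halves hH (trans (cong₂ _+_ ∣H∣ ∣H∣) (≡sym n≡))
      other : ∀ i {f : Bool → ℕ} {c} → f false + f true ≡ 9 → f i ≡ c → f (not i) ≡ 9 ∸ c
      other false {f} {c} e refl = trans (≡sym (m+n∸m≡n (f false) (f true))) (cong (_∸ f false) e)
      other true {f} {c} e refl = trans (≡sym (m+n∸n≡m (f false) (f true))) (cong (_∸ f true) e)
      one : ∀ (C : Config 9) → let open SideConfig C in Hit triples₂₄ (λ i → ∣ Aˢ i ∣) (λ i → ∣ Bˢ i ∣) (λ i → ∣ Dˢ i ∣) → ⊥
      one C (i , j , h) = go h
        where
        open SideConfig C
        open TwentyFour.Cross n≡ hH ∣H∣ C i j
        open TwentyFourCases.CosetCase n≡ hH ∣H∣ C i j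
        E≡ : ∀ l {c} → ∣ Dˢ l ∣ ≡ c → ∣ Eˢ l ∣ ≡ 12 ∸ c
        E≡ l refl = trans (≡sym (m+n∸m≡n ∣ Dˢ l ∣ ∣ Eˢ l ∣)) (cong (_∸ ∣ Dˢ l ∣) (trans (∣Eˢ∣ l) ∣H∣))
        module Sizes {x y z} (e : (∣ X₀ ∣ , ∣ Y₀ ∣ , ∣ Z₀ ∣) ≡ (x , y , z)) where
          x0 = cong proj₁ e
          y0 = cong (proj₁ ∘ proj₂) e
          z0 = cong (proj₂ ∘ proj₂) e
          x1 = other i {λ i → ∣ Aˢ i ∣} ∣Aˢ∣ x0
          y1 = other j {λ i → ∣ Bˢ i ∣} ∣Bˢ∣ y0
          z1 = other ij {λ i → ∣ Dˢ i ∣} ∣Dˢ∣ z0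
        go : (∣ X₀ ∣ , ∣ Y₀ ∣ , ∣ Z₀ ∣) ∈L triples₂₄ → ⊥
        go (here e) = TwentyFourLast.Last.Sized.last n≡ hH ∣H∣ zs C i j x0 x1 y0 y1 z0 z1 (E≡ ij z0) (E≡ (not ij) z1)
             (proj₂ (nonempty X₀ (pos X₀ x0))) (proj₂ (nonempty X₁ (pos X₁ x1))) (proj₂ (nonempty Y₁ (pos Y₁ y1))) (proj₂ (nonempty Y₀ (pos Y₀ y0)))
          where
          open Sizes e
          pos : ∀ (S : Sub n) {c} → ∣ S ∣ ≡ suc c → 0 < ∣ S ∣
          pos S p = subst (0 <_) (≡sym p) (s≤s z≤n)
        go (there (here e)) = SixCosets.contra x0 x1 y0 y1 (E≡ ij z0) (E≡ (not ij) z1)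
            (from-yes (7 <? 8)) (from-yes (14 <? 18)) (from-yes (36 <? 50)) (from-yes (5 ≤? 6)) (from-yes (7 ≤? 7)) (from-yes (8 <? 12)) (from-yes (7 <? 10))
            (from-yes (6 <? 7)) (from-yes (6 <? 11)) (from-yes (6 <? 8)) (from-yes (8 <? 12)) (from-yes (0 <? 3))
          where open Sizes e
        go (there (there (here e))) = SixCosets.contra x0 x1 y0 y1 (E≡ ij z0) (E≡ (not ij) z1)
            (from-yes (7 <? 10)) (from-yes (14 <? 15)) (from-yes (25 <? 30)) (from-yes (5 ≤? 5)) (from-yes (7 ≤? 7)) (from-yes (8 <? 10)) (from-yes (7 <? 8))
            (from-yes (6 <? 9)) (from-yes (6 <? 9)) (from-yes (6 <? 8)) (from-yes (8 <? 12)) (from-yes (0 <? 4))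
          where open Sizes e
        go (there (there (there (here e)))) = SixCosets.contra x0 x1 y0 y1 (E≡ ij z0) (E≡ (not ij) z1)
            (from-yes (6 <? 10)) (from-yes (12 <? 18)) (from-yes (36 <? 66)) (from-yes (5 ≤? 6)) (from-yes (6 ≤? 7)) (from-yes (9 <? 12)) (from-yes (6 <? 8))
            (from-yes (6 <? 8)) (from-yes (6 <? 10)) (from-yes (6 <? 7)) (from-yes (9 <? 12)) (from-yes (0 <? 3))
          where open Sizes e
        go (there (there (there (there (here e))))) = five-five-seven (cong proj₁ e) (cong (proj₁ ∘ proj₂) e) (E≡ ij (cong (proj₂ ∘ proj₂) e))
      dispatch : ∀ C → let open SideConfig C in AnyHit triples₂₄ (λ i → ∣ Aˢ i ∣) (λ i → ∣ Bˢ i ∣) (λ i → ∣ Dˢ i ∣) → ⊥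
      dispatch C (inj₁ h) = one C h
      dispatch C (inj₂ (inj₁ h)) = one (rotate C) h
      dispatch C (inj₂ (inj₂ h)) = one (rotate (rotate C)) h

  -- Class equation

  -- Conjugacy and centralisers of G / N, expressed by their preimages in G so that no quotient
  -- group has to be formed. The trivial N gives back the ordinary notions.
  module Modulo {N} (hN : IsSubgroup N) (normal : ∀ {z κ} → κ ∈ N → z · κ · z ⁻¹ ∈ N) where

    normal⁻ : ∀ {z κ} → κ ∈ N → z ⁻¹ · κ · z ∈ N
    normal⁻ {z} {κ} p = subst (λ t → z ⁻¹ · κ · t ∈ N) (⁻¹⁻¹ z) (normal p)

    Cent : Fin n → Sub n
    Cent x = ⟪ (λ g → mem? N (x ⁻¹ · (g · x · g ⁻¹))) ⟫

    cent : ∀ x → IsSubgroup (Cent x)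
    cent x = record
      { ε∈ = subst (_∈ N) (free 𝟙 (inv 𝕩 ⊗ (𝟙 ⊗ 𝕩 ⊗ inv 𝟙)) (x ∷ []) refl) (ε∈ hN)
      ; ·∈ = λ {g} {h} p q → subst (_∈ N) (free ((inv 𝕩 ⊗ (𝕪 ⊗ 𝕩 ⊗ inv 𝕪)) ⊗ (𝕪 ⊗ (inv 𝕩 ⊗ (𝕫 ⊗ 𝕩 ⊗ inv 𝕫)) ⊗ inv 𝕪)) (inv 𝕩 ⊗ (𝕪 ⊗ 𝕫 ⊗ 𝕩 ⊗ inv (𝕪 ⊗ 𝕫))) (x ∷ g ∷ h ∷ []) refl) (·∈ hN p (normal {g} q))
      ; ⁻¹∈ = λ {g} p → subst (_∈ N) (free (inv 𝕪 ⊗ inv (inv 𝕩 ⊗ (𝕪 ⊗ 𝕩 ⊗ inv 𝕪)) ⊗ 𝕪) (inv 𝕩 ⊗ (inv 𝕪 ⊗ 𝕩 ⊗ inv (inv 𝕪))) (x ∷ g ∷ []) refl) (normal⁻ {g} (⁻¹∈ hN p)) }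

    Conj : Fin n → Fin n → Set
    Conj x y = ∃ λ g → y ⁻¹ · (g · x · g ⁻¹) ∈ N

    conj? : ∀ x y → Dec (Conj x y)
    conj? x y = any? (λ g → mem? N (y ⁻¹ · (g · x · g ⁻¹)))

    conj-refl : ∀ {x} → Conj x x
    conj-refl {x} = ε , ε∈ (cent x)

    conj-sym : ∀ {x y} → Conj x y → Conj y x
    conj-sym {x} {y} (g , p) = g ⁻¹ , subst (_∈ N) (free (inv 𝕫 ⊗ inv (inv 𝕪 ⊗ (𝕫 ⊗ 𝕩 ⊗ inv 𝕫)) ⊗ 𝕫) (inv 𝕩 ⊗ (inv 𝕫 ⊗ 𝕪 ⊗ inv (inv 𝕫))) (x ∷ y ∷ g ∷ []) refl) (normal⁻ {g} (⁻¹∈ hN p))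

    conj-trans : ∀ {x y z} → Conj x y → Conj y z → Conj x z
    conj-trans {x} {y} {z} (g , p) (h , q) = h · g , subst (_∈ N) (free ((inv 𝕫 ⊗ (𝕧 ⊗ 𝕪 ⊗ inv 𝕧)) ⊗ (𝕧 ⊗ (inv 𝕪 ⊗ (𝕦 ⊗ 𝕩 ⊗ inv 𝕦)) ⊗ inv 𝕧)) (inv 𝕫 ⊗ (𝕧 ⊗ 𝕦 ⊗ 𝕩 ⊗ inv (𝕧 ⊗ 𝕦))) (x ∷ y ∷ z ∷ g ∷ h ∷ []) refl) (·∈ hN q (normal {h} p))

    -- Counts the pairs (g, y) with y in the coset of gxg⁻¹ modulo N: each g has |N| partners, and
    -- the g belonging to one y form a coset of the centraliser.
    class-equation : ∀ x → ∣ ⟪ conj? x ⟫ ∣ * ∣ Cent x ∣ ≡ n * ∣ N ∣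
    class-equation x = ≤-antisym
      (subst (λ z → ∣ ⟪ conj? x ⟫ ∣ * ∣ Cent x ∣ ≤ z * ∣ N ∣) (∣full∣ {n}) (double-count (λ y g → Q? g y) ⟪ conj? x ⟫ (full {n}) ∣ Cent x ∣ ∣ N ∣ (λ p → ≤-reflexive (≡sym (cols p))) (λ {g} _ → ≤-reflexive (rows g)) (λ _ → tt)))
      (subst (λ z → z * ∣ N ∣ ≤ ∣ ⟪ conj? x ⟫ ∣ * ∣ Cent x ∣) (∣full∣ {n}) (double-count Q? (full {n}) ⟪ conj? x ⟫ ∣ N ∣ ∣ Cent x ∣ (λ {g} _ → ≤-reflexive (≡sym (rows g))) (λ p → ≤-reflexive (cols p)) (λ {g} p → g , p)))
      where
      Q? : ∀ g y → Dec (y ⁻¹ · (g · x · g ⁻¹) ∈ N)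
      Q? g y = mem? N (y ⁻¹ · (g · x · g ⁻¹))
      rows : ∀ g → ∣ ⟪ Q? g ⟫ ∣ ≡ ∣ N ∣
      rows g = ∣∣-bij ⟪ Q? g ⟫ N (λ y → y ⁻¹ · c) (λ κ → c · κ ⁻¹)
        (λ y → free (𝕪 ⊗ inv (inv 𝕩 ⊗ 𝕪)) 𝕩 (y ∷ c ∷ []) refl) bk id (λ {κ} p → subst (_∈ N) (≡sym (bk κ)) p)
        where
        c = g · x · g ⁻¹
        bk : ∀ κ → (c · κ ⁻¹) ⁻¹ · c ≡ κ
        bk κ = free (inv (𝕪 ⊗ inv 𝕩) ⊗ 𝕪) 𝕩 (κ ∷ c ∷ []) refl
      cols : ∀ {y} → y ∈ ⟪ conj? x ⟫ → ∣ ⟪ (λ g → Q? g y) ⟫ ∣ ≡ ∣ Cent x ∣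
      cols {y} (g₀ , p) = ∣∣-bij ⟪ (λ g → Q? g y) ⟫ (Cent x) (g₀ ⁻¹ ·_) (g₀ ·_) (cancelˡ g₀) (cancelˡ′ g₀)
        (λ {g} q → subst (_∈ N) (free (inv 𝕫 ⊗ (inv (inv 𝕪 ⊗ (𝕫 ⊗ 𝕩 ⊗ inv 𝕫)) ⊗ (inv 𝕪 ⊗ (𝕦 ⊗ 𝕩 ⊗ inv 𝕦))) ⊗ 𝕫) (inv 𝕩 ⊗ (inv 𝕫 ⊗ 𝕦 ⊗ 𝕩 ⊗ inv (inv 𝕫 ⊗ 𝕦))) (x ∷ y ∷ g₀ ∷ g ∷ []) refl) (normal⁻ {g₀} (·∈ hN (⁻¹∈ hN p) q)))
        (λ {k} q → subst (_∈ N) (free ((inv 𝕪 ⊗ (𝕫 ⊗ 𝕩 ⊗ inv 𝕫)) ⊗ (𝕫 ⊗ (inv 𝕩 ⊗ (𝕦 ⊗ 𝕩 ⊗ inv 𝕦)) ⊗ inv 𝕫)) (inv 𝕪 ⊗ (𝕫 ⊗ 𝕦 ⊗ 𝕩 ⊗ inv (𝕫 ⊗ 𝕦))) (x ∷ y ∷ g₀ ∷ k ∷ []) refl) (·∈ hN p (normal {g₀} q)))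

    class-size : ∀ x {q} → n ≡ q * ∣ Cent x ∣ → ∣ ⟪ conj? x ⟫ ∣ ≡ q * ∣ N ∣
    class-size x {q} e = *-cancelʳ-≡ _ _ ∣ Cent x ∣ {{>-nonZero (∣∣-pos (Cent x) (ε∈ (cent x)))}} (trans (class-equation x) (trans (cong (_* ∣ N ∣) e) (l q _ _)))
      where
      l : ∀ a b c → a * b * c ≡ a * c * b
      l = solve-∀

    Central : Fin n → Set
    Central x = ∀ g → x ⁻¹ · (g · x · g ⁻¹) ∈ N

    central? : ∀ x → Dec (Central x)
    central? x = all? (λ g → mem? (Cent x) g)

    central-conj : ∀ {x y} → Central x → Conj x y → x ⁻¹ · y ∈ N
    central-conj {x} {y} c (g , p) = subst (_∈ N) (free ((inv 𝕩 ⊗ (𝕫 ⊗ 𝕩 ⊗ inv 𝕫)) ⊗ inv (inv 𝕪 ⊗ (𝕫 ⊗ 𝕩 ⊗ inv 𝕫))) (inv 𝕩 ⊗ 𝕪) (x ∷ y ∷ g ∷ []) refl) (·∈ hN (c g) (⁻¹∈ hN p))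

    central-ε : ∀ {κ} → κ ∈ N → Central κ
    central-ε {κ} p g = ·∈ hN (⁻¹∈ hN p) (normal p)

    central-· : ∀ {x y} → Central x → Central y → Central (x · y)
    central-· {x} {y} p q g = subst (_∈ N) (free (inv 𝕪 ⊗ (inv 𝕩 ⊗ (𝕫 ⊗ 𝕩 ⊗ inv 𝕫)) ⊗ 𝕪 ⊗ (inv 𝕪 ⊗ (𝕫 ⊗ 𝕪 ⊗ inv 𝕫))) (inv (𝕩 ⊗ 𝕪) ⊗ (𝕫 ⊗ (𝕩 ⊗ 𝕪) ⊗ inv 𝕫)) (x ∷ y ∷ g ∷ []) refl) (·∈ hN (normal⁻ {y} (p g)) (q g))

    -- The centre of a non-trivial 2-group is non-trivial. If no element outside N were central
    -- modulo N, every class outside N would have size divisible by 2|N|; as 2|N| divides n, it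
    -- would divide |N|.
    central-outside : ∀ m → n ≡ 2 ^ m → ∀ c → n ≡ c * (2 * ∣ N ∣) → ∃ λ x → ¬ x ∈ N × Central x
    central-outside m pow c e with any? (λ x → ¬? (mem? N x) ×-dec central? x)
    ... | yes p = p
    ... | no none = contradiction (∣⇒≤ {{>-nonZero pos}} bad) (<⇒≱ (m<m+n ∣ N ∣ {∣ N ∣ + 0} (subst (0 <_) (≡sym (+-identityʳ _)) pos)))
      where
      pos : 0 < ∣ N ∣
      pos = ∣∣-pos N (ε∈ hN)
      dv : ∀ {x} → x ∈ ∁ N → 2 * ∣ N ∣ ∣ ∣ ⟪ conj? x ⟫ ∣
      dv {x} p = go (lagrange-full (cent x))
        where
        go : ∣ Cent x ∣ ∣ n → 2 * ∣ N ∣ ∣ ∣ ⟪ conj? x ⟫ ∣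
        go (divides q eq) = subst (2 * ∣ N ∣ ∣_) (≡sym (class-size x {q} eq)) (two (power-of-two m q (divides ∣ Cent x ∣ (trans (≡sym pow) (trans eq (*-comm q _))))))
          where
          two : q ≡ 1 ⊎ 2 ∣ q → 2 * ∣ N ∣ ∣ q * ∣ N ∣
          two (inj₁ refl) = contradiction (x , p , λ g → ⊆-full (Cent x) full (λ _ → tt) (≤-reflexive (trans ∣full∣ (trans eq (+-identityʳ _)))) {g} tt) none
          two (inj₂ (divides r refl)) = divides r (*-assoc r 2 ∣ N ∣)
      bad : 2 * ∣ N ∣ ∣ ∣ N ∣
      bad = ∣m+n∣m⇒∣n (subst (2 * ∣ N ∣ ∣_) (trans (≡sym (∣∣-∁ N)) (+-comm ∣ N ∣ _)) (divides c e))
              (class-divides conj? (2 * ∣ N ∣) (∁ N) (λ _ → conj-refl) conj-sym conj-trans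
                 (λ {x} {y} x∉ (g , p) y∈ → x∉ (subst (_∈ N) (free (inv 𝕫 ⊗ (𝕪 ⊗ (inv 𝕪 ⊗ (𝕫 ⊗ 𝕩 ⊗ inv 𝕫))) ⊗ 𝕫) 𝕩 (x ∷ y ∷ g ∷ []) refl) (normal⁻ {g} (·∈ hN y∈ p)))) dv)

    -- Repeated squaring of a central element ends in N, and its last value outside N is the
    -- required element.
    central-square : ∀ m → n ≡ 2 ^ m → ∀ c → n ≡ c * (2 * ∣ N ∣) → ∃ λ x → ¬ x ∈ N × Central x × x · x ∈ N
    central-square m pow c e = let x , x∉ , cx = central-outside m pow c e in
        go m x x∉ cx (subst (_∈ N) (≡sym (trans (cong (x ^^_) (trans (≡sym pow) (≡sym ∣full∣))) (^-∣∣ full-subgroup tt))) (ε∈ hN))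
      where
      ^-square : ∀ x k → (x · x) ^^ k ≡ x ^^ (2 * k)
      ^-square x zero = refl
      ^-square x (suc k) = trans (cong (x · x ·_) (^-square x k)) (trans (assoc x x _) (cong (x ^^_) (l k)))
        where
        l : ∀ k → 2 + 2 * k ≡ 2 * suc k
        l = solve-∀
      go : ∀ k x → ¬ x ∈ N → Central x → x ^^ (2 ^ k) ∈ N → ∃ λ x → ¬ x ∈ N × Central x × x · x ∈ N
      go zero x x∉ cx p = contradiction (subst (_∈ N) (^-1 x) p) x∉
      go (suc k) x x∉ cx p with mem? N (x · x)
      ... | yes q = x , x∉ , cx , q
      ... | no q = go k (x · x) q (central-· cx cx) (subst (_∈ N) (≡sym (^-square x (2 ^ k))) p)

  trivial : Sub n
  trivial = ⁅ ε ⁆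

  trivial-subgroup : IsSubgroup trivial
  trivial-subgroup = record { ε∈ = refl ; ·∈ = λ { refl refl → identityˡ ε } ; ⁻¹∈ = λ { refl → ε⁻¹ } }

  trivial-normal : ∀ {z κ} → κ ∈ trivial → z · κ · z ⁻¹ ∈ trivial
  trivial-normal {z} refl = free (𝕩 ⊗ 𝟙 ⊗ inv 𝕩) 𝟙 (z ∷ []) refl

  Abelian : Set
  Abelian = ∀ x y → x · y ≡ y · x

  module Plain where
    open Modulo trivial-subgroup trivial-normal public

    commutes : ∀ {x g} → g ∈ Cent x → g · x ≡ x · g
    commutes {x} {g} p = trans (≡sym (cancelʳ′ (g · x) g)) (cong (_· g) (≡sym (trans (≡sym (identityʳ x)) (trans (cong (x ·_) (≡sym p)) (cancelˡ x _)))))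

    commutes⁻ : ∀ {x g} → g · x ≡ x · g → g ∈ Cent x
    commutes⁻ {x} {g} p = trans (cong (λ z → x ⁻¹ · (z · g ⁻¹)) p) (free (inv 𝕩 ⊗ (𝕩 ⊗ 𝕪 ⊗ inv 𝕪)) 𝟙 (x ∷ g ∷ []) refl)

    Z : Sub n
    Z = ⟪ central? ⟫

    Z-subgroup : IsSubgroup Z
    Z-subgroup = record { ε∈ = central-ε refl ; ·∈ = central-· ; ⁻¹∈ = λ {x} p g → commutes⁻ {x ⁻¹} {g} (lem x g (commutes (p g))) }
      where
      lem : ∀ x g → g · x ≡ x · g → g · x ⁻¹ ≡ x ⁻¹ · g
      lem x g e = ·-cancelˡ x (·-cancelʳ x (trans (free (𝕩 ⊗ (𝕪 ⊗ inv 𝕩) ⊗ 𝕩) (𝕩 ⊗ 𝕪) (x ∷ g ∷ []) refl) (trans (≡sym e) (free (𝕪 ⊗ 𝕩) (𝕩 ⊗ (inv 𝕩 ⊗ 𝕪) ⊗ 𝕩) (x ∷ g ∷ []) refl))))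

    abelian : (∀ x → Central x) → Abelian
    abelian c x y = commutes (c y x)

    Z⊆Cent : ∀ {x} → Z ⊆ Cent x
    Z⊆Cent {x} {z} p = commutes⁻ (≡sym (commutes (p x)))

    x∈Cent : ∀ {x} → x ∈ Cent x
    x∈Cent = commutes⁻ refl

    cent<n : ∀ {x} → ¬ Central x → ∣ Cent x ∣ ≢ n
    cent<n {x} nc e = nc (λ g → ⊆-full (Cent x) full (λ _ → tt) (≤-reflexive (trans ∣full∣ (≡sym e))) {g} tt)

    Z<cent : ∀ {x} → ¬ Central x → ∣ Z ∣ < ∣ Cent x ∣
    Z<cent {x} nc = ≰⇒> λ le → nc (⊆-full Z (Cent x) Z⊆Cent le x∈Cent)

    class≡ : ∀ x {q} → n ≡ q * ∣ Cent x ∣ → ∣ ⟪ conj? x ⟫ ∣ ≡ q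
    class≡ x {q} e = trans (class-size x {q} e) (trans (cong (q *_) (∣⁅⁆∣ ε)) (*-identityʳ q))

    by-contra : (∀ {x} → ¬ Central x → ⊥) → Abelian
    by-contra f = abelian λ x → dne x (central? x)
      where
      dne : ∀ x → Dec (Central x) → Central x
      dne x (yes p) = p
      dne x (no p) = ⊥-elim (f p)

    conj-invariant : ∀ {x y} → Conj x y → ∃ λ g → y ≡ g · x · g ⁻¹
    conj-invariant {x} {y} (g , p) = g , trans (≡sym (identityʳ y)) (trans (cong (y ·_) (≡sym p)) (cancelˡ y _))

  prime-abelian : Prime n → Abelian
  prime-abelian pr = by-contra λ {x} nc → go (prime⇒irreducible pr (lagrange-full (cent x))) nc
    where
    open Plain
    go : ∀ {x} → ∣ Cent x ∣ ≡ 1 ⊎ ∣ Cent x ∣ ≡ n → ¬ Central x → ⊥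
    go {x} (inj₁ e) nc = <⇒≱ (<-≤-trans (s≤s (∣∣-pos Z (central-ε refl))) (Z<cent nc)) (≤-reflexive e)
    go (inj₂ e) nc = cent<n nc e

  -- A non-central x has a centraliser of order p, so all non-central classes have size p and p
  -- divides |Z|. Then |Z| ≥ p, although Z is properly contained in that centraliser.
  square-abelian : ∀ p → Prime p → n ≡ p * p → Abelian
  square-abelian p pr e = by-contra λ {x} nc → final nc
    where
    open Plain
    1<p : 1 < p
    1<p = nonTrivial⇒n>1 p {{prime⇒nonTrivial pr}}
    cent≡ : ∀ {x} → ¬ Central x → ∣ Cent x ∣ ≡ p
    cent≡ {x} nc = go (lagrange-full (cent x))
      where
      go : ∣ Cent x ∣ ∣ n → ∣ Cent x ∣ ≡ p
      go (divides q eq) = sp (euclidsLemma q ∣ Cent x ∣ pr (divides p (trans (≡sym eq) e)))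
        where
        c = ∣ Cent x ∣
        1<c : 1 < c
        1<c = <-≤-trans (s≤s (∣∣-pos Z (central-ε refl))) (Z<cent nc)
        sp : (p ∣ q) ⊎ (p ∣ c) → c ≡ p
        sp (inj₁ (divides r refl)) = sd (prime⇒irreducible pr (divides r (*-cancelʳ-≡ _ _ p {{>-nonZero (<-trans (s≤s z≤n) 1<p)}} (trans (≡sym e) (trans eq (l r p c))))))
          where
          l : ∀ r p c → r * p * c ≡ r * c * p
          l = solve-∀
          sd : c ≡ 1 ⊎ c ≡ p → c ≡ p
          sd (inj₁ z) = contradiction (≡sym z) (<⇒≢ 1<c)
          sd (inj₂ z) = z
        sp (inj₂ (divides r z)) = sd (prime⇒irreducible pr (divides q (*-cancelʳ-≡ _ _ p {{>-nonZero (<-trans (s≤s z≤n) 1<p)}} (trans (≡sym e) (trans eq (trans (cong (q *_) z) (≡sym (*-assoc q r p))))))))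
          where
          sd : r ≡ 1 ⊎ r ≡ p → c ≡ p
          sd (inj₁ refl) = trans z (+-identityʳ p)
          sd (inj₂ refl) = contradiction (trans z (≡sym e)) (cent<n nc)
    p∣Z : p ∣ ∣ Z ∣
    p∣Z = ∣m+n∣m⇒∣n (subst (p ∣_) (trans (≡sym (∣∣-∁ Z)) (+-comm ∣ Z ∣ _)) (divides p e))
        (class-divides conj? p (∁ Z) (λ _ → conj-refl) conj-sym conj-trans
          (λ {x} {y} nx r ny → nx (λ g → subst (λ t → Central t) (cen (conj-sym r) ny) ny g))
          (λ {x} nx → divides 1 (trans (class≡ x {p} (trans e (cong (p *_) (≡sym (cent≡ nx))))) (≡sym (+-identityʳ p)))))
      where
      cen : ∀ {x y} → Conj y x → Central y → y ≡ x
      cen {x} {y} r c = ≡sym (trans (≡sym (cancelˡ y x)) (trans (cong (y ·_) (central-conj c r)) (identityʳ y)))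
    final : ∀ {x} → ¬ Central x → ⊥
    final {x} nc = <⇒≱ (Z<cent nc) (subst (_≤ ∣ Z ∣) (≡sym (cent≡ nc)) (∣⇒≤ {{>-nonZero (∣∣-pos Z (central-ε refl))}} p∣Z))

  -- In a non-abelian group the non-trivial classes would have sizes 5 and 3, and inversion pairs them up,
  -- but 10a + 6b = 14 has no solution.
  abelian₁₅ : n ≡ 15 → Abelian
  abelian₁₅ n≡ = by-contra λ {x} nc → contra nc
    where
    open Plain
    divs : ∀ c → 1 < c → c ≢ 15 → c ∣ 15 → c ≡ 3 ⊎ c ≡ 5
    divs c lt ne p = below {λ c → 1 < c → c ≢ 15 → c ∣ 15 → c ≡ 3 ⊎ c ≡ 5} 15
      (from-yes (all? {n = 16} λ i → (1 <? toℕ i) →-dec (¬? (toℕ i ≟ 15) →-dec ((toℕ i ∣? 15) →-dec ((toℕ i ≟ 3) ⊎-dec (toℕ i ≟ 5)))))) (∣⇒≤ p) lt ne p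
    cent35 : ∀ {x} → ¬ Central x → ∣ Cent x ∣ ≡ 3 ⊎ ∣ Cent x ∣ ≡ 5
    cent35 {x} nc = divs ∣ Cent x ∣ (<-≤-trans (s≤s (∣∣-pos Z (central-ε refl))) (Z<cent nc)) (λ z → cent<n nc (trans z (≡sym n≡))) (subst (∣ Cent x ∣ ∣_) n≡ (lagrange-full (cent x)))
    C= : ℕ → Sub n
    C= c = ⟪ (λ x → ∣ Cent x ∣ ≟ c) ⟫
    cent-conj : ∀ {x y} → Conj x y → ∣ Cent x ∣ ≤ ∣ Cent y ∣
    cent-conj {x} r = let g , e = conj-invariant r in
      ∣∣-inj (Cent x) (Cent _) (λ h → g · h · g ⁻¹) (λ {h} p → commutes⁻ (subst (λ t → g · h · g ⁻¹ · t ≡ t · (g · h · g ⁻¹)) (≡sym e)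
          (trans (free (𝕪 ⊗ 𝕫 ⊗ inv 𝕪 ⊗ (𝕪 ⊗ 𝕩 ⊗ inv 𝕪)) (𝕪 ⊗ (𝕫 ⊗ 𝕩) ⊗ inv 𝕪) (x ∷ g ∷ h ∷ []) refl) (trans (cong (λ t → g · t · g ⁻¹) (commutes p)) (free (𝕪 ⊗ (𝕩 ⊗ 𝕫) ⊗ inv 𝕪) (𝕪 ⊗ 𝕩 ⊗ inv 𝕪 ⊗ (𝕪 ⊗ 𝕫 ⊗ inv 𝕪)) (x ∷ g ∷ h ∷ []) refl)))))
        (λ _ _ z → ·-cancelˡ g (·-cancelʳ (g ⁻¹) z))
    cls : ∀ c q → 15 ≡ q * c → q ∣ ∣ C= c ∣
    cls c q e = class-divides conj? q (C= c) (λ _ → conj-refl) conj-sym conj-trans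
      (λ p r → trans (≤-antisym (cent-conj (conj-sym r)) (cent-conj r)) p)
      (λ {x} p → divides 1 (trans (class≡ x {q} (trans n≡ (trans e (cong (q *_) (≡sym p))))) (≡sym (+-identityʳ q))))
    no-invol : ∀ x → x ⁻¹ ≡ x → x ≡ ε
    no-invol x p = trans (≡sym (identityʳ x)) (trans (cong (x ·_) (≡sym x¹⁴)) (subst (λ m → x ^^ m ≡ ε) (trans ∣full∣ n≡) (^-∣∣ full-subgroup tt)))
      where
      x² : x · x ≡ ε
      x² = trans (cong (x ·_) (≡sym p)) (inverseʳ x)
      x¹⁴ : x ^^ 14 ≡ ε
      x¹⁴ = ^-mul x 2 (trans (cong (x ·_) (identityʳ x)) x²) 7
    evn : ∀ c → ∣ Cent ε ∣ ≢ c → 2 ∣ ∣ C= c ∣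
    evn c ne = even-fixfree (C= c) _⁻¹ (λ {x} p → trans (∣∣-cong (Cent (x ⁻¹)) (Cent x) (λ q → commutes⁻ (subst (λ t → _ · t ≡ t · _) (⁻¹⁻¹ x) (inv-comm (commutes q)))) (λ q → commutes⁻ (inv-comm (commutes q)))) p)
       (λ _ → ⁻¹⁻¹ _) (λ {x} p z → ne (subst (λ t → ∣ Cent t ∣ ≡ c) (no-invol x z) p))
      where
      inv-comm : ∀ {x g} → g · x ≡ x · g → g · x ⁻¹ ≡ x ⁻¹ · g
      inv-comm {x} {g} e = ·-cancelˡ x (·-cancelʳ x (trans (free (𝕩 ⊗ (𝕪 ⊗ inv 𝕩) ⊗ 𝕩) (𝕩 ⊗ 𝕪) (x ∷ g ∷ []) refl) (trans (≡sym e) (free (𝕪 ⊗ 𝕩) (𝕩 ⊗ (inv 𝕩 ⊗ 𝕪) ⊗ 𝕩) (x ∷ g ∷ []) refl))))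
    centε : ∣ Cent ε ∣ ≡ 15
    centε = trans (∣∣-cong (Cent ε) full (λ _ → tt) (λ {g} _ → commutes⁻ (trans (identityʳ g) (≡sym (identityˡ g))))) (trans ∣full∣ n≡)
    cent15 : ∀ {x} → Central x → ∣ Cent x ∣ ≡ 15
    cent15 {x} c = trans (∣∣-cong (Cent x) full (λ _ → tt) (λ {g} _ → c g)) (trans ∣full∣ n≡)
    module _ {x} (nc : ¬ Central x) where
      ∣Z∣ : ∣ Z ∣ ≡ 1
      ∣Z∣ = go (cent35 nc) (lagrange Z-subgroup (cent x) Z⊆Cent) (Z<cent nc)
        where
        one : ∀ {c d} → Prime d → c ∣ d → c < d → c ≡ 1
        one pr dv lt with prime⇒irreducible pr dv
        ... | inj₁ z = z
        ... | inj₂ z = contradiction z (<⇒≢ lt)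
        go : ∣ Cent x ∣ ≡ 3 ⊎ ∣ Cent x ∣ ≡ 5 → ∣ Z ∣ ∣ ∣ Cent x ∣ → ∣ Z ∣ < ∣ Cent x ∣ → ∣ Z ∣ ≡ 1
        go (inj₁ e) dv lt = one (from-yes (prime? 3)) (subst (∣ Z ∣ ∣_) e dv) (subst (∣ Z ∣ <_) e lt)
        go (inj₂ e) dv lt = one (from-yes (prime? 5)) (subst (∣ Z ∣ ∣_) e dv) (subst (∣ Z ∣ <_) e lt)
      count : 1 + (∣ C= 3 ∣ + ∣ C= 5 ∣) ≡ 15
      count = begin
        1 + (∣ C= 3 ∣ + ∣ C= 5 ∣) ≡⟨ cong₂ (λ a b → a + (∣ C= 3 ∣ + b)) (≡sym ∣Z∣) c5 ⟩
        ∣ Z ∣ + (∣ C= 3 ∣ + ∣ ∁ Z ∩ ∁ (C= 3) ∣) ≡⟨ cong (λ a → ∣ Z ∣ + (a + ∣ ∁ Z ∩ ∁ (C= 3) ∣)) (∣∣-cong (C= 3) (∁ Z ∩ C= 3) (λ p → (λ c → contradiction (trans (≡sym p) (cent15 c)) λ ()) , p) proj₂) ⟩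
        ∣ Z ∣ + (∣ ∁ Z ∩ C= 3 ∣ + ∣ ∁ Z ∩ ∁ (C= 3) ∣) ≡⟨ cong (∣ Z ∣ +_) (∣∣-split (∁ Z) (C= 3)) ⟨
        ∣ Z ∣ + ∣ ∁ Z ∣ ≡⟨ ∣∣-∁ Z ⟩
        n ≡⟨ n≡ ⟩
        15 ∎
        where
        open ≡-Reasoning
        five : ∀ {y} → ¬ Central y → ¬ ∣ Cent y ∣ ≡ 3 → ∣ Cent y ∣ ≡ 5
        five nc n3 with cent35 nc
        ... | inj₁ z = contradiction z n3
        ... | inj₂ z = z
        c5 : ∣ C= 5 ∣ ≡ ∣ ∁ Z ∩ ∁ (C= 3) ∣
        c5 = ∣∣-cong (C= 5) (∁ Z ∩ ∁ (C= 3)) (λ p → (λ c → contradiction (trans (≡sym p) (cent15 c)) λ ()) , λ q → contradiction (trans (≡sym p) q) λ ()) (λ { (p , q) → five p q })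
      contra : ⊥
      contra = numeric ∣ C= 3 ∣ ∣ C= 5 ∣ (suc-injective count) (cls 3 5 refl) (evn 3 (λ z → contradiction (trans (≡sym centε) z) λ ())) (cls 5 3 refl) (evn 5 (λ z → contradiction (trans (≡sym centε) z) λ ()))
        where
        numeric : ∀ a b → a + b ≡ 14 → 5 ∣ a → 2 ∣ a → 3 ∣ b → 2 ∣ b → ⊥
        numeric a b e p q r s = below {λ a → 5 ∣ a → 2 ∣ a → 3 ∣ 14 ∸ a → ¬ 2 ∣ 14 ∸ a} 14
            (from-yes (all? {n = 15} λ i → (5 ∣? toℕ i) →-dec ((2 ∣? toℕ i) →-dec ((3 ∣? (14 ∸ toℕ i)) →-dec ¬? (2 ∣? (14 ∸ toℕ i)))))) (subst (a ≤_) e (m≤m+n a b)) p q (subst (3 ∣_) b≡ r) (subst (2 ∣_) b≡ s)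
          where
          b≡ : b ≡ 14 ∸ a
          b≡ = trans (≡sym (m+n∸m≡n a b)) (cong (_∸ a) e)

  -- Every group of order 2^m has a power-commutator presentation

  module Tower where
    open Presented _·_ ε
    open Assoc assoc identityˡ identityʳ

    Img : ∀ {i} → Vec (Fin n) i → Sub n
    Img gs = ⟪ (λ y → ∃V? (λ v → ev gs v ≟F y)) ⟫

    -- Each generator is central modulo those after it, so its commutators are words in those:
    -- exactly what a tail can record.
    CentralSeq : ∀ {i} → Vec (Fin n) i → Set
    CentralSeq [] = ⊤
    CentralSeq (h ∷ hs) = (∀ z → h ⁻¹ · (z · h · z ⁻¹) ∈ Img hs) × CentralSeq hs

    mkTails : ∀ {i} (gs : Vec (Fin n) i) → CentralSeq gs → ∀ g → Σ (Tails i) λ τ → Comm g gs τ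
    mkTails [] _ g = tt , tt
    mkTails (h ∷ hs) (c , cs) g =
      -- Centrality is applied to g⁻¹ because the tail is h⁻¹g⁻¹hg.
      let t , e = c (g ⁻¹)
          ts , r = mkTails hs cs g
      in (t , ts) , trans (free (𝕩 ⊗ 𝕪) (𝕪 ⊗ (𝕩 ⊗ (inv 𝕩 ⊗ (inv 𝕪 ⊗ 𝕩 ⊗ inv (inv 𝕪))))) (h ∷ g ∷ []) refl) (cong (λ z → g · (h · z)) (≡sym e)) , r

    ev-zeros : ∀ {i} (gs : Vec (Fin n) i) → ev gs zeros ≡ ε
    ev-zeros [] = refl
    ev-zeros (g ∷ gs) = ev-zeros gs

    record Level (i : ℕ) : Set where
      field
        gs     : Vec (Fin n) i
        pres   : Pres i
        sat    : Sat pres gs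
        inj    : ∀ {u v} → ev gs u ≡ ev gs v → u ≡ v
        normal : ∀ {z κ} → κ ∈ Img gs → z · κ · z ⁻¹ ∈ Img gs
        series : CentralSeq gs
        size   : ∣ Img gs ∣ ≡ 2 ^ i

      img : IsSubgroup (Img gs)
      img = record
        { ε∈ = zeros , ev-zeros gs ; ·∈ = mul
        ; ⁻¹∈ = λ {x} p → subst (_∈ Img gs) (⁻¹-unique x _ (Order.killed (order x))) (pow p (Order.d-1 (order x))) }
        where
        mul : ∀ {x y} → x ∈ Img gs → y ∈ Img gs → x · y ∈ Img gs
        mul (u , refl) (v , refl) = pmul pres u v , ≡sym (ev-mul pres gs sat u v)
        pow : ∀ {x} → x ∈ Img gs → ∀ k → x ^^ k ∈ Img gs
        pow p zero = zeros , ev-zeros gs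
        pow p (suc k) = mul p (pow p k)

    base : Level 0
    base = record
      { gs = [] ; pres = triv ; sat = tt ; inj = λ { {[]} {[]} _ → refl }
      ; normal = λ { {z} ([] , refl) → [] , free 𝟙 (𝕩 ⊗ 𝟙 ⊗ inv 𝕩) (z ∷ []) refl }
      ; series = tt
      ; size = trans (∣∣-cong (Img []) ⁅ ε ⁆ (λ { ([] , refl) → refl }) (λ { refl → [] , refl })) (∣⁅⁆∣ ε) }

    module Step {m} (pow : n ≡ 2 ^ m) {i} (lt : i < m) (L : Level i) where
      open Level L
      open Modulo img normal

      c : ℕ
      c = 2 ^ (m ∸ suc i)

      n≡ : n ≡ c * (2 * ∣ Img gs ∣)
      n≡ = trans pow (trans (cong (2 ^_) (≡sym (m∸n+n≡m lt))) (trans (^-distribˡ-+-* 2 (m ∸ suc i) (suc i)) (cong (λ z → c * (2 * z)) (≡sym size))))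

      module WithTop {g} (g∉ : ¬ g ∈ Img gs) (cg : Central g) (g² : g · g ∈ Img gs) where
        gs′ : Vec (Fin n) (suc i)
        gs′ = g ∷ gs

        lower : Img gs ⊆ Img gs′
        lower (v , e) = false ∷ v , e

        upper : ∀ {y} → g ⁻¹ · y ∈ Img gs → y ∈ Img gs′
        upper {y} (v , e) = true ∷ v , trans (cong (g ·_) e) (cancelˡ g y)

        upper⁻ : ∀ v → g ⁻¹ · ev gs′ (true ∷ v) ∈ Img gs
        upper⁻ v = v , ≡sym (cancelˡ′ g _)

        no-mix : ∀ u v → ev gs u ≢ g · ev gs v
        no-mix u v e = g∉ (IsSubgroup.cosetˡ img (v , refl) (u , e))

        level : Level (suc i)
        level = record
          { gs = gs′
          ; pres = ext pres (proj₁ g²) (proj₁ (mkTails gs series g))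
          ; sat = sat , ≡sym (proj₂ g²) , proj₂ (mkTails gs series g)
          ; inj = λ { {false ∷ u} {false ∷ v} e → cong (false ∷_) (inj e)
                    ; {true ∷ u} {true ∷ v} e → cong (true ∷_) (inj (·-cancelˡ g e))
                    ; {false ∷ u} {true ∷ v} e → contradiction e (no-mix u v)
                    ; {true ∷ u} {false ∷ v} e → contradiction (≡sym e) (no-mix v u) }
          ; normal = λ { {z} (false ∷ v , refl) → lower (normal (v , refl))
                       ; {z} (true ∷ v , refl) → upper (subst (_∈ Img gs) (free ((inv 𝕪 ⊗ (𝕩 ⊗ 𝕪 ⊗ inv 𝕩)) ⊗ (𝕩 ⊗ 𝕫 ⊗ inv 𝕩)) (inv 𝕪 ⊗ (𝕩 ⊗ (𝕪 ⊗ 𝕫) ⊗ inv 𝕩)) (z ∷ g ∷ ev gs v ∷ []) refl) (·∈ img (cg z) (normal {z} (v , refl)))) }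
          ; series = cg , series
          ; size = trans (∣∣-split (Img gs′) (Img gs)) (trans (cong₂ _+_
              (trans (∣∣-cong (Img gs′ ∩ Img gs) (Img gs) proj₂ (λ p → lower p , p)) size)
              (trans (trans (∣∣-cong (Img gs′ ∩ ∁ (Img gs)) (g ◃ Img gs) (λ { ((false ∷ v , refl) , q) → contradiction (v , refl) q ; ((true ∷ v , refl) , q) → upper⁻ v })
                  (λ {y} p → upper p , λ q → g∉ (subst (_∈ Img gs) (free (𝕪 ⊗ inv (inv 𝕩 ⊗ 𝕪)) 𝕩 (g ∷ y ∷ []) refl) (·∈ img q (⁻¹∈ img p))))) (∣◃∣ g (Img gs))) size)) (cong (2 ^ i +_) (≡sym (+-identityʳ _)))) }

      step : Level (suc i)
      step = top (central-square m pow c n≡)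
        where
        top : (∃ λ g → ¬ g ∈ Img gs × Central g × g · g ∈ Img gs) → Level (suc i)
        top (g , g∉ , cg , g²) = WithTop.level g∉ cg g²

    tower : ∀ m → n ≡ 2 ^ m → ∀ i → i ≤ m → Level i
    tower m pow zero _ = base
    tower m pow (suc i) lt = Step.step pow lt (tower m pow i (<⇒≤ lt))

    struct : ∀ m → n ≡ 2 ^ m → Σ (Pres m) (Struct G)
    struct m pow = whole (tower m pow m ≤-refl)
      where
      whole : Level m → Σ (Pres m) (Struct G)
      whole L = pres , record { w = ev gs ; w-inj = inj ; w-surj = λ x → ⊆-full (Img gs) full (λ _ → tt) (≤-reflexive (trans ∣full∣ (trans pow (≡sym size)))) {x} tt
        ; w-hom = ev-mul pres gs sat ; w-ε = ev-zeros gs }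
        where open Level L

  module Represent {m} {p : Pres m} (S : Struct G p) where
    open Struct S
    open Transfer {_∙_ = pmul p} {zeros} {_·_} {ε} w (λ u v → ≡sym (w-hom u v)) w-ε

    represent : (q : Pres m) (cs : Vec (V m) m) → PX.Sat q cs → (∀ u v → PX.ev cs u ≡ PX.ev cs v → u ≡ v) → (∀ v → ∃ λ u → PX.ev cs u ≡ v) → Struct G q
    represent q cs s inj surj = record
      { w = λ v → w (PX.ev cs v)
      ; w-inj = λ e → inj _ _ (w-inj e)
      ; w-surj = λ x → let v , e = w-surj x ; u , e′ = surj v in u , trans (cong w e′) e
      ; w-hom = λ u v → trans (cong₂ _·_ (ev-map cs u) (ev-map cs v)) (trans (PY.Assoc.ev-mul assoc identityˡ identityʳ q (mapV w cs) (sat-map q cs s) u v) (≡sym (ev-map cs _)))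
      ; w-ε = trans (ev-map cs zeros) (ev-zeros (mapV w cs)) }
      where
      ev-zeros : ∀ {i} (gs : Vec (Fin n) i) → PY.ev gs zeros ≡ ε
      ev-zeros [] = refl
      ev-zeros (g ∷ gs) = ev-zeros gs

  module StructFacts {m} {p : Pres m} (S : Struct G p) where
    open Struct S

    not-nonAssoc : ¬ NonAssoc p
    not-nonAssoc na = let u , x = satisfied na ; v , y = satisfied x ; t , z = satisfied y in
      z (w-inj (trans (≡sym (w-hom _ t)) (trans (cong (_· w t) (≡sym (w-hom u v))) (trans (assoc _ _ _) (trans (cong (w u ·_) (w-hom v t)) (w-hom u _))))))

    commutative-abelian : Commutative p → ∀ x y → x · y ≡ y · x
    commutative-abelian c x y = let u , eu = w-surj x ; v , ev = w-surj y in
      subst₂ (λ x y → x · y ≡ y · x) eu ev (trans (w-hom u v) (trans (cong w (All-lookup (All-lookup c (allV-complete u)) (allV-complete v))) (≡sym (w-hom v u))))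

    re-present : ∀ q cs → Presents p q cs → Struct G q
    re-present q cs (s , u , al) = Represent.represent S q cs s (λ a b → unique-map u (allV-complete a) (allV-complete b))
      (λ v → let a , _ , e = ∈-map⁻ _ (All-lookup al (allV-complete v)) in a , ≡sym e)

  -- The tower supplies some presentation p of G, which occurs in the complete list. A presentation
  -- realised by a group cannot violate associativity, so its code is not 0 and names a canonical
  -- presentation together with new generators.
  classify : ∀ {m} (canon : List (Pres m)) cs → Classification.Verdicts canon (allPres m) cs → n ≡ 2 ^ m → ∃ λ q → q ∈L canon × Struct G q
  classify {m} canon cs vs pow = let p , S = Tower.struct m pow in decide S (verdict {allPres m} {cs} vs (allPres-complete p))
    where
    open Classification canon
    decide : ∀ {p} → Struct G p → ∃ (Verdict p) → ∃ λ q → q ∈L canon × Struct G q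
    decide S (zero , na) = contradiction na (StructFacts.not-nonAssoc S)
    decide S (suc c , v) = found (nth canon (c % 16)) v
      where
      found : ∀ q → Is _ (digits m m (c / 16)) q → ∃ λ q → q ∈L canon × Struct G q
      found (just (q , q∈)) pr = q , q∈ , StructFacts.re-present S q _ pr

  -- From exhaustive search to missing lengths

  module BruteForce {X : Set} (_≟X_ : ∀ (x y : X) → Dec (x ≡ y)) (elems : List X) (complete : ∀ x → x ∈L elems) (uniq : Unique elems)
                    (_∙_ : X → X → X) (e₀ : X) (t : Table G _∙_) where
    open Explicit.Brute _≟X_ elems complete uniq _∙_ e₀
    open Table t

    f-e₀ : f e₀ ≡ ε → ∀ {x y z} → (x ∙ y) ∙ z ≡ e₀ → f x · f y · f z ≡ ε
    f-e₀ p q = trans (cong (_· f _) (f-hom _ _)) (trans (f-hom _ _) (trans (cong f q) p))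

    listed : Sub n → List X
    listed S = filter (λ v → mem? S (f v)) elems

    listed-unique : ∀ S → Unique (mapL f (listed S))
    listed-unique S = Unique-map⁺ f-inj (Unique-filter⁺ (λ v → mem? S (f v)) uniq)

    listed⊆ : ∀ S {x} → x ∈L mapL f (listed S) → x ∈ S
    listed⊆ S p = let v , v∈ , e = ∈-map⁻ f p in subst (_∈ S) (≡sym e) (proj₂ (∈-filter⁻ (λ v → mem? S (f v)) {xs = elems} v∈))

    listed-all : ∀ S {x} → ¬ x ∈ S ∖ mapL f (listed S)
    listed-all S {x} (p , q) = q (subst (_∈L mapL f (listed S)) (f-f⁻¹ x) (∈-map⁺ f (∈-filter⁺ (λ v → mem? S (f v)) (complete (f⁻¹ x)) (subst (_∈ S) (≡sym (f-f⁻¹ x)) p))))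

    length-listed : ∀ S → length (listed S) ≡ ∣ S ∣
    length-listed S = ≡sym (trans (∣∣-list S (mapL f (listed S)) (listed-unique S) (listed⊆ S)) (trans (cong₂ _+_ (length-map f (listed S)) (∣∣-empty (S ∖ mapL f (listed S)) (listed-all S))) (+-identityʳ _)))

    -- Listed in the order of `elems`, the sets A, B and D occur among the enumerated choices, D
    -- because it passes the test `okD`. The mismatch recorded there contradicts `hom-sum`.
    no-config : ∀ {k φs} → NoConfig k φs → f e₀ ≡ ε → ¬ Config k
    no-config {k} {φs} (add , al) fe C = contra (find (All-lookup (All-lookup (All-lookup al as∈) bs∈) ds∈))
      where
      open Config C
      open Mod 8
      as = listed A
      bs = listed B
      ds = listed D
      as∈ : as ∈L choose k (λ _ → true) elems
      as∈ = subst (λ z → as ∈L choose z (λ _ → true) elems) (trans (length-listed A) ∣A∣) (choose-filter _ (λ _ → true) (λ _ → refl) elems)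
      bs∈ : bs ∈L choose k (λ _ → true) elems
      bs∈ = subst (λ z → bs ∈L choose z (λ _ → true) elems) (trans (length-listed B) ∣B∣) (choose-filter _ (λ _ → true) (λ _ → refl) elems)
      mem⁻ : ∀ S {v} → v ∈L listed S → f v ∈ S
      mem⁻ S p = proj₂ (∈-filter⁻ (λ v → mem? S (f v)) {xs = elems} p)
      ds∈ : ds ∈L choose k (okD as bs) elems
      ds∈ = subst (λ z → ds ∈L choose z (okD as bs) elems) (trans (length-listed D) ∣D∣) (choose-filter (λ v → mem? D (f v)) (okD as bs)
          (λ p → dec-true (all-list? (λ a → all-list? (λ b → ¬? (((a ∙ b) ∙ _) ≟X e₀)) bs) as) (All-tabulate λ a∈ → All-tabulate λ b∈ z → free-of-ε (mem⁻ A a∈) (mem⁻ B b∈) p (f-e₀ fe z))) elems)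
      additive : ∀ φ → Additive φ → Homᴴ full 8 (φ ∘ f⁻¹)
      additive φ ad = mkHom λ {x} {y} _ _ → mtrans (≡⇒≈ (cong φ (f⁻¹-hom x y))) (mtrans (%≈ 8 _) (mtrans (≡⇒≈ (All-lookup (All-lookup ad (complete (f⁻¹ x))) (complete (f⁻¹ y)))) (msym (%≈ 8 _))))
      sums : ∀ (φ : X → ℕ) xs → W.listSum (φ ∘ f⁻¹) (mapL f xs) ≡ total φ xs
      sums φ [] = refl
      sums φ (x ∷ xs) = cong₂ _+_ (cong φ (f⁻¹-f x)) (sums φ xs)
      wt≈ : ∀ φ S → total φ (listed S) ≈[ 8 ] wt S (φ ∘ f⁻¹)
      wt≈ φ S = msym (mtrans (W.weight-list S (φ ∘ f⁻¹) (mapL f (listed S)) (listed-unique S) (listed⊆ S))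
        (mtrans (m+ (≡⇒≈ (sums φ (listed S))) (W.weight-empty (S ∖ mapL f (listed S)) (φ ∘ f⁻¹) (listed-all S))) (≡⇒≈ (+-identityʳ _))))
      total≈ : ∀ φ → total φ elems ≈[ 8 ] wt full (φ ∘ f⁻¹)
      total≈ φ = subst (λ xs → total φ xs ≈[ 8 ] wt full (φ ∘ f⁻¹)) (all-in elems) (wt≈ φ full)
        where
        all-in : ∀ xs → filter (λ v → mem? (full {n}) (f v)) xs ≡ xs
        all-in [] = refl
        all-in (x ∷ xs) = cong (x ∷_) (all-in xs)
      contra : (∃ λ φ → φ ∈L φs × Mismatch as bs ds φ) → ⊥
      contra (φ , φ∈ , mis) = mis (≈⇒% 8 (mtrans (total≈ φ) (mtrans (hom-sum 8 (φ ∘ f⁻¹) (additive φ (All-lookup add φ∈))) (msym (m+ (m+ (wt≈ φ A) (wt≈ φ B)) (wt≈ φ D))))))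

  Refuted : Set
  Refuted = ¬ Omniversal (cayley G) × ¬ NearOmniversal (cayley G)

  -- For order 24 it is only known that k₂ and k₃ do not both occur.
  refute : ∀ k₁ k₂ k₃ → k₁ + k₁ ≤ n → k₂ + k₂ ≤ n → k₃ + k₃ ≤ n → k₁ ≢ k₂ → k₁ ≢ k₃ → ¬ Has k₁ → (Has k₂ → ¬ Has k₃) → Refuted
  refute k₁ k₂ k₃ l₁ l₂ l₃ ne₂ ne₃ m₁ m₂₃ =
      (λ om → m₁ (om (n ∸ k₁) (double-half k₁ l₁) (m∸n≤m n k₁))) ,
      (λ { (ℓ , _ , un) → let e₁ = un (n ∸ k₁) (double-half k₁ l₁) (m∸n≤m n k₁) m₁
                              no₂ : ¬ ¬ Has k₂
                              no₂ q = ne₂ (∸-cancelˡ-≡ (k≤ k₁ l₁) (k≤ k₂ l₂) (trans e₁ (≡sym (un (n ∸ k₂) (double-half k₂ l₂) (m∸n≤m n k₂) q))))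
                              no₃ : ¬ ¬ Has k₃
                              no₃ q = ne₃ (∸-cancelˡ-≡ (k≤ k₁ l₁) (k≤ k₃ l₃) (trans e₁ (≡sym (un (n ∸ k₃) (double-half k₃ l₃) (m∸n≤m n k₃) q))))
                          in no₂ λ h₂ → no₃ (m₂₃ h₂) })
    where
    k≤ : ∀ k → k + k ≤ n → k ≤ n
    k≤ k le = ≤-trans (m≤m+n k k) le

  refute₂ : ∀ k₁ k₂ → k₁ + k₁ ≤ n → k₂ + k₂ ≤ n → k₁ ≢ k₂ → ¬ Has k₁ → ¬ Has k₂ → Refuted
  refute₂ k₁ k₂ l₁ l₂ ne m₁ m₂ = refute k₁ k₂ k₂ l₁ l₂ l₂ ne ne m₁ (λ h _ → m₂ h)

  -- Such a deficit would produce a subgroup of index two, which a group of odd order does not have.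
  miss-odd-large : ∀ m k → n ≡ suc (m + m) → k ≤ n → n + n < k + k + k + k + k → ¬ Has k
  miss-odd-large m k e k≤ lt h = let m′ , mm , _ = large-parity (has-config k≤ h) lt in odd m′ m (trans mm e)
    where
    odd : ∀ a b → a + a ≢ suc (b + b)
    odd a b z = contradiction (trans (≡sym (even% a)) (trans (cong (_% 2) z) (odd% b))) λ ()
      where
      even% : ∀ a → (a + a) % 2 ≡ 0
      even% a = ≈⇒% 2 (≈by 0 a (l a))
        where
        l : ∀ a → a + a + 0 ≡ 0 + a * 2
        l = solve-∀
      odd% : ∀ b → suc (b + b) % 2 ≡ 1
      odd% b = ≈⇒% 2 (≈by 0 b (l b))
        where
        l : ∀ a → suc (a + a) + 0 ≡ 1 + a * 2
        l = solve-∀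

  miss-parity : ∀ m k → n ≡ m + m → k ≤ n → n + n < k + k + k + k + k → m % 2 ≢ k % 2 → ¬ Has k
  miss-parity m k e k≤ lt ne h = let m′ , mm , par = large-parity (has-config k≤ h) lt in
    ne (≈⇒% 2 (subst (_≈[ 2 ] k) (double-injective {m′} {m} (trans mm e)) par))

  miss-zero : ∀ j → n ≡ suc (j + j) + suc (j + j) → ¬ Has 0
  miss-zero j e h = ¬ZeroSum-4j+2 full-subgroup j (trans ∣full∣ e) (has-all h)

  miss-half : ∀ j → n ≡ (suc (j + j) + suc (j + j)) + (suc (j + j) + suc (j + j)) → ¬ Has (suc (j + j) + suc (j + j))
  miss-half j e h = let K , hK , ∣K∣ , zs = has-half (≡sym e) h in ¬ZeroSum-4j+2 hK j ∣K∣ zs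

  -- One of the deficits 0 and 1 is already missing, and k ≥ 2 makes the second missing deficit
  -- different from it.
  abelian-refuted : (∀ x y → x · y ≡ y · x) → ∀ k → 2 ≤ k → k + k ≤ n → ¬ Has k → Refuted
  abelian-refuted comm k 2≤k le miss = go (Abelian.abelian-missing comm 2≤n)
    where
    2≤n : 2 ≤ n
    2≤n = ≤-trans 2≤k (≤-trans (m≤m+n k k) le)
    go : ¬ Has 0 ⊎ ¬ Has 1 → Refuted
    go (inj₁ m) = refute₂ k 0 le z≤n (λ { refl → contradiction 2≤k λ () }) miss m
    go (inj₂ m) = refute₂ k 1 le 2≤n (λ { refl → contradiction 2≤k λ { (s≤s ()) } }) miss m

  -- A subgroup of order 4 then contains an x with x² ≢ ε, so it is cyclic and has no complete mapping.
  miss-four : n ≡ 8 → ∀ {p : Pres 3} → Struct G p → ∀ a → All (λ v → pmul p v v ≢ zeros ⊎ v ∈L zeros ∷ a ∷ []) (allV 3) → ¬ Has 4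
  miss-four n≡ {p} S a al h = let K , hK , ∣K∣ , zs = has-half {4} (≡sym n≡) h in go hK ∣K∣ zs (any? (λ x → mem? K x ×-dec ¬? (x · x ≟F ε)))
    where
    open Struct S
    go : ∀ {K} → IsSubgroup K → ∣ K ∣ ≡ 4 → ZeroSum K → Dec (∃ λ x → x ∈ K × x · x ≢ ε) → ⊥
    go hK ∣K∣ zs (yes (x , x∈ , ne)) = Quarter.quarter-¬ZeroSum hK trivial-subgroup (λ { refl → ε∈ hK }) (λ _ → trivial-normal) (trans ∣K∣ (≡sym (cong₂ _+_ (cong₂ _+_ o o) (cong₂ _+_ o o)))) {x} x∈ ne 0 o zs
      where
      o = ∣⁅⁆∣ ε
    go {K} hK ∣K∣ zs (no none) = contradiction (begin
        4 ≡⟨ ∣K∣ ⟨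
        ∣ K ∣ ≡⟨ ∣∣-split K ⁅ ε ⁆ ⟩
        ∣ K ∩ ⁅ ε ⁆ ∣ + ∣ K ∩ ∁ ⁅ ε ⁆ ∣ ≤⟨ +-mono-≤ (∣∣-mono (K ∩ ⁅ ε ⁆) ⁅ ε ⁆ proj₂) (∣∣-mono (K ∩ ∁ ⁅ ε ⁆) ⁅ w a ⁆ two) ⟩
        ∣ ⁅ ε ⁆ ∣ + ∣ ⁅ w a ⁆ ∣ ≡⟨ cong₂ _+_ (∣⁅⁆∣ ε) (∣⁅⁆∣ (w a)) ⟩
        2 ∎) (from-no (4 ≤? 2))
      where
      open ≤-Reasoning
      two : ∀ {x} → x ∈ K ∩ ∁ ⁅ ε ⁆ → x ∈ ⁅ w a ⁆
      two {x} (x∈ , x≢) = let v , e = w-surj x in sq v e (All-lookup al (allV-complete v))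
        where
        x² : Dec (x · x ≡ ε) → x · x ≡ ε
        x² (yes z) = z
        x² (no z) = contradiction (x , x∈ , z) none
        sq : ∀ v → w v ≡ x → pmul p v v ≢ zeros ⊎ v ∈L zeros ∷ a ∷ [] → x ≡ w a
        sq v e (inj₁ ne) = contradiction (w-inj (trans (≡sym (w-hom v v)) (trans (cong₂ _·_ e e) (trans (x² (x · x ≟F ε)) (≡sym w-ε))))) ne
        sq v e (inj₂ (here refl)) = contradiction (trans (≡sym e) w-ε) x≢
        sq v e (inj₂ (there (here refl))) = ≡sym e

  -- The listed groups miss exactly one length

  near-Z₂ : IsCyclic G 2 → NearOmniversal (cayley G)
  near-Z₂ i = Cyc.near-table 2 G t 0 z≤n enough-Z₂ (miss-zero 0 (Cyc.table-order 2 t))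
    where t = from-iso i

  near-Z₆ : IsCyclic G 6 → NearOmniversal (cayley G)
  near-Z₆ i = Cyc.near-table 6 G t 0 z≤n enough-Z₆ (miss-zero 1 (Cyc.table-order 6 t))
    where t = from-iso i

  near-D₆ : IsDihedral G 3 → NearOmniversal (cayley G)
  near-D₆ i = Dih₃.near-table G t 0 z≤n enough-D₆ (miss-zero 1 (Dih₃.table-order t))
    where t = from-iso i

  miss-one : Prime n → 2 ≤ n → Has 0 → ¬ Has 1
  miss-one pr 2≤n h₀ = go (Abelian.abelian-missing (prime-abelian pr) 2≤n)
    where
    go : ¬ Has 0 ⊎ ¬ Has 1 → ¬ Has 1
    go (inj₁ m) = contradiction h₀ m
    go (inj₂ m) = m

  near-Z₃ : IsCyclic G 3 → NearOmniversal (cayley G)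
  near-Z₃ i = Cyc.near-table 3 G t 1 (from-yes (2 ≤? 3)) enough-Z₃
      (miss-one (subst Prime (≡sym n≡) (from-yes (prime? 3))) (subst (2 ≤_) (≡sym n≡) (from-yes (2 ≤? 3))) (subst (HasMaximalPTOfLength (cayley G)) (≡sym n≡) (Cyc.has-length 3 t (proj₁ enough-Z₃) (here refl))))
    where
    t = from-iso i
    n≡ = Cyc.table-order 3 t

  near-Z₅ : IsCyclic G 5 → NearOmniversal (cayley G)
  near-Z₅ i = Cyc.near-table 5 G t 1 (from-yes (2 ≤? 5)) enough-Z₅
      (miss-one (subst Prime (≡sym n≡) (from-yes (prime? 5))) (subst (2 ≤_) (≡sym n≡) (from-yes (2 ≤? 5))) (subst (HasMaximalPTOfLength (cayley G)) (≡sym n≡) (Cyc.has-length 5 t (proj₁ enough-Z₅) (here refl))))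
    where
    t = from-iso i
    n≡ = Cyc.table-order 5 t

  miss-config : ∀ {k} → k + k ≤ n → ¬ Config k → ¬ Has k
  miss-config {k} le nc h = nc (has-config (≤-trans (m≤m+n k k) le) h)

  near-D₈ : IsDihedral G 4 → NearOmniversal (cayley G)
  near-D₈ i = Dih₄.near-table G t 3 (from-yes (6 ≤? 8)) enough-D₈
      (miss-config (subst (6 ≤_) (≡sym (Dih₄.table-order t)) (from-yes (6 ≤? 8))) (BruteForce.no-config _≟D_ (elemsD 4) elemsD-complete elemsD₄-unique (dmul 4) r⟨ 0F ⟩ t brute-D₈ unit))
    where
    t = from-iso i
    open Table t
    unit : f r⟨ 0F ⟩ ≡ ε
    unit = ·-cancelˡ (f r⟨ 0F ⟩) (trans (f-hom r⟨ 0F ⟩ r⟨ 0F ⟩) (≡sym (identityʳ _)))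

  -- Recognition of the groups of small order

  toℕ-mod : ∀ m k .{{_ : NonZero k}} → toℕ (m mod k) ≡ m % k
  toℕ-mod m k = toℕ-fromℕ< (m%n<n m k)

  cyclic-table : ∀ {x} (o : Order x) → Order.d o ≡ n → ∀ k .{{_ : NonZero k}} → Order.d o ≡ k → IsCyclic G k
  cyclic-table {x} o d≡n k refl = Table.iso table
    where
    open Order o
    open Cyclic o
    table : Table G (zadd k)
    table = record
      { f = λ i → x ^^ toℕ i
      ; f-inj = λ {i} {j} e → toℕ-injective (distinct (toℕ<n i) (toℕ<n j) e)
      ; f-surj = λ y → let i , e = ⊆-full ⟨x⟩ full (λ _ → tt) (≤-reflexive (trans ∣full∣ (trans (≡sym d≡n) (≡sym ∣⟨⟩∣)))) {y} tt in i , ≡sym e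
      ; f-hom = λ i j → trans (≡sym (^-+ x (toℕ i) (toℕ j))) (trans (^-% x k killed (toℕ i + toℕ j)) (cong (x ^^_) (≡sym (toℕ-mod (toℕ i + toℕ j) k)))) }

  prime-cyclic : ∀ p .{{_ : NonZero p}} → Prime p → n ≡ p → IsCyclic G p
  prime-cyclic p pr n≡ = let x , _ , x≢ = another full ε (subst (1 <_) (≡sym (trans ∣full∣ n≡)) (nonTrivial⇒n>1 p {{prime⇒nonTrivial pr}})) in go x x≢ (order x)
    where
    go : ∀ x → x ≢ ε → Order x → IsCyclic G p
    go x x≢ o = sp (prime⇒irreducible pr (subst (Order.d o ∣_) (trans ∣full∣ n≡) (Cyclic.d∣ o full-subgroup tt)))
      where
      sp : Order.d o ≡ 1 ⊎ Order.d o ≡ p → IsCyclic G p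
      sp (inj₁ e) = contradiction (trans (≡sym (^-1 x)) (subst (λ k → x ^^ k ≡ ε) e (Order.killed o))) x≢
      sp (inj₂ e) = cyclic-table o (trans e (≡sym n≡)) p e

  module Six (n≡ : n ≡ 6) where
    module Gens {H} (hH : IsSubgroup H) (∣H∣ : ∣ H ∣ ≡ 3) (r : Fin n) (r∈ : r ∈ H) (r≢ : r ≢ ε) (t : Fin n) (t≢ : t ≢ ε) (tt≡ : t · t ≡ ε) where
      o = order r
      open Order o
      open Cyclic o

      d≡3 : d ≡ 3
      d≡3 = sp (prime⇒irreducible (from-yes (prime? 3)) (subst (d ∣_) ∣H∣ (d∣ hH r∈)))
        where
        sp : d ≡ 1 ⊎ d ≡ 3 → d ≡ 3
        sp (inj₁ e) = contradiction (trans (≡sym (^-1 r)) (subst (λ k → r ^^ k ≡ ε) e killed)) r≢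
        sp (inj₂ e) = e

      r³ : r ^^ 3 ≡ ε
      r³ = subst (λ k → r ^^ k ≡ ε) d≡3 killed

      H⊆ : ∀ {y} → y ∈ H → ∃ λ (i : Fin 3) → r ^^ toℕ i ≡ y
      H⊆ {y} p = let i , e = ⊆-full ⟨x⟩ H (λ { (i , refl) → ^∈ hH r∈ (toℕ i) }) (≤-reflexive (trans ∣H∣ (≡sym (trans ∣⟨⟩∣ d≡3)))) p in
        fromℕ< (lt i) , trans (cong (r ^^_) (toℕ-fromℕ< (lt i))) (≡sym e)
        where
        lt : ∀ (i : Fin d) → toℕ i < 3
        lt i = subst (toℕ i <_) d≡3 (toℕ<n i)

      t∉ : ¬ t ∈ H
      t∉ p = t≢ (trans (≡sym (identityʳ t)) (trans (cong (t ·_) (≡sym (trans (cong (t ·_) (identityʳ t)) tt≡))) (subst (λ k → t ^^ k ≡ ε) ∣H∣ (^-∣∣ hH p))))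

      half : ∣ H ∣ + ∣ H ∣ ≡ n
      half = trans (cong₂ _+_ ∣H∣ ∣H∣) (≡sym n≡)
      open Halves hH half using (cross)

      conj∈ : t · r · t ⁻¹ ∈ H
      conj∈ = index2-normal full-subgroup hH (λ _ → tt) (≤-reflexive (trans ∣full∣ (≡sym half))) tt r∈

      Result : Set
      Result = IsCyclic G 6 ⊎ IsDihedral G 3

      -- Here x = tr satisfies x² = r² and x³ = t, neither of which is ε, so the order of x divides
      -- neither 2 nor 3.
      commuting : t · r ≡ r · t → IsCyclic G 6
      commuting c = go (order x) (divisors-of-6 _ (subst (Order.d (order x) ∣_) (trans ∣full∣ n≡) (Cyclic.d∣ (order x) full-subgroup tt)))
        where
        x = t · r
        x² : x · x ≡ r · r
        x² = trans (cong (_· (t · r)) c) (trans (free (𝕩 ⊗ 𝕪 ⊗ (𝕪 ⊗ 𝕩)) (𝕩 ⊗ (𝕪 ⊗ 𝕪) ⊗ 𝕩) (r ∷ t ∷ []) refl) (trans (cong (λ z → r · z · r) tt≡) (cong (_· r) (identityʳ r))))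
        r²≢ : r · r ≢ ε
        r²≢ z = r≢ (trans (≡sym (identityʳ r)) (trans (cong (r ·_) (≡sym (trans (cong (r ·_) (identityʳ r)) z))) r³))
        go : (o : Order x) → Order.d o ≡ 1 ⊎ Order.d o ≡ 2 ⊎ Order.d o ≡ 3 ⊎ Order.d o ≡ 6 → IsCyclic G 6
        go o (inj₁ e) = contradiction (trans (≡sym x²) (trans (cong₂ _·_ x≡ε x≡ε) (identityˡ ε))) r²≢
          where
          x≡ε : x ≡ ε
          x≡ε = trans (≡sym (^-1 x)) (subst (λ k → x ^^ k ≡ ε) e (Order.killed o))
        go o (inj₂ (inj₁ e)) = contradiction (trans (≡sym x²) (trans (cong (x ·_) (≡sym (identityʳ x))) (subst (λ k → x ^^ k ≡ ε) e (Order.killed o)))) r²≢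
        go o (inj₂ (inj₂ (inj₁ e))) = contradiction (trans (≡sym (trans x³ (trans (cong (t ·_) r³) (identityʳ t)))) (subst (λ k → x ^^ k ≡ ε) e (Order.killed o))) t≢
          where
          x³ : x ^^ 3 ≡ t · r ^^ 3
          x³ = trans (cong (x ·_) (trans (cong (x ·_) (identityʳ x)) x²)) (free (𝕪 ⊗ 𝕩 ⊗ (𝕩 ⊗ 𝕩)) (𝕪 ⊗ (𝕩 ⊗ (𝕩 ⊗ (𝕩 ⊗ 𝟙)))) (r ∷ t ∷ []) refl)
        go o (inj₂ (inj₂ (inj₂ e))) = cyclic-table o (trans e (≡sym n≡)) 6 e

      dihedral : t · r ≡ r · r · t → IsDihedral G 3
      dihedral c = Table.iso table
        where
        flip : Bool → Fin n
        flip false = ε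
        flip true = t
        f : Bool × Fin 3 → Fin n
        f (a , i) = r ^^ toℕ i · flip a
        red : ∀ m → r ^^ m ≡ r ^^ toℕ (m mod 3)
        red m = trans (^-% r 3 r³ m) (cong (r ^^_) (≡sym (toℕ-mod m 3)))
        t-pow : ∀ (j : Fin 3) → t · r ^^ toℕ j ≡ r ^^ (3 ∸ toℕ j) · t
        t-pow 0F = trans (identityʳ t) (trans (≡sym (identityˡ t)) (cong (_· t) (≡sym r³)))
        t-pow 1F = trans (cong (t ·_) (identityʳ r)) (trans c (cong (_· t) (cong (r ·_) (≡sym (identityʳ r)))))
        t-pow 2F = begin
          t · (r · (r · ε)) ≡⟨ free (𝕪 ⊗ (𝕩 ⊗ (𝕩 ⊗ 𝟙))) (𝕪 ⊗ 𝕩 ⊗ 𝕩) (r ∷ t ∷ []) refl ⟩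
          t · r · r ≡⟨ cong (_· r) c ⟩
          r · r · t · r ≡⟨ assoc (r · r) t r ⟩
          r · r · (t · r) ≡⟨ cong (r · r ·_) c ⟩
          r · r · (r · r · t) ≡⟨ free (𝕩 ⊗ 𝕩 ⊗ (𝕩 ⊗ 𝕩 ⊗ 𝕪)) ((𝕩 ⊗ (𝕩 ⊗ (𝕩 ⊗ 𝟙))) ⊗ (𝕩 ⊗ 𝟙 ⊗ 𝕪)) (r ∷ t ∷ []) refl ⟩
          r ^^ 3 · (r ^^ 1 · t) ≡⟨ cong (_· (r ^^ 1 · t)) r³ ⟩
          ε · (r ^^ 1 · t) ≡⟨ identityˡ _ ⟩
          r ^^ 1 · t ∎
          where open ≡-Reasoning
        flip-xor : ∀ b → t · flip b ≡ flip (true xor b)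
        flip-xor false = identityʳ t
        flip-xor true = tt≡
        hm : ∀ x y → f x · f y ≡ f (dmul 3 x y)
        hm (false , i) (b , j) = begin
          r ^^ toℕ i · ε · (r ^^ toℕ j · flip b) ≡⟨ free (𝕩 ⊗ 𝟙 ⊗ (𝕪 ⊗ 𝕫)) (𝕩 ⊗ 𝕪 ⊗ 𝕫) (r ^^ toℕ i ∷ r ^^ toℕ j ∷ flip b ∷ []) refl ⟩
          r ^^ toℕ i · r ^^ toℕ j · flip b ≡⟨ cong (_· flip b) (trans (≡sym (^-+ r (toℕ i) (toℕ j))) (red (toℕ i + toℕ j))) ⟩
          r ^^ toℕ ((toℕ i + toℕ j) mod 3) · flip b ∎
          where open ≡-Reasoning
        hm (true , i) (b , j) = begin
          r ^^ toℕ i · t · (r ^^ toℕ j · flip b) ≡⟨ free (𝕩 ⊗ 𝕦 ⊗ (𝕪 ⊗ 𝕫)) (𝕩 ⊗ (𝕦 ⊗ 𝕪) ⊗ 𝕫) (r ^^ toℕ i ∷ r ^^ toℕ j ∷ flip b ∷ t ∷ []) refl ⟩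
          r ^^ toℕ i · (t · r ^^ toℕ j) · flip b ≡⟨ cong (λ z → r ^^ toℕ i · z · flip b) (t-pow j) ⟩
          r ^^ toℕ i · (r ^^ (3 ∸ toℕ j) · t) · flip b ≡⟨ free (𝕩 ⊗ (𝕪 ⊗ 𝕦) ⊗ 𝕫) (𝕩 ⊗ 𝕪 ⊗ (𝕦 ⊗ 𝕫)) (r ^^ toℕ i ∷ r ^^ (3 ∸ toℕ j) ∷ flip b ∷ t ∷ []) refl ⟩
          r ^^ toℕ i · r ^^ (3 ∸ toℕ j) · (t · flip b) ≡⟨ cong₂ _·_ (trans (≡sym (^-+ r (toℕ i) (3 ∸ toℕ j))) (red (toℕ i + (3 ∸ toℕ j)))) (flip-xor b) ⟩
          r ^^ toℕ ((toℕ i + (3 ∸ toℕ j)) mod 3) · flip (true xor b) ∎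
          where open ≡-Reasoning
        rr : ∀ {i j : Fin 3} → r ^^ toℕ i ≡ r ^^ toℕ j → i ≡ j
        rr {i} {j} e = toℕ-injective (distinct (subst (toℕ i <_) (≡sym d≡3) (toℕ<n i)) (subst (toℕ j <_) (≡sym d≡3) (toℕ<n j)) e)
        mixed : ∀ i j → r ^^ i · ε ≢ r ^^ j · t
        mixed i j e = t∉ (cosetʳ hH (^∈ hH r∈ j) (subst (_∈ H) e (·∈ hH (^∈ hH r∈ i) (ε∈ hH))))
        f-inj : ∀ {x y} → f x ≡ f y → x ≡ y
        f-inj {false , i} {false , j} e = cong (false ,_) (rr (·-cancelʳ ε e))
        f-inj {true , i} {true , j} e = cong (true ,_) (rr (·-cancelʳ t e))
        f-inj {false , i} {true , j} e = contradiction e (mixed (toℕ i) (toℕ j))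
        f-inj {true , i} {false , j} e = contradiction (≡sym e) (mixed (toℕ j) (toℕ i))
        f-surj : ∀ x → ∃ λ v → f v ≡ x
        f-surj x with mem? H x
        ... | yes p = let i , e = H⊆ p in (false , i) , trans (identityʳ _) e
        ... | no p = let i , e = H⊆ (cross p t∉) in (true , i) , trans (cong (_· t) e) (trans (assoc x t t) (trans (cong (x ·_) tt≡) (identityʳ x)))
        table : Table G (dmul 3)
        table = record { f = f ; f-inj = f-inj ; f-surj = f-surj ; f-hom = hm }

      -- trt⁻¹ is one of ε, r and r². The first is impossible, the second makes t and r commute, the
      -- third is the dihedral relation.
      result : Result
      result = let i , e = H⊆ conj∈ in go i e
        where
        move : ∀ {g} → g ≡ t · r · t ⁻¹ → t · r ≡ g · t
        move {g} e = trans (≡sym (cancelʳ′ (t · r) t)) (cong (_· t) (≡sym e))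
        go : ∀ (i : Fin 3) → r ^^ toℕ i ≡ t · r · t ⁻¹ → Result
        go 0F e = contradiction (·-cancelˡ t (trans (move e) (trans (identityˡ t) (≡sym (identityʳ t))))) r≢
        go 1F e = inj₁ (commuting (trans (move e) (cong (_· t) (identityʳ r))))
        go 2F e = inj₂ (dihedral (trans (move e) (cong (λ z → r · z · t) (identityʳ r))))

    order-6 : IsCyclic G 6 ⊎ IsDihedral G 3
    order-6 = let H , hH , ∣H∣ = half-4j+2 1 n≡
                  r , r∈ , r≢ = another H ε (subst (1 <_) (≡sym ∣H∣) (from-yes (1 <? 3)))
                  t , _ , t≢ , tt≡ = involution full-subgroup 3 (trans ∣full∣ n≡)
              in Gens.result hH ∣H∣ r r∈ r≢ t t≢ tt≡

  module Eight (n≡ : n ≡ 8) where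
    two-k : ∀ k → k + k ≤ 8 → k + k ≤ n
    two-k k = subst (k + k ≤_) (≡sym n≡)

    miss-three : ∀ {p φs} → Struct G p → E₃.Brute.NoConfig p zeros 3 φs → ¬ Has 3
    miss-three {p} S br = miss-config (two-k 3 (from-yes (6 ≤? 8))) (BruteForce.no-config _≟V_ (allV 3) allV-complete allV-unique₃ (pmul p) zeros (struct-table S) br (Struct.w-ε S))

    few : ∀ p → Dec (All (λ v → pmul p v v ≢ zeros ⊎ v ∈L zeros ∷ bits 3 1 ∷ []) (allV 3))
    few p = all-list? (λ v → ¬? (_ ≟V _) ⊎-dec mem-dec _≟V_ _ _) (allV 3)

    dihedral : Struct G rotation → IsDihedral G 4
    dihedral S = Table.iso (rename-table {_∙_ = dmul 4} dihedral-word elemsD-complete dihedral-words S)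

    order-8 : Refuted ⊎ IsDihedral G 4
    order-8 = let q , q∈ , S = classify canon₃ codes₃ verdicts₃ n≡ in go q∈ S
      where
      comm : ∀ {q} → Struct G q → Commutative q → ∀ x y → x · y ≡ y · x
      comm S c = StructFacts.commutative-abelian S c
      go : ∀ {q} → q ∈L canon₃ → Struct G q → Refuted ⊎ IsDihedral G 4
      go (here refl) S = inj₁ (abelian-refuted (comm S (from-yes (commutative? (pres₃ 0 0 0)))) 3 (from-yes (2 ≤? 3)) (two-k 3 (from-yes (6 ≤? 8))) (miss-three S brute-E₈))
      go (there (here refl)) S = inj₂ (dihedral S)
      go (there (there (here refl))) S = inj₁ (abelian-refuted (comm S (from-yes (commutative? (pres₃ 0 1 0)))) 3 (from-yes (2 ≤? 3)) (two-k 3 (from-yes (6 ≤? 8))) (miss-three S brute-Z₄Z₂))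
      go (there (there (there (here refl)))) S = inj₁ (refute₂ 3 4 (two-k 3 (from-yes (6 ≤? 8))) (two-k 4 (from-yes (8 ≤? 8))) (λ ()) (miss-three S brute-Q₈) (miss-four n≡ S (bits 3 1) (from-yes (few (pres₃ 1 1 1)))))
      go (there (there (there (there (here refl))))) S = inj₁ (abelian-refuted (comm S (from-yes (commutative? (pres₃ 1 2 0)))) 4 (from-yes (2 ≤? 4)) (two-k 4 (from-yes (8 ≤? 8))) (miss-four n≡ S (bits 3 1) (from-yes (few (pres₃ 1 2 0)))))

  module Sixteen (n≡ : n ≡ 16) where
    miss-seven : ¬ Has 7
    miss-seven = miss-parity 8 7 n≡ (subst (7 ≤_) (≡sym n≡) (from-yes (7 ≤? 16))) (subst (λ z → z + z < 35) (≡sym n≡) (from-yes (32 <? 35))) (λ ())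

    near-16 : NonAbelian G → NearOmniversal (cayley G)
    near-16 (x , y , ne) = let q , q∈ , S = classify canon₄ codes₄ verdicts₄ n≡ in go S (checked {canon₄} {transversals₄} checked₄ q∈)
      where
      go : ∀ {q} → Struct G q → ∃ (Checked q) → NearOmniversal (cayley G)
      go S (_ , inj₁ c) = contradiction (StructFacts.commutative-abelian S c x y) ne
      go {q} S (pss , inj₂ (al , len)) = near G 7 (subst (14 ≤_) (≡sym n≡) (from-yes (14 ≤? 16))) miss-seven has
        where
        open Struct S
        has : ∀ k → k + k ≤ n → k ≢ 7 → Has k
        has k le k≢ = subst (λ z → HasMaximalPTOfLength (cayley G) (z ∸ k)) (≡sym n≡) (found (∈-map⁻ length (subst (16 ∸ k ∈L_) (≡sym len) (in-range le′ k≢))))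
          where
          le′ : k + k ≤ 16
          le′ = subst (k + k ≤_) n≡ le
          in-range : k + k ≤ 16 → k ≢ 7 → (16 ∸ k) ∈L lengths₄
          in-range = below {λ k → k + k ≤ 16 → k ≢ 7 → (16 ∸ k) ∈L lengths₄} 16
            (from-yes (all? {n = 17} λ i → (toℕ i + toℕ i ≤? 16) →-dec (¬? (toℕ i ≟ 7) →-dec mem-dec _≟_ (16 ∸ toℕ i) lengths₄))) (≤-trans (m≤m+n k k) le′)
          found : (∃ λ ps → ps ∈L pss × 16 ∸ k ≡ length ps) → HasMaximalPTOfLength (cayley G) (16 ∸ k)
          found (ps , ps∈ , e) = subst (HasMaximalPTOfLength (cayley G)) (trans (length-map cell ps) (≡sym e)) (W₄.has-witness (pmul q) G w w-inj w-surj w-hom (mapL cell ps) (All-lookup al ps∈))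

  listed-near : Listed G → NearOmniversal (cayley G)
  listed-near (inj₁ i) = near-Z₂ i
  listed-near (inj₂ (inj₁ i)) = near-Z₃ i
  listed-near (inj₂ (inj₂ (inj₁ i))) = near-Z₅ i
  listed-near (inj₂ (inj₂ (inj₂ (inj₁ i)))) = near-Z₆ i
  listed-near (inj₂ (inj₂ (inj₂ (inj₂ (inj₁ i))))) = near-D₆ i
  listed-near (inj₂ (inj₂ (inj₂ (inj₂ (inj₂ (inj₁ i)))))) = near-D₈ i
  listed-near (inj₂ (inj₂ (inj₂ (inj₂ (inj₂ (inj₂ (n≡ , na))))))) = Sixteen.near-16 n≡ na

  -- Case distinction by the order of the group

  module Verdict where
    open SizeCases using (no-config₁₀; no-config₂₄)

    module Even (m : ℕ) (n≡ : n ≡ m + m) where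
      within : ∀ {k} → k ≤ m → k + k ≤ n
      within {k} le = subst (k + k ≤_) (≡sym n≡) (+-mono-≤ le le)

      miss : ∀ k → k ≤ m → (m + m) + (m + m) < k + k + k + k + k → m % 2 ≢ k % 2 → ¬ Has k
      miss k le lt = miss-parity m k n≡ (≤-trans (m≤m+n k k) (within le)) (subst (λ z → z + z < k + k + k + k + k) (≡sym n≡) lt)

      zero-and : ∀ j → m ≡ suc (j + j) → ∀ k → 0 < k → k ≤ m → ¬ Has k → Refuted
      zero-and j refl k pos le = refute₂ 0 k z≤n (within le) (<⇒≢ pos) (miss-zero j n≡)

      half-and : ∀ j → m ≡ suc (j + j) + suc (j + j) → ∀ k → k < m → ¬ Has k → Refuted
      half-and j refl k lt mk = refute₂ k m (within (<⇒≤ lt)) (within ≤-refl) (<⇒≢ lt) mk (miss-half j n≡)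

    even : ∀ m → n ≡ m + m → Refuted ⊎ Listed G
    even 0 refl = contradiction ε λ ()
    even 1 n≡ = inj₂ (inj₁ (prime-cyclic 2 prime[2] n≡))
    even 2 n≡ = inj₁ (abelian-refuted (square-abelian 2 prime[2] n≡) 2 ≤-refl (≤-reflexive (≡sym n≡)) (miss-half 0 n≡))
    even 3 n≡ = go (Six.order-6 n≡)
      where
      go : IsCyclic G 6 ⊎ IsDihedral G 3 → Refuted ⊎ Listed G
      go (inj₁ c) = inj₂ (inj₂ (inj₂ (inj₂ (inj₁ c))))
      go (inj₂ d) = inj₂ (inj₂ (inj₂ (inj₂ (inj₂ (inj₁ d)))))
    even 4 n≡ = go (Eight.order-8 n≡)
      where
      go : Refuted ⊎ IsDihedral G 4 → Refuted ⊎ Listed G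
      go (inj₁ r) = inj₁ r
      go (inj₂ d) = inj₂ (inj₂ (inj₂ (inj₂ (inj₂ (inj₂ (inj₁ d))))))
    even 5 n≡ = inj₁ (zero-and 2 refl 4 (from-yes (0 <? 4)) (from-yes (4 ≤? 5)) (miss-config (within (from-yes (4 ≤? 5))) (no-config₁₀ n≡)))
      where open Even 5 n≡
    even 6 n≡ = inj₁ (half-and 1 refl 5 (from-yes (5 <? 6)) (miss 5 (from-yes (5 ≤? 6)) (from-yes (24 <? 25)) λ ()))
      where open Even 6 n≡
    even 7 n≡ = inj₁ (zero-and 3 refl 6 (from-yes (0 <? 6)) (from-yes (6 ≤? 7)) (miss 6 (from-yes (6 ≤? 7)) (from-yes (28 <? 30)) λ ()))
      where open Even 7 n≡
    even 8 n≡ = go (all? (λ x → all? (λ y → x · y ≟F y · x)))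
      where
      open Even 8 n≡
      go : Dec (∀ x y → x · y ≡ y · x) → Refuted ⊎ Listed G
      go (yes c) = inj₁ (abelian-refuted c 7 (from-yes (2 ≤? 7)) (within (from-yes (7 ≤? 8))) (Sixteen.miss-seven n≡))
      go (no nc) = inj₂ (inj₂ (inj₂ (inj₂ (inj₂ (inj₂ (inj₂ (n≡ , nonabelian)))))))
        where
        nonabelian : NonAbelian G
        nonabelian =
          let x , p = ¬∀⟶∃¬ n (λ x → ∀ y → x · y ≡ y · x) (λ x → all? (λ y → x · y ≟F y · x)) nc
              y , q = ¬∀⟶∃¬ n (λ y → x · y ≡ y · x) (λ y → x · y ≟F y · x) p
          in x , y , q
    even 9 n≡ = inj₁ (zero-and 4 refl 8 (from-yes (0 <? 8)) (from-yes (8 ≤? 9)) (miss 8 (from-yes (8 ≤? 9)) (from-yes (36 <? 40)) λ ()))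
      where open Even 9 n≡
    even 10 n≡ = inj₁ (half-and 2 refl 9 (from-yes (9 <? 10)) (miss 9 (from-yes (9 ≤? 10)) (from-yes (40 <? 45)) λ ()))
      where open Even 10 n≡
    even 11 n≡ = inj₁ (zero-and 5 refl 10 (from-yes (0 <? 10)) (from-yes (10 ≤? 11)) (miss 10 (from-yes (10 ≤? 11)) (from-yes (44 <? 50)) λ ()))
      where open Even 11 n≡
    even 12 n≡ = inj₁ (refute 11 12 9 (within (from-yes (11 ≤? 12))) (within ≤-refl) (within (from-yes (9 ≤? 12))) (λ ()) (λ ())
        (miss 11 (from-yes (11 ≤? 12)) (from-yes (48 <? 55)) λ ())
        (λ h → let H , hH , ∣H∣ , zs = has-half {12} (≡sym n≡) h in miss-config (within (from-yes (9 ≤? 12))) (no-config₂₄ n≡ hH ∣H∣ zs)))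
      where open Even 12 n≡
    even 13 n≡ = inj₁ (zero-and 6 refl 12 (from-yes (0 <? 12)) (from-yes (12 ≤? 13)) (miss 12 (from-yes (12 ≤? 13)) (from-yes (52 <? 60)) λ ()))
      where open Even 13 n≡
    even 14 n≡ = inj₁ (half-and 3 refl 13 (from-yes (13 <? 14)) (miss 13 (from-yes (13 ≤? 14)) (from-yes (56 <? 65)) λ ()))
      where open Even 14 n≡
    even 15 n≡ = inj₁ (zero-and 7 refl 14 (from-yes (0 <? 14)) (from-yes (14 ≤? 15)) (miss 14 (from-yes (14 ≤? 15)) (from-yes (60 <? 70)) λ ()))
      where open Even 15 n≡
    -- Here m = 16 + j and the deficits are m - 1 and m - 3. The slacks are 5(m - 1) - 4m = 11 + j
    -- and 5(m - 3) - 4m = 1 + j; `<-by` takes the slack less one.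
    even m@(suc (suc (suc (suc (suc (suc (suc (suc (suc (suc (suc (suc (suc (suc (suc (suc j)))))))))))))))) n≡ =
        inj₁ (refute₂ (15 + j) (13 + j) (within (n≤1+n _)) (within (m≤n+m (13 + j) 3)) (λ e → contradiction (+-cancelʳ-≡ j 15 13 e) λ ())
          (miss (15 + j) (n≤1+n _) (<-by (m + m + (m + m)) (10 + j) (l₁ j)) (parity-suc (15 + j)))
          (miss (13 + j) (m≤n+m (13 + j) 3) (<-by (m + m + (m + m)) j (l₂ j)) (parity-suc (13 + j))))
      where
      open Even m n≡
      l₁ : ∀ j → (16 + j + (16 + j)) + (16 + j + (16 + j)) + (11 + j) ≡ 15 + j + (15 + j) + (15 + j) + (15 + j) + (15 + j)
      l₁ = solve-∀
      l₂ : ∀ j → (16 + j + (16 + j)) + (16 + j + (16 + j)) + (1 + j) ≡ 13 + j + (13 + j) + (13 + j) + (13 + j) + (13 + j)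
      l₂ = solve-∀

    module Odd (m : ℕ) (n≡ : n ≡ suc (m + m)) where
      within : ∀ {k} → k ≤ m → k + k ≤ n
      within {k} le = subst (k + k ≤_) (≡sym n≡) (m≤n⇒m≤1+n (+-mono-≤ le le))

      miss : ∀ k → k ≤ m → suc (m + m) + suc (m + m) < k + k + k + k + k → ¬ Has k
      miss k le lt = miss-odd-large m k n≡ (≤-trans (m≤m+n k k) (within le)) (subst (λ z → z + z < k + k + k + k + k) (≡sym n≡) lt)

      prime-refuted : Prime (suc (m + m)) → 2 ≤ m → suc (m + m) + suc (m + m) < m + m + m + m + m → Refuted
      prime-refuted pr 2≤m lt = abelian-refuted (prime-abelian (subst Prime (≡sym n≡) pr)) m 2≤m (within ≤-refl) (miss m ≤-refl lt)

    odd : 2 ≤ n → ∀ m → n ≡ suc (m + m) → Refuted ⊎ Listed G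
    odd 2≤n 0 refl = contradiction 2≤n λ { (s≤s ()) }
    odd _ 1 n≡ = inj₂ (inj₂ (inj₁ (prime-cyclic 3 (from-yes (prime? 3)) n≡)))
    odd _ 2 n≡ = inj₂ (inj₂ (inj₂ (inj₁ (prime-cyclic 5 (from-yes (prime? 5)) n≡))))
    odd _ 3 n≡ = inj₁ (Odd.prime-refuted 3 n≡ (from-yes (prime? 7)) (from-yes (2 ≤? 3)) (from-yes (14 <? 15)))
    odd _ 4 n≡ = inj₁ (abelian-refuted (square-abelian 3 (from-yes (prime? 3)) n≡) 4 (from-yes (2 ≤? 4)) (within ≤-refl) (miss 4 ≤-refl (from-yes (18 <? 20))))
      where open Odd 4 n≡
    odd _ 5 n≡ = inj₁ (Odd.prime-refuted 5 n≡ (from-yes (prime? 11)) (from-yes (2 ≤? 5)) (from-yes (22 <? 25)))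
    odd _ 6 n≡ = inj₁ (Odd.prime-refuted 6 n≡ (from-yes (prime? 13)) (from-yes (2 ≤? 6)) (from-yes (26 <? 30)))
    odd _ 7 n≡ = inj₁ (abelian-refuted (abelian₁₅ n≡) 7 (from-yes (2 ≤? 7)) (within ≤-refl) (miss 7 ≤-refl (from-yes (30 <? 35))))
      where open Odd 7 n≡
    -- Here m = 8 + j and 2n = 4m + 2. The deficits m and m - 1 leave the slacks 5m - 2n = 6 + j and
    -- 5(m - 1) - 2n = 1 + j.
    odd _ m@(suc (suc (suc (suc (suc (suc (suc (suc j)))))))) n≡ =
        inj₁ (refute₂ (8 + j) (7 + j) (within ≤-refl) (within (n≤1+n _)) (λ e → contradiction (+-cancelʳ-≡ j 8 7 e) λ ())
          (miss (8 + j) ≤-refl (<-by (suc (m + m) + suc (m + m)) (5 + j) (l₁ j)))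
          (miss (7 + j) (n≤1+n _) (<-by (suc (m + m) + suc (m + m)) j (l₂ j))))
      where
      open Odd m n≡
      l₁ : ∀ j → suc (8 + j + (8 + j)) + suc (8 + j + (8 + j)) + (6 + j) ≡ 8 + j + (8 + j) + (8 + j) + (8 + j) + (8 + j)
      l₁ = solve-∀
      l₂ : ∀ j → suc (8 + j + (8 + j)) + suc (8 + j + (8 + j)) + (1 + j) ≡ 7 + j + (7 + j) + (7 + j) + (7 + j) + (7 + j)
      l₂ = solve-∀

    refuted-or-listed : 2 ≤ n → Refuted ⊎ Listed G
    refuted-or-listed 2≤n = go (halve n)
      where
      go : (∃ λ m → n ≡ m + m ⊎ n ≡ suc (m + m)) → Refuted ⊎ Listed G
      go (m , inj₁ e) = even m e
      go (m , inj₂ e) = odd 2≤n m e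

-- For the trivial group the only length in the range is 1, and its single cell attains it, so no
-- length is missing.
near-nontrivial : ∀ {n} (G : FinGroup n) → NearOmniversal (cayley G) → 2 ≤ n
near-nontrivial {0} G _ = contradiction (FinGroup.ε G) λ ()
near-nontrivial {1} G (ℓ , (lo , hi , miss) , _) = contradiction (subst (HasMaximalPTOfLength (cayley G)) (≤-antisym lo hi) whole) miss
  where
  open FinGroup G
  whole : HasMaximalPTOfLength (cayley G) 1
  whole = (0F , 0F , 0F · 0F) ∷ [] ,
    (record { triples = λ { (here refl) → refl } ; rowsUniq = [] ∷ [] ; colsUniq = [] ∷ [] ; symsUniq = [] ∷ [] } , max) , refl
    where
    max : ∀ T′ → PartialTransversal (cayley G) T′ → _ → length T′ ≤ 1
    max [] _ _ = z≤n
    max (_ ∷ []) _ _ = s≤s z≤n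
    max (s ∷ t ∷ _) pt _ with row s | row t | PartialTransversal.rowsUniq pt
    ... | 0F | 0F | (ne ∷ _) ∷ _ = contradiction refl ne
near-nontrivial {suc (suc n)} G _ = s≤s (s≤s z≤n)

theorem1p5 : (∀ n → 2 ≤ n → (G : FinGroup n) → ¬ Omniversal (cayley G))
    × (∀ n → (G : FinGroup n) →
    NearOmniversal (cayley G) ⇔
    (IsCyclic G 2 ⊎ IsCyclic G 3 ⊎ IsCyclic G 5 ⊎ IsCyclic G 6
    ⊎ IsDihedral G 3 ⊎ IsDihedral G 4 ⊎ (n ≡ 16 × NonAbelian G)))
theorem1p5 = not-omniversal , λ n G → mk⇔ (listed G) (Theory.listed-near G)
  where
  not-omniversal : ∀ n → 2 ≤ n → (G : FinGroup n) → ¬ Omniversal (cayley G)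
  not-omniversal n 2≤n G om = go (Theory.Verdict.refuted-or-listed G 2≤n)
    where
    go : Theory.Refuted G ⊎ Listed G → ⊥
    go (inj₁ (no-om , _)) = no-om om
    go (inj₂ l) = let ℓ , (lo , hi , miss) , _ = Theory.listed-near G l in miss (om ℓ lo hi)
  listed : ∀ {n} (G : FinGroup n) → NearOmniversal (cayley G) → Listed G
  listed G nr = go (Theory.Verdict.refuted-or-listed G (near-nontrivial G nr))
    where
    go : Theory.Refuted G ⊎ Listed G → Listed G
    go (inj₁ (_ , no-near)) = contradiction nr no-near
    go (inj₂ l) = l
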